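{- Let $q=2^r$. (a) For odd $n\ge1$ and $j=0,\dots,N^-(n,q)$, where $N^-(n,q)=|DC^-(n,q)|$, the number $C_j^-(n,q)$ of codewords of weight $j$ in $C(DC^-(n,q))$ is $$C_j^-(n,q)=\sum\binom{q^{ -1}A^-(n,q)(B^-(n,q)+1)}{\nu_0}\prod_{\beta\in\mathbb{F}_q^*,\ tr(\beta^{ -1})=0}\binom{q^{ -1}A^-(n,q)(B^-(n,q)+q+1)}{\nu_\beta}\prod_{\beta\in\mathbb{F}_q^*,\ tr(\beta^{ -1})=1}\binom{q^{ -1}A^-(n,q)(B^-(n,q)-q+1)}{\nu_\beta},$$ the sum being over all families of nonnegative integers $\{\nu_\beta\}_{\beta\in\mathbb{F}_q}$ with $\sum_\beta\nu_\beta=j$ and $\sum_\beta\nu_\beta\beta=0$. (b) For even $n\ge2$, $q\ge4$, and $j=0,\dots,N^+(n,q)$, where $N^+(n,q)=|DC^+(n,q)|$, the number $C_j^+(n,q)$ of codewords of weight $j$ in $C(DC^+(n,q))$ is $$C_j^+(n,q)=\sum\binom{q^{ -1}A^+(n,q)(B^+(n,q)+q^3-q^2-1)}{\nu_0}\prod_{\substack{\tau\in\mathbb{Z},\ |\tau|<2\sqrt q\\ \tau\equiv-1\ (\mathrm{mod}\ 4)}}\ \prod_{\beta\in\mathbb{F}_q^*,\ K(\lambda;\beta^{ -1})=\tau}\binom{q^{ -1}A^+(n,q)(B^+(n,q)+q\tau-q^2-1)}{\nu_\beta},$$ the sum being over all families of nonnegative integers $\{\nu_\beta\}_{\beta\in\mathbb{F}_q}$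 with $\sum_\beta\nu_\beta=j$ and $\sum_\beta\nu_\beta\beta=0$.
   Context: $q=2^r$; $tr:\mathbb{F}_q\to\mathbb{F}_2$, $tr(x)=x+x^2+\dots+x^{2^{r-1}}$; $\lambda(x)=(-1)^{tr(x)}$; $\mathrm{Tr}$ is the matrix trace. $Sp(2n,q)=\{w\in GL(2n,\mathbb{F}_q):{}^twJw=J\}$, $J=\begin{pmatrix}0&1_n\\1_n&0\end{pmatrix}$. $P=P(2n,q)$ is the subgroup of all $\begin{pmatrix}A&0\\0&{}^tA^{ -1}\end{pmatrix}\begin{pmatrix}1_n&B\\0&1_n\end{pmatrix}$, $A\in GL(n,\mathbb{F}_q)$, $B$ symmetric. $\sigma_s=\begin{pmatrix}0&0&1_s&0\\0&1_{n-s}&0&0\\1_s&0&0&0\\0&0&0&1_{n-s}\end{pmatrix}$ (block sizes $s,n-s,s,n-s$). $DC^-(n,q)=P\sigma_{n-1}P$ ($n$ odd), $DC^+(n,q)=P\sigma_{n-2}P$ ($n$ even). For $D=DC^\mp(n,q)$, $N=|D|$, fix an ordering $g_1,\dots,g_N$ of $D$ and let $C(D)=\{u\in\mathbb{F}_2^N:\sum_j u_j\,\mathrm{Tr}\,g_j=0\text{ in }\mathbb{F}_q\}$. $\left[\begin{smallmatrix}n\\ s\end{smallmatrix}\right]_q=\prod_{j=0}^{s-1}\frac{q^{n-j}-1}{q^{s-j}-1}$. $A^-(n,q)=q^{\frac14(5n^2-1)}\left[\begin{smallmatrix}n\\1\end{smallmatrix}\right]_q\prod_{j=1}^{(n-1)/2}(q^{2j-1}-1)$,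 $B^-(n,q)=q^{\frac14(n-1)^2}(q^n-1)\prod_{j=1}^{(n-1)/2}(q^{2j}-1)$, $A^+(n,q)=q^{\frac14(5n^2-2n)}\left[\begin{smallmatrix}n\\2\end{smallmatrix}\right]_q\prod_{j=1}^{(n-2)/2}(q^{2j-1}-1)$, $B^+(n,q)=q^{\frac14(n-2)^2}(q^n-1)(q^{n-1}-1)\prod_{j=1}^{(n-2)/2}(q^{2j}-1)$ (empty products $=1$). $K(\lambda;a)=\sum_{\alpha\in\mathbb{F}_q^*}\lambda(\alpha+a\alpha^{ -1})$. Convention: $\binom ba=0$ if $a>b$ or $a<0$. -}

module Defs where

open import Level using (0ℓ)
open import Algebra.Core using (Op₁; Op₂)
open import Algebra.Structures using (IsCommutativeRing)
open import Data.Bool using (Bool; true; false; if_then_else_)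
import Data.Bool
open import Data.Empty using (⊥)
open import Data.Fin as Fin using (Fin; zero; suc; splitAt)
open import Data.Integer as ℤ using (ℤ; +_; -[1+_])
open import Data.List as List using (List; []; _∷_; map; concatMap; filter; length; foldr; upTo; allFin)
open import Data.Nat.ListAction using (sum; product)
open import Data.Nat as ℕ using (ℕ; zero; suc; _∸_; _^_; _≤ᵇ_)
open import Data.Nat.Combinatorics using (_C_)
open import Data.Product using (Σ; ∃; _×_; _,_)
open import Data.Sum using (inj₁; inj₂)
open import Function using (_∘_)
open import Function.Bundles using (_↔_; Inverse)
open import Relation.Binary.Definitions using (DecidableEquality)
open import Relation.Binary.PropositionalEquality using (_≡_; _≢_)
open import Relation.Nullary using (Dec; yes; no; ¬_; _×-dec_)
import Relation.Nullary
open import Relation.Nullary.Decidable using (⌊_⌋)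

-- A finite field with q = 2^r elements (all such fields are isomorphic,
-- so F_q is represented by an arbitrary field of cardinality 2^r).

record BinaryField (r : ℕ) : Set₁ where
  infixl 6 _+F_
  infixl 7 _*F_
  field
    Carrier  : Set
    _+F_ _*F_ : Op₂ Carrier
    -F_       : Op₁ Carrier
    0F 1F     : Carrier
    isCommutativeRing : IsCommutativeRing _≡_ _+F_ _*F_ -F_ 0F 1F
    0≢1      : 0F ≢ 1F
    _⁻¹      : Op₁ Carrier
    inverse  : ∀ x → x ≢ 0F → x *F (x ⁻¹) ≡ 1F
    _≟F_     : DecidableEquality Carrier
    enum     : Fin (2 ^ r) ↔ Carrier

-- natural-number division with the exact quotients of the paper
-- (division by 0 never occurs for q ≥ 2; it is set to 0)
divℕ : ℕ → ℕ → ℕ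
divℕ m zero    = 0
divℕ m (suc k) = m ℕ./ suc k

prodFromTo : ℕ → ℕ → (ℕ → ℕ) → ℕ
prodFromTo a b f = product (map (λ k → f (a ℕ.+ k)) (upTo (suc b ∸ a)))

-- binomial coefficient with integer top, convention binom(b,a) = 0 if a > b
binomℤ : ℤ → ℕ → ℕ
binomℤ (+ m)      k = m C k
binomℤ -[1+ m ]   k = 0

allFuns : ∀ {A : Set} → List A → (m : ℕ) → List (Fin m → A)
allFuns xs zero    = (λ ()) ∷ []
allFuns xs (suc m) = concatMap (λ x → map (λ f → cons x f) (allFuns xs m)) xs
  where
  cons : _ → (Fin m → _) → Fin (suc m) → _
  cons x f zero    = x
  cons x f (suc i) = f i

sumFin : ∀ {m} → (Fin m → ℕ) → ℕ
sumFin {m} f = sum (map f (allFin m))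

module Over {r : ℕ} (F : BinaryField r) where
  open BinaryField F

  q : ℕ
  q = 2 ^ r

  el : Fin q → Carrier
  el = Inverse.to enum

  idx : Carrier → Fin q
  idx = Inverse.from enum

  ∑ : ∀ {k} → (Fin k → Carrier) → Carrier
  ∑ {zero}  f = 0F
  ∑ {suc k} f = f zero +F ∑ (f ∘ suc)

  _·_ : ℕ → Carrier → Carrier
  zero  · x = 0F
  suc m · x = x +F (m · x)

  pow : Carrier → ℕ → Carrier
  pow x zero    = 1F
  pow x (suc k) = x *F pow x k

  tr : Carrier → Carrier
  tr x = ∑ {r} (λ k → pow x (2 ^ Fin.toℕ k))

  λ' : Carrier → ℤ
  λ' x with tr x ≟F 0F
  ... | yes _ = + 1
  ... | no  _ = ℤ.- (+ 1)

  K : Carrier → ℤ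
  K a = foldr ℤ._+_ (+ 0)
          (map (λ α → λ' (α +F a *F (α ⁻¹)))
               (filter (λ α → Relation.Nullary.¬? (α ≟F 0F)) (map el (allFin q))))

  Mat : ℕ → ℕ → Set
  Mat m k = Fin m → Fin k → Carrier

  _≈M_ : ∀ {m k} → Mat m k → Mat m k → Set
  X ≈M Y = ∀ i j → X i j ≡ Y i j

  _⊠_ : ∀ {m k l} → Mat m k → Mat k l → Mat m l
  (X ⊠ Y) i j = ∑ (λ t → X i t *F Y t j)

  1M : ∀ {m} → Mat m m
  1M i j with i Fin.≟ j
  ... | yes _ = 1F
  ... | no  _ = 0F

  0M : ∀ {m k} → Mat m k
  0M i j = 0F

  transpose : ∀ {m k} → Mat m k → Mat k m
  transpose X i j = X j i

  block : ∀ {n} → Mat n n → Mat n n → Mat n n → Mat n n → Mat (n ℕ.+ n) (n ℕ.+ n)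
  block {n} X Y Z W i j with splitAt n i | splitAt n j
  ... | inj₁ a | inj₁ b = X a b
  ... | inj₁ a | inj₂ b = Y a b
  ... | inj₂ a | inj₁ b = Z a b
  ... | inj₂ a | inj₂ b = W a b

  Tr : ∀ {m} → Mat m m → Carrier
  Tr X = ∑ (λ i → X i i)

  InP : (n : ℕ) → Mat (n ℕ.+ n) (n ℕ.+ n) → Set
  InP n w = Σ (Mat n n) λ A → Σ (Mat n n) λ A' → Σ (Mat n n) λ B →
              ((A ⊠ A') ≈M 1M) × ((A' ⊠ A) ≈M 1M) × (B ≈M transpose B) ×
              (w ≈M (block A 0M 0M (transpose A') ⊠ block 1M B 0M 1M))

  Ediag : (n s : ℕ) → Mat n n
  Ediag n s i j with i Fin.≟ j | suc (Fin.toℕ i) ≤ᵇ s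
  ... | yes _ | true  = 1F
  ... | _     | _     = 0F

  Ediag' : (n s : ℕ) → Mat n n
  Ediag' n s i j with i Fin.≟ j | suc (Fin.toℕ i) ≤ᵇ s
  ... | yes _ | false = 1F
  ... | _     | _     = 0F

  σ : (n s : ℕ) → Mat (n ℕ.+ n) (n ℕ.+ n)
  σ n s = block (Ediag' n s) (Ediag n s) (Ediag n s) (Ediag' n s)

  InPσP : (n s : ℕ) → Mat (n ℕ.+ n) (n ℕ.+ n) → Set
  InPσP n s g = Σ (Mat (n ℕ.+ n) (n ℕ.+ n)) λ p₁ → Σ (Mat (n ℕ.+ n) (n ℕ.+ n)) λ p₂ →
                  InP n p₁ × InP n p₂ × (g ≈M ((p₁ ⊠ σ n s) ⊠ p₂))

  DCminus DCplus : (n : ℕ) → Mat (n ℕ.+ n) (n ℕ.+ n) → Set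
  DCminus n = InPσP n (n ∸ 1)
  DCplus  n = InPσP n (n ∸ 2)

  IsOrdering : ∀ {m} → (Mat m m → Set) → (N : ℕ) → (Fin N → Mat m m) → Set
  IsOrdering D N g = (∀ k → D (g k)) × (∀ k l → g k ≈M g l → k ≡ l) ×
                     (∀ h → D h → ∃ λ k → h ≈M g k)

  -- The code C(D) ⊆ F_2^N (F_2 = Bool) and its weight distribution

  weight : ∀ {N} → (Fin N → Bool) → ℕ
  weight u = sumFin (λ k → if u k then 1 else 0)

  -- u ∈ C(D)  iff  Σ_k u_k Tr g_k = 0 in F_q
  codeSum : ∀ {N m} → (Fin N → Mat m m) → (Fin N → Bool) → Carrier
  codeSum g u = ∑ (λ k → if u k then Tr (g k) else 0F)

  codeCount : ∀ {m} (N : ℕ) → (Fin N → Mat m m) → ℕ → ℕ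
  codeCount N g j = length (filter (λ u → (weight u ℕ.≟ j) ×-dec (codeSum g u ≟F 0F))
                                   (allFuns (true ∷ false ∷ []) N))

  gauss : ℕ → ℕ → ℕ
  gauss n s = divℕ (product (map (λ j → q ^ (n ∸ j) ∸ 1) (upTo s)))
                   (product (map (λ j → q ^ (s ∸ j) ∸ 1) (upTo s)))

  Aminus Bminus Aplus Bplus : ℕ → ℕ
  Aminus n = q ^ ((5 ℕ.* n ℕ.* n ∸ 1) ℕ./ 4) ℕ.* gauss n 1 ℕ.*
             prodFromTo 1 ((n ∸ 1) ℕ./ 2) (λ j → q ^ (2 ℕ.* j ∸ 1) ∸ 1)
  Bminus n = q ^ (((n ∸ 1) ℕ.* (n ∸ 1)) ℕ./ 4) ℕ.* (q ^ n ∸ 1) ℕ.*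
             prodFromTo 1 ((n ∸ 1) ℕ./ 2) (λ j → q ^ (2 ℕ.* j) ∸ 1)
  Aplus n  = q ^ ((5 ℕ.* n ℕ.* n ∸ 2 ℕ.* n) ℕ./ 4) ℕ.* gauss n 2 ℕ.*
             prodFromTo 1 ((n ∸ 2) ℕ./ 2) (λ j → q ^ (2 ℕ.* j ∸ 1) ∸ 1)
  Bplus n  = q ^ (((n ∸ 2) ℕ.* (n ∸ 2)) ℕ./ 4) ℕ.* (q ^ n ∸ 1) ℕ.* (q ^ (n ∸ 1) ∸ 1) ℕ.*
             prodFromTo 1 ((n ∸ 2) ℕ./ 2) (λ j → q ^ (2 ℕ.* j) ∸ 1)

  topℤ : ℕ → ℕ → ℤ → ℤ
  topℤ A B c = (+ divℕ A q) ℤ.* (+ B ℤ.+ c)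

  families : ℕ → List (Fin q → ℕ)
  families j = filter (λ ν → (sumFin ν ℕ.≟ j) ×-dec (∑ (λ i → ν i · el i) ≟F 0F))
                      (allFuns (upTo (suc j)) q)

  nonzeroIdx : (Carrier → Bool) → List (Fin q)
  nonzeroIdx P = filter (λ i → Data.Bool._≟_ (⌊ Relation.Nullary.¬? (el i ≟F 0F) ⌋ Data.Bool.∧ P (el i)) true)
                        (allFin q)

  ∏over : List (Fin q) → (Fin q → ℕ) → ℕ
  ∏over is f = product (map f is)

  formulaMinus : ℕ → ℕ → ℕ
  formulaMinus n j = sum (map term (families j))
    where
    A = Aminus n
    B = Bminus n
    term : (Fin q → ℕ) → ℕ
    term ν = binomℤ (topℤ A B (+ 1)) (ν (idx 0F)) ℕ.*
             ∏over (nonzeroIdx (λ β → ⌊ tr (β ⁻¹) ≟F 0F ⌋))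
                   (λ i → binomℤ (topℤ A B (+ q ℤ.+ + 1)) (ν i)) ℕ.*
             ∏over (nonzeroIdx (λ β → ⌊ tr (β ⁻¹) ≟F 1F ⌋))
                   (λ i → binomℤ (topℤ A B (ℤ.- (+ q) ℤ.+ + 1)) (ν i))

  -- integers τ with |τ| < 2√q (i.e. τ² < 4q) and τ ≡ -1 (mod 4)
  tauRange : List ℤ
  tauRange = filter (λ τ → ((τ ℤ.* τ) ℤ.<? + (4 ℕ.* q)) ×-dec (τ ℤ.%ℕ 4 ℕ.≟ 3))
                    (map (λ k → + k ℤ.- + (2 ℕ.* q)) (upTo (suc (4 ℕ.* q))))

  formulaPlus : ℕ → ℕ → ℕ
  formulaPlus n j = sum (map term (families j))
    where
    A = Aplus n
    B = Bplus n
    term : (Fin q → ℕ) → ℕ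
    term ν = binomℤ (topℤ A B (+ (q ^ 3) ℤ.- + (q ^ 2) ℤ.- + 1)) (ν (idx 0F)) ℕ.*
             product (map (λ τ →
               ∏over (nonzeroIdx (λ β → ⌊ K (β ⁻¹) ℤ.≟ τ ⌋))
                     (λ i → binomℤ (topℤ A B (+ q ℤ.* τ ℤ.- + (q ^ 2) ℤ.- + 1)) (ν i)))
               tauRange)

{-# OPTIONS --safe #-}

-- A word of C(D) is determined up to the choice of positions by the numbers ν_β
-- of positions in its support at which the trace is β, so the weight
-- distribution is read off from the numbers n_β of elements of D = PσP of trace β.
--
-- Every element of PσP is p₁ σ p₂ in |P ∩ σPσ| ways and the trace is invariant
-- under conjugation by P, hence n_β · |P ∩ σPσ| = |P| · #{p ∈ P : Tr(σp) = β}.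
-- For p = (A , B) the symmetric matrix B enters Tr(σp) through the functional
-- B ↦ Tr(EAB), which is equidistributed unless EA is alternating; when it is, A
-- is block lower triangular with an invertible alternating block, and only the
-- trace of the remaining 1 × 1 or 2 × 2 block and of its transposed inverse is
-- left. The 1 × 1 count solves x + 1/x = β; the 2 × 2 count is a Kloosterman sum.
--
-- That the Kloosterman sums lie in the range of τ is the Hasse bound for
-- w² + w = X + a/X, proved by Manin's argument: the heights d_n of the points
-- Frobenius + n (t , 0) of the curve over F_q(t) satisfy
-- d_(n-1) + d_(n+1) ≤ 2 d_n + 2, so they lie below a quadratic in n whose
-- nonnegativity is the bound.

module Submission where

open import Algebra.Bundles using (CommutativeMonoid; CommutativeRing; RawRing)
import Algebra.Properties.AbelianGroup
import Algebra.Properties.CommutativeMonoid.Sum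
import Algebra.Solver.Ring
open import Algebra.Solver.Ring.AlmostCommutativeRing using (fromCommutativeRing; _-Raw-AlmostCommutative⟶_)
open import Data.Bool using (Bool; true; false; if_then_else_; _∧_; _xor_)
open import Data.Maybe using (Maybe; just; nothing)
open import Data.Product using (∃; ∃₂; _×_; _,_; proj₁; proj₂)
open import Function using (_∘_; id)
open import Level using (0ℓ)
import Relation.Binary.PropositionalEquality as ≡
import Relation.Binary.Reasoning.Setoid

-- Two obstacles shape the argument. Matrices are functions compared entrywise, so all counting
-- takes place in finite setoids, as sums of indicators. And every intermediate count is a quotient
-- of group orders, while the counts live in ℕ; so each is stated with its denominators multiplied
-- out, and the common factor, the order of P ∩ σPσ, is cancelled once, in `reduced`. The constants
-- of the theorem are differences. In part (a) they are q c - (q - 1), where c = 1, 2 or 0 is the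
-- number of x with x + 1/x = β. In part (b) they are c - (q² - 1)(q - 1), where c counts the D in
-- GL(2,q) with Tr D + Tr D⁻¹ = β. The subtracted term takes out of the equidistributed share those
-- A for which EA is alternating. That τ ≡ -1 mod 4 comes from K = q - 1 - 2 n₁ with n₁ even, since
-- x + a/x takes each nonzero value twice or never. In the height argument Frobenius + (t , 0) and
-- Frobenius - (t , 0) bound K from opposite sides. The point count enters through the second height
-- d_1: the fraction giving the x-coordinate cancels one linear factor for each c of the right
-- trace.

module Char2 {c ℓ} (R : CommutativeRing c ℓ)
             (double : ∀ x → CommutativeRing._≈_ R (CommutativeRing._+_ R x x) (CommutativeRing.0# R)) where

  open CommutativeRing R hiding (_+_; _*_; zero)

  F₂ : RawRing 0ℓ 0ℓ
  F₂ = record { Carrier = Bool ; _≈_ = ≡._≡_ ; _+_ = _xor_ ; _*_ = _∧_ ; -_ = id ; 0# = false ; 1# = true }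

  ⟦_⟧ : Bool → Carrier
  ⟦ true ⟧  = 1#
  ⟦ false ⟧ = 0#

  -‿id : ∀ x → x ≈ - x
  -‿id x = inverseˡ-unique x x (double x)
    where open Algebra.Properties.AbelianGroup +-abelianGroup using (inverseˡ-unique)

  -- Coefficients in F₂ make the normal form cancel doubled terms by itself, so each polynomial
  -- identity of characteristic 2 is a single call of `solve`. Negation of coefficients may be the
  -- identity because x = -x in R.
  morphism : F₂ -Raw-AlmostCommutative⟶ fromCommutativeRing R
  morphism = record
    { ⟦_⟧    = ⟦_⟧
    ; +-homo = λ { false y → sym′ (+-identityˡ _) ; true false → sym′ (+-identityʳ _) ; true true → sym′ (double _) }
    ; *-homo = λ { false y → sym′ (zeroˡ _) ; true y → sym′ (*-identityˡ _) }
    ; -‿homo = λ { b → -‿id ⟦ b ⟧ }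
    ; 0-homo = reflexive ≡.refl
    ; 1-homo = reflexive ≡.refl
    }
    where sym′ = CommutativeRing.sym R

  _coeff≟_ : ∀ a b → Maybe (⟦ a ⟧ ≈ ⟦ b ⟧)
  true  coeff≟ true  = just (reflexive ≡.refl)
  false coeff≟ false = just (reflexive ≡.refl)
  _     coeff≟ _     = nothing

  open Algebra.Solver.Ring F₂ (fromCommutativeRing R) morphism _coeff≟_ public
    using (solve; _:=_; _:+_; _:*_; con)

-- Bezout coprimality, and addition of (t , 0) on the curve

module Coprimality {c ℓ} (R : CommutativeRing c ℓ)
                   (double : ∀ x → CommutativeRing._≈_ R (CommutativeRing._+_ R x x) (CommutativeRing.0# R)) where

  open CommutativeRing R
  open Char2 R double using (solve; _:=_; _:+_; _:*_; con)
  open Relation.Binary.Reasoning.Setoid setoid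

  infix 4 _∣_
  _∣_ : Carrier → Carrier → Set _
  x ∣ y = ∃ λ h → y ≈ x * h

  -- Coprimality is carried as a Bezout identity, hence passes to products and powers by multiplying
  -- identities; no division algorithm enters.
  InIdeal : Carrier → Carrier → Carrier → Set _
  InIdeal x y z = ∃₂ λ u v → z ≈ u * x + v * y

  Coprime : Carrier → Carrier → Set _
  Coprime x y = InIdeal x y 1#

  ideal-cong : ∀ {x y z w} → z ≈ w → InIdeal x y z → InIdeal x y w
  ideal-cong e (u , v , h) = u , v , trans (sym e) h

  ideal-+ : ∀ {x y z w} → InIdeal x y z → InIdeal x y w → InIdeal x y (z + w)
  ideal-+ {x} {y} (u , v , h) (u′ , v′ , h′) = u + u′ , v + v′ , trans (+-cong h h′)
    (solve 6 (λ x y u v u′ v′ → (u :* x :+ v :* y) :+ (u′ :* x :+ v′ :* y) := (u :+ u′) :* x :+ (v :+ v′) :* y) refl x y u v u′ v′)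

  ideal-* : ∀ {x y z} w → InIdeal x y z → InIdeal x y (w * z)
  ideal-* {x} {y} w (u , v , h) = w * u , w * v , trans (*-congˡ h)
    (solve 5 (λ x y u v w → w :* (u :* x :+ v :* y) := w :* u :* x :+ w :* v :* y) refl x y u v w)

  ideal-1st : ∀ x y → InIdeal x y x
  ideal-1st x y = 1# , 0# , solve 2 (λ x y → x := con true :* x :+ con false :* y) refl x y

  ideal-swap : ∀ {x y z} → InIdeal x y z → InIdeal y x z
  ideal-swap (u , v , h) = v , u , trans h (+-comm _ _)

  ideal-2nd : ∀ x y → InIdeal x y y
  ideal-2nd x y = ideal-swap (ideal-1st y x)

  coprime-sym : ∀ {x y} → Coprime x y → Coprime y x
  coprime-sym = ideal-swap

  coprime-* : ∀ {x y z} → Coprime x y → Coprime x z → Coprime x (y * z)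
  coprime-* {x} {y} {z} (u , v , h) (u′ , v′ , h′) = u * u′ * x + u * v′ * z + v * y * u′ , v * v′ , (begin
    1#                                   ≈⟨ *-identityˡ 1# ⟨
    1# * 1#                              ≈⟨ *-cong h h′ ⟩
    (u * x + v * y) * (u′ * x + v′ * z)  ≈⟨ solve 7 (λ x y z u v u′ v′ →
      (u :* x :+ v :* y) :* (u′ :* x :+ v′ :* z) := (u :* u′ :* x :+ u :* v′ :* z :+ v :* y :* u′) :* x :+ v :* v′ :* (y :* z)) refl x y z u v u′ v′ ⟩
    (u * u′ * x + u * v′ * z + v * y * u′) * x + v * v′ * (y * z) ∎)

  coprime-square : ∀ {x y} → Coprime x y → Coprime (x * x) (y * y)
  coprime-square c = coprime-sym (coprime-* d d)
    where d = coprime-sym (coprime-* c c)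

  ∣-coprime-* : ∀ {x y z} → Coprime x y → x ∣ z → y ∣ z → x * y ∣ z
  ∣-coprime-* {x} {y} {z} (u , v , e) (h , eh) (k , ek) = u * k + v * h , (begin
    z                                ≈⟨ *-identityʳ z ⟨
    z * 1#                           ≈⟨ *-congˡ e ⟩
    z * (u * x + v * y)              ≈⟨ distribˡ z _ _ ⟩
    z * (u * x) + z * (v * y)        ≈⟨ +-cong (*-congʳ ek) (*-congʳ eh) ⟩
    y * k * (u * x) + x * h * (v * y) ≈⟨ solve 6 (λ x y u v h k → y :* k :* (u :* x) :+ x :* h :* (v :* y) := x :* y :* (u :* k :+ v :* h)) refl x y u v h k ⟩
    x * y * (u * k + v * h)          ∎)

  -- For a point P with x-coordinate f/g on the curve
  -- w² + w = X + a/X + t + a/t and Q = (t , 0), the roots f′/g′ of this form are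
  -- the x-coordinates of P + Q and P − Q (both denominators are homogenised).
  module Neighbours (t a a⁻¹ : Carrier) (a-unit : a * a⁻¹ ≈ 1#) where

    A B C : Carrier → Carrier → Carrier
    A f g = f * t + a * g
    B f g = f + t * g
    C f g = f * g * t

    form : Carrier → Carrier → Carrier → Carrier → Carrier
    form f g f′ g′ = B f g * B f g * (f′ * f′) + C f g * (f′ * g′) + A f g * A f g * (g′ * g′)

    Related : Carrier → Carrier → Carrier → Carrier → Set _
    Related f g f′ g′ = form f g f′ g′ ≈ 0#

    -- If P′ = P ± Q then P = P′ ∓ Q, and an x-coordinate does not see the sign. So a point is a
    -- neighbour of each of its neighbours, which lets the descent reuse the previous point as a
    -- known root.
    related-sym : ∀ {f g f′ g′} → Related f g f′ g′ → Related f′ g′ f g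
    related-sym {f} {g} {f′} {g′} h = trans (solve 6 (λ f g f′ g′ t a →
        (f′ :+ t :* g′) :* (f′ :+ t :* g′) :* (f :* f) :+ f′ :* g′ :* t :* (f :* g) :+ (f′ :* t :+ a :* g′) :* (f′ :* t :+ a :* g′) :* (g :* g)
      := (f :+ t :* g) :* (f :+ t :* g) :* (f′ :* f′) :+ f :* g :* t :* (f′ :* g′) :+ (f :* t :+ a :* g) :* (f :* t :+ a :* g) :* (g′ :* g′))
      refl f g f′ g′ t a) h

    -- Vieta's formulas for the roots f′/g′ and f″/g″ of `form`, whose product is A²/B² and whose
    -- sum is C/B². Numerators and denominators agree exactly and not only up to a common factor, as
    -- the comparison of degrees requires.
    record Opposite (f g f′ g′ f″ g″ : Carrier) : Set ℓ where
      field
        ff : f′ * f″ ≈ A f g * A f g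
        gg : g′ * g″ ≈ B f g * B f g
        fg : f′ * g″ + f″ * g′ ≈ C f g

    opposite : ∀ {f g f′ g′} → Coprime f′ g′ → Related f g f′ g′ → ∃₂ λ f″ g″ → Opposite f g f′ g′ f″ g″
    -- The form βX² + γXY + αY² is to factor as (g′X + f′Y)(g″X + f″Y). Its middle coefficient gives
    -- f′g″ + g′f″ = γ and its value at (v , u) gives v g″ + u f″ = Q. This linear system for f″ and
    -- g″ has determinant u f′ + v g′ = 1.
    opposite {f} {g} {f′} {g′} (u , v , e) rel = v * γ + f′ * Q , u * γ + g′ * Q , record
      { ff = part f′ g′ u v α β γ e rel
      ; gg = trans (*-congˡ (+-congˡ (*-congˡ (solve 5 (λ u v α β γ → β :* (v :* v) :+ γ :* (u :* v) :+ α :* (u :* u)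
                 := α :* (u :* u) :+ γ :* (v :* u) :+ β :* (v :* v)) refl u v α β γ))))
               (part g′ f′ v u β α γ (trans e (+-comm _ _)) (trans (solve 5 (λ f′ g′ α β γ →
                   α :* (g′ :* g′) :+ γ :* (g′ :* f′) :+ β :* (f′ :* f′) := β :* (f′ :* f′) :+ γ :* (f′ :* g′) :+ α :* (g′ :* g′)) refl f′ g′ α β γ) rel))
      ; fg = begin
          f′ * (u * γ + g′ * Q) + (v * γ + f′ * Q) * g′
            ≈⟨ solve 6 (λ f′ g′ u v γ q → f′ :* (u :* γ :+ g′ :* q) :+ (v :* γ :+ f′ :* q) :* g′ := γ :* (u :* f′ :+ v :* g′)) refl f′ g′ u v γ Q ⟩
          γ * s   ≈⟨ *-congˡ e ⟨
          γ * 1#  ≈⟨ *-identityʳ γ ⟩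
          γ       ∎
      }
      where
      α = A f g * A f g
      β = B f g * B f g
      γ = C f g
      s = u * f′ + v * g′
      Q = β * (v * v) + γ * (u * v) + α * (u * u)
      part : ∀ f′ g′ u v α β γ → 1# ≈ u * f′ + v * g′ → β * (f′ * f′) + γ * (f′ * g′) + α * (g′ * g′) ≈ 0# →
             f′ * (v * γ + f′ * (β * (v * v) + γ * (u * v) + α * (u * u))) ≈ α
      part f′ g′ u v α β γ e rel = begin
        f′ * (v * γ + f′ * (β * (v * v) + γ * (u * v) + α * (u * u)))
          ≈⟨ solve 6 (λ f′ u v α β γ → f′ :* (v :* γ :+ f′ :* (β :* (v :* v) :+ γ :* (u :* v) :+ α :* (u :* u)))
               := γ :* (f′ :* v) :+ (β :* (f′ :* v :* (f′ :* v)) :+ γ :* (u :* f′ :* (f′ :* v))) :+ α :* (u :* f′ :* (u :* f′))) refl f′ u v α β γ ⟩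
        γ * m + (β * (m * m) + γ * (p * m)) + α * (p * p)
          ≈⟨ solve 6 (λ m p r α β γ → γ :* m :+ (β :* (m :* m) :+ γ :* (p :* m)) :+ α :* (p :* p)
               := γ :* m :* (con true :+ (p :+ r)) :+ α :* ((p :+ r) :* (p :+ r)) :+ (β :* (m :* m) :+ γ :* (m :* r) :+ α :* (r :* r))) refl m p r α β γ ⟩
        γ * m * (1# + (p + r)) + α * ((p + r) * (p + r)) + (β * (m * m) + γ * (m * r) + α * (r * r))
          ≈⟨ +-cong (+-cong (*-congˡ (+-congˡ (sym e))) (*-congˡ (*-cong (sym e) (sym e)))) (trans (solve 6 (λ f′ g′ v α β γ →
               β :* (f′ :* v :* (f′ :* v)) :+ γ :* (f′ :* v :* (v :* g′)) :+ α :* (v :* g′ :* (v :* g′))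
               := v :* v :* (β :* (f′ :* f′) :+ γ :* (f′ :* g′) :+ α :* (g′ :* g′))) refl f′ g′ v α β γ) (trans (*-congˡ rel) (zeroʳ _))) ⟩
        γ * m * (1# + 1#) + α * (1# * 1#) + 0#
          ≈⟨ solve 3 (λ m α γ → γ :* m :* (con true :+ con true) :+ α :* (con true :* con true) :+ con false := α) refl m α γ ⟩
        α ∎
        where
        m = f′ * v
        p = u * f′
        r = v * g′

    module _ {f g f′ g′ f″ g″} (opp : Opposite f g f′ g′ f″ g″) where
      open Opposite opp

      opposite-related : Related f g f″ g″
      opposite-related = begin
        B f g * B f g * (f″ * f″) + C f g * (f″ * g″) + A f g * A f g * (g″ * g″)
          ≈⟨ +-cong (+-cong (*-congʳ (sym gg)) (*-congʳ (sym fg))) (*-congʳ (sym ff)) ⟩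
        g′ * g″ * (f″ * f″) + (f′ * g″ + f″ * g′) * (f″ * g″) + f′ * f″ * (g″ * g″)
          ≈⟨ solve 4 (λ f′ g′ f″ g″ → g′ :* g″ :* (f″ :* f″) :+ (f′ :* g″ :+ f″ :* g′) :* (f″ :* g″) :+ f′ :* f″ :* (g″ :* g″) := con false) refl f′ g′ f″ g″ ⟩
        0# ∎

      -- f⁴ and a² g⁴ lie in the ideal generated by A², B² and C.
      opposite-coprime : Coprime f g → Coprime f″ g″
      opposite-coprime cop = combine (coprime-square (coprime-square cop))
        where
        α∈ : InIdeal f″ g″ (A f g * A f g)
        α∈ = ideal-cong ff (ideal-* f′ (ideal-1st f″ g″))
        β∈ : InIdeal f″ g″ (B f g * B f g)
        β∈ = ideal-cong gg (ideal-* g′ (ideal-2nd f″ g″))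
        C²∈ : InIdeal f″ g″ (C f g * C f g)
        C²∈ = ideal-* (C f g) (ideal-cong (trans (+-congˡ (*-comm g′ f″)) fg)
          (ideal-+ (ideal-* f′ (ideal-2nd f″ g″)) (ideal-* g′ (ideal-1st f″ g″))))
        f⁴ : f * f * (f * f) ≈ f * f * (B f g * B f g) + C f g * C f g
        f⁴ = solve 3 (λ f g t → f :* f :* (f :* f) := f :* f :* ((f :+ t :* g) :* (f :+ t :* g)) :+ f :* g :* t :* (f :* g :* t)) refl f g t
        g⁴ : g * g * (g * g) ≈ a⁻¹ * a⁻¹ * (g * g * (A f g * A f g) + C f g * C f g)
        g⁴ = begin
          g * g * (g * g)                      ≈⟨ trans (*-congˡ (*-identityˡ 1#)) (*-identityʳ _) ⟨
          g * g * (g * g) * (1# * 1#)          ≈⟨ *-congˡ (*-cong a-unit a-unit) ⟨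
          g * g * (g * g) * (a * a⁻¹ * (a * a⁻¹)) ≈⟨ solve 5 (λ f g t a b → g :* g :* (g :* g) :* (a :* b :* (a :* b)) :=
              b :* b :* (g :* g :* ((f :* t :+ a :* g) :* (f :* t :+ a :* g)) :+ f :* g :* t :* (f :* g :* t))) refl f g t a a⁻¹ ⟩
          a⁻¹ * a⁻¹ * (g * g * (A f g * A f g) + C f g * C f g) ∎
        combine : InIdeal (f * f * (f * f)) (g * g * (g * g)) 1# → Coprime f″ g″
        combine (x , y , e) = ideal-cong (sym e) (ideal-+ (ideal-* x (ideal-cong (sym f⁴) (ideal-+ (ideal-* (f * f) β∈) C²∈)))
          (ideal-* y (ideal-cong (sym g⁴) (ideal-* (a⁻¹ * a⁻¹) (ideal-+ (ideal-* (g * g) α∈) C²∈)))))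

open import Defs
open import Algebra.Structures using (IsCommutativeRing)
open import Data.Empty using (⊥; ⊥-elim)
open import Data.Fin using (Fin; zero; suc; splitAt; _↑ˡ_; _↑ʳ_; toℕ)
import Data.Fin as Fin
open import Data.Fin.Permutation using (Permutation′; permutation)
import Data.Fin.Properties as Fin
import Data.Integer as ℤ
import Data.Integer.Properties as ℤ
import Data.Integer.Tactic.RingSolver as ℤ
open import Data.List using (List; []; _∷_; map; concatMap; filter; length; upTo; allFin; foldr; _++_)
open import Data.List.Properties using (map-++; map-tabulate; map-∘; map-cong; upTo-∷ʳ; length-map; length-tabulate)
open import Data.List.Relation.Unary.All using (All; []; _∷_; universal)
import Data.List.Relation.Unary.All as All
open import Data.List.Relation.Unary.All.Properties using (all-filter)
open import Data.List.Relation.Unary.AllPairs using ([]; _∷_)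
open import Data.List.Relation.Unary.Unique.Propositional using (Unique)
open import Data.List.Relation.Unary.Unique.Propositional.Properties using (map⁺; allFin⁺; filter⁺)
open import Data.Nat using (ℕ; zero; suc; pred; _+_; _*_; _∸_; _^_; _/_; _%_; _⊔_; _≤_; _<_; _≤ᵇ_; z≤n; s≤s)
import Data.Nat as ℕ
open import Data.Nat.DivMod using ([m+kn]%n≡m%n; m*n/n≡m; m≡m%n+[m/n]*n)
import Data.Nat.Properties as ℕ
open import Data.Nat.Tactic.RingSolver using (solve-∀)
open import Data.Sum using (_⊎_; inj₁; inj₂; [_,_]′)
open import Data.Unit using (⊤; tt)
open import Data.Vec.Functional using () renaming (_∷_ to _∷ᵛ_)
open import Function.Bundles using (Inverse)
open import Relation.Binary.Bundles using (Setoid)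
open import Relation.Binary.PropositionalEquality hiding (isEquivalence; J)
open import Relation.Binary.Structures using (IsEquivalence)
open import Relation.Nullary using (Dec; yes; no; ¬_; ¬?; does; _×-dec_)
import Relation.Nullary.Decidable as Dec
open import Relation.Nullary.Decidable using (⌊_⌋)

-- Finite sums, and counting in finite setoids

module FiniteSums where
  open import Data.Fin.Properties using (all?)
  open import Data.List.Relation.Unary.Any using (Any; here; there; any?; satisfied)
  import Data.List.Relation.Unary.Any as Any
  open import Data.Nat.ListAction using (sum; product)
  open import Data.Nat.ListAction.Properties using (sum-++; product-++)
  open import Data.Nat.Properties hiding (_≟_)

  private variable
    A B : Set
    P Q : Set

  ∑ₗ : List A → (A → ℕ) → ℕ
  ∑ₗ xs f = sum (map f xs)

  𝟙 : Dec P → ℕ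
  𝟙 d = if does d then 1 else 0

  𝟙-yes : (d : Dec P) → P → 𝟙 d ≡ 1
  𝟙-yes (yes _) _ = refl
  𝟙-yes (no ¬p) p = ⊥-elim (¬p p)

  𝟙-no : (d : Dec P) → ¬ P → 𝟙 d ≡ 0
  𝟙-no (yes p) ¬p = ⊥-elim (¬p p)
  𝟙-no (no _) _ = refl

  𝟙-cong : (d : Dec P) (e : Dec Q) → (P → Q) → (Q → P) → 𝟙 d ≡ 𝟙 e
  𝟙-cong (yes p) e f g = sym (𝟙-yes e (f p))
  𝟙-cong (no ¬p) e f g = sym (𝟙-no e (¬p ∘ g))

  𝟙-× : (d : Dec P) (e : Dec Q) → 𝟙 (d ×-dec e) ≡ 𝟙 d * 𝟙 e
  𝟙-× (yes _) e = sym (+-identityʳ _)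
  𝟙-× (no _)  e = refl

  𝟙-*-cong : (d : Dec P) {m n : ℕ} → (P → m ≡ n) → 𝟙 d * m ≡ 𝟙 d * n
  𝟙-*-cong (yes p) h = cong (1 *_) (h p)
  𝟙-*-cong (no _)  h = refl

  𝟙-¬ : (d : Dec P) → 𝟙 d + 𝟙 (Dec.¬? d) ≡ 1
  𝟙-¬ (yes _) = refl
  𝟙-¬ (no _)  = refl

  ∑-cong : (xs : List A) {f g : A → ℕ} → (∀ x → f x ≡ g x) → ∑ₗ xs f ≡ ∑ₗ xs g
  ∑-cong xs h = cong sum (map-cong h xs)

  ∑-zero : (xs : List A) → ∑ₗ xs (λ _ → 0) ≡ 0
  ∑-zero []       = refl
  ∑-zero (x ∷ xs) = ∑-zero xs

  ∑-+ : (xs : List A) (f g : A → ℕ) → ∑ₗ xs (λ x → f x + g x) ≡ ∑ₗ xs f + ∑ₗ xs g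
  ∑-+ []       f g = refl
  ∑-+ (x ∷ xs) f g = trans (cong (f x + g x +_) (∑-+ xs f g)) (+-interchange (f x) (g x) (∑ₗ xs f) (∑ₗ xs g))
    where
    +-interchange : ∀ a b c d → (a + b) + (c + d) ≡ (a + c) + (b + d)
    +-interchange = solve-∀

  ∑-*ˡ : (xs : List A) (c : ℕ) (f : A → ℕ) → ∑ₗ xs (λ x → c * f x) ≡ c * ∑ₗ xs f
  ∑-*ˡ []       c f = sym (*-zeroʳ c)
  ∑-*ˡ (x ∷ xs) c f = trans (cong (c * f x +_) (∑-*ˡ xs c f)) (sym (*-distribˡ-+ c _ _))

  ∑-*ʳ : (xs : List A) (c : ℕ) (f : A → ℕ) → ∑ₗ xs (λ x → f x * c) ≡ ∑ₗ xs f * c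
  ∑-*ʳ xs c f = trans (∑-cong xs (λ x → *-comm (f x) c)) (trans (∑-*ˡ xs c f) (*-comm c _))

  ∑-swap : (xs : List A) (ys : List B) (f : A → B → ℕ) →
           ∑ₗ xs (λ x → ∑ₗ ys (f x)) ≡ ∑ₗ ys (λ y → ∑ₗ xs (λ x → f x y))
  ∑-swap []       ys f = sym (∑-zero ys)
  ∑-swap (x ∷ xs) ys f = trans (cong (∑ₗ ys (f x) +_) (∑-swap xs ys f)) (sym (∑-+ ys (f x) _))

  ∑-≤ : (xs : List A) {f g : A → ℕ} → (∀ x → f x ≤ g x) → ∑ₗ xs f ≤ ∑ₗ xs g
  ∑-≤ []       h = z≤n
  ∑-≤ (x ∷ xs) h = +-mono-≤ (h x) (∑-≤ xs h)

  -- The differences g x - f x are nonnegative and add up to 0. The entry is located through `Any`,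
  -- because an element of a setoid is only equivalent to some entry of the list.
  ∑-squeeze : (xs : List A) {f g : A → ℕ} → (∀ x → f x ≤ g x) → ∑ₗ xs f ≡ ∑ₗ xs g →
              ∀ {R : A → Set} → Any R xs → Any (λ x → R x × f x ≡ g x) xs
  ∑-squeeze (x ∷ xs) {f} {g} h e (here r)  = here (r , ≤-antisym (h x) (+-cancelʳ-≤ (∑ₗ xs g) (g x) (f x)
    (≤-trans (≤-reflexive (sym e)) (+-monoʳ-≤ (f x) (∑-≤ xs h)))))
  ∑-squeeze (x ∷ xs) {f} {g} h e (there a) = there (∑-squeeze xs h (≤-antisym (∑-≤ xs h)
    (+-cancelˡ-≤ (g x) _ _ (≤-trans (≤-reflexive (sym e)) (+-monoˡ-≤ (∑ₗ xs f) (h x))))) a)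

  ∑-map : (xs : List A) (φ : A → B) (h : B → ℕ) → ∑ₗ (map φ xs) h ≡ ∑ₗ xs (h ∘ φ)
  ∑-map xs φ h = cong sum (sym (map-∘ xs))

  ∑-++ : (xs ys : List A) (h : A → ℕ) → ∑ₗ (xs ++ ys) h ≡ ∑ₗ xs h + ∑ₗ ys h
  ∑-++ xs ys h = trans (cong sum (map-++ h xs ys)) (sum-++ (map h xs) _)

  ∑-concatMap-map : {C : Set} (xs : List A) (ys : List B) (c : A → B → C) (h : C → ℕ) →
    ∑ₗ (concatMap (λ x → map (c x) ys) xs) h ≡ ∑ₗ xs (λ x → ∑ₗ ys (λ y → h (c x y)))
  ∑-concatMap-map []       ys c h = refl
  ∑-concatMap-map (x ∷ xs) ys c h =
    trans (∑-++ (map (c x) ys) _ h) (cong₂ _+_ (∑-map ys (c x) h) (∑-concatMap-map xs ys c h))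

  ∑-filter : {R : A → Set} (R? : ∀ x → Dec (R x)) (xs : List A) (f : A → ℕ) →
             ∑ₗ (filter R? xs) f ≡ ∑ₗ xs (λ x → 𝟙 (R? x) * f x)
  ∑-filter R? []       f = refl
  ∑-filter R? (x ∷ xs) f with R? x
  ... | yes _ = cong₂ _+_ (sym (+-identityʳ (f x))) (∑-filter R? xs f)
  ... | no _  = ∑-filter R? xs f

  length-filter : {R : A → Set} (R? : ∀ x → Dec (R x)) (xs : List A) →
                  length (filter R? xs) ≡ ∑ₗ xs (λ x → 𝟙 (R? x))
  length-filter R? []       = refl
  length-filter R? (x ∷ xs) with R? x
  ... | yes _ = cong suc (length-filter R? xs)
  ... | no _  = length-filter R? xs

  -- Every class has exactly one representative in `elems`. `once` says this as a sum of indicators,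
  -- the shape that can be inserted into a sum and exchanged with it.
  record FiniteSetoid : Set₁ where
    infix 4 _≈_ _≟_
    field
      Carrier       : Set
      _≈_           : Carrier → Carrier → Set
      isEquivalence : IsEquivalence _≈_
      _≟_           : ∀ x y → Dec (x ≈ y)
      elems         : List Carrier
      once          : ∀ a → ∑ₗ elems (λ x → 𝟙 (x ≟ a)) ≡ 1

    open IsEquivalence isEquivalence public
      renaming (refl to ≈-refl; sym to ≈-sym; trans to ≈-trans)

    ∑ˢ : (Carrier → ℕ) → ℕ
    ∑ˢ = ∑ₗ elems

    size : ℕ
    size = ∑ˢ (λ _ → 1)

    once′ : ∀ a → ∑ˢ (λ x → 𝟙 (a ≟ x)) ≡ 1
    once′ a = trans (∑-cong elems λ x → 𝟙-cong (a ≟ x) (x ≟ a) ≈-sym ≈-sym) (once a)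

    sift : ∀ a (f : Carrier → ℕ) → (∀ {x} → x ≈ a → f x ≡ f a) →
           ∑ˢ (λ x → 𝟙 (x ≟ a) * f x) ≡ f a
    sift a f resp = begin
      ∑ˢ (λ x → 𝟙 (x ≟ a) * f x) ≡⟨ ∑-cong elems (λ x → 𝟙-*-cong (x ≟ a) resp) ⟩
      ∑ˢ (λ x → 𝟙 (x ≟ a) * f a) ≡⟨ ∑-*ʳ elems (f a) _ ⟩
      ∑ˢ (λ x → 𝟙 (x ≟ a)) * f a ≡⟨ cong (_* f a) (once a) ⟩
      1 * f a                     ≡⟨ *-identityˡ _ ⟩
      f a                         ∎
      where open ≡-Reasoning

    listed : ∀ a → Any (_≈ a) elems
    listed a = go elems (once a)
      where
      go : ∀ xs → ∑ₗ xs (λ x → 𝟙 (x ≟ a)) ≡ 1 → Any (_≈ a) xs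
      go (x ∷ xs) h with x ≟ a
      ... | yes x≈a = here x≈a
      ... | no _    = there (go xs h)

    search : {R : Carrier → Set} → (∀ {x y} → x ≈ y → R x → R y) → (∀ x → Dec (R x)) → Dec (∃ R)
    search {R} resp R? with any? R? elems
    ... | yes h = yes (satisfied h)
    ... | no ¬h = no λ (a , ra) → ¬h (Any.map (λ {x} x≈a → resp (≈-sym x≈a) ra) (listed a))

  open FiniteSetoid using (∑ˢ; elems; size)

  fibres : (T : FiniteSetoid) (let open FiniteSetoid T using (Carrier; _≟_)) (xs : List A) (φ : A → Carrier) (f : A → ℕ) →
           ∑ₗ xs f ≡ ∑ˢ T (λ y → ∑ₗ xs (λ x → 𝟙 (φ x ≟ y) * f x))
  fibres T xs φ f = begin
    ∑ₗ xs f                                            ≡⟨ ∑-cong xs (λ x → trans (sym (*-identityˡ (f x))) (cong (_* f x) (sym (once′ (φ x))))) ⟩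
    ∑ₗ xs (λ x → ∑ˢ T (λ y → 𝟙 (φ x ≟ y)) * f x)       ≡⟨ ∑-cong xs (λ x → ∑-*ʳ (elems T) (f x) _) ⟨
    ∑ₗ xs (λ x → ∑ˢ T (λ y → 𝟙 (φ x ≟ y) * f x))       ≡⟨ ∑-swap xs (elems T) _ ⟩
    ∑ˢ T (λ y → ∑ₗ xs (λ x → 𝟙 (φ x ≟ y) * f x))       ∎
    where
    open FiniteSetoid T using (_≟_; once′)
    open ≡-Reasoning

  -- The hypotheses speak of all representatives y of φ x, so that no separate
  -- proof that φ and ψ respect the equivalences is required.
  sum-bij : (S T : FiniteSetoid) (let open FiniteSetoid S using () renaming (Carrier to X; _≈_ to _≈₁_))
    (let open FiniteSetoid T using () renaming (Carrier to Y; _≈_ to _≈₂_))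
    {R : X → Set} {W : Y → Set} (R? : ∀ x → Dec (R x)) (W? : ∀ y → Dec (W y))
    (f : X → ℕ) (g : Y → ℕ) (φ : X → Y) (ψ : Y → X) →
    (∀ x y → R x → φ x ≈₂ y → W y × ψ y ≈₁ x × f x ≡ g y) →
    (∀ x y → W y → ψ y ≈₁ x → R x × φ x ≈₂ y) →
    ∑ˢ S (λ x → 𝟙 (R? x) * f x) ≡ ∑ˢ T (λ y → 𝟙 (W? y) * g y)
  sum-bij S T R? W? f g φ ψ to from = begin
    ∑ˢ S (λ x → 𝟙 (R? x) * f x)                                  ≡⟨ fibres T (elems S) φ _ ⟩
    ∑ˢ T (λ y → ∑ˢ S (λ x → 𝟙 (φ x ≟₂ y) * (𝟙 (R? x) * f x)))    ≡⟨ ∑-cong (elems T) (λ y → ∑-cong (elems S) (λ x → pointwise x y)) ⟩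
    ∑ˢ T (λ y → ∑ˢ S (λ x → 𝟙 (ψ y ≟₁ x) * (𝟙 (W? y) * g y)))    ≡⟨ ∑-swap (elems T) (elems S) _ ⟩
    ∑ˢ S (λ x → ∑ˢ T (λ y → 𝟙 (ψ y ≟₁ x) * (𝟙 (W? y) * g y)))    ≡⟨ fibres S (elems T) ψ _ ⟨
    ∑ˢ T (λ y → 𝟙 (W? y) * g y)                                  ∎
    where
    open FiniteSetoid S using () renaming (_≟_ to _≟₁_)
    open FiniteSetoid T using () renaming (_≟_ to _≟₂_)
    open ≡-Reasoning
    pointwise : ∀ x y → 𝟙 (φ x ≟₂ y) * (𝟙 (R? x) * f x) ≡ 𝟙 (ψ y ≟₁ x) * (𝟙 (W? y) * g y)
    pointwise x y with R? x | φ x ≟₂ y | W? y | ψ y ≟₁ x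
    ... | yes r | yes e | yes _ | yes _  = cong (λ k → 1 * (1 * k)) (proj₂ (proj₂ (to x y r e)))
    ... | yes r | yes e | no ¬w | _      = ⊥-elim (¬w (proj₁ (to x y r e)))
    ... | yes r | yes e | _     | no ¬e′ = ⊥-elim (¬e′ (proj₁ (proj₂ (to x y r e))))
    ... | yes r | no ¬e | yes w | yes e′ = ⊥-elim (¬e (proj₂ (from x y w e′)))
    ... | yes r | no ¬e | no _  | yes _  = refl
    ... | yes r | no ¬e | _     | no _   = refl
    ... | no ¬r | _     | yes w | yes e′ = ⊥-elim (¬r (proj₁ (from x y w e′)))
    ... | no ¬r | yes _ | no _  | yes _  = refl
    ... | no ¬r | yes _ | _     | no _   = refl
    ... | no ¬r | no _  | no _  | yes _  = refl
    ... | no ¬r | no _  | _     | no _   = refl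

  # : (S : FiniteSetoid) {R : FiniteSetoid.Carrier S → Set} → (∀ x → Dec (R x)) → ℕ
  # S R? = ∑ˢ S (λ x → 𝟙 (R? x))

  #-cong : (S : FiniteSetoid) {R W : FiniteSetoid.Carrier S → Set} (R? : ∀ x → Dec (R x)) (W? : ∀ x → Dec (W x)) →
    (∀ x → R x → W x) → (∀ x → W x → R x) → # S R? ≡ # S W?
  #-cong S R? W? f g = ∑-cong (elems S) λ x → 𝟙-cong (R? x) (W? x) (f x) (g x)

  #-¬ : (S : FiniteSetoid) {R : FiniteSetoid.Carrier S → Set} (R? : ∀ x → Dec (R x)) →
    # S R? + # S (λ x → Dec.¬? (R? x)) ≡ size S
  #-¬ S R? = trans (sym (∑-+ (elems S) _ _)) (∑-cong (elems S) λ x → 𝟙-¬ (R? x))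

  #-bij : (S T : FiniteSetoid) (let open FiniteSetoid S using () renaming (Carrier to X; _≈_ to _≈₁_))
    (let open FiniteSetoid T using () renaming (Carrier to Y; _≈_ to _≈₂_))
    {R : X → Set} {W : Y → Set} (R? : ∀ x → Dec (R x)) (W? : ∀ y → Dec (W y)) (φ : X → Y) (ψ : Y → X) →
    (∀ x y → R x → φ x ≈₂ y → W y × ψ y ≈₁ x) →
    (∀ x y → W y → ψ y ≈₁ x → R x × φ x ≈₂ y) →
    # S R? ≡ # T W?
  #-bij S T R? W? φ ψ to from = trans (∑-cong (elems S) λ x → sym (*-identityʳ _))
    (trans (sum-bij S T R? W? (λ _ → 1) (λ _ → 1) φ ψ
             (λ x y r e → let w , e′ = to x y r e in w , e′ , refl) from)
           (∑-cong (elems T) λ x → *-identityʳ _))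

  infixr 2 _×ˢ_
  _×ˢ_ : FiniteSetoid → FiniteSetoid → FiniteSetoid
  S ×ˢ T = record
    { Carrier       = S.Carrier × T.Carrier
    ; _≈_           = λ (x , y) (x′ , y′) → x S.≈ x′ × y T.≈ y′
    ; isEquivalence = record
      { refl  = S.≈-refl , T.≈-refl
      ; sym   = λ (e , e′) → S.≈-sym e , T.≈-sym e′
      ; trans = λ (e , e′) (h , h′) → S.≈-trans e h , T.≈-trans e′ h′ }
    ; _≟_           = λ (x , y) (x′ , y′) → (x S.≟ x′) ×-dec (y T.≟ y′)
    ; elems         = concatMap (λ x → map (x ,_) T.elems) S.elems
    ; once          = λ (a , b) → begin
        ∑ₗ (concatMap (λ x → map (x ,_) T.elems) S.elems) (λ (x , y) → 𝟙 ((x S.≟ a) ×-dec (y T.≟ b)))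
          ≡⟨ ∑-concatMap-map S.elems T.elems _,_ _ ⟩
        ∑ˢ S (λ x → ∑ˢ T (λ y → 𝟙 ((x S.≟ a) ×-dec (y T.≟ b))))
          ≡⟨ ∑-cong S.elems (λ x → trans (∑-cong T.elems λ y → 𝟙-× (x S.≟ a) (y T.≟ b)) (∑-*ˡ T.elems (𝟙 (x S.≟ a)) _)) ⟩
        ∑ˢ S (λ x → 𝟙 (x S.≟ a) * ∑ˢ T (λ y → 𝟙 (y T.≟ b)))
          ≡⟨ ∑-cong S.elems (λ x → trans (cong (𝟙 (x S.≟ a) *_) (T.once b)) (*-identityʳ _)) ⟩
        ∑ˢ S (λ x → 𝟙 (x S.≟ a)) ≡⟨ S.once a ⟩
        1 ∎
    }
    where
    module S = FiniteSetoid S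
    module T = FiniteSetoid T
    open ≡-Reasoning

  ∑-×ˢ : (S T : FiniteSetoid) (f : FiniteSetoid.Carrier (S ×ˢ T) → ℕ) →
         ∑ˢ (S ×ˢ T) f ≡ ∑ˢ S (λ x → ∑ˢ T (λ y → f (x , y)))
  ∑-×ˢ S T f = ∑-concatMap-map (elems S) (elems T) _,_ f

  #-×ˢ : (S T : FiniteSetoid) (let open FiniteSetoid S using () renaming (Carrier to X))
    (let open FiniteSetoid T using () renaming (Carrier to Y))
    {R : X → Set} {W : Y → Set} (R? : ∀ x → Dec (R x)) (W? : ∀ y → Dec (W y)) →
    # (S ×ˢ T) (λ (x , y) → R? x ×-dec W? y) ≡ # S R? * # T W?
  #-×ˢ S T R? W? = begin
    # (S ×ˢ T) (λ (x , y) → R? x ×-dec W? y)         ≡⟨ ∑-×ˢ S T _ ⟩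
    ∑ˢ S (λ x → ∑ˢ T (λ y → 𝟙 (R? x ×-dec W? y)))    ≡⟨ ∑-cong (elems S) (λ x → trans (∑-cong (elems T) λ y → 𝟙-× (R? x) (W? y)) (∑-*ˡ (elems T) (𝟙 (R? x)) _)) ⟩
    ∑ˢ S (λ x → 𝟙 (R? x) * # T W?)                   ≡⟨ ∑-*ʳ (elems S) _ _ ⟩
    # S R? * # T W?                                   ∎
    where open ≡-Reasoning

  -- allFuns hides its cons in a where clause, hence the detour through an
  -- arbitrary function agreeing with _∷ᵛ_ pointwise.
  ∑-allFuns : (xs : List A) (m : ℕ) (h : (Fin (suc m) → A) → ℕ) →
    (∀ {f g} → (∀ i → f i ≡ g i) → h f ≡ h g) →
    ∑ₗ (allFuns xs (suc m)) h ≡ ∑ₗ xs (λ x → ∑ₗ (allFuns xs m) (λ f → h (x ∷ᵛ f)))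
  ∑-allFuns xs m h resp = trans (∑-concatMap-map xs (allFuns xs m) _ h)
    (∑-cong xs λ x → ∑-cong (allFuns xs m) λ f → resp λ { zero → refl ; (suc i) → refl })

  𝟙-all? : {m : ℕ} {R : Fin (suc m) → Set} (R? : ∀ i → Dec (R i)) →
           𝟙 (all? R?) ≡ 𝟙 (R? zero) * 𝟙 (all? (R? ∘ suc))
  𝟙-all? R? = trans (𝟙-cong (all? R?) (R? zero ×-dec all? (R? ∘ suc))
      (λ h → h zero , h ∘ suc) (λ { (h , t) zero → h ; (h , t) (suc i) → t i }))
    (𝟙-× (R? zero) (all? (R? ∘ suc)))

  allFuns-once : {_≈_ : A → A → Set} (_≟_ : ∀ x y → Dec (x ≈ y)) (xs : List A) (m : ℕ) (g : Fin m → A) →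
    (∀ i → ∑ₗ xs (λ x → 𝟙 (x ≟ g i)) ≡ 1) →
    ∑ₗ (allFuns xs m) (λ f → 𝟙 (all? (λ i → f i ≟ g i))) ≡ 1
  allFuns-once _≟_ xs zero    g h = refl
  allFuns-once {_≈_ = _≈_} _≟_ xs (suc m) g h = begin
    ∑ₗ (allFuns xs (suc m)) (λ f → 𝟙 (all? (λ i → f i ≟ g i)))
      ≡⟨ ∑-allFuns xs m _ (λ {f} {f′} e → 𝟙-cong (all? λ i → f i ≟ g i) (all? λ i → f′ i ≟ g i)
           (λ k i → subst (_≈ g i) (e i) (k i)) (λ k i → subst (_≈ g i) (sym (e i)) (k i))) ⟩
    ∑ₗ xs (λ x → ∑ₗ (allFuns xs m) (λ f → 𝟙 (all? (λ i → (x ∷ᵛ f) i ≟ g i))))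
      ≡⟨ ∑-cong xs (λ x → trans (∑-cong (allFuns xs m) λ f → 𝟙-all? (λ i → (x ∷ᵛ f) i ≟ g i)) (∑-*ˡ (allFuns xs m) (𝟙 (x ≟ g zero)) _)) ⟩
    ∑ₗ xs (λ x → 𝟙 (x ≟ g zero) * ∑ₗ (allFuns xs m) (λ f → 𝟙 (all? (λ i → f i ≟ g (suc i)))))
      ≡⟨ ∑-cong xs (λ x → trans (cong (𝟙 (x ≟ g zero) *_) (allFuns-once {_≈_ = _≈_} _≟_ xs m (g ∘ suc) (h ∘ suc))) (*-identityʳ _)) ⟩
    ∑ₗ xs (λ x → 𝟙 (x ≟ g zero)) ≡⟨ h zero ⟩
    1 ∎
    where open ≡-Reasoning

  Fun : ℕ → FiniteSetoid → FiniteSetoid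
  Fun m S = record
    { Carrier       = Fin m → S.Carrier
    ; _≈_           = λ f g → ∀ i → f i S.≈ g i
    ; isEquivalence = record
      { refl  = λ i → S.≈-refl
      ; sym   = λ e i → S.≈-sym (e i)
      ; trans = λ e h i → S.≈-trans (e i) (h i) }
    ; _≟_           = λ f g → all? λ i → f i S.≟ g i
    ; elems         = allFuns S.elems m
    ; once          = λ g → allFuns-once {_≈_ = S._≈_} S._≟_ S.elems m g (λ i → S.once (g i))
    }
    where module S = FiniteSetoid S

  size-Fun : ∀ m S → size (Fun m S) ≡ size S ^ m
  size-Fun zero    S = refl
  size-Fun (suc m) S = begin
    size (Fun (suc m) S)                 ≡⟨ ∑-allFuns (elems S) m (λ _ → 1) (λ _ → refl) ⟩
    ∑ˢ S (λ x → size (Fun m S))          ≡⟨ ∑-cong (elems S) (λ x → sym (*-identityˡ _)) ⟩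
    ∑ˢ S (λ x → 1 * size (Fun m S))      ≡⟨ ∑-*ʳ (elems S) (size (Fun m S)) (λ _ → 1) ⟩
    size S * size (Fun m S)              ≡⟨ cong (size S *_) (size-Fun m S) ⟩
    size S * size S ^ m         ∎
    where open ≡-Reasoning

  ≤-squeeze : (S : FiniteSetoid) (let open FiniteSetoid S using (Carrier; _≈_)) {f g : Carrier → ℕ} →
    (∀ {x y} → x ≈ y → f x ≡ f y) → (∀ {x y} → x ≈ y → g x ≡ g y) →
    (∀ x → f x ≤ g x) → ∑ˢ S f ≡ ∑ˢ S g → ∀ a → f a ≡ g a
  ≤-squeeze S f-resp g-resp h e a with satisfied (∑-squeeze (elems S) h e (FiniteSetoid.listed S a))
  ... | x , x≈a , fx≡gx = trans (sym (f-resp x≈a)) (trans fx≡gx (g-resp x≈a))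

open FiniteSums

sum-allFin-suc : {A : Set} (_∙_ : A → A → A) (e : A) {m : ℕ} (f : Fin (suc m) → A) →
  foldr _∙_ e (map f (allFin (suc m))) ≡ f zero ∙ foldr _∙_ e (map (f ∘ suc) (allFin m))
sum-allFin-suc _∙_ e {m} f = cong (λ l → f zero ∙ foldr _∙_ e l)
  (trans (map-tabulate suc f) (sym (map-tabulate id (f ∘ suc))))

module MonoidSum (M : CommutativeMonoid 0ℓ 0ℓ) where
  open CommutativeMonoid M using (Carrier; _≈_; ε; identityˡ; identityʳ; ∙-cong; ∙-congˡ)
    renaming (trans to ≈-trans; refl to ≈-refl)
  open Algebra.Properties.CommutativeMonoid.Sum M public

  sum-ε : ∀ {n} (f : Fin n → Carrier) → (∀ i → f i ≈ ε) → sum f ≈ ε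
  sum-ε {zero}  f h = ≈-refl
  sum-ε {suc n} f h = ≈-trans (∙-cong (h zero) (sum-ε (f ∘ suc) (h ∘ suc))) (identityˡ ε)

  sum-single : ∀ {n} (f : Fin n → Carrier) (i : Fin n) → (∀ j → j ≢ i → f j ≈ ε) → sum f ≈ f i
  sum-single f zero    h = ≈-trans (∙-congˡ (sum-ε (f ∘ suc) λ j → h (suc j) λ ())) (identityʳ _)
  sum-single f (suc i) h = ≈-trans (∙-cong (h zero λ ()) (sum-single (f ∘ suc) i λ j j≢i → h (suc j) λ { refl → j≢i refl })) (identityˡ _)

-- Finite fields of characteristic 2: additive order, Frobenius, Fermat

module FieldFacts {r : ℕ} (F : BinaryField r) where
  open BinaryField F public
  open Over F public

  ring : CommutativeRing 0ℓ 0ℓ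
  ring = record { isCommutativeRing = isCommutativeRing }

  open CommutativeRing ring public using
    (+-assoc; +-comm; +-identityˡ; +-identityʳ; *-assoc; *-comm; *-identityˡ; *-identityʳ; zeroˡ; zeroʳ;
     distribˡ; distribʳ; +-commutativeMonoid; *-commutativeMonoid)

  1≢0 : 1F ≢ 0F
  1≢0 = 0≢1 ∘ sym

  ⁻¹-inverseˡ : ∀ x → x ≢ 0F → (x ⁻¹) *F x ≡ 1F
  ⁻¹-inverseˡ x x≢0 = trans (*-comm (x ⁻¹) x) (inverse x x≢0)

  *-cancelˡ : ∀ x {y z} → x ≢ 0F → x *F y ≡ x *F z → y ≡ z
  *-cancelˡ x {y} {z} x≢0 e = begin
    y                    ≡⟨ *-identityˡ y ⟨
    1F *F y              ≡⟨ cong (_*F y) (⁻¹-inverseˡ x x≢0) ⟨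
    (x ⁻¹) *F x *F y     ≡⟨ *-assoc (x ⁻¹) x y ⟩
    (x ⁻¹) *F (x *F y)   ≡⟨ cong ((x ⁻¹) *F_) e ⟩
    (x ⁻¹) *F (x *F z)   ≡⟨ *-assoc (x ⁻¹) x z ⟨
    (x ⁻¹) *F x *F z     ≡⟨ cong (_*F z) (⁻¹-inverseˡ x x≢0) ⟩
    1F *F z              ≡⟨ *-identityˡ z ⟩
    z                    ∎
    where open ≡-Reasoning

  *-≢0 : ∀ {x y} → x ≢ 0F → y ≢ 0F → x *F y ≢ 0F
  *-≢0 {x} x≢0 y≢0 e = y≢0 (*-cancelˡ x x≢0 (trans e (sym (zeroʳ x))))

  *-zero⁻ : ∀ {x y} → x *F y ≡ 0F → (x ≡ 0F) ⊎ (y ≡ 0F)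
  *-zero⁻ {x} {y} e with x ≟F 0F | y ≟F 0F
  ... | yes x≡0 | _       = inj₁ x≡0
  ... | no _    | yes y≡0 = inj₂ y≡0
  ... | no x≢0  | no y≢0  = ⊥-elim (*-≢0 x≢0 y≢0 e)

  ⁻¹-≢0 : ∀ {x} → x ≢ 0F → x ⁻¹ ≢ 0F
  ⁻¹-≢0 {x} x≢0 e = 1≢0 (trans (sym (inverse x x≢0)) (trans (cong (x *F_) e) (zeroʳ x)))

  ⁻¹-unique : ∀ {x y} → x *F y ≡ 1F → y ≡ x ⁻¹
  ⁻¹-unique {x} {y} e = *-cancelˡ x x≢0 (trans e (sym (inverse x x≢0)))
    where
    x≢0 : x ≢ 0F
    x≢0 x≡0 = 1≢0 (trans (sym e) (trans (cong (_*F y) x≡0) (zeroˡ y)))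

  ⁻¹-involutive : ∀ {x} → x ≢ 0F → (x ⁻¹) ⁻¹ ≡ x
  ⁻¹-involutive {x} x≢0 = sym (⁻¹-unique (⁻¹-inverseˡ x x≢0))

  el-idx : ∀ x → el (idx x) ≡ x
  el-idx = Inverse.strictlyInverseˡ enum

  idx-el : ∀ i → idx (el i) ≡ i
  idx-el = Inverse.strictlyInverseʳ enum

  module Sum+ = MonoidSum +-commutativeMonoid
  module Prod = MonoidSum *-commutativeMonoid

  translation : ∀ c d → (c +F d) ≡ 0F → Permutation′ q
  translation c d e = permutation (λ i → idx (el i +F c)) (λ i → idx (el i +F d)) (inv d c (trans (+-comm d c) e)) (inv c d e)
    where
    inv : ∀ c d → (c +F d) ≡ 0F → ∀ i → idx (el (idx (el i +F c)) +F d) ≡ i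
    inv c d e i = trans (cong (λ z → idx (z +F d)) (el-idx _))
      (trans (cong idx (trans (+-assoc (el i) c d) (trans (cong (el i +F_) e) (+-identityʳ _)))) (idx-el i))

  dilation : ∀ c d → (c *F d) ≡ 1F → Permutation′ q
  dilation c d e = permutation (λ i → idx (el i *F c)) (λ i → idx (el i *F d)) (inv d c (trans (*-comm d c) e)) (inv c d e)
    where
    inv : ∀ c d → (c *F d) ≡ 1F → ∀ i → idx (el (idx (el i *F c)) *F d) ≡ i
    inv c d e i = trans (cong (λ z → idx (z *F d)) (el-idx _))
      (trans (cong idx (trans (*-assoc (el i) c d) (trans (cong (el i *F_) e) (*-identityʳ _)))) (idx-el i))

  ·-+ : ∀ m n x → ((m + n) · x) ≡ (m · x) +F (n · x)
  ·-+ zero    n x = sym (+-identityˡ _)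
  ·-+ (suc m) n x = trans (cong (x +F_) (·-+ m n x)) (sym (+-assoc x _ _))

  -- Translating by 1 permutes the field, so Σ x = Σ (x + 1) = Σ x + q·1.
  q·1≡0 : q · 1F ≡ 0F
  q·1≡0 = +-cancel (begin
    Sum+.sum el +F (q · 1F)                  ≡⟨ cong (Sum+.sum el +F_) (sum-const q) ⟨
    Sum+.sum el +F Sum+.sum {q} (λ _ → 1F)   ≡⟨ Sum+.∑-distrib-+ el _ ⟨
    Sum+.sum (λ i → el i +F 1F)              ≡⟨ Sum+.sum-cong-≗ {q} (λ i → el-idx _) ⟨
    Sum+.sum (λ i → el (idx (el i +F 1F)))   ≡⟨ Sum+.sum-permute el (translation 1F (-F 1F) (CommutativeRing.-‿inverseʳ ring 1F)) ⟨
    Sum+.sum el                              ≡⟨ +-identityʳ _ ⟨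
    Sum+.sum el +F 0F                        ∎)
    where
    open ≡-Reasoning
    open import Algebra.Properties.AbelianGroup (CommutativeRing.+-abelianGroup ring) using (∙-cancelˡ)
    sum-const : ∀ n → Sum+.sum {n} (λ _ → 1F) ≡ (n · 1F)
    sum-const zero    = refl
    sum-const (suc n) = cong (1F +F_) (sum-const n)
    +-cancel : ∀ {x y} → Sum+.sum el +F x ≡ Sum+.sum el +F y → x ≡ y
    +-cancel = ∙-cancelˡ _ _ _

  -- Start from 2^r · 1 = 0. Since 2^(k+1) · 1 = (2^k · 1)(1 + 1) and there are no zero divisors,
  -- either 1 + 1 vanishes or k drops; the descent cannot reach 2^0 · 1 = 1.
  1+1≡0 : 1F +F 1F ≡ 0F
  1+1≡0 = go r q·1≡0
    where
    go : ∀ k → ((2 ^ k) · 1F) ≡ 0F → 1F +F 1F ≡ 0F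
    go zero    e = ⊥-elim (1≢0 (trans (sym (+-identityʳ 1F)) e))
    go (suc k) e with *-zero⁻ {(2 ^ k) · 1F} {1F +F 1F} (begin
        u *F (1F +F 1F)           ≡⟨ distribˡ u 1F 1F ⟩
        u *F 1F +F u *F 1F        ≡⟨ cong₂ _+F_ (*-identityʳ u) (*-identityʳ u) ⟩
        u +F u                    ≡⟨ ·-+ (2 ^ k) (2 ^ k) 1F ⟨
        (2 ^ k + 2 ^ k) · 1F      ≡⟨ cong (λ m → (2 ^ k + m) · 1F) (ℕ.+-identityʳ (2 ^ k)) ⟨
        (2 ^ suc k) · 1F          ≡⟨ e ⟩
        0F                        ∎)
      where
      open ≡-Reasoning
      u = (2 ^ k) · 1F
    ... | inj₁ u≡0 = go k u≡0
    ... | inj₂ h   = h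

  double : ∀ x → x +F x ≡ 0F
  double x = begin
    x +F x                ≡⟨ cong₂ _+F_ (*-identityʳ x) (*-identityʳ x) ⟨
    x *F 1F +F x *F 1F    ≡⟨ distribˡ x 1F 1F ⟨
    x *F (1F +F 1F)       ≡⟨ cong (x *F_) 1+1≡0 ⟩
    x *F 0F               ≡⟨ zeroʳ x ⟩
    0F                    ∎
    where open ≡-Reasoning

  module FSolver = Char2 ring double
  open FSolver public

  +-≡0 : ∀ {x y} → x +F y ≡ 0F → x ≡ y
  +-≡0 {x} {y} e = trans (solve 2 (λ x y → x := (x :+ y) :+ y) refl x y) (trans (cong (_+F y) e) (+-identityˡ y))

  ≡-+0 : ∀ {x y} → x ≡ y → x +F y ≡ 0F
  ≡-+0 {x} refl = double x

  pow-+ : ∀ x m n → pow x (m + n) ≡ pow x m *F pow x n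
  pow-+ x zero    n = sym (*-identityˡ _)
  pow-+ x (suc m) n = trans (cong (x *F_) (pow-+ x m n)) (sym (*-assoc x _ _))

  pow-2^suc : ∀ x k → pow x (2 ^ suc k) ≡ pow x (2 ^ k) *F pow x (2 ^ k)
  pow-2^suc x k = trans (cong (pow x) (cong (2 ^ k +_) (ℕ.+-identityʳ (2 ^ k)))) (pow-+ x (2 ^ k) (2 ^ k))

  frobenius-+ : ∀ k x y → pow (x +F y) (2 ^ k) ≡ pow x (2 ^ k) +F pow y (2 ^ k)
  frobenius-+ zero    x y = solve 2 (λ x y → (x :+ y) :* con true := x :* con true :+ y :* con true) refl x y
  frobenius-+ (suc k) x y = begin
    pow (x +F y) (2 ^ suc k)                                ≡⟨ pow-2^suc (x +F y) k ⟩
    pow (x +F y) (2 ^ k) *F pow (x +F y) (2 ^ k)            ≡⟨ cong (λ z → z *F z) (frobenius-+ k x y) ⟩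
    (pow x (2 ^ k) +F pow y (2 ^ k)) *F (pow x (2 ^ k) +F pow y (2 ^ k))
      ≡⟨ solve 2 (λ a b → (a :+ b) :* (a :+ b) := a :* a :+ b :* b) refl _ _ ⟩
    pow x (2 ^ k) *F pow x (2 ^ k) +F pow y (2 ^ k) *F pow y (2 ^ k)
      ≡⟨ cong₂ _+F_ (pow-2^suc x k) (pow-2^suc y k) ⟨
    pow x (2 ^ suc k) +F pow y (2 ^ suc k)                  ∎
    where open ≡-Reasoning

  pow-* : ∀ x y n → pow (x *F y) n ≡ pow x n *F pow y n
  pow-* x y zero    = sym (*-identityˡ 1F)
  pow-* x y (suc n) = trans (cong (x *F y *F_) (pow-* x y n))
    (solve 4 (λ x y a b → x :* y :* (a :* b) := x :* a :* (y :* b)) refl x y _ _)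

  pow-0 : ∀ k → pow 0F (2 ^ k) ≡ 0F
  pow-0 zero    = zeroˡ 1F
  pow-0 (suc k) = trans (pow-2^suc 0F k) (trans (cong₂ _*F_ (pow-0 k) (pow-0 k)) (zeroˡ 0F))

  nonzeroPart : Carrier → Carrier
  nonzeroPart y with y ≟F 0F
  ... | yes _ = 1F
  ... | no _  = y

  nonzeroPart-≢0 : ∀ y → nonzeroPart y ≢ 0F
  nonzeroPart-≢0 y with y ≟F 0F
  ... | yes _  = 1≢0
  ... | no y≢0 = y≢0

  -- Multiplication by c permutes the field; comparing the products of the
  -- nonzero elements before and after gives c^(q-1) = 1.
  fermat : ∀ x → pow x q ≡ x
  fermat c with c ≟F 0F
  ... | yes refl = pow-0 r
  ... | no c≢0   = begin
    pow c q                                    ≡⟨ prod-const q ⟨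
    Prod.sum {q} (λ _ → c)                     ≡⟨ Prod.sum-cong-≗ {q} (λ i → split (el i)) ⟩
    Prod.sum (λ i → g (el i) *F h (el i))      ≡⟨ Prod.∑-distrib-+ (g ∘ el) (h ∘ el) ⟩
    Prod.sum (g ∘ el) *F Prod.sum (h ∘ el)     ≡⟨ cong₂ _*F_ Πg≡1 Πh≡c ⟩
    1F *F c                                    ≡⟨ *-identityˡ c ⟩
    c                                          ∎
    where
    open ≡-Reasoning
    -- The constant c is split as g y · h y with h y = c only at y = 0. The product of all values of
    -- g is the c^(q-1) to be shown equal to 1, and that of h is c; thus c^q = c comes out without
    -- an exponent q - 1.
    g h : Carrier → Carrier
    g y with y ≟F 0F
    ... | yes _ = 1F
    ... | no _  = c
    h y with y ≟F 0F
    ... | yes _ = c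
    ... | no _  = 1F
    split : ∀ y → c ≡ g y *F h y
    split y with y ≟F 0F
    ... | yes _ = sym (*-identityˡ c)
    ... | no _  = sym (*-identityʳ c)
    prod-const : ∀ n → Prod.sum {n} (λ _ → c) ≡ pow c n
    prod-const zero    = refl
    prod-const (suc n) = cong (c *F_) (prod-const n)
    scaled : ∀ y → nonzeroPart (y *F c) ≡ nonzeroPart y *F g y
    scaled y with y ≟F 0F | (y *F c) ≟F 0F
    ... | yes _   | yes _ = sym (*-identityˡ 1F)
    ... | yes y≡0 | no ¬e = ⊥-elim (¬e (trans (cong (_*F c) y≡0) (zeroˡ c)))
    ... | no y≢0  | yes e = ⊥-elim (*-≢0 y≢0 c≢0 e)
    ... | no _    | no _  = refl
    Π : Carrier
    Π = Prod.sum (nonzeroPart ∘ el)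
    product-≢0 : ∀ {n} (f : Fin n → Carrier) → (∀ i → f i ≢ 0F) → Prod.sum f ≢ 0F
    product-≢0 {zero}  f k = 1≢0
    product-≢0 {suc n} f k = *-≢0 (k zero) (product-≢0 (f ∘ suc) (k ∘ suc))
    Πg≡1 : Prod.sum (g ∘ el) ≡ 1F
    Πg≡1 = *-cancelˡ Π (product-≢0 (nonzeroPart ∘ el) (λ i → nonzeroPart-≢0 (el i))) (begin
      Π *F Prod.sum (g ∘ el)                             ≡⟨ Prod.∑-distrib-+ (nonzeroPart ∘ el) (g ∘ el) ⟨
      Prod.sum (λ i → nonzeroPart (el i) *F g (el i))    ≡⟨ Prod.sum-cong-≗ {q} (λ i → scaled (el i)) ⟨
      Prod.sum (λ i → nonzeroPart (el i *F c))           ≡⟨ Prod.sum-cong-≗ {q} (λ i → cong nonzeroPart (el-idx _)) ⟨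
      Prod.sum (λ i → nonzeroPart (el (idx (el i *F c)))) ≡⟨ Prod.sum-permute (nonzeroPart ∘ el) (dilation c (c ⁻¹) (inverse c c≢0)) ⟨
      Π                                                  ≡⟨ *-identityʳ Π ⟨
      Π *F 1F                                            ∎)
    h-0 : h 0F ≡ c
    h-0 with 0F ≟F 0F
    ... | yes _  = refl
    ... | no 0≢0 = ⊥-elim (0≢0 refl)
    h-≢0 : ∀ i → i ≢ idx 0F → h (el i) ≡ 1F
    h-≢0 i i≢ with el i ≟F 0F
    ... | yes e = ⊥-elim (i≢ (trans (sym (idx-el i)) (cong idx e)))
    ... | no _  = refl
    Πh≡c : Prod.sum (h ∘ el) ≡ c
    Πh≡c = trans (Prod.sum-single (h ∘ el) (idx 0F) h-≢0) (trans (cong h (el-idx 0F)) h-0)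

  ∑-cong′ : ∀ {n} {f g : Fin n → Carrier} → (∀ i → f i ≡ g i) → ∑ f ≡ ∑ g
  ∑-cong′ {zero}  h = refl
  ∑-cong′ {suc n} h = cong₂ _+F_ (h zero) (∑-cong′ (h ∘ suc))

  ∑≡sum : ∀ {n} (f : Fin n → Carrier) → ∑ f ≡ Sum+.sum f
  ∑≡sum {zero}  f = refl
  ∑≡sum {suc n} f = cong (f zero +F_) (∑≡sum (f ∘ suc))

  ∑-zero′ : ∀ {n} {f : Fin n → Carrier} → (∀ i → f i ≡ 0F) → ∑ f ≡ 0F
  ∑-zero′ {f = f} h = trans (∑≡sum f) (Sum+.sum-ε f h)

  ∑-single : ∀ {n} (f : Fin n → Carrier) (i : Fin n) → (∀ j → j ≢ i → f j ≡ 0F) → ∑ f ≡ f i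
  ∑-single f i h = trans (∑≡sum f) (Sum+.sum-single f i h)

  ∑-+′ : ∀ {n} (f g : Fin n → Carrier) → ∑ (λ i → f i +F g i) ≡ ∑ f +F ∑ g
  ∑-+′ f g = trans (∑≡sum (λ i → f i +F g i)) (trans (Sum+.∑-distrib-+ f g) (sym (cong₂ _+F_ (∑≡sum f) (∑≡sum g))))

  ∑-*ˡ′ : ∀ {n} c (f : Fin n → Carrier) → ∑ (λ i → c *F f i) ≡ c *F ∑ f
  ∑-*ˡ′ {zero}  c f = sym (zeroʳ c)
  ∑-*ˡ′ {suc n} c f = trans (cong (c *F f zero +F_) (∑-*ˡ′ c (f ∘ suc))) (sym (distribˡ c _ _))

  ∑-*ʳ′ : ∀ {n} c (f : Fin n → Carrier) → ∑ (λ i → f i *F c) ≡ ∑ f *F c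
  ∑-*ʳ′ c f = trans (∑-cong′ λ i → *-comm (f i) c) (trans (∑-*ˡ′ c f) (*-comm c _))

  ∑-swap′ : ∀ {m n} (f : Fin m → Fin n → Carrier) → ∑ (λ i → ∑ (f i)) ≡ ∑ (λ j → ∑ (λ i → f i j))
  ∑-swap′ {zero}  {n} f = sym (∑-zero′ {n} λ _ → refl)
  ∑-swap′ {suc m} f = trans (cong (∑ (f zero) +F_) (∑-swap′ (f ∘ suc))) (sym (∑-+′ (f zero) (λ j → ∑ (λ i → f (suc i) j))))

  ∑ₗ-allFin-once : ∀ {n} (i : Fin n) → ∑ₗ (allFin n) (λ j → 𝟙 (j Fin.≟ i)) ≡ 1
  ∑ₗ-allFin-once {suc n} zero    = trans (sum-allFin-suc _+_ 0 {n} (λ j → 𝟙 (j Fin.≟ zero)))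
    (cong suc (trans (∑-cong (allFin n) λ j → refl) (∑-zero (allFin n))))
  ∑ₗ-allFin-once {suc n} (suc i) = trans (sum-allFin-suc _+_ 0 {n} (λ j → 𝟙 (j Fin.≟ suc i)))
    (trans (∑-cong (allFin n) λ j → 𝟙-cong (suc j Fin.≟ suc i) (j Fin.≟ i) Fin.suc-injective (cong suc)) (∑ₗ-allFin-once i))

  𝔽 : FiniteSetoid
  𝔽 = record
    { Carrier       = Carrier
    ; _≈_           = _≡_
    ; isEquivalence = ≡.isEquivalence
    ; _≟_           = _≟F_
    ; elems         = map el (allFin q)
    ; once          = λ a → trans (∑-map (allFin q) el _)
        (trans (∑-cong (allFin q) λ i → 𝟙-cong (el i ≟F a) (i Fin.≟ idx a)
                 (λ e → trans (sym (idx-el i)) (cong idx e)) (λ e → trans (cong el e) (el-idx a)))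
               (∑ₗ-allFin-once (idx a)))
    }

  size-allFin : ∀ n → ∑ₗ (allFin n) (λ _ → 1) ≡ n
  size-allFin zero    = refl
  size-allFin (suc n) = trans (sum-allFin-suc _+_ 0 {n} (λ _ → 1)) (cong suc (size-allFin n))

  size-𝔽 : FiniteSetoid.size 𝔽 ≡ q
  size-𝔽 = trans (∑-map (allFin q) el _) (size-allFin q)

-- Polynomials over F_q as coefficient sequences

module Polynomials {r : ℕ} (F : BinaryField r) where
  open FieldFacts F

  Series : Set
  Series = ℕ → Carrier

  infixl 7 _⋆_
  _⋆_ : Series → Series → Series
  (p ⋆ s) zero    = p 0 *F s 0
  (p ⋆ s) (suc k) = p 0 *F s (suc k) +F ((p ∘ suc) ⋆ s) k

  ⋆-cong : ∀ k {p p′ s s′ : Series} → (∀ i → p i ≡ p′ i) → (∀ i → s i ≡ s′ i) → (p ⋆ s) k ≡ (p′ ⋆ s′) k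
  ⋆-cong zero    e h = cong₂ _*F_ (e 0) (h 0)
  ⋆-cong (suc k) e h = cong₂ _+F_ (cong₂ _*F_ (e 0) (h (suc k))) (⋆-cong k (e ∘ suc) h)

  ⋆-zeroˡ : ∀ k {p s : Series} → (∀ i → p i ≡ 0F) → (p ⋆ s) k ≡ 0F
  ⋆-zeroˡ zero    {s = s} e = trans (cong (_*F s 0) (e 0)) (zeroˡ _)
  ⋆-zeroˡ (suc k) {s = s} e = trans (cong₂ _+F_ (trans (cong (_*F s (suc k)) (e 0)) (zeroˡ _)) (⋆-zeroˡ k (e ∘ suc))) (+-identityˡ 0F)

  ⋆-scaleˡ : ∀ k c (p s : Series) → ((λ i → c *F p i) ⋆ s) k ≡ c *F (p ⋆ s) k
  ⋆-scaleˡ zero    c p s = *-assoc c _ _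
  ⋆-scaleˡ (suc k) c p s = trans (cong₂ _+F_ (*-assoc c _ _) (⋆-scaleˡ k c (p ∘ suc) s)) (sym (distribˡ c _ _))

  ⋆-distribʳ : ∀ k (s p p′ : Series) → ((λ i → p i +F p′ i) ⋆ s) k ≡ (p ⋆ s) k +F (p′ ⋆ s) k
  ⋆-distribʳ zero    s p p′ = distribʳ (s 0) (p 0) (p′ 0)
  ⋆-distribʳ (suc k) s p p′ = trans (cong ((p 0 +F p′ 0) *F s (suc k) +F_) (⋆-distribʳ k s (p ∘ suc) (p′ ∘ suc)))
    (solve 5 (λ a b s x y → (a :+ b) :* s :+ (x :+ y) := (a :* s :+ x) :+ (b :* s :+ y)) refl (p 0) (p′ 0) (s (suc k)) _ _)

  ⋆-sucʳ : ∀ k (p s : Series) → (p ⋆ s) (suc k) ≡ p (suc k) *F s 0 +F (p ⋆ (s ∘ suc)) k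
  ⋆-sucʳ zero    p s = +-comm _ _
  ⋆-sucʳ (suc k) p s = trans (cong (p 0 *F s (suc (suc k)) +F_) (⋆-sucʳ k (p ∘ suc) s))
    (solve 3 (λ a b c → a :+ (b :+ c) := b :+ (a :+ c)) refl (p 0 *F s (suc (suc k))) (p (suc (suc k)) *F s 0) _)

  ⋆-comm : ∀ k (p s : Series) → (p ⋆ s) k ≡ (s ⋆ p) k
  ⋆-comm zero    p s = *-comm _ _
  ⋆-comm (suc k) p s = trans (cong₂ _+F_ (*-comm _ _) (⋆-comm k (p ∘ suc) s)) (sym (⋆-sucʳ k s p))

  ⋆-assoc : ∀ k (p s u : Series) → ((p ⋆ s) ⋆ u) k ≡ (p ⋆ (s ⋆ u)) k
  ⋆-assoc zero    p s u = *-assoc _ _ _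
  ⋆-assoc (suc k) p s u = begin
    p 0 *F s 0 *F u (suc k) +F (((p ⋆ s) ∘ suc) ⋆ u) k
      ≡⟨ cong (p 0 *F s 0 *F u (suc k) +F_) (trans (⋆-distribʳ k u (λ i → p 0 *F s (suc i)) ((p ∘ suc) ⋆ s))
           (cong₂ _+F_ (⋆-scaleˡ k (p 0) (s ∘ suc) u) (⋆-assoc k (p ∘ suc) s u))) ⟩
    p 0 *F s 0 *F u (suc k) +F (p 0 *F ((s ∘ suc) ⋆ u) k +F ((p ∘ suc) ⋆ (s ⋆ u)) k)
      ≡⟨ solve 5 (λ a b c x y → a :* b :* c :+ (a :* x :+ y) := a :* (b :* c :+ x) :+ y) refl (p 0) (s 0) (u (suc k)) _ _ ⟩
    p 0 *F (s 0 *F u (suc k) +F ((s ∘ suc) ⋆ u) k) +F ((p ∘ suc) ⋆ (s ⋆ u)) k ∎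
    where open ≡-Reasoning

  Bounded : Series → ℕ → Set
  Bounded p d = ∀ k → d < k → p k ≡ 0F

  bounded-mono : ∀ {p d e} → d ≤ e → Bounded p d → Bounded p e
  bounded-mono d≤e h k e<k = h k (ℕ.≤-<-trans d≤e e<k)

  bounded-+ : ∀ {p s d} → Bounded p d → Bounded s d → Bounded (λ k → p k +F s k) d
  bounded-+ h h′ k d<k = trans (cong₂ _+F_ (h k d<k) (h′ k d<k)) (+-identityˡ 0F)

  bounded-⋆ : ∀ {p s m n} → Bounded p m → Bounded s n → Bounded (p ⋆ s) (m + n)
  bounded-⋆ {p} {s} {zero} {n} hp hs (suc k) lt = trans (cong₂ _+F_
    (trans (cong (p 0 *F_) (hs (suc k) lt)) (zeroʳ _)) (⋆-zeroˡ k λ i → hp (suc i) (s≤s z≤n))) (+-identityˡ 0F)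
  bounded-⋆ {p} {s} {suc m} {n} hp hs (suc k) (s≤s lt) = trans (cong₂ _+F_
    (trans (cong (p 0 *F_) (hs (suc k) (ℕ.≤-trans (s≤s (ℕ.m≤n+m n m)) (ℕ.m≤n⇒m≤1+n lt)))) (zeroʳ _))
    (bounded-⋆ {p ∘ suc} {s} {m} (λ i m<i → hp (suc i) (s≤s m<i)) hs k lt)) (+-identityˡ 0F)

  top-⋆ : ∀ {p s} m n → Bounded p m → Bounded s n → (p ⋆ s) (m + n) ≡ p m *F s n
  top-⋆ zero zero hp hs = refl
  top-⋆ zero (suc n) hp hs = trans (cong (_ +F_) (⋆-zeroˡ n λ i → hp (suc i) (s≤s z≤n))) (+-identityʳ _)
  top-⋆ {p} {s} (suc m) n hp hs = trans (cong₂ _+F_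
    (trans (cong (p 0 *F_) (hs (suc (m + n)) (s≤s (ℕ.m≤n+m n m)))) (zeroʳ _))
    (top-⋆ {p ∘ suc} {s} m n (λ i m<i → hp (suc i) (s≤s m<i)) hs)) (+-identityˡ _)

  -- The bound need not be sharp. Degrees are asserted separately by `Deg≤` and `Lead`, so the ring
  -- operations never have to decide whether leading coefficients cancel.
  record Poly : Set where
    constructor poly
    field
      coeff   : Series
      bound   : ℕ
      bounded : Bounded coeff bound
  open Poly public

  infix 4 _≈_
  record _≈_ (p s : Poly) : Set where
    constructor ≈-intro
    field coeffs : ∀ k → coeff p k ≡ coeff s k
  open _≈_ public

  Deg≤ : Poly → ℕ → Set
  Deg≤ p = Bounded (coeff p)

  deg-cong : ∀ {p s d} → p ≈ s → Deg≤ p d → Deg≤ s d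
  deg-cong e h k lt = trans (sym (coeffs e k)) (h k lt)

  deg-mono : ∀ {p d e} → d ≤ e → Deg≤ p d → Deg≤ p e
  deg-mono {p} = bounded-mono {coeff p}

  record Lead (p : Poly) (d : ℕ) (c : Carrier) : Set where
    constructor lead
    field
      deg : Deg≤ p d
      top : coeff p d ≡ c

  opaque
    const : Carrier → Poly
    const c = poly (λ { zero → c ; (suc _) → 0F }) 0 λ { (suc k) _ → refl }

    X : Poly
    X = poly (λ { 1 → 1F ; _ → 0F }) 1 λ { (suc (suc k)) _ → refl ; 1 (s≤s ()) }

    infixl 6 _⊕_
    infixl 7 _⊗_
    _⊕_ _⊗_ : Poly → Poly → Poly
    p ⊕ s = poly (λ k → coeff p k +F coeff s k) (bound p ⊔ bound s)
      (bounded-+ (bounded-mono (ℕ.m≤m⊔n (bound p) _) (bounded p)) (bounded-mono (ℕ.m≤n⊔m (bound p) _) (bounded s)))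
    p ⊗ s = poly (coeff p ⋆ coeff s) (bound p + bound s) (bounded-⋆ (bounded p) (bounded s))

    coeff-⊕ : ∀ p s k → coeff (p ⊕ s) k ≡ coeff p k +F coeff s k
    coeff-⊕ p s k = refl

    coeff-0 : ∀ k → coeff (const 0F) k ≡ 0F
    coeff-0 zero    = refl
    coeff-0 (suc k) = refl

    const-zero : ∀ {p} → coeff p 0 ≡ 0F → Deg≤ p 0 → p ≈ const 0F
    const-zero e h = ≈-intro λ { zero → e ; (suc k) → h (suc k) (s≤s z≤n) }

    ≈-const : ∀ {p} → Deg≤ p 0 → p ≈ const (coeff p 0)
    ≈-const h = ≈-intro λ { zero → refl ; (suc k) → h (suc k) (s≤s z≤n) }

    poly-isCommutativeRing : IsCommutativeRing _≈_ _⊕_ _⊗_ id (const 0F) (const 1F)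
    poly-isCommutativeRing = record
        { isRing = record
          { +-isAbelianGroup = record
            { isGroup = record
              { isMonoid = record
                { isSemigroup = record
                  { isMagma = record
                    { isEquivalence = record { refl = ≈-intro λ k → refl
                                             ; sym = λ e → ≈-intro λ k → sym (coeffs e k)
                                             ; trans = λ e h → ≈-intro λ k → trans (coeffs e k) (coeffs h k) }
                    ; ∙-cong = λ e h → ≈-intro λ k → cong₂ _+F_ (coeffs e k) (coeffs h k) }
                  ; assoc = λ p s u → ≈-intro λ k → +-assoc _ _ _ }
                ; identity = (λ p → ≈-intro λ { zero → +-identityˡ _ ; (suc k) → +-identityˡ _ })
                           , (λ p → ≈-intro λ { zero → +-identityʳ _ ; (suc k) → +-identityʳ _ }) }
              ; inverse = (λ p → ≈-intro λ { zero → double _ ; (suc k) → double _ })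
                        , (λ p → ≈-intro λ { zero → double _ ; (suc k) → double _ })
              ; ⁻¹-cong = id }
            ; comm = λ p s → ≈-intro λ k → +-comm _ _ }
          ; *-cong = λ e h → ≈-intro λ k → ⋆-cong k (coeffs e) (coeffs h)
          ; *-assoc = λ p s u → ≈-intro λ k → ⋆-assoc k (coeff p) (coeff s) (coeff u)
          ; *-identity = (λ p → ≈-intro (1⋆ p)) , (λ p → ≈-intro λ k → trans (⋆-comm k (coeff p) (coeff (const 1F))) (1⋆ p k))
          ; distrib = (λ p s u → ≈-intro λ k → trans (⋆-comm k (coeff p) (coeff (s ⊕ u))) (trans (⋆-distribʳ k (coeff p) (coeff s) (coeff u))
                        (cong₂ _+F_ (⋆-comm k (coeff s) (coeff p)) (⋆-comm k (coeff u) (coeff p)))))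
                    , (λ p s u → ≈-intro λ k → ⋆-distribʳ k (coeff p) (coeff s) (coeff u)) }
        ; *-comm = λ p s → ≈-intro λ k → ⋆-comm k (coeff p) (coeff s) }
      where
      1⋆ : ∀ p k → (coeff (const 1F) ⋆ coeff p) k ≡ coeff p k
      1⋆ p zero    = *-identityˡ _
      1⋆ p (suc k) = trans (cong₂ _+F_ (*-identityˡ _) (⋆-zeroˡ k λ i → refl)) (+-identityʳ _)

    const-+ : ∀ x y → const x ⊕ const y ≈ const (x +F y)
    const-+ x y = ≈-intro λ { zero → refl ; (suc k) → +-identityˡ 0F }

    const-* : ∀ x y → const x ⊗ const y ≈ const (x *F y)
    const-* x y = ≈-intro λ { zero → refl ; (suc k) → trans (cong₂ _+F_ (zeroʳ x) (⋆-zeroˡ k λ i → refl)) (+-identityˡ 0F) }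

    deg-⊕ : ∀ {p s d} → Deg≤ p d → Deg≤ s d → Deg≤ (p ⊕ s) d
    deg-⊕ {p} {s} = bounded-+ {coeff p} {coeff s}

    deg-⊗ : ∀ {p s m n} → Deg≤ p m → Deg≤ s n → Deg≤ (p ⊗ s) (m + n)
    deg-⊗ {p} {s} = bounded-⋆ {coeff p} {coeff s}

    deg-const : ∀ c {d} → Deg≤ (const c) d
    deg-const c (suc k) lt = refl

    deg-X : Deg≤ X 1
    deg-X = bounded X

    lead-cong : ∀ {p s d c} → p ≈ s → Lead p d c → Lead s d c
    lead-cong e (lead h t) = lead (deg-cong e h) (trans (sym (coeffs e _)) t)

    lead-⊗ : ∀ {p s m n c c′} → Lead p m c → Lead s n c′ → Lead (p ⊗ s) (m + n) (c *F c′)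
    lead-⊗ {p} {s} {m} {n} (lead h t) (lead h′ t′) = lead (deg-⊗ {p} {s} h h′)
      (trans (top-⋆ {coeff p} {coeff s} m n h h′) (cong₂ _*F_ t t′))

    lead-⊕ : ∀ {p s d e c} → d < e → Deg≤ p d → Lead s e c → Lead (p ⊕ s) e c
    lead-⊕ {p} {s} d<e h (lead h′ t) = lead (deg-⊕ {p} {s} (deg-mono {p} (ℕ.<⇒≤ d<e) h) h′)
      (trans (cong₂ _+F_ (h _ d<e) t) (+-identityˡ _))

    lead-const : ∀ c → Lead (const c) 0 c
    lead-const c = lead (deg-const c) refl

    lead-X : Lead X 1 1F
    lead-X = lead deg-X refl

  polyRing : CommutativeRing 0ℓ 0ℓ
  polyRing = record { isCommutativeRing = poly-isCommutativeRing }

  module P = CommutativeRing polyRing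
  open P public using () renaming (refl to ≈-refl; sym to ≈-sym; trans to ≈-trans; +-cong to ⊕-cong; *-cong to ⊗-cong; setoid to polySetoid)

  ⊕-double : ∀ p → p ⊕ p ≈ const 0F
  ⊕-double = P.-‿inverseʳ

  open Coprimality polyRing ⊕-double public
  module PS = Char2 polyRing ⊕-double
  module ≈-Reasoning = Relation.Binary.Reasoning.Setoid polySetoid

  ⊕≈0 : ∀ {p s} → p ⊕ s ≈ const 0F → p ≈ s
  ⊕≈0 {p} {s} e = ≈-intro λ k → +-≡0 (trans (sym (coeff-⊕ p s k)) (trans (coeffs e k) (coeff-0 k)))

  const-cong : ∀ {x y} → x ≡ y → const x ≈ const y
  const-cong refl = ≈-refl

  infixr 8 _↑_
  _↑_ : Poly → ℕ → Poly
  p ↑ zero  = const 1F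
  p ↑ suc n = p ⊗ (p ↑ n)

  ↑-+ : ∀ p m n → p ↑ (m + n) ≈ (p ↑ m) ⊗ (p ↑ n)
  ↑-+ p zero    n = ≈-sym (P.*-identityˡ _)
  ↑-+ p (suc m) n = ≈-trans (P.*-congˡ (↑-+ p m n)) (≈-sym (P.*-assoc p _ _))

  coprime-↑ : ∀ {p s} n → Coprime p s → Coprime p (s ↑ n)
  coprime-↑ {p} zero    h = ideal-2nd p (const 1F)
  coprime-↑ (suc n) h = coprime-* h (coprime-↑ n h)

  lead-X↑ : ∀ n → Lead (X ↑ n) n 1F
  lead-X↑ zero    = lead-const 1F
  lead-X↑ (suc n) = subst (Lead (X ↑ suc n) (suc n)) (*-identityˡ 1F) (lead-⊗ lead-X (lead-X↑ n))

  deg-X↑ : ∀ n → Deg≤ (X ↑ n) n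
  deg-X↑ n = Lead.deg (lead-X↑ n)

  leading : ∀ p d → Deg≤ p d → p ≈ const 0F ⊎ (∃ λ e → e ≤ d × ∃ λ c → c ≢ 0F × Lead p e c)
  leading p d h with coeff p d ≟F 0F
  leading p zero    h | yes e = inj₁ (const-zero e h)
  leading p (suc d) h | yes e with leading p d (λ k d<k → below k (ℕ.m≤n⇒m<n∨m≡n d<k))
    where
    below : ∀ k → suc d < k ⊎ suc d ≡ k → coeff p k ≡ 0F
    below k (inj₁ lt)   = h k lt
    below k (inj₂ refl) = e
  ... | inj₁ p≈0 = inj₁ p≈0
  ... | inj₂ (k , k≤d , rest) = inj₂ (k , ℕ.m≤n⇒m≤1+n k≤d , rest)
  leading p d h | no ¬e = inj₂ (d , ℕ.≤-refl , coeff p d , ¬e , lead h refl)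

  linear : Carrier → Poly
  linear c = X ⊕ const c

  Πlinear : List Carrier → Poly
  Πlinear []       = const 1F
  Πlinear (c ∷ cs) = linear c ⊗ Πlinear cs

  linear-lead : ∀ c → Lead (linear c) 1 1F
  linear-lead c = lead-cong (P.+-comm (const c) X) (lead-⊕ (s≤s z≤n) (deg-const c) lead-X)

  Πlinear-lead : ∀ cs → Lead (Πlinear cs) (length cs) 1F
  Πlinear-lead []       = lead-const 1F
  Πlinear-lead (c ∷ cs) = subst (Lead (Πlinear (c ∷ cs)) (suc (length cs))) (*-identityˡ 1F)
    (lead-⊗ (linear-lead c) (Πlinear-lead cs))

  coprime-linear : ∀ {c d} → c ≢ d → Coprime (linear c) (linear d)
  coprime-linear {c} {d} c≢d = const u , const u , ≈-sym (begin
    const u ⊗ linear c ⊕ const u ⊗ linear d  ≈⟨ PS.solve 4 (λ u x c d → u PS.:* (x PS.:+ c) PS.:+ u PS.:* (x PS.:+ d) PS.:= u PS.:* (c PS.:+ d)) ≈-refl (const u) X (const c) (const d) ⟩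
    const u ⊗ (const c ⊕ const d)            ≈⟨ P.*-congˡ (const-+ c d) ⟩
    const u ⊗ const (c +F d)                 ≈⟨ const-* u _ ⟩
    const (u *F (c +F d))                    ≈⟨ const-cong (⁻¹-inverseˡ _ (c≢d ∘ +-≡0)) ⟩
    const 1F                                 ∎)
    where
    open ≈-Reasoning
    u = (c +F d) ⁻¹

  coprime-Πlinear : ∀ p cs → All (λ c → Coprime p (linear c)) cs → Coprime p (Πlinear cs)
  coprime-Πlinear p []       []       = ideal-2nd p (const 1F)
  coprime-Πlinear p (c ∷ cs) (h ∷ hs) = coprime-* h (coprime-Πlinear p cs hs)

  Πlinear-∣ : ∀ {p} cs → Unique cs → All (λ c → linear c ∣ p) cs → Πlinear cs ∣ p
  Πlinear-∣ {p} []       _            _        = p , ≈-sym (P.*-identityˡ p)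
  Πlinear-∣ (c ∷ cs) (c∉cs ∷ uniq) (h ∷ hs) =
    ∣-coprime-* (coprime-Πlinear (linear c) cs (All.map coprime-linear c∉cs)) h (Πlinear-∣ cs uniq hs)

  -- p takes the value v at c, in the form p ≡ v mod (t − c).
  Value : Carrier → Poly → Carrier → Set
  Value c p v = linear c ∣ p ⊕ const v

  value-X : ∀ c → Value c X c
  value-X c = const 1F , ≈-sym (P.*-identityʳ _)

  value-const : ∀ {c} x → Value c (const x) x
  value-const {c} x = const 0F , ≈-trans (⊕-double _) (≈-sym (P.zeroʳ _))

  value-⊕ : ∀ {c p s v w} → Value c p v → Value c s w → Value c (p ⊕ s) (v +F w)
  value-⊕ {c} {p} {s} {v} {w} (h , e) (k , e′) = h ⊕ k , (begin
    (p ⊕ s) ⊕ const (v +F w)             ≈⟨ P.+-congˡ (≈-sym (const-+ v w)) ⟩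
    (p ⊕ s) ⊕ (const v ⊕ const w)        ≈⟨ PS.solve 4 (λ p s v w → (p PS.:+ s) PS.:+ (v PS.:+ w) PS.:= (p PS.:+ v) PS.:+ (s PS.:+ w)) ≈-refl p s _ _ ⟩
    (p ⊕ const v) ⊕ (s ⊕ const w)        ≈⟨ ⊕-cong e e′ ⟩
    linear c ⊗ h ⊕ linear c ⊗ k          ≈⟨ P.distribˡ _ h k ⟨
    linear c ⊗ (h ⊕ k)                   ∎)
    where
    open ≈-Reasoning

  value-⊗ : ∀ {c p s v w} → Value c p v → Value c s w → Value c (p ⊗ s) (v *F w)
  value-⊗ {c} {p} {s} {v} {w} (h , e) (k , e′) = h ⊗ s ⊕ const v ⊗ k , (begin
    p ⊗ s ⊕ const (v *F w)                                     ≈⟨ P.+-congˡ (≈-sym (const-* v w)) ⟩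
    p ⊗ s ⊕ const v ⊗ const w                                  ≈⟨ PS.solve 4 (λ p s v w → p PS.:* s PS.:+ v PS.:* w PS.:= (p PS.:+ v) PS.:* s PS.:+ v PS.:* (s PS.:+ w)) ≈-refl p s _ _ ⟩
    (p ⊕ const v) ⊗ s ⊕ const v ⊗ (s ⊕ const w)                ≈⟨ ⊕-cong (P.*-congʳ e) (P.*-congˡ e′) ⟩
    linear c ⊗ h ⊗ s ⊕ const v ⊗ (linear c ⊗ k)                ≈⟨ PS.solve 5 (λ l h s v k → l PS.:* h PS.:* s PS.:+ v PS.:* (l PS.:* k) PS.:= l PS.:* (h PS.:* s PS.:+ v PS.:* k)) ≈-refl (linear c) h s (const v) k ⟩
    linear c ⊗ (h ⊗ s ⊕ const v ⊗ k)                           ∎)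
    where
    open ≈-Reasoning

  value-↑ : ∀ {c p v} n → Value c p v → Value c (p ↑ n) (pow v n)
  value-↑ zero    h = value-const 1F
  value-↑ (suc n) h = value-⊗ h (value-↑ n h)

  value-0 : ∀ {c p v} → Value c p v → v ≡ 0F → linear c ∣ p
  value-0 {p = p} (h , e) refl = h , ≈-trans (≈-sym (P.+-identityʳ p)) e

-- The absolute trace, quadratic equations and Kloosterman sums

module TraceFacts {r : ℕ} (F : BinaryField r) where
  open import Data.Integer using (ℤ; +_)
  open FieldFacts F
  open FiniteSetoid 𝔽 using () renaming (elems to 𝔽-elems)

  1≤r : 1 ≤ r
  1≤r = go r refl
    where
    go : ∀ k → k ≡ r → 1 ≤ k
    go zero    refl = ⊥-elim (1≢0 (trans (sym (el-idx 1F)) (trans (cong el (single _ _)) (el-idx 0F))))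
      where
      single : (i j : Fin 1) → i ≡ j
      single zero zero = refl
    go (suc k) _ = s≤s z≤n

  partialTr : ℕ → Carrier → Carrier
  partialTr n x = ∑ {n} (λ k → pow x (2 ^ Fin.toℕ k))

  ∑-snoc : ∀ n (y : ℕ → Carrier) → ∑ {suc n} (y ∘ Fin.toℕ) ≡ ∑ {n} (y ∘ Fin.toℕ) +F y n
  ∑-snoc zero    y = trans (+-identityʳ _) (sym (+-identityˡ _))
  ∑-snoc (suc n) y = trans (cong (y 0 +F_) (∑-snoc n (y ∘ suc))) (sym (+-assoc _ _ _))

  -- Squaring is additive and moves each power x^(2^k) to the next, so the sum loses its first term
  -- x and gains x^(2^n).
  square-partialTr : ∀ n x → partialTr n x *F partialTr n x ≡ partialTr n x +F pow x (2 ^ n) +F x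
  square-partialTr zero    x = solve 1 (λ x → con false :* con false := con false :+ x :* con true :+ x) refl x
  square-partialTr (suc n) x = begin
    partialTr (suc n) x *F partialTr (suc n) x  ≡⟨ cong (λ z → z *F z) (∑-snoc n y) ⟩
    (T +F y n) *F (T +F y n)                    ≡⟨ solve 2 (λ T y → (T :+ y) :* (T :+ y) := T :* T :+ y :* y) refl T (y n) ⟩
    T *F T +F y n *F y n                        ≡⟨ cong₂ _+F_ (square-partialTr n x) (sym (pow-2^suc x n)) ⟩
    T +F y n +F x +F y (suc n)                  ≡⟨ solve 3 (λ T x y → T :+ x :+ y := T :+ y :+ x) refl (T +F y n) x (y (suc n)) ⟩
    T +F y n +F y (suc n) +F x                  ≡⟨ cong (λ z → z +F y (suc n) +F x) (∑-snoc n y) ⟨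
    partialTr (suc n) x +F y (suc n) +F x       ∎
    where
    open ≡-Reasoning
    y = λ k → pow x (2 ^ k)
    T = partialTr n x

  tr-idem : ∀ x → tr x *F tr x ≡ tr x
  tr-idem x = begin
    tr x *F tr x          ≡⟨ square-partialTr r x ⟩
    tr x +F pow x q +F x  ≡⟨ cong (λ z → tr x +F z +F x) (fermat x) ⟩
    tr x +F x +F x        ≡⟨ solve 2 (λ t x → t :+ x :+ x := t) refl (tr x) x ⟩
    tr x                  ∎
    where open ≡-Reasoning

  tr-0∨1 : ∀ x → tr x ≡ 0F ⊎ tr x ≡ 1F
  tr-0∨1 x with tr x ≟F 0F
  ... | yes e = inj₁ e
  ... | no ¬e = inj₂ (*-cancelˡ (tr x) ¬e (trans (tr-idem x) (sym (*-identityʳ _))))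

  tr-+ : ∀ x y → tr (x +F y) ≡ tr x +F tr y
  tr-+ x y = trans (∑-cong′ {r} (λ k → frobenius-+ (Fin.toℕ k) x y)) (∑-+′ {r} (λ k → pow x (2 ^ Fin.toℕ k)) (λ k → pow y (2 ^ Fin.toℕ k)))

  tr-square : ∀ x → tr (x *F x) ≡ tr x
  tr-square x = trans (go r) (tr-idem x)
    where
    go : ∀ n → partialTr n (x *F x) ≡ partialTr n x *F partialTr n x
    go zero    = sym (zeroˡ 0F)
    go (suc n) = begin
      partialTr (suc n) (x *F x)                                       ≡⟨ ∑-snoc n (λ k → pow (x *F x) (2 ^ k)) ⟩
      partialTr n (x *F x) +F pow (x *F x) (2 ^ n)                     ≡⟨ cong₂ _+F_ (go n) (pow-* x x (2 ^ n)) ⟩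
      T *F T +F y *F y                                                 ≡⟨ solve 2 (λ T y → T :* T :+ y :* y := (T :+ y) :* (T :+ y)) refl T y ⟩
      (T +F y) *F (T +F y)                                             ≡⟨ cong (λ z → z *F z) (∑-snoc n (λ k → pow x (2 ^ k))) ⟨
      partialTr (suc n) x *F partialTr (suc n) x                       ∎
      where
      open ≡-Reasoning
      T = partialTr n x
      y = pow x (2 ^ n)

  tr-0 : tr 0F ≡ 0F
  tr-0 = ∑-zero′ {r} (λ k → pow-0 (Fin.toℕ k))

  module _ where
    open Polynomials F

    -- The product of the distinct linear factors divides p and is monic of degree `length cs`; a
    -- nonzero cofactor cannot lower the degree.
    root-bound : ∀ {p d v} cs → Unique cs → All (λ c → linear c ∣ p) cs → Lead p d v → v ≢ 0F → length cs ≤ d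
    root-bound {p} {d} {v} cs uniq roots (lead h t) v≢0 = go (leading (proj₁ Πcs∣p) _ (bounded (proj₁ Πcs∣p)))
      where
      Πcs∣p = Πlinear-∣ cs uniq roots
      go : proj₁ Πcs∣p ≈ const 0F ⊎ _ → length cs ≤ d
      go (inj₁ e) = ⊥-elim (v≢0 (trans (sym t) (trans (coeffs (≈-trans (proj₂ Πcs∣p) (≈-trans (P.*-congˡ e) (P.zeroʳ _))) d) (coeff-0 d))))
      go (inj₂ (e , _ , c , c≢0 , l)) with d ℕ.<? length cs
      ... | no ¬lt = ℕ.≮⇒≥ ¬lt
      ... | yes lt = ⊥-elim (c≢0 (trans (sym (*-identityˡ c)) (trans (sym (Lead.top (lead-⊗ (Πlinear-lead cs) l)))
                       (trans (sym (coeffs (proj₂ Πcs∣p) _)) (h _ (ℕ.<-≤-trans lt (ℕ.m≤m+n _ e)))))))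

    trPoly : ℕ → Poly
    trPoly zero    = const 0F
    trPoly (suc n) = trPoly n ⊕ X ↑ (2 ^ n)

    trPoly-value : ∀ n c → Value c (trPoly n) (partialTr n c)
    trPoly-value zero    c = value-const 0F
    trPoly-value (suc n) c = subst (Value c (trPoly (suc n))) (sym (∑-snoc n (λ k → pow c (2 ^ k))))
      (value-⊕ (trPoly-value n c) (value-↑ (2 ^ n) (value-X c)))

    trPoly-lead : ∀ n → Lead (trPoly (suc n)) (2 ^ n) 1F
    trPoly-lead zero    = lead-⊕ {d = 0} (s≤s z≤n) (deg-const 0F) (lead-X↑ 1)
    trPoly-lead (suc n) = lead-⊕ (ℕ.^-monoʳ-< 2 (s≤s (s≤s z≤n)) (ℕ.n<1+n n)) (Lead.deg (trPoly-lead n)) (lead-X↑ (2 ^ suc n))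

    el-injective : ∀ {i j} → el i ≡ el j → i ≡ j
    el-injective {i} {j} e = trans (sym (idx-el i)) (trans (cong idx e) (idx-el j))

    𝔽-unique : Unique 𝔽-elems
    𝔽-unique = map⁺ el-injective (allFin⁺ q)

    -- Otherwise the trace polynomial, of degree 2^(r-1), would have q roots.
    tr-onto : ∃ λ e → tr e ≡ 1F
    tr-onto with FiniteSetoid.search 𝔽 (λ { refl h → h }) (λ e → tr e ≟F 1F)
    ... | yes h = h
    ... | no ¬h = ⊥-elim (go r refl)
      where
      tr≡0 : ∀ x → tr x ≡ 0F
      tr≡0 x with tr-0∨1 x
      ... | inj₁ e = e
      ... | inj₂ e = ⊥-elim (¬h (x , e))
      go : ∀ k → k ≡ r → ⊥
      go zero    refl with 1≤r
      ... | ()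
      go (suc k) refl = ℕ.<⇒≱ (ℕ.^-monoʳ-< 2 (s≤s (s≤s z≤n)) (ℕ.n<1+n k))
        (subst (_≤ 2 ^ k) (trans (length-map el (allFin q)) (length-tabulate {n = q} id))
          (root-bound 𝔽-elems 𝔽-unique (universal (λ c → value-0 (trPoly-value r c) (tr≡0 c)) _) (trPoly-lead k) 1≢0))

  -- Artin–Schreier and quadratic equations

  -- Translation by an element of trace 1 exchanges the kernel of the trace with its complement.
  #tr≡0 : 2 * # 𝔽 (λ x → tr x ≟F 0F) ≡ q
  #tr≡0 = trans (cong (λ m → # 𝔽 (λ x → tr x ≟F 0F) + m) (trans (ℕ.+-identityʳ _) shift)) (trans (#-¬ 𝔽 (λ x → tr x ≟F 0F)) size-𝔽)
    where
    e = proj₁ tr-onto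
    tr-e : ∀ x → tr (x +F e) ≡ tr x +F 1F
    tr-e x = trans (tr-+ x e) (cong (tr x +F_) (proj₂ tr-onto))
    x+e+e : ∀ x → x +F e +F e ≡ x
    x+e+e x = solve 2 (λ x e → x :+ e :+ e := x) refl x e
    shift : # 𝔽 (λ x → tr x ≟F 0F) ≡ # 𝔽 (λ x → ¬? (tr x ≟F 0F))
    shift = #-bij 𝔽 𝔽 (λ x → tr x ≟F 0F) (λ x → ¬? (tr x ≟F 0F)) (_+F e) (_+F e)
      (λ { x _ t refl → (λ t′ → 1≢0 (trans (sym (+-identityˡ 1F)) (trans (cong (_+F 1F) (sym t)) (trans (sym (tr-e x)) t′)))) , x+e+e x })
      (λ { _ y ¬t refl → trans (tr-e y) (flip y ¬t) , x+e+e y })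
      where
      flip : ∀ y → tr y ≢ 0F → tr y +F 1F ≡ 0F
      flip y ¬t with tr-0∨1 y
      ... | inj₁ t = ⊥-elim (¬t t)
      ... | inj₂ t = ≡-+0 t

  ℘ : Carrier → Carrier
  ℘ z = z *F z +F z

  tr-℘ : ∀ z → tr (℘ z) ≡ 0F
  tr-℘ z = trans (tr-+ (z *F z) z) (≡-+0 (tr-square z))

  -- The fibres of ℘ have at most 2 elements and live over the kernel of the
  -- trace, which has q/2 elements; so all of them have exactly 2.
  #℘ : ∀ c → # 𝔽 (λ z → ℘ z ≟F c) ≡ 2 * 𝟙 (tr c ≟F 0F)
  #℘ = ≤-squeeze 𝔽 (λ { refl → refl }) (λ { refl → refl }) fibre≤ (begin
    ∑ₗ 𝔽-elems (λ c → # 𝔽 (λ z → ℘ z ≟F c))                   ≡⟨ ∑-cong 𝔽-elems (λ c → ∑-cong 𝔽-elems λ z → ℕ.*-identityʳ _) ⟨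
    ∑ₗ 𝔽-elems (λ c → ∑ₗ 𝔽-elems (λ z → 𝟙 (℘ z ≟F c) * 1))    ≡⟨ fibres 𝔽 𝔽-elems ℘ (λ _ → 1) ⟨
    FiniteSetoid.size 𝔽                                       ≡⟨ size-𝔽 ⟩
    q                                                         ≡⟨ #tr≡0 ⟨
    2 * # 𝔽 (λ c → tr c ≟F 0F)                                ≡⟨ ∑-*ˡ 𝔽-elems 2 _ ⟨
    ∑ₗ 𝔽-elems (λ c → 2 * 𝟙 (tr c ≟F 0F))                     ∎)
    where
    open ≡-Reasoning
    fibre≤ : ∀ c → # 𝔽 (λ z → ℘ z ≟F c) ≤ 2 * 𝟙 (tr c ≟F 0F)
    fibre≤ c with FiniteSetoid.search 𝔽 (λ { refl h → h }) (λ z → ℘ z ≟F c)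
    ... | no ¬h = subst (_≤ 2 * 𝟙 (tr c ≟F 0F)) (sym (trans (∑-cong 𝔽-elems λ z → 𝟙-no (℘ z ≟F c) (λ e → ¬h (z , e))) (∑-zero 𝔽-elems))) z≤n
    ... | yes (z₀ , refl) = subst₂ _≤_ refl (cong (2 *_) (sym (𝟙-yes (tr (℘ z₀) ≟F 0F) (tr-℘ z₀))))
        (ℕ.≤-trans (∑-≤ 𝔽-elems two) (ℕ.≤-reflexive (trans (∑-+ 𝔽-elems _ _)
          (cong₂ _+_ (FiniteSetoid.once 𝔽 z₀) (FiniteSetoid.once 𝔽 (z₀ +F 1F))))))
      where
      two : ∀ z → 𝟙 (℘ z ≟F ℘ z₀) ≤ 𝟙 (z ≟F z₀) + 𝟙 (z ≟F (z₀ +F 1F))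
      two z with ℘ z ≟F ℘ z₀ | z ≟F z₀ | z ≟F (z₀ +F 1F)
      ... | no _  | _     | _     = z≤n
      ... | yes _ | yes _ | _     = s≤s z≤n
      ... | yes _ | no _  | yes _ = s≤s z≤n
      ... | yes e | no n₁ | no n₂ with *-zero⁻ {z +F z₀} {z +F (z₀ +F 1F)} (trans
              (solve 2 (λ z y → (z :+ y) :* (z :+ (y :+ con true)) := (z :* z :+ z) :+ (y :* y :+ y)) refl z z₀) (≡-+0 e))
      ...   | inj₁ h = ⊥-elim (n₁ (+-≡0 h))
      ...   | inj₂ h = ⊥-elim (n₂ (+-≡0 h))

  -- x = s z turns x² + s x + d into s² (z² + z + d/s²).
  #quadratic : ∀ s d → s ≢ 0F → # 𝔽 (λ x → (x *F x +F s *F x +F d) ≟F 0F) ≡ 2 * 𝟙 (tr (d *F (s ⁻¹ *F s ⁻¹)) ≟F 0F)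
  #quadratic s d s≢0 = trans (#-bij 𝔽 𝔽 (λ x → (x *F x +F s *F x +F d) ≟F 0F) (λ z → ℘ z ≟F (d *F (s ⁻¹ *F s ⁻¹)))
      (λ x → x *F s ⁻¹) (λ z → z *F s)
      (λ { x _ e refl → to x e , back x })
      (λ { _ z e refl → from z e , forth z })) (#℘ _)
    where
    s′ = s ⁻¹
    ss′ : s *F s′ ≡ 1F
    ss′ = inverse s s≢0
    back : ∀ x → x *F s′ *F s ≡ x
    back x = trans (solve 3 (λ x s t → x :* t :* s := x :* (s :* t)) refl x s s′) (trans (cong (x *F_) ss′) (*-identityʳ x))
    forth : ∀ z → z *F s *F s′ ≡ z
    forth z = trans (*-assoc z s s′) (trans (cong (z *F_) ss′) (*-identityʳ z))
    to : ∀ x → x *F x +F s *F x +F d ≡ 0F → ℘ (x *F s′) ≡ d *F (s′ *F s′)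
    to x e = +-≡0 (begin
      x *F s′ *F (x *F s′) +F x *F s′ +F d *F (s′ *F s′)
        ≡⟨ cong (λ z → x *F s′ *F (x *F s′) +F z +F d *F (s′ *F s′)) (trans (sym (*-identityʳ _)) (cong (x *F s′ *F_) (sym ss′))) ⟩
      x *F s′ *F (x *F s′) +F x *F s′ *F (s *F s′) +F d *F (s′ *F s′)
        ≡⟨ solve 4 (λ x s t d → x :* t :* (x :* t) :+ x :* t :* (s :* t) :+ d :* (t :* t) := (x :* x :+ s :* x :+ d) :* (t :* t)) refl x s s′ d ⟩
      (x *F x +F s *F x +F d) *F (s′ *F s′)   ≡⟨ trans (cong (_*F (s′ *F s′)) e) (zeroˡ _) ⟩
      0F ∎)
      where open ≡-Reasoning
    from : ∀ z → ℘ z ≡ d *F (s′ *F s′) → z *F s *F (z *F s) +F s *F (z *F s) +F d ≡ 0F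
    from z e = begin
      z *F s *F (z *F s) +F s *F (z *F s) +F d   ≡⟨ solve 3 (λ z s d → z :* s :* (z :* s) :+ s :* (z :* s) :+ d := (z :* z :+ z) :* (s :* s) :+ d) refl z s d ⟩
      ℘ z *F (s *F s) +F d                       ≡⟨ cong (λ w → w *F (s *F s) +F d) e ⟩
      d *F (s′ *F s′) *F (s *F s) +F d             ≡⟨ solve 3 (λ s t d → d :* (t :* t) :* (s :* s) :+ d := d :* (s :* t :* (s :* t)) :+ d) refl s s′ d ⟩
      d *F (s *F s′ *F (s *F s′)) +F d             ≡⟨ cong (λ w → d *F (w *F w) +F d) ss′ ⟩
      d *F (1F *F 1F) +F d                       ≡⟨ solve 1 (λ d → d :* (con true :* con true) :+ d := con false) refl d ⟩
      0F ∎
      where open ≡-Reasoning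

  -- x + a/x = s is the quadratic equation x² + s x + a = 0.
  #x+a/x≡s : ∀ a s → a ≢ 0F → s ≢ 0F →
    # 𝔽 (λ x → ¬? (x ≟F 0F) ×-dec ((x +F a *F x ⁻¹) ≟F s)) ≡ 2 * 𝟙 (tr (a *F (s ⁻¹ *F s ⁻¹)) ≟F 0F)
  #x+a/x≡s a s a≢0 s≢0 = trans (#-cong 𝔽 (λ x → ¬? (x ≟F 0F) ×-dec ((x +F a *F x ⁻¹) ≟F s)) (λ x → (x *F x +F s *F x +F a) ≟F 0F) to from) (#quadratic s a s≢0)
    where
    open ≡-Reasoning
    to : ∀ x → x ≢ 0F × x +F a *F x ⁻¹ ≡ s → x *F x +F s *F x +F a ≡ 0F
    to x (x≢0 , refl) = begin
      x *F x +F (x +F a *F x ⁻¹) *F x +F a    ≡⟨ solve 3 (λ x a y → x :* x :+ (x :+ a :* y) :* x :+ a := a :* (x :* y) :+ a) refl x a (x ⁻¹) ⟩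
      a *F (x *F x ⁻¹) +F a                   ≡⟨ cong (λ z → a *F z +F a) (inverse x x≢0) ⟩
      a *F 1F +F a                            ≡⟨ solve 1 (λ a → a :* con true :+ a := con false) refl a ⟩
      0F                                      ∎
    from : ∀ x → x *F x +F s *F x +F a ≡ 0F → x ≢ 0F × x +F a *F x ⁻¹ ≡ s
    from x e = x≢0 , +-≡0 (*-cancelˡ x x≢0 (begin
      x *F (x +F a *F x ⁻¹ +F s)            ≡⟨ solve 4 (λ x a y s → x :* (x :+ a :* y :+ s) := x :* x :+ s :* x :+ a :* (x :* y)) refl x a (x ⁻¹) s ⟩
      x *F x +F s *F x +F a *F (x *F x ⁻¹)  ≡⟨ cong (λ z → x *F x +F s *F x +F a *F z) (inverse x x≢0) ⟩
      x *F x +F s *F x +F a *F 1F           ≡⟨ cong (x *F x +F s *F x +F_) (*-identityʳ a) ⟩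
      x *F x +F s *F x +F a                 ≡⟨ e ⟩
      0F                                    ≡⟨ zeroʳ x ⟨
      x *F 0F                               ∎))
      where
      x≢0 : x ≢ 0F
      x≢0 refl = a≢0 (trans (sym (solve 2 (λ s a → con false :* con false :+ s :* con false :+ a := a) refl s a)) e)

  -- Kloosterman sums

  -- The numbers of summands 1 and -1 in the Kloosterman sum at a. Carrying both lets bounds on K =
  -- n₀ - n₁ of either sign be stated in ℕ.
  n₀ n₁ : Carrier → ℕ
  n₀ a = # 𝔽 (λ x → ¬? (x ≟F 0F) ×-dec (tr (x +F a *F x ⁻¹) ≟F 0F))
  n₁ a = # 𝔽 (λ x → ¬? (x ≟F 0F) ×-dec ¬? (tr (x +F a *F x ⁻¹) ≟F 0F))

  #≢0 : suc (# 𝔽 (λ x → ¬? (x ≟F 0F))) ≡ q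
  #≢0 = trans (cong (_+ # 𝔽 (λ x → ¬? (x ≟F 0F))) (sym (FiniteSetoid.once 𝔽 0F))) (trans (#-¬ 𝔽 (_≟F 0F)) size-𝔽)

  n₀+n₁ : ∀ a → suc (n₀ a + n₁ a) ≡ q
  n₀+n₁ a = trans (cong suc (trans (sym (∑-+ 𝔽-elems _ _)) (∑-cong 𝔽-elems λ x →
      split (¬? (x ≟F 0F)) (tr (x +F a *F x ⁻¹) ≟F 0F)))) #≢0
    where
    split : {P Q : Set} (d : Dec P) (e : Dec Q) → 𝟙 (d ×-dec e) + 𝟙 (d ×-dec ¬? e) ≡ 𝟙 d
    split (yes _) (yes _) = refl
    split (yes _) (no _)  = refl
    split (no _)  e       = refl

  K≡n₀-n₁ : ∀ a → K a ℤ.+ + n₁ a ≡ + n₀ a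
  K≡n₀-n₁ a = go 𝔽-elems
    where
    T? = λ x → tr (x +F a *F x ⁻¹) ≟F 0F
    Z? = λ x → ¬? (x ≟F 0F)
    open import Data.Integer.Tactic.RingSolver renaming (solve-∀ to ℤ-solve)
    up : ∀ k m n → k ℤ.+ m ≡ n → (+ 1 ℤ.+ k) ℤ.+ m ≡ + 1 ℤ.+ n
    up k m n h = trans (ℤ.+-assoc (+ 1) k m) (cong (λ z → + 1 ℤ.+ z) h)
    down : ∀ k m n → k ℤ.+ m ≡ n → (ℤ.- (+ 1) ℤ.+ k) ℤ.+ (+ 1 ℤ.+ m) ≡ n
    down k m n h = trans (eq k m) h
      where
      eq : ∀ k m → (ℤ.- (+ 1) ℤ.+ k) ℤ.+ (+ 1 ℤ.+ m) ≡ k ℤ.+ m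
      eq = ℤ-solve
    go : ∀ xs → foldr ℤ._+_ (+ 0) (map (λ α → λ' (α +F a *F (α ⁻¹))) (filter Z? xs))
              ℤ.+ + ∑ₗ xs (λ x → 𝟙 (Z? x ×-dec ¬? (T? x))) ≡ + ∑ₗ xs (λ x → 𝟙 (Z? x ×-dec T? x))
    go [] = refl
    go (x ∷ xs) with x ≟F 0F
    ... | yes _ = go xs
    ... | no _ with tr (x +F a *F x ⁻¹) ≟F 0F
    ...   | yes _ = up (foldr ℤ._+_ (+ 0) (map (λ α → λ' (α +F a *F (α ⁻¹))) (filter Z? xs))) _ _ (go xs)
    ...   | no _  = down (foldr ℤ._+_ (+ 0) (map (λ α → λ' (α +F a *F (α ⁻¹))) (filter Z? xs))) _ _ (go xs)

  -- Group the x counted by n₁ a according to the value s of x + a/x.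
  n₁-even : ∀ a → a ≢ 0F → ∃ λ m → n₁ a ≡ 2 * m
  n₁-even a a≢0 = ∑ₗ 𝔽-elems (λ s → 𝟙 (¬? (tr s ≟F 0F)) * h s) , (begin
    n₁ a
      ≡⟨ fibres 𝔽 𝔽-elems φ _ ⟩
    ∑ₗ 𝔽-elems (λ s → ∑ₗ 𝔽-elems (λ x → 𝟙 (φ x ≟F s) * 𝟙 (¬? (x ≟F 0F) ×-dec ¬? (tr (φ x) ≟F 0F))))
      ≡⟨ ∑-cong 𝔽-elems (λ s → trans (∑-cong 𝔽-elems (λ x → regroup s x)) (∑-*ˡ 𝔽-elems (𝟙 (¬? (tr s ≟F 0F))) _)) ⟩
    ∑ₗ 𝔽-elems (λ s → 𝟙 (¬? (tr s ≟F 0F)) * # 𝔽 (λ x → ¬? (x ≟F 0F) ×-dec (φ x ≟F s)))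
      ≡⟨ ∑-cong 𝔽-elems (λ s → trans (𝟙-*-cong (¬? (tr s ≟F 0F)) (λ t → #x+a/x≡s a s a≢0 λ { refl → t tr-0 }))
           (exchange (𝟙 (¬? (tr s ≟F 0F))) (h s))) ⟩
    ∑ₗ 𝔽-elems (λ s → 2 * (𝟙 (¬? (tr s ≟F 0F)) * h s))
      ≡⟨ ∑-*ˡ 𝔽-elems 2 _ ⟩
    2 * ∑ₗ 𝔽-elems (λ s → 𝟙 (¬? (tr s ≟F 0F)) * h s) ∎)
    where
    open ≡-Reasoning
    φ = λ x → x +F a *F x ⁻¹
    h = λ s → 𝟙 (tr (a *F (s ⁻¹ *F s ⁻¹)) ≟F 0F)
    exchange : ∀ x y → x * (2 * y) ≡ 2 * (x * y)
    exchange = solve-∀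
    regroup : ∀ s x → 𝟙 (φ x ≟F s) * 𝟙 (¬? (x ≟F 0F) ×-dec ¬? (tr (φ x) ≟F 0F))
                    ≡ 𝟙 (¬? (tr s ≟F 0F)) * 𝟙 (¬? (x ≟F 0F) ×-dec (φ x ≟F s))
    regroup s x = trans (sym (𝟙-× (φ x ≟F s) (¬? (x ≟F 0F) ×-dec ¬? (tr (φ x) ≟F 0F)))) (trans (𝟙-cong ((φ x ≟F s) ×-dec (¬? (x ≟F 0F) ×-dec ¬? (tr (φ x) ≟F 0F)))
        (¬? (tr s ≟F 0F) ×-dec (¬? (x ≟F 0F) ×-dec (φ x ≟F s)))
        (λ { (refl , n , t) → t , n , refl }) (λ { (t , n , refl) → refl , n , t })) (𝟙-× (¬? (tr s ≟F 0F)) (¬? (x ≟F 0F) ×-dec (φ x ≟F s))))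

-- The Hasse bound by descent on heights

module Hasse {r : ℕ} (F : BinaryField r) (a : BinaryField.Carrier F) (a≢0 : a ≢ BinaryField.0F F) where
  open FieldFacts F
  open TraceFacts F
  open Polynomials F
  open ≈-Reasoning

  𝕒 : Poly
  𝕒 = const a

  𝕒-unit : 𝕒 ⊗ const (a ⁻¹) ≈ const 1F
  𝕒-unit = ≈-trans (const-* a (a ⁻¹)) (const-cong (inverse a a≢0))

  open Neighbours X 𝕒 (const (a ⁻¹)) 𝕒-unit

  -- For coprime f and g this is the degree of the rational function f/g, the larger of the two
  -- degrees.
  record Height (f g : Poly) (d : ℕ) : Set where
    field
      deg-f    : Deg≤ f d
      deg-g    : Deg≤ g d
      attained : coeff f d ≢ 0F ⊎ coeff g d ≢ 0F

  lead⇒≢0 : ∀ {p d c} → c ≢ 0F → Lead p d c → coeff p d ≢ 0F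
  lead⇒≢0 c≢0 (lead _ t) e = c≢0 (trans (sym t) e)

  deg-0 : ∀ {p d} → p ≈ const 0F → Deg≤ p d
  deg-0 e = deg-cong (≈-sym e) (deg-const 0F)

  height : ∀ {f g D} → Coprime f g → Deg≤ f D → Deg≤ g D → ∃ λ d → d ≤ D × Height f g d
  height {f} {g} {D} (u , v , e) hf hg = go (leading f D hf) (leading g D hg)
    where
    go : f ≈ const 0F ⊎ _ → g ≈ const 0F ⊎ _ → ∃ λ d → d ≤ D × Height f g d
    go (inj₁ zf) (inj₁ zg) = ⊥-elim (1≢0 (trans (sym (Lead.top (lead-const 1F)))
      (trans (coeffs (≈-trans e (≈-trans (⊕-cong (≈-trans (P.*-congˡ zf) (P.zeroʳ u)) (≈-trans (P.*-congˡ zg) (P.zeroʳ v))) (P.+-identityˡ _))) 0) (coeff-0 0))))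
    go (inj₁ zf) (inj₂ (d , d≤D , c , c≢0 , l)) = d , d≤D , record { deg-f = deg-0 zf ; deg-g = Lead.deg l ; attained = inj₂ (lead⇒≢0 c≢0 l) }
    go (inj₂ (d , d≤D , c , c≢0 , l)) (inj₁ zg) = d , d≤D , record { deg-f = Lead.deg l ; deg-g = deg-0 zg ; attained = inj₁ (lead⇒≢0 c≢0 l) }
    go (inj₂ (d , d≤D , c , c≢0 , l)) (inj₂ (d′ , d′≤D , c′ , c′≢0 , l′)) with ℕ.≤-total d d′
    ... | inj₁ d≤d′ = d′ , d′≤D , record { deg-f = deg-mono {f} d≤d′ (Lead.deg l) ; deg-g = Lead.deg l′ ; attained = inj₂ (lead⇒≢0 c′≢0 l′) }
    ... | inj₂ d′≤d = d , d≤D , record { deg-f = Lead.deg l ; deg-g = deg-mono {g} d′≤d (Lead.deg l′) ; attained = inj₁ (lead⇒≢0 c≢0 l) }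

  coeff-⊗ : ∀ {p s m n} → Deg≤ p m → Deg≤ s n → coeff (p ⊗ s) (m + n) ≡ coeff p m *F coeff s n
  coeff-⊗ h h′ = Lead.top (lead-⊗ (lead h refl) (lead h′ refl))

  -- Heights of the two neighbours add up to at most 2d + 2 (the inequality half
  -- of Manin's "basic identity").
  opposite-height : ∀ {f g f′ g′ f″ g″ d d′ d″} → Opposite f g f′ g′ f″ g″ →
    Height f g d → Height f′ g′ d′ → Height f″ g″ d″ → d′ + d″ ≤ suc d + suc d
  opposite-height {f} {g} {f′} {g′} {f″} {g″} {d} {d′} {d″} opp h h′ h″ with (d′ + d″) ℕ.≤? (suc d + suc d)
  ... | yes le = le
  ... | no ¬le = ⊥-elim (cases attained′ attained″)
    where
    open Opposite opp
    open Height h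
    open Height h′ renaming (deg-f to deg-f′; deg-g to deg-g′; attained to attained′)
    open Height h″ renaming (deg-f to deg-f″; deg-g to deg-g″; attained to attained″)
    big : suc d + suc d < d′ + d″
    big = ℕ.≰⇒> ¬le
    deg-⊗X : ∀ {p} → Deg≤ p d → Deg≤ (p ⊗ X) (suc d)
    deg-⊗X {p} hp = subst (Deg≤ (p ⊗ X)) (ℕ.+-comm d 1) (deg-⊗ {p} {X} hp deg-X)
    deg-A : Deg≤ (A f g) (suc d)
    deg-A = deg-⊕ {f ⊗ X} {𝕒 ⊗ g} (deg-⊗X {f} deg-f) (deg-mono {𝕒 ⊗ g} (ℕ.n≤1+n d) (deg-⊗ {𝕒} {g} {0} (deg-const a) deg-g))
    deg-B : Deg≤ (B f g) (suc d)
    deg-B = deg-⊕ {f} {X ⊗ g} (deg-mono {f} (ℕ.n≤1+n d) deg-f) (deg-⊗ {X} {g} deg-X deg-g)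
    deg-C : Deg≤ (C f g) (suc d + suc d)
    deg-C = deg-mono {C f g} (ℕ.≤-trans (ℕ.≤-reflexive (ℕ.+-comm (d + d) 1)) (s≤s (ℕ.+-monoʳ-≤ d (ℕ.n≤1+n d)))) (deg-⊗ {f ⊗ g} {X} (deg-⊗ {f} {g} deg-f deg-g) deg-X)
    -- Above degree 2d + 2 the right sides A², B² and C have no coefficients. So the linear forms
    -- made of the coefficients at d′ and at d″ have product zero; over a field one of the two forms
    -- is then zero, contrary to `attained`.
    vanish-ff : coeff f′ d′ *F coeff f″ d″ ≡ 0F
    vanish-ff = trans (sym (coeff-⊗ deg-f′ deg-f″)) (trans (coeffs ff _) (deg-⊗ {A f g} {A f g} deg-A deg-A _ big))
    vanish-gg : coeff g′ d′ *F coeff g″ d″ ≡ 0F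
    vanish-gg = trans (sym (coeff-⊗ deg-g′ deg-g″)) (trans (coeffs gg _) (deg-⊗ {B f g} {B f g} deg-B deg-B _ big))
    vanish-fg : coeff f′ d′ *F coeff g″ d″ +F coeff f″ d″ *F coeff g′ d′ ≡ 0F
    vanish-fg = trans (sym (cong₂ _+F_ (coeff-⊗ deg-f′ deg-g″)
        (trans (cong (coeff (f″ ⊗ g′)) (ℕ.+-comm d′ d″)) (coeff-⊗ deg-f″ deg-g′))))
      (trans (sym (coeff-⊕ (f′ ⊗ g″) (f″ ⊗ g′) (d′ + d″))) (trans (coeffs fg _) (deg-C _ big)))
    mixed : coeff f′ d′ ≢ 0F → coeff g″ d″ ≢ 0F → ⊥
    mixed nz nz″ with *-zero⁻ vanish-ff
    ... | inj₁ z = nz z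
    ... | inj₂ z = *-≢0 nz nz″ (trans (sym (+-identityʳ _)) (trans (cong (coeff f′ d′ *F coeff g″ d″ +F_)
                     (sym (trans (cong (_*F coeff g′ d′) z) (zeroˡ _)))) vanish-fg))
    mixed′ : coeff g′ d′ ≢ 0F → coeff f″ d″ ≢ 0F → ⊥
    mixed′ nz nz″ with *-zero⁻ vanish-gg
    ... | inj₁ z = nz z
    ... | inj₂ z = *-≢0 nz″ nz (trans (sym (+-identityˡ _)) (trans (cong (_+F coeff f″ d″ *F coeff g′ d′)
                     (sym (trans (cong (coeff f′ d′ *F_) z) (zeroʳ _)))) vanish-fg))
    cases : coeff f′ d′ ≢ 0F ⊎ coeff g′ d′ ≢ 0F → coeff f″ d″ ≢ 0F ⊎ coeff g″ d″ ≢ 0F → ⊥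
    cases (inj₁ x) (inj₁ y) = *-≢0 x y vanish-ff
    cases (inj₁ x) (inj₂ y) = mixed x y
    cases (inj₂ x) (inj₁ y) = mixed′ x y
    cases (inj₂ x) (inj₂ y) = *-≢0 x y vanish-gg

  module Descent (n₊ n₋ : ℕ) {f₀ g₀ f₁ g₁ : Poly} (cop₀ : Coprime f₀ g₀) (cop₁ : Coprime f₁ g₁) (rel : Related f₀ g₀ f₁ g₁)
                 {d₁ : ℕ} (h₀ : Height f₀ g₀ q) (h₁ : Height f₁ g₁ d₁) (start : d₁ + n₊ ≤ suc q + n₋) where

    -- A stage carries the points numbered n and n + 1. With κ = n₊ - n₋, `total` is d_n ≤ n² - κ n
    -- + q and `increment` is d_(n+1) - d_n ≤ 2n + 1 - κ, rearranged so that nothing is subtracted.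
    -- Both persist because the second difference of the heights is at most 2.
    record Stage (n : ℕ) : Set where
      field
        {f g f′ g′} : Poly
        {d d′}      : ℕ
        cop         : Coprime f g
        cop′        : Coprime f′ g′
        related     : Related f g f′ g′
        ht          : Height f g d
        ht′         : Height f′ g′ d′
        total       : d + n * n₊ ≤ n * n + q + n * n₋
        increment   : d′ + n₊ ≤ d + suc (n + n) + n₋

    stage : ∀ n → Stage n
    stage zero = record
      { cop = cop₀ ; cop′ = cop₁ ; related = rel ; ht = h₀ ; ht′ = h₁ ; total = ℕ.≤-refl
      ; increment = ℕ.≤-trans start (ℕ.≤-reflexive (cong (_+ n₋) (ℕ.+-comm 1 q))) }
    stage (suc n) = next (stage n)
      where
      next : Stage n → Stage (suc n)
      next s = record
        { cop = cop′ ; cop′ = cop″ ; related = opposite-related opp ; ht = ht′ ; ht′ = proj₂ (proj₂ hh)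
        ; total = ℕ.≤-trans (ℕ.≤-reflexive (sym (ℕ.+-assoc d′ n₊ _))) (ℕ.≤-trans (ℕ.+-monoˡ-≤ (n * n₊) increment)
            (ℕ.≤-trans (ℕ.≤-reflexive (e₁ d n n₋ (n * n₊))) (ℕ.≤-trans (ℕ.+-monoˡ-≤ (suc (n + n) + n₋) total)
            (ℕ.≤-reflexive (e₂ n q n₋)))))
        ; increment = ℕ.+-cancelˡ-≤ d _ _ (ℕ.≤-trans (ℕ.≤-reflexive (sym (ℕ.+-assoc d d″ n₊)))
            (ℕ.≤-trans (ℕ.+-monoˡ-≤ n₊ (opposite-height opp ht′ ht (proj₂ (proj₂ hh))))
            (ℕ.≤-trans (ℕ.≤-reflexive (e₃ d′ n₊)) (ℕ.≤-trans (ℕ.+-monoˡ-≤ (suc (suc d′)) increment)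
            (ℕ.≤-reflexive (e₄ d n n₋ d′))))))
        }
        where
        open Stage s
        -- The centre is now f′/g′: its known neighbour is the preceding point f/g, and the other
        -- root of its form is the next point.
        op : _
        op = opposite cop (related-sym {f} {g} related)
        opp = proj₂ (proj₂ op)
        cop″ = opposite-coprime opp cop′
        f″ = proj₁ op
        g″ = proj₁ (proj₂ op)
        hh = height cop″ (deg-mono {f″} (ℕ.m≤m⊔n (bound f″) (bound g″)) (bounded f″)) (deg-mono {g″} (ℕ.m≤n⊔m (bound f″) (bound g″)) (bounded g″))
        d″ = proj₁ hh
        e₁ : ∀ d n m x → d + suc (n + n) + m + x ≡ d + x + (suc (n + n) + m)
        e₁ = solve-∀
        e₂ : ∀ n q m → n * n + q + n * m + (suc (n + n) + m) ≡ suc n * suc n + q + suc n * m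
        e₂ = solve-∀
        e₃ : ∀ d′ m → suc d′ + suc d′ + m ≡ d′ + m + suc (suc d′)
        e₃ = solve-∀
        e₄ : ∀ d n m d′ → d + suc (n + n) + m + suc (suc d′) ≡ d + (d′ + suc (suc n + suc n) + m)
        e₄ = solve-∀

    conclusion : ∀ n → n * n₊ ≤ n * n + q + n * n₋
    conclusion n = ℕ.≤-trans (ℕ.m≤n+m _ _) (Stage.total (stage n))

  -- The initial point: the Frobenius point (t^q , tr(t + a/t)) plus (t , 0).

  -- Write u = t + a/t. Then `E n` is t^(2^n), `O n` is t^(2^n - 1), and `U n` is (t u)^(2^n), the
  -- factor t clearing the denominator of u.
  E O U : ℕ → Poly
  E n = X ↑ (2 ^ n)
  U zero    = X ⊗ X ⊕ 𝕒
  U (suc n) = U n ⊗ U n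
  O zero    = const 1F
  O (suc n) = E n ⊗ O n

  E-suc : ∀ n → E (suc n) ≈ E n ⊗ E n
  E-suc n = ≈-trans (P.reflexive (cong (λ m → X ↑ (2 ^ n + m)) (ℕ.+-identityʳ (2 ^ n)))) (↑-+ X (2 ^ n) (2 ^ n))

  X⊗O : ∀ n → X ⊗ O n ≈ E n
  X⊗O zero    = ≈-refl
  X⊗O (suc n) = begin
    X ⊗ (E n ⊗ O n)  ≈⟨ PS.solve 3 (λ x e o → x PS.:* (e PS.:* o) PS.:= e PS.:* (x PS.:* o)) ≈-refl X (E n) (O n) ⟩
    E n ⊗ (X ⊗ O n)  ≈⟨ P.*-congˡ (X⊗O n) ⟩
    E n ⊗ E n        ≈⟨ E-suc n ⟨
    E (suc n)        ∎

  U≈ : ∀ n → U n ≈ E n ⊗ E n ⊕ const (pow a (2 ^ n))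
  U≈ zero    = PS.solve 2 (λ x c → x PS.:* x PS.:+ c PS.:= x PS.:* PS.con true PS.:* (x PS.:* PS.con true) PS.:+ c) ≈-refl X 𝕒
    ⟨trans⟩ P.+-congˡ (const-cong (sym (*-identityʳ a)))
    where _⟨trans⟩_ = ≈-trans
  U≈ (suc n) = begin
    U n ⊗ U n                      ≈⟨ ⊗-cong (U≈ n) (U≈ n) ⟩
    (e ⊗ e ⊕ c) ⊗ (e ⊗ e ⊕ c)      ≈⟨ PS.solve 2 (λ e c → (e PS.:* e PS.:+ c) PS.:* (e PS.:* e PS.:+ c) PS.:= e PS.:* e PS.:* (e PS.:* e) PS.:+ c PS.:* c) ≈-refl e c ⟩
    e ⊗ e ⊗ (e ⊗ e) ⊕ c ⊗ c        ≈⟨ ⊕-cong (⊗-cong (≈-sym (E-suc n)) (≈-sym (E-suc n))) (≈-trans (const-* _ _) (const-cong (sym (pow-2^suc a n)))) ⟩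
    E (suc n) ⊗ E (suc n) ⊕ const (pow a (2 ^ suc n)) ∎
    where
    e = E n
    c = const (pow a (2 ^ n))

  -- w n = t^(2^n) Σ_{i ≤ n} u^(2^i) with u = t + a/t.
  w : ℕ → Poly
  w zero    = U zero
  w (suc n) = E n ⊗ w n ⊕ U (suc n)

  -- Artin-Schreier telescoping: T = Σ u^(2^i) over i ≤ n satisfies T² + T = u^(2^(n+1)) + u.
  -- Multiplying by t^(2^(n+1)) turns T into w and leaves u in the form t^(2^(n+1) - 1) · (t u).
  w-equation : ∀ n → w n ⊗ (w n ⊕ E n) ≈ U (suc n) ⊕ O (suc n) ⊗ U zero
  w-equation zero = PS.solve 2 (λ u x → u PS.:* (u PS.:+ x PS.:* PS.con true) PS.:= u PS.:* u PS.:+ x PS.:* PS.con true PS.:* PS.con true PS.:* u) ≈-refl (U 0) X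
  w-equation (suc n) = begin
    (e ⊗ w n ⊕ u) ⊗ (e ⊗ w n ⊕ u ⊕ E (suc n))
      ≈⟨ P.*-congˡ (P.+-congˡ (E-suc n)) ⟩
    (e ⊗ w n ⊕ u) ⊗ (e ⊗ w n ⊕ u ⊕ e ⊗ e)
      ≈⟨ PS.solve 3 (λ e w u → (e PS.:* w PS.:+ u) PS.:* (e PS.:* w PS.:+ u PS.:+ e PS.:* e) PS.:= e PS.:* e PS.:* (w PS.:* (w PS.:+ e)) PS.:+ u PS.:* u PS.:+ e PS.:* e PS.:* u) ≈-refl e (w n) u ⟩
    e ⊗ e ⊗ (w n ⊗ (w n ⊕ e)) ⊕ u ⊗ u ⊕ e ⊗ e ⊗ u
      ≈⟨ P.+-congʳ (P.+-congʳ (P.*-congˡ (w-equation n))) ⟩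
    e ⊗ e ⊗ (u ⊕ O (suc n) ⊗ U 0) ⊕ u ⊗ u ⊕ e ⊗ e ⊗ u
      ≈⟨ PS.solve 4 (λ e u o v → e PS.:* e PS.:* (u PS.:+ o PS.:* v) PS.:+ u PS.:* u PS.:+ e PS.:* e PS.:* u PS.:= u PS.:* u PS.:+ e PS.:* e PS.:* o PS.:* v) ≈-refl e u (O (suc n)) (U 0) ⟩
    u ⊗ u ⊕ e ⊗ e ⊗ O (suc n) ⊗ U 0
      ≈⟨ P.+-congˡ (P.*-congʳ (P.*-congʳ (E-suc n))) ⟨
    u ⊗ u ⊕ E (suc n) ⊗ O (suc n) ⊗ U 0 ∎
    where
    e = E n
    u = U (suc n)

  -- For 2^(n+1) = q the partial trace is the full trace of c + a/c. Hence `w n` vanishes at the c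
  -- counted by `n₀`, and `w n ⊕ E n` at those counted by `n₁`.
  w-value : ∀ n {c} → c ≢ 0F → Value c (w n) (pow c (2 ^ n) *F partialTr (suc n) (c +F a *F c ⁻¹))
  U-value : ∀ n {c} → c ≢ 0F → Value c (U n) (pow c (2 ^ n) *F pow (c +F a *F c ⁻¹) (2 ^ n))
  U-value zero    {c} c≢0 = subst (Value c (U zero)) eq (value-⊕ (value-⊗ (value-X c) (value-X c)) (value-const a))
    where
    eq : c *F c +F a ≡ c *F 1F *F ((c +F a *F c ⁻¹) *F 1F)
    eq = sym (trans (solve 3 (λ c a y → c :* con true :* ((c :+ a :* y) :* con true) := c :* c :+ a :* (c :* y)) refl c a (c ⁻¹))
      (cong (c *F c +F_) (trans (cong (a *F_) (inverse c c≢0)) (*-identityʳ a))))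
  U-value (suc n) {c} c≢0 = subst (Value c (U (suc n))) (trans (solve 2 (λ x y → x :* y :* (x :* y) := x :* x :* (y :* y)) refl _ _)
    (sym (cong₂ _*F_ (pow-2^suc c n) (pow-2^suc (c +F a *F c ⁻¹) n)))) (value-⊗ (U-value n c≢0) (U-value n c≢0))
  w-value zero    {c} c≢0 = subst (Value c (w zero)) (cong (c *F 1F *F_) (sym (+-identityʳ _))) (U-value zero c≢0)
  w-value (suc n) {c} c≢0 = subst (Value c (w (suc n))) eq
      (value-⊕ (value-⊗ (value-↑ (2 ^ n) (value-X c)) (w-value n c≢0)) (U-value (suc n) c≢0))
    where
    u = c +F a *F c ⁻¹
    y = pow c (2 ^ n)
    eq : y *F (y *F partialTr (suc n) u) +F pow c (2 ^ suc n) *F pow u (2 ^ suc n) ≡ pow c (2 ^ suc n) *F partialTr (suc (suc n)) u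
    eq = trans (cong₂ _+F_ (trans (sym (*-assoc y y _)) (cong (_*F partialTr (suc n) u) (sym (pow-2^suc c n)))) refl)
      (trans (sym (distribˡ _ _ _)) (cong (pow c (2 ^ suc n) *F_) (sym (∑-snoc (suc n) (λ k → pow u (2 ^ k))))))

  deg-U : ∀ n → Deg≤ (U n) (2 ^ suc n)
  deg-U zero    = deg-⊕ {X ⊗ X} {𝕒} (deg-⊗ {X} {X} deg-X deg-X) (deg-const a)
  deg-U (suc n) = subst (Deg≤ (U (suc n))) (cong (λ k → 2 ^ suc n + k) (sym (ℕ.+-identityʳ (2 ^ suc n)))) (deg-⊗ {U n} {U n} (deg-U n) (deg-U n))

  deg-w : ∀ n → Deg≤ (w n) (2 ^ suc n)
  deg-w zero    = deg-U zero
  deg-w (suc n) = deg-⊕ {E n ⊗ w n} {U (suc n)}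
    (deg-mono {E n ⊗ w n} (ℕ.+-mono-≤ (ℕ.m≤m+n (2 ^ n) _) (ℕ.m≤m+n (2 ^ suc n) 0)) (deg-⊗ {E n} {w n} (deg-X↑ (2 ^ n)) (deg-w n)))
    (deg-U (suc n))

  O-lead : ∀ n {m} → 2 ^ n ≡ suc m → Lead (O n) m 1F
  O-lead zero    refl = lead-const 1F
  O-lead (suc n) {m} e = subst₂ (Lead (O (suc n))) (ℕ.suc-injective (trans (eq (2 ^ n) (ℕ.pred (2 ^ n)) pred-2^n) e)) (*-identityˡ 1F)
      (lead-⊗ (lead-X↑ (2 ^ n)) (O-lead n pred-2^n))
    where
    pred-2^n : 2 ^ n ≡ suc (ℕ.pred (2 ^ n))
    pred-2^n = sym (ℕ.suc-pred (2 ^ n) {{ℕ.m^n≢0 2 n}})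
    eq : ∀ x k → x ≡ suc k → suc (x + k) ≡ x + (x + 0)
    eq x k refl = trans (sym (ℕ.+-suc (suc k) k)) (cong (λ y → suc k + y) (sym (ℕ.+-identityʳ (suc k))))

  monic-cancel : ∀ {p s d} → Lead p d 1F → p ⊗ s ≈ const 0F → s ≈ const 0F
  monic-cancel {p} {s} l e with leading s (bound s) (bounded s)
  ... | inj₁ z = z
  ... | inj₂ (k , _ , c , c≢0 , l′) = ⊥-elim (*-≢0 1≢0 c≢0 (trans (sym (Lead.top (lead-⊗ l l′))) (trans (coeffs e _) (coeff-0 _))))

  quotient-deg : ∀ {p s m n} → Lead p m 1F → Deg≤ (p ⊗ s) (m + n) → Deg≤ s n
  quotient-deg {p} {s} {m} {n} l h with leading s (bound s) (bounded s)
  ... | inj₁ z = deg-0 z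
  ... | inj₂ (k , _ , c , c≢0 , l′) with k ℕ.≤? n
  ...   | yes k≤n = deg-mono {s} k≤n (Lead.deg l′)
  ...   | no k≰n = ⊥-elim (*-≢0 1≢0 c≢0 (trans (sym (Lead.top (lead-⊗ l l′))) (h _ (ℕ.+-monoʳ-< m (ℕ.≰⇒> k≰n)))))

  -- Here N = t^(q-1) + 1 and M = t^(q+1) + a. As v v′ = N M and v + v′ = t^(q/2), the two
  -- neighbours of the Frobenius point have x-coordinates (v/N)²/t and (v′/N)²/t. The factors of N
  -- at the roots `ds` of v cancel in v/N, leaving V/D₁; each cancelled factor lowers the possible
  -- height, and this is how the point count enters.
  module Start (h : ℕ) (r≡ : r ≡ suc h) {v v′ : Poly}
      (product : v ⊗ v′ ≈ (O (suc h) ⊕ const 1F) ⊗ (X ⊗ X ⊗ O (suc h) ⊕ 𝕒)) (sum : v ⊕ v′ ≈ E h) (deg-v : Deg≤ v (2 ^ suc h))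
      (ds es : List Carrier) (ds-unique : Unique ds) (es-unique : Unique es) (ds-es : All (λ d → All (d ≢_) es) ds)
      (ds≢0 : All (_≢ 0F) ds) (es≢0 : All (_≢ 0F) es) (count : suc (length ds + length es) ≡ 2 ^ suc h)
      (ds-roots : All (λ c → linear c ∣ v) ds) (es-roots : All (λ c → linear c ∣ v′) es) where

    N M : Poly
    N = O (suc h) ⊕ const 1F
    M = X ⊗ X ⊗ O (suc h) ⊕ 𝕒

    D₀ D₁ : Poly
    D₀ = Πlinear ds
    D₁ = Πlinear es

    O-value : ∀ n {c} → c ≢ 0F → Value c (O n) (pow c (2 ^ n) *F c ⁻¹)
    O-value zero    {c} c≢0 = subst (Value c (O 0)) (sym (trans (cong (_*F c ⁻¹) (*-identityʳ c)) (inverse c c≢0))) (value-const 1F)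
    O-value (suc n) {c} c≢0 = subst (Value c (O (suc n))) (trans (sym (*-assoc _ _ _)) (cong (_*F c ⁻¹) (sym (pow-2^suc c n))))
      (value-⊗ (value-↑ (2 ^ n) (value-X c)) (O-value n c≢0))

    N-root : ∀ {c} → c ≢ 0F → linear c ∣ N
    N-root {c} c≢0 = value-0 (value-⊕ (O-value (suc h) c≢0) (value-const 1F))
      (≡-+0 (trans (cong (_*F c ⁻¹) (trans (cong (λ k → pow c (2 ^ k)) (sym r≡)) (fermat c))) (inverse c c≢0)))

    coprime-D₀D₁ : Coprime D₀ D₁
    coprime-D₀D₁ = coprime-Πlinear D₀ es (All.tabulate λ {e} e∈es → coprime-sym (coprime-Πlinear (linear e) ds
      (All.map (λ d≢es → coprime-linear (λ e≡d → All.lookup d≢es e∈es (sym e≡d))) ds-es)))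

    lead-D₀D₁ : Lead (D₀ ⊗ D₁) (length ds + length es) 1F
    lead-D₀D₁ = subst (Lead (D₀ ⊗ D₁) _) (*-identityˡ 1F) (lead-⊗ (Πlinear-lead ds) (Πlinear-lead es))

    lead-N : Lead N (length ds + length es) 1F
    lead-N = lead-cong (P.+-comm _ _) (lead-⊕ (ℕ.≤-pred (subst (1 <_) (sym count) (ℕ.^-monoʳ-< 2 (s≤s (s≤s z≤n)) {0} {suc h} (s≤s z≤n))))
      (deg-const 1F) (O-lead (suc h) (sym count)))

    -- By Fermat every listed c is a root of N, and by `count` there are q - 1 of them. Both sides
    -- are monic of this degree, so the cofactor is 1.
    D₀D₁≈N : D₀ ⊗ D₁ ≈ N
    D₀D₁≈N = go (∣-coprime-* coprime-D₀D₁ (Πlinear-∣ ds ds-unique (All.map N-root ds≢0)) (Πlinear-∣ es es-unique (All.map N-root es≢0)))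
      where
      go : D₀ ⊗ D₁ ∣ N → D₀ ⊗ D₁ ≈ N
      go (k , e) = ≈-sym (≈-trans e (≈-trans (P.*-congˡ k≈1) (P.*-identityʳ _)))
        where
        l = length ds + length es
        deg-k : Deg≤ k 0
        deg-k = quotient-deg lead-D₀D₁ (deg-cong e (deg-mono {N} (ℕ.m≤m+n l 0) (Lead.deg lead-N)))
        top-k : coeff k 0 ≡ 1F
        top-k = trans (sym (*-identityˡ _)) (trans (sym (Lead.top (lead-⊗ lead-D₀D₁ (lead deg-k refl))))
          (trans (sym (coeffs e (l + 0))) (trans (cong (coeff N) (ℕ.+-identityʳ l)) (Lead.top lead-N))))
        k≈1 : k ≈ const 1F
        k≈1 = ≈-trans (≈-const deg-k) (const-cong top-k)

    D₀∣v = Πlinear-∣ ds ds-unique ds-roots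
    D₁∣v′ = Πlinear-∣ es es-unique es-roots
    V V′ : Poly
    V  = proj₁ D₀∣v
    V′ = proj₁ D₁∣v′

    VV′≈M : V ⊗ V′ ≈ M
    VV′≈M = ⊕≈0 (monic-cancel lead-D₀D₁ (begin
      D₀ ⊗ D₁ ⊗ (V ⊗ V′ ⊕ M)             ≈⟨ PS.solve 5 (λ d e v w m → d PS.:* e PS.:* (v PS.:* w PS.:+ m) PS.:= d PS.:* v PS.:* (e PS.:* w) PS.:+ d PS.:* e PS.:* m) ≈-refl D₀ D₁ V V′ M ⟩
      D₀ ⊗ V ⊗ (D₁ ⊗ V′) ⊕ D₀ ⊗ D₁ ⊗ M   ≈⟨ ⊕-cong (⊗-cong (≈-sym (proj₂ D₀∣v)) (≈-sym (proj₂ D₁∣v′))) (P.*-congʳ D₀D₁≈N) ⟩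
      v ⊗ v′ ⊕ N ⊗ M                     ≈⟨ P.+-congʳ product ⟩
      N ⊗ M ⊕ N ⊗ M                      ≈⟨ ⊕-double _ ⟩
      const 0F                           ∎))

    D₀V+D₁V′≈E : D₀ ⊗ V ⊕ D₁ ⊗ V′ ≈ E h
    D₀V+D₁V′≈E = ≈-trans (⊕-cong (≈-sym (proj₂ D₀∣v)) (≈-sym (proj₂ D₁∣v′))) sum

    -- V divides M, and M is congruent to the unit a modulo t.
    coprime-XV : Coprime X V
    coprime-XV = ideal-cong (≈-trans (P.*-comm _ _) 𝕒-unit) (ideal-* (const (a ⁻¹)) (ideal-cong M+M (ideal-+
        (ideal-* (X ⊗ O (suc h)) (ideal-1st X V)) (ideal-* V′ (ideal-2nd X V)))))
      where
      M+M : X ⊗ O (suc h) ⊗ X ⊕ V′ ⊗ V ≈ 𝕒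
      M+M = begin
        X ⊗ O (suc h) ⊗ X ⊕ V′ ⊗ V   ≈⟨ P.+-congˡ (≈-trans (P.*-comm V′ V) VV′≈M) ⟩
        X ⊗ O (suc h) ⊗ X ⊕ M        ≈⟨ PS.solve 3 (λ x o c → x PS.:* o PS.:* x PS.:+ (x PS.:* x PS.:* o PS.:+ c) PS.:= c) ≈-refl X (O (suc h)) 𝕒 ⟩
        𝕒                            ∎

    coprime-XD₁ : Coprime X D₁
    coprime-XD₁ = coprime-Πlinear X es (All.map (λ {c} c≢0 → const (c ⁻¹) , const (c ⁻¹) , ≈-sym (begin
        const (c ⁻¹) ⊗ X ⊕ const (c ⁻¹) ⊗ linear c  ≈⟨ PS.solve 3 (λ i x c → i PS.:* x PS.:+ i PS.:* (x PS.:+ c) PS.:= i PS.:* c) ≈-refl (const (c ⁻¹)) X (const c) ⟩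
        const (c ⁻¹) ⊗ const c                      ≈⟨ const-* _ _ ⟩
        const (c ⁻¹ *F c)                           ≈⟨ const-cong (⁻¹-inverseˡ c c≢0) ⟩
        const 1F                                    ∎)) es≢0)

    -- D₀ V + D₁ V′ is a power of t and t is prime to D₁.
    coprime-VD₁ : Coprime V D₁
    coprime-VD₁ = go (coprime-↑ (2 ^ h) (coprime-sym coprime-XD₁))
      where
      go : Coprime D₁ (X ↑ (2 ^ h)) → Coprime V D₁
      go (x , y , e) = ideal-cong (≈-sym e) (ideal-+ (ideal-* x (ideal-2nd V D₁)) (ideal-* y
        (ideal-cong D₀V+D₁V′≈E (ideal-+ (ideal-* D₀ (ideal-1st V D₁)) (ideal-cong (P.*-comm V′ D₁) (ideal-* V′ (ideal-2nd V D₁)))))))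

    f₁ g₁ : Poly
    f₁ = V ⊗ V
    g₁ = X ⊗ (D₁ ⊗ D₁)

    coprime₁ : Coprime f₁ g₁
    coprime₁ = coprime-* (coprime-sym (coprime-* coprime-XV coprime-XV)) (coprime-square coprime-VD₁)

    f₀ g₀ : Poly
    f₀ = X ⊗ O (suc h)
    g₀ = const 1F

    f₀≈X↑q : X ↑ q ≈ f₀
    f₀≈X↑q = ≈-trans (P.reflexive (cong (λ k → X ↑ (2 ^ k)) r≡)) (≈-sym (X⊗O (suc h)))

    -- After a factor t² is taken out, only N², t^q and M² remain. Writing them as (D₀D₁)², (D₀V +
    -- D₁V′)² and (VV′)² leaves terms that cancel in pairs.
    related₁ : Related f₀ g₀ f₁ g₁
    related₁ = begin
      (X ⊗ o ⊕ X ⊗ const 1F) ⊗ (X ⊗ o ⊕ X ⊗ const 1F) ⊗ (f₁ ⊗ f₁) ⊕ X ⊗ o ⊗ const 1F ⊗ X ⊗ (f₁ ⊗ g₁)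
        ⊕ (X ⊗ o ⊗ X ⊕ 𝕒 ⊗ const 1F) ⊗ (X ⊗ o ⊗ X ⊕ 𝕒 ⊗ const 1F) ⊗ (g₁ ⊗ g₁)
        ≈⟨ PS.solve 5 (λ x o c f d → (x PS.:* o PS.:+ x PS.:* PS.con true) PS.:* (x PS.:* o PS.:+ x PS.:* PS.con true) PS.:* (f PS.:* f) PS.:+ x PS.:* o PS.:* PS.con true PS.:* x PS.:* (f PS.:* (x PS.:* d))
              PS.:+ (x PS.:* o PS.:* x PS.:+ c PS.:* PS.con true) PS.:* (x PS.:* o PS.:* x PS.:+ c PS.:* PS.con true) PS.:* (x PS.:* d PS.:* (x PS.:* d))
            PS.:= x PS.:* x PS.:* ((o PS.:+ PS.con true) PS.:* (o PS.:+ PS.con true) PS.:* (f PS.:* f) PS.:+ x PS.:* o PS.:* (f PS.:* d) PS.:+ (x PS.:* x PS.:* o PS.:+ c) PS.:* (x PS.:* x PS.:* o PS.:+ c) PS.:* (d PS.:* d)))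
            ≈-refl X o 𝕒 f₁ (D₁ ⊗ D₁) ⟩
      X ⊗ X ⊗ (N ⊗ N ⊗ (f₁ ⊗ f₁) ⊕ X ⊗ o ⊗ (f₁ ⊗ (D₁ ⊗ D₁)) ⊕ M ⊗ M ⊗ (D₁ ⊗ D₁ ⊗ (D₁ ⊗ D₁)))
        ≈⟨ P.*-congˡ (⊕-cong (⊕-cong (P.*-congʳ (⊗-cong D₀D₁≈N D₀D₁≈N)) (P.*-congʳ (≈-trans (⊗-cong D₀V+D₁V′≈E D₀V+D₁V′≈E)
             (≈-trans (≈-sym (E-suc h)) (≈-sym (X⊗O (suc h))))))) (P.*-congʳ (⊗-cong VV′≈M VV′≈M))) ⟨
      X ⊗ X ⊗ (D₀ ⊗ D₁ ⊗ (D₀ ⊗ D₁) ⊗ (f₁ ⊗ f₁) ⊕ (D₀ ⊗ V ⊕ D₁ ⊗ V′) ⊗ (D₀ ⊗ V ⊕ D₁ ⊗ V′) ⊗ (f₁ ⊗ (D₁ ⊗ D₁))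
        ⊕ V ⊗ V′ ⊗ (V ⊗ V′) ⊗ (D₁ ⊗ D₁ ⊗ (D₁ ⊗ D₁)))
        ≈⟨ P.*-congˡ (PS.solve 4 (λ d e v w → d PS.:* e PS.:* (d PS.:* e) PS.:* (v PS.:* v PS.:* (v PS.:* v)) PS.:+ (d PS.:* v PS.:+ e PS.:* w) PS.:* (d PS.:* v PS.:+ e PS.:* w) PS.:* (v PS.:* v PS.:* (e PS.:* e))
             PS.:+ v PS.:* w PS.:* (v PS.:* w) PS.:* (e PS.:* e PS.:* (e PS.:* e)) PS.:= PS.con false) ≈-refl D₀ D₁ V V′) ⟩
      X ⊗ X ⊗ const 0F ≈⟨ P.zeroʳ _ ⟩
      const 0F ∎
      where
      o = O (suc h)

    coprime₀ : Coprime f₀ g₀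
    coprime₀ = ideal-2nd f₀ g₀

    height₀ : Height f₀ g₀ q
    height₀ = record { deg-f = Lead.deg l ; deg-g = deg-const 1F ; attained = inj₁ (lead⇒≢0 1≢0 l) }
      where
      l = lead-cong f₀≈X↑q (lead-X↑ q)

    deg-V : Deg≤ V (suc (length es))
    deg-V = quotient-deg (Πlinear-lead ds) (deg-cong (proj₂ D₀∣v)
      (deg-mono {v} (ℕ.≤-reflexive (trans (sym count) (sym (ℕ.+-suc (length ds) (length es))))) deg-v))

    bound₁ : ∃ λ d → d ≤ suc (length es) + suc (length es) × Height f₁ g₁ d
    bound₁ = height coprime₁ (deg-⊗ {V} {V} deg-V deg-V) (deg-mono {g₁}
      (s≤s (ℕ.+-monoʳ-≤ (length es) (ℕ.n≤1+n (length es))))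
      (deg-⊗ {X} {D₁ ⊗ D₁} deg-X (deg-⊗ {D₁} {D₁} (Lead.deg (Πlinear-lead es)) (Lead.deg (Πlinear-lead es)))))

    one-sided : ∀ n → n * length ds ≤ n * n + q + n * length es
    -- The first height is at most 2(n₋ + 1), where n₋ is the length of `es`. Since q = 1 + n₊ + n₋,
    -- adding n₊ gives exactly q + 1 + n₋, the starting hypothesis of the descent.
    one-sided = Descent.conclusion (length ds) (length es) coprime₀ coprime₁ related₁ height₀ (proj₂ (proj₂ bound₁))
      (ℕ.≤-trans (ℕ.+-monoˡ-≤ (length ds) (proj₁ (proj₂ bound₁))) (ℕ.≤-reflexive (trans (eq (length ds) (length es))
        (cong (λ k → suc k + length es) (trans count (cong (2 ^_) (sym r≡)))))))
      where
      eq : ∀ m n → suc n + suc n + m ≡ suc (suc (m + n)) + n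
      eq = solve-∀

  -- Exchanging the roots `w h` and `w h ⊕ E h`, that is, Frobenius + Q with Frobenius - Q,
  -- exchanges `n₀` with `n₁`; one construction thus bounds K from both sides.
  hasse-ℕ : (∀ n → n * n₀ a ≤ n * n + q + n * n₁ a) × (∀ n → n * n₁ a ≤ n * n + q + n * n₀ a)
  hasse-ℕ = go r refl
    where
    go : ∀ k → r ≡ k → (∀ n → n * n₀ a ≤ n * n + q + n * n₁ a) × (∀ n → n * n₁ a ≤ n * n + q + n * n₀ a)
    go zero    e = ⊥-elim (ℕ.n≮0 (subst (1 ≤_) e 1≤r))
    go (suc h) e = subst₂ (λ x y → ∀ n → n * x ≤ n * n + q + n * y) (length-filter P? 𝔽-elems) (length-filter Q? 𝔽-elems) S₁.one-sided
                 , subst₂ (λ x y → ∀ n → n * y ≤ n * n + q + n * x) (length-filter P? 𝔽-elems) (length-filter Q? 𝔽-elems) S₂.one-sided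
      where
      open FiniteSetoid 𝔽 using () renaming (elems to 𝔽-elems)
      u = λ c → c +F a *F c ⁻¹
      P? = λ x → ¬? (x ≟F 0F) ×-dec (tr (u x) ≟F 0F)
      Q? = λ x → ¬? (x ≟F 0F) ×-dec ¬? (tr (u x) ≟F 0F)
      ds = filter P? 𝔽-elems
      es = filter Q? 𝔽-elems
      P-ds = all-filter P? 𝔽-elems
      Q-es = all-filter Q? 𝔽-elems
      o = O (suc h)
      -- Because a^q = a, the right side of `w-equation` is t^(2q) + a + t^(q-1) (t² + a), which
      -- splits as (t^(q-1) + 1)(t^(q+1) + a).
      product : w h ⊗ (w h ⊕ E h) ≈ (o ⊕ const 1F) ⊗ (X ⊗ X ⊗ o ⊕ 𝕒)
      product = begin
        w h ⊗ (w h ⊕ E h)                 ≈⟨ w-equation h ⟩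
        U (suc h) ⊕ o ⊗ (X ⊗ X ⊕ 𝕒)       ≈⟨ P.+-congʳ (≈-trans (U≈ (suc h)) (⊕-cong (⊗-cong (≈-sym (X⊗O (suc h))) (≈-sym (X⊗O (suc h))))
                                               (const-cong (trans (cong (λ k → pow a (2 ^ k)) (sym e)) (fermat a))))) ⟩
        X ⊗ o ⊗ (X ⊗ o) ⊕ 𝕒 ⊕ o ⊗ (X ⊗ X ⊕ 𝕒)
          ≈⟨ PS.solve 3 (λ x o c → x PS.:* o PS.:* (x PS.:* o) PS.:+ c PS.:+ o PS.:* (x PS.:* x PS.:+ c) PS.:= (o PS.:+ PS.con true) PS.:* (x PS.:* x PS.:* o PS.:+ c)) ≈-refl X o 𝕒 ⟩
        (o ⊕ const 1F) ⊗ (X ⊗ X ⊗ o ⊕ 𝕒)  ∎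
      sum : w h ⊕ (w h ⊕ E h) ≈ E h
      sum = PS.solve 2 (λ w e → w PS.:+ (w PS.:+ e) PS.:= e) ≈-refl (w h) (E h)
      tr-suc : ∀ x → tr x ≡ partialTr (suc h) x
      tr-suc x = cong (λ k → partialTr k x) e
      roots₀ : All (λ c → linear c ∣ w h) ds
      roots₀ = All.map (λ (c≢0 , t) → value-0 (w-value h c≢0) (trans (cong (pow _ (2 ^ h) *F_) (trans (sym (tr-suc _)) t)) (zeroʳ _))) P-ds
      roots₁ : All (λ c → linear c ∣ w h ⊕ E h) es
      roots₁ = All.map (λ {c} (c≢0 , t) → value-0 (value-⊕ (w-value h c≢0) (value-↑ (2 ^ h) (value-X c))) (≡-+0
        (trans (cong (pow c (2 ^ h) *F_) (trans (sym (tr-suc _)) (tr≡1 t))) (*-identityʳ _)))) Q-es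
        where
        tr≡1 : ∀ {x} → tr x ≢ 0F → tr x ≡ 1F
        tr≡1 {x} t with tr-0∨1 x
        ... | inj₁ z = ⊥-elim (t z)
        ... | inj₂ z = z
      apart : ∀ {d c} → d ≢ 0F × tr (u d) ≡ 0F → c ≢ 0F × tr (u c) ≢ 0F → d ≢ c
      apart (_ , t) (_ , t′) refl = t′ t
      count : suc (length ds + length es) ≡ 2 ^ suc h
      count = trans (cong suc (cong₂ _+_ (length-filter P? 𝔽-elems) (length-filter Q? 𝔽-elems))) (trans (n₀+n₁ a) (cong (2 ^_) e))
      module S₁ = Start h e product sum (deg-w h) ds es (filter⁺ P? 𝔽-unique) (filter⁺ Q? 𝔽-unique)
        (All.map (λ p → All.map (apart p) Q-es) P-ds) (All.map proj₁ P-ds) (All.map proj₁ Q-es) count roots₀ roots₁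
      module S₂ = Start h e (≈-trans (P.*-comm _ _) product) (≈-trans (P.+-comm _ _) sum)
        (deg-⊕ {w h} {E h} (deg-w h) (deg-mono {E h} (ℕ.m≤m+n (2 ^ h) _) (deg-X↑ (2 ^ h))))
        es ds (filter⁺ Q? 𝔽-unique) (filter⁺ P? 𝔽-unique)
        (All.map (λ p → All.map (λ p′ e → apart p′ p (sym e)) P-ds) Q-es) (All.map proj₁ Q-es) (All.map proj₁ P-ds)
        (trans (cong suc (ℕ.+-comm (length es) _)) count) roots₁ roots₀

-- Range and congruence of the Kloosterman sums

parity : ∀ l → (∃ λ m → l ≡ 2 * m) ⊎ (∃ λ m → l ≡ suc (2 * m))
parity zero = inj₁ (0 , refl)
parity (suc l) with parity l
... | inj₁ (m , refl) = inj₂ (m , refl)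
... | inj₂ (m , refl) = inj₁ (suc m , eq m)
  where
  eq : ∀ m → suc (suc (2 * m)) ≡ 2 * suc m
  eq = solve-∀

odd-divisor : ∀ k l r → suc (2 * k) * l ≡ 2 ^ r → k ≡ 0
odd-divisor zero    l zero    e = refl
odd-divisor (suc k) l zero    e = ⊥-elim (ℕ.1+n≢0 (ℕ.suc-injective (ℕ.m*n≡1⇒m≡1 (suc (2 * suc k)) l e)))
odd-divisor k       l (suc r) e with parity l
... | inj₁ (m , refl) = odd-divisor k m r (ℕ.*-cancelˡ-≡ _ _ 2 (trans (eq k m) e))
  where
  eq : ∀ k m → 2 * (suc (2 * k) * m) ≡ suc (2 * k) * (2 * m)
  eq = solve-∀
... | inj₂ (m , refl) = ⊥-elim (ℕ.even≢odd (2 ^ r) (m + k * suc (2 * m)) (trans (sym e) (eq k m)))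
  where
  eq : ∀ k m → suc (2 * k) * suc (2 * m) ≡ suc (2 * (m + k * suc (2 * m)))
  eq = solve-∀

-- The quadratic n² − κ n + q is nonnegative at the integer n = (κ + 1)/2; the
-- only odd κ with κ² = 4q + 1 is κ = 3, which has q = 2.
square-bound : ∀ r m → 4 ≤ 2 ^ r → (∀ n → n * suc (2 * m) ≤ n * n + 2 ^ r) → suc (2 * m) * suc (2 * m) < 4 * 2 ^ r
square-bound r m 4≤q h = ℕ.≤-trans (ℕ.≤-reflexive (e₂ m)) (ℕ.≤-trans (ℕ.m≤m+n _ 2) (ℕ.≤-trans (ℕ.≤-reflexive (e₃ m)) (ℕ.*-monoʳ-≤ 4 lt)))
  where
  e₁ : ∀ m → suc m * suc (2 * m) ≡ suc m * suc m + suc m * m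
  e₁ = solve-∀
  e₂ : ∀ m → suc (suc (2 * m) * suc (2 * m)) ≡ 4 * (suc m * m) + 2
  e₂ = solve-∀
  e₃ : ∀ m → 4 * (suc m * m) + 2 + 2 ≡ 4 * suc (suc m * m)
  e₃ = solve-∀
  le : suc m * m ≤ 2 ^ r
  le = ℕ.+-cancelˡ-≤ (suc m * suc m) _ _ (ℕ.≤-trans (ℕ.≤-reflexive (sym (e₁ m))) (h (suc m)))
  ne : suc m * m ≢ 2 ^ r
  ne e with parity m
  ... | inj₁ (k , refl) with odd-divisor k (2 * k) r e
  ...   | refl = ℕ.<⇒≱ (s≤s z≤n) (subst (4 ≤_) (sym e) 4≤q)
  ne e | inj₂ (k , refl) with odd-divisor k (suc (suc (2 * k))) r (trans (ℕ.*-comm (suc (2 * k)) _) e)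
  ...   | refl = ℕ.<⇒≱ (s≤s (s≤s (s≤s z≤n))) (subst (4 ≤_) (sym e) 4≤q)
  lt : suc (suc m * m) ≤ 2 ^ r
  lt = ℕ.≤∧≢⇒< le ne

module KloostermanBounds {r : ℕ} (F : BinaryField r) (4≤q : 4 ≤ 2 ^ r)
                         (a : BinaryField.Carrier F) (a≢0 : a ≢ BinaryField.0F F) where
  open import Data.Integer using (+_; -[1+_])
  open FieldFacts F using (q; K; 0F)
  open TraceFacts F

  q-mod4 : ∃ λ s → q ≡ 4 * s
  q-mod4 = go r 4≤q
    where
    go : ∀ k → 4 ≤ 2 ^ k → ∃ λ s → 2 ^ k ≡ 4 * s
    go 0             (s≤s ())
    go 1             (s≤s (s≤s ()))
    go (suc (suc k)) _ = 2 ^ k , eq (2 ^ k)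
      where
      eq : ∀ x → 2 * (2 * x) ≡ 4 * x
      eq = solve-∀

  -- K is ± κ, and κ ≡ ∓ 1 mod 4.
  data Shape : Set where
    plus  : ∀ d → K a ≡ + (3 + d * 4) → n₀ a ≡ n₁ a + (3 + d * 4) → Shape
    minus : ∀ d → K a ≡ -[1+ d * 4 ] → n₁ a ≡ n₀ a + (1 + d * 4) → Shape

  ℤ-cancel : ∀ {x y} → x ℤ.+ + n₁ a ≡ y ℤ.+ + n₁ a → x ≡ y
  ℤ-cancel = ∙-cancelʳ (+ n₁ a) _ _
    where open import Algebra.Properties.AbelianGroup ℤ.+-0-abelianGroup using (∙-cancelʳ)

  -- With n₁ = 2m and q = 4s one has K = q - 1 - 2 n₁ = 4(s - m) - 1, so the sign of K is decided by
  -- m < s, and its absolute value is 3 or 1 modulo 4 accordingly.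
  shape : Shape
  shape = go (proj₁ n₁-halves) (proj₁ q-mod4) (proj₂ n₁-halves) (proj₂ q-mod4) (_ ℕ.<? _)
    where
    n₁-halves = n₁-even a a≢0
    go : ∀ m s → n₁ a ≡ 2 * m → q ≡ 4 * s → Dec (m < s) → Shape
    go m s n₁≡ q≡ (yes m<s) = plus d (ℤ-cancel (trans (K≡n₀-n₁ a) (trans (cong +_ n₀≡) (trans (cong +_ (ℕ.+-comm (n₁ a) _)) (ℤ.pos-+ (3 + d * 4) (n₁ a)))))) n₀≡
      where
      d = s ∸ suc m
      e₁ : ∀ m d → 4 * (suc m + d) ≡ suc (2 * m + (3 + d * 4) + 2 * m)
      e₁ = solve-∀
      n₀≡ : n₀ a ≡ n₁ a + (3 + d * 4)
      n₀≡ = trans (ℕ.+-cancelʳ-≡ (2 * m) _ _ (ℕ.suc-injective (trans (trans (cong (λ x → suc (n₀ a + x)) (sym n₁≡)) (n₀+n₁ a))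
        (trans q≡ (trans (cong (4 *_) (sym (ℕ.m+[n∸m]≡n m<s))) (e₁ m d)))))) (cong (_+ (3 + d * 4)) (sym n₁≡))
    go m s n₁≡ q≡ (no m≮s) = minus d (ℤ-cancel (trans (K≡n₀-n₁ a) (sym (trans (cong (λ x → -[1+ d * 4 ] ℤ.+ x) (trans (cong +_ n₁≡′) (trans (cong +_ (ℕ.+-comm (n₀ a) _)) (ℤ.pos-+ (1 + d * 4) (n₀ a)))))
          (trans (sym (ℤ.+-assoc -[1+ d * 4 ] (+ (1 + d * 4)) (+ n₀ a))) (trans (cong (ℤ._+ + n₀ a) (ℤ.+-inverseˡ (+ (1 + d * 4)))) (ℤ.+-identityˡ _))))))) n₁≡′
      where
      d = m ∸ s
      e₂ : ∀ s d → 2 * (2 * (s + d)) + 1 ≡ 4 * s + (1 + d * 4)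
      e₂ = solve-∀
      e₃ : ∀ n m k → suc (n + m) + k ≡ n + k + m + 1
      e₃ = solve-∀
      e₄ : ∀ m → 2 * (2 * m) + 1 ≡ 2 * m + 2 * m + 1
      e₄ = solve-∀
      n₁≡′ : n₁ a ≡ n₀ a + (1 + d * 4)
      n₁≡′ = trans n₁≡ (ℕ.+-cancelʳ-≡ (2 * m) _ _ (ℕ.+-cancelʳ-≡ 1 _ _ (trans (sym (e₄ m)) (trans (cong (λ x → 2 * (2 * x) + 1) (sym (ℕ.m+[n∸m]≡n (ℕ.≮⇒≥ m≮s))))
        (trans (e₂ s d) (trans (cong (_+ (1 + d * 4)) (trans (sym q≡) (trans (sym (n₀+n₁ a)) (cong (λ x → suc (n₀ a + x)) n₁≡))))
        (e₃ (n₀ a) (2 * m) (1 + d * 4))))))))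

  K-mod4 : K a ℤ.%ℕ 4 ≡ 3
  K-mod4 = go shape
    where
    neg : ∀ d → -[1+ d * 4 ] ℤ.%ℕ 4 ≡ 3
    neg d with suc (d * 4) ℕ.% 4 | [m+kn]%n≡m%n 1 d 4
    ... | .1 | refl = refl
    go : Shape → K a ℤ.%ℕ 4 ≡ 3
    go (plus d e _)  = trans (cong (ℤ._%ℕ 4) e) ([m+kn]%n≡m%n 3 d 4)
    go (minus d e _) = trans (cong (ℤ._%ℕ 4) e) (neg d)

  hasse : K a ℤ.* K a ℤ.< + (4 * q)
  hasse = go shape
    where
    go : Shape → K a ℤ.* K a ℤ.< + (4 * q)
    go (plus d e n₀≡) = subst (ℤ._< + (4 * q)) (trans (ℤ.pos-* (3 + d * 4) (3 + d * 4)) (sym (cong₂ ℤ._*_ e e)))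
        (ℤ.+<+ (subst (λ k → k * k < 4 * q) (sym (e₁ d)) (square-bound r (1 + 2 * d) 4≤q λ n → subst (λ k → n * k ≤ n * n + q) (e₁ d)
          (ℕ.+-cancelˡ-≤ (n * n₁ a) _ _ (ℕ.≤-trans (ℕ.≤-reflexive (trans (sym (ℕ.*-distribˡ-+ n (n₁ a) _)) (cong (n *_) (sym n₀≡))))
            (ℕ.≤-trans (proj₁ (Hasse.hasse-ℕ F a a≢0) n) (ℕ.≤-reflexive (ℕ.+-comm (n * n + q) _))))))))
      where
      e₁ : ∀ d → 3 + d * 4 ≡ suc (2 * (1 + 2 * d))
      e₁ = solve-∀
    go (minus d e n₁≡) = subst (ℤ._< + (4 * q)) (sym (cong₂ ℤ._*_ e e))
        (ℤ.+<+ (subst (λ k → k * k < 4 * q) (sym (e₁ d)) (square-bound r (2 * d) 4≤q λ n → subst (λ k → n * k ≤ n * n + q) (e₁ d)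
          (ℕ.+-cancelˡ-≤ (n * n₀ a) _ _ (ℕ.≤-trans (ℕ.≤-reflexive (trans (sym (ℕ.*-distribˡ-+ n (n₀ a) _)) (cong (n *_) (sym n₁≡))))
            (ℕ.≤-trans (proj₂ (Hasse.hasse-ℕ F a a≢0) n) (ℕ.≤-reflexive (ℕ.+-comm (n * n + q) _))))))))
      where
      e₁ : ∀ d → 1 + d * 4 ≡ suc (2 * (2 * d))
      e₁ = solve-∀

-- Products over lists

open import Data.Nat.Combinatorics using (_C_; nCk+nC[k+1]≡[n+1]C[k+1])
open import Data.Nat.ListAction using (sum; product)
open import Data.Nat.ListAction.Properties using (product-++)

module ListProducts where
  private variable
    X Y : Set

  ∏ₗ : List X → (X → ℕ) → ℕ
  ∏ₗ xs f = product (map f xs)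

  ∏-cong : (xs : List X) {f g : X → ℕ} → (∀ x → f x ≡ g x) → ∏ₗ xs f ≡ ∏ₗ xs g
  ∏-cong xs h = cong product (map-cong h xs)

  ∏-one : (xs : List X) → ∏ₗ xs (λ _ → 1) ≡ 1
  ∏-one []       = refl
  ∏-one (x ∷ xs) = trans (ℕ.+-identityʳ _) (∏-one xs)

  ∏-* : (xs : List X) (f g : X → ℕ) → ∏ₗ xs (λ x → f x * g x) ≡ ∏ₗ xs f * ∏ₗ xs g
  ∏-* []       f g = refl
  ∏-* (x ∷ xs) f g = trans (cong (f x * g x *_) (∏-* xs f g)) (eq (f x) (g x) (∏ₗ xs f) (∏ₗ xs g))
    where
    eq : ∀ a b c d → a * b * (c * d) ≡ a * c * (b * d)
    eq = solve-∀

  ∏-swap : (xs : List X) (ys : List Y) (f : X → Y → ℕ) → ∏ₗ xs (λ x → ∏ₗ ys (f x)) ≡ ∏ₗ ys (λ y → ∏ₗ xs (λ x → f x y))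
  ∏-swap []       ys f = sym (∏-one ys)
  ∏-swap (x ∷ xs) ys f = trans (cong (∏ₗ ys (f x) *_) (∏-swap xs ys f)) (sym (∏-* ys (f x) _))

  ∏-filter : {R : X → Set} (R? : ∀ x → Dec (R x)) (xs : List X) (f : X → ℕ) →
             ∏ₗ (filter R? xs) f ≡ ∏ₗ xs (λ x → if does (R? x) then f x else 1)
  ∏-filter R? []       f = refl
  ∏-filter R? (x ∷ xs) f with R? x
  ... | yes _ = cong (f x *_) (∏-filter R? xs f)
  ... | no _  = trans (∏-filter R? xs f) (sym (ℕ.+-identityʳ _))

  ∏-none : (_≟_ : (x y : X) → Dec (x ≡ y)) (xs : List X) (a : X) (f : X → ℕ) → ∑ₗ xs (λ x → 𝟙 (x ≟ a)) ≡ 0 →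
           ∏ₗ xs (λ x → if does (x ≟ a) then f x else 1) ≡ 1
  ∏-none _≟_ []       a f h = refl
  ∏-none _≟_ (x ∷ xs) a f h with x ≟ a
  ... | no _ = trans (ℕ.+-identityʳ _) (∏-none _≟_ xs a f h)

  ∏-once : (_≟_ : (x y : X) → Dec (x ≡ y)) (xs : List X) (a : X) (f : X → ℕ) → ∑ₗ xs (λ x → 𝟙 (x ≟ a)) ≡ 1 →
           ∏ₗ xs (λ x → if does (x ≟ a) then f x else 1) ≡ f a
  ∏-once _≟_ (x ∷ xs) a f h with x ≟ a
  ... | yes refl = trans (cong (f x *_) (∏-none _≟_ xs x f (ℕ.suc-injective h))) (ℕ.*-identityʳ _)
  ... | no _     = trans (ℕ.+-identityʳ _) (∏-once _≟_ xs a f h)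

  sumFin-suc : ∀ {m} (f : Fin (suc m) → ℕ) → sumFin f ≡ f zero + sumFin (f ∘ suc)
  sumFin-suc {m} f = sum-allFin-suc _+_ 0 {m} f

  ∏Fin : ∀ {m} → (Fin m → ℕ) → ℕ
  ∏Fin {m} f = ∏ₗ (allFin m) f

  ∏Fin-suc : ∀ {m} (f : Fin (suc m) → ℕ) → ∏Fin f ≡ f zero * ∏Fin (f ∘ suc)
  ∏Fin-suc {m} f = sum-allFin-suc _*_ 1 {m} f

  -- The product is affine in its i-th factor.
  ∏Fin-+ : ∀ {m} (i : Fin m) (f g h : Fin m → ℕ) → (∀ j → j ≢ i → f j ≡ g j × f j ≡ h j) → f i ≡ g i + h i →
           ∏Fin f ≡ ∏Fin g + ∏Fin h
  ∏Fin-+ {suc m} zero    f g h e e′ = begin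
    ∏Fin f                                              ≡⟨ ∏Fin-suc f ⟩
    f zero * ∏Fin (f ∘ suc)                             ≡⟨ cong (_* ∏Fin (f ∘ suc)) e′ ⟩
    (g zero + h zero) * ∏Fin (f ∘ suc)                  ≡⟨ ℕ.*-distribʳ-+ (∏Fin (f ∘ suc)) (g zero) _ ⟩
    g zero * ∏Fin (f ∘ suc) + h zero * ∏Fin (f ∘ suc)   ≡⟨ cong₂ (λ x y → g zero * x + h zero * y) (∏-cong (allFin m) λ j → proj₁ (e (suc j) λ ())) (∏-cong (allFin m) λ j → proj₂ (e (suc j) λ ())) ⟩
    g zero * ∏Fin (g ∘ suc) + h zero * ∏Fin (h ∘ suc)   ≡⟨ cong₂ _+_ (∏Fin-suc g) (∏Fin-suc h) ⟨
    ∏Fin g + ∏Fin h                                     ∎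
    where open ≡-Reasoning
  ∏Fin-+ {suc m} (suc i) f g h e e′ = begin
    ∏Fin f                                                  ≡⟨ ∏Fin-suc f ⟩
    f zero * ∏Fin (f ∘ suc)                                 ≡⟨ cong (f zero *_) (∏Fin-+ i (f ∘ suc) (g ∘ suc) (h ∘ suc) (λ j j≢i → e (suc j) λ { refl → j≢i refl }) e′) ⟩
    f zero * (∏Fin (g ∘ suc) + ∏Fin (h ∘ suc))              ≡⟨ ℕ.*-distribˡ-+ (f zero) _ _ ⟩
    f zero * ∏Fin (g ∘ suc) + f zero * ∏Fin (h ∘ suc)       ≡⟨ cong₂ (λ x y → x * ∏Fin (g ∘ suc) + y * ∏Fin (h ∘ suc)) (proj₁ (e zero λ ())) (proj₂ (e zero λ ())) ⟩
    g zero * ∏Fin (g ∘ suc) + h zero * ∏Fin (h ∘ suc)       ≡⟨ cong₂ _+_ (∏Fin-suc g) (∏Fin-suc h) ⟨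
    ∏Fin g + ∏Fin h                                         ∎
    where open ≡-Reasoning

  ∏Fin-zero : ∀ {m} (i : Fin m) (f : Fin m → ℕ) → f i ≡ 0 → ∏Fin f ≡ 0
  ∏Fin-zero zero    f e = trans (∏Fin-suc f) (cong (_* ∏Fin (f ∘ suc)) e)
  ∏Fin-zero (suc i) f e = trans (∏Fin-suc f) (trans (cong (f zero *_) (∏Fin-zero i (f ∘ suc) e)) (ℕ.*-zeroʳ (f zero)))

  𝟙-all-∏ : ∀ {m} {R : Fin m → Set} (R? : ∀ i → Dec (R i)) → 𝟙 (Fin.all? R?) ≡ ∏Fin (λ i → 𝟙 (R? i))
  𝟙-all-∏ {zero}  R? = refl
  𝟙-all-∏ {suc m} R? = trans (𝟙-all? R?) (trans (cong (𝟙 (R? zero) *_) (𝟙-all-∏ (R? ∘ suc))) (sym (∏Fin-suc (λ i → 𝟙 (R? i)))))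

  upTo-once : ∀ n a → a < n → ∑ₗ (upTo n) (λ x → 𝟙 (x ℕ.≟ a)) ≡ 1
  upTo-once (suc n) a (s≤s a≤n) = trans (cong (λ l → ∑ₗ l (λ x → 𝟙 (x ℕ.≟ a))) (sym (upTo-∷ʳ n))) (trans (∑-++ (upTo n) (n ∷ []) _) (last (n ℕ.≟ a)))
    where
    absent : ∀ n a → n ≤ a → ∑ₗ (upTo n) (λ x → 𝟙 (x ℕ.≟ a)) ≡ 0
    absent zero    a _ = refl
    absent (suc n) a n<a = trans (cong (λ l → ∑ₗ l (λ x → 𝟙 (x ℕ.≟ a))) (sym (upTo-∷ʳ n))) (trans (∑-++ (upTo n) (n ∷ []) _)
      (cong₂ _+_ (absent n a (ℕ.<⇒≤ n<a)) (cong (_+ 0) (𝟙-no (n ℕ.≟ a) (ℕ.<⇒≢ n<a)))))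
    last : Dec (n ≡ a) → ∑ₗ (upTo n) (λ x → 𝟙 (x ℕ.≟ a)) + (𝟙 (n ℕ.≟ a) + 0) ≡ 1
    last (yes refl) = cong₂ _+_ (absent n n ℕ.≤-refl) (cong (_+ 0) (𝟙-yes (n ℕ.≟ n) refl))
    last (no n≢a)   = cong₂ _+_ (upTo-once n a (ℕ.≤∧≢⇒< a≤n (n≢a ∘ sym))) (cong (_+ 0) (𝟙-no (n ℕ.≟ a) n≢a))

open ListProducts

-- Codewords of given weight from the multiplicities of the traces

module Codewords {r : ℕ} (F : BinaryField r) where
  open FieldFacts F

  Word : ℕ → Set
  Word N = Fin N → Bool

  words : ∀ N → List (Word N)
  words N = allFuns (true ∷ false ∷ []) N

  δ : Carrier → Fin q → ℕ
  δ x i = 𝟙 (x ≟F el i)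

  δ-once : ∀ x → ∑ₗ (allFin q) (δ x) ≡ 1
  δ-once x = trans (∑-cong (allFin q) λ i → 𝟙-cong (x ≟F el i) (i Fin.≟ idx x) (λ e → trans (sym (idx-el i)) (cong idx (sym e))) (λ e → sym (trans (cong el e) (el-idx x)))) (∑ₗ-allFin-once (idx x))

  -- This is the family ν attached to the word u: its entry at i is ν_β for β = `el i`.
  profile : ∀ {N} → (Fin N → Carrier) → Word N → Fin q → ℕ
  profile t u i = sumFin (λ k → if u k then δ (t k) i else 0)

  occurrences : ∀ {N} → (Fin N → Carrier) → Fin q → ℕ
  occurrences t i = sumFin (λ k → δ (t k) i)

  profile-∷ : ∀ {N} (t : Fin (suc N) → Carrier) b (u : Word N) i →
              profile t (b ∷ᵛ u) i ≡ (if b then δ (t zero) i else 0) + profile (t ∘ suc) u i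
  profile-∷ t b u i = sumFin-suc (λ k → if (b ∷ᵛ u) k then δ (t k) i else 0)

  profile-ext : ∀ {N} (t : Fin N → Carrier) {u v : Word N} → (∀ k → u k ≡ v k) → ∀ i → profile t u i ≡ profile t v i
  profile-ext {N} t e i = ∑-cong (allFin N) λ k → cong (λ b → if b then δ (t k) i else 0) (e k)

  profile? : ∀ {N} (t : Fin N → Carrier) (ν : Fin q → ℕ) (u : Word N) → Dec (∀ i → profile t u i ≡ ν i)
  profile? t ν u = Fin.all? λ i → profile t u i ℕ.≟ ν i

  C-zero : ∀ k → 𝟙 (0 ℕ.≟ k) ≡ 0 C k
  C-zero zero    = refl
  C-zero (suc k) = refl

  -- Pascal's rule at the index of t 0, by induction on the length.
  profile-count : ∀ {N} (t : Fin N → Carrier) (ν : Fin q → ℕ) →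
    ∑ₗ (words N) (λ u → 𝟙 (profile? t ν u)) ≡ ∏Fin (λ i → occurrences t i C ν i)
  profile-count {zero}  t ν = trans (ℕ.+-identityʳ _) (trans (𝟙-all-∏ (λ i → 0 ℕ.≟ ν i)) (∏-cong (allFin q) λ i → C-zero (ν i)))
  profile-count {suc N} t ν = begin
    ∑ₗ (words (suc N)) (λ u → 𝟙 (profile? t ν u))
      ≡⟨ ∑-allFuns (true ∷ false ∷ []) N _ (λ {u} {v} e → 𝟙-cong (profile? t ν u) (profile? t ν v)
           (λ h i → trans (sym (profile-ext t e i)) (h i)) (λ h i → trans (profile-ext t e i) (h i))) ⟩
    ∑ₗ (words N) (λ u → 𝟙 (profile? t ν (true ∷ᵛ u))) + (∑ₗ (words N) (λ u → 𝟙 (profile? t ν (false ∷ᵛ u))) + 0)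
      ≡⟨ cong₂ _+_ (taken (ν i₀) refl) (trans (ℕ.+-identityʳ _) skipped) ⟩
    ∏Fin h + ∏Fin g
      ≡⟨ ℕ.+-comm (∏Fin h) _ ⟩
    ∏Fin g + ∏Fin h
      ≡⟨ ∏Fin-+ i₀ f g h off on ⟨
    ∏Fin f ∎
    where
    open ≡-Reasoning
    t′ = t ∘ suc
    i₀ = idx (t zero)
    δ₀ : δ (t zero) i₀ ≡ 1
    δ₀ = 𝟙-yes (t zero ≟F el i₀) (sym (el-idx _))
    δ-off : ∀ j → j ≢ i₀ → δ (t zero) j ≡ 0
    δ-off j j≢ = 𝟙-no (t zero ≟F el j) λ e → j≢ (trans (sym (idx-el j)) (cong idx (sym e)))
    -- The Pascal summand for words that select position 0: at i₀ the lower index drops by one, with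
    -- the value 0 if it was 0 already, since such a word has positive profile at i₀. At every other
    -- index the binomial is unchanged.
    H : ∀ {i : Fin q} → ℕ → Dec (i ≡ i₀) → ℕ → ℕ
    H n (no _)  k       = n C k
    H n (yes _) zero    = 0
    H n (yes _) (suc k) = n C k
    f g h : Fin q → ℕ
    f i = occurrences t i C ν i
    g i = occurrences t′ i C ν i
    h i = H (occurrences t′ i) (i Fin.≟ i₀) (ν i)
    occ : ∀ i → occurrences t i ≡ δ (t zero) i + occurrences t′ i
    occ i = sumFin-suc (λ k → δ (t k) i)
    h-off : ∀ j → j ≢ i₀ → h j ≡ g j
    h-off j j≢ with j Fin.≟ i₀
    ... | yes e = ⊥-elim (j≢ e)
    ... | no _  = refl
    off : ∀ j → j ≢ i₀ → f j ≡ g j × f j ≡ h j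
    off j j≢ = e , trans e (sym (h-off j j≢))
      where
      e : f j ≡ g j
      e = cong (_C ν j) (trans (occ j) (cong (_+ occurrences t′ j) (δ-off j j≢)))
    on : f i₀ ≡ g i₀ + h i₀
    on = trans (cong (_C ν i₀) (trans (occ i₀) (cong (_+ occurrences t′ i₀) δ₀))) pascal
      where
      pascal : suc (occurrences t′ i₀) C ν i₀ ≡ g i₀ + h i₀
      pascal with i₀ Fin.≟ i₀ | ν i₀
      ... | no ne | _     = ⊥-elim (ne refl)
      ... | yes _ | zero  = refl
      ... | yes _ | suc k = trans (sym (nCk+nC[k+1]≡[n+1]C[k+1] (occurrences t′ i₀) k)) (ℕ.+-comm (occurrences t′ i₀ C k) _)
    h-zero : ν i₀ ≡ 0 → h i₀ ≡ 0
    h-zero e with i₀ Fin.≟ i₀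
    ... | no ne = ⊥-elim (ne refl)
    ... | yes _ with ν i₀ | e
    ...   | zero | _ = refl
    skipped : ∑ₗ (words N) (λ u → 𝟙 (profile? t ν (false ∷ᵛ u))) ≡ ∏Fin g
    skipped = trans (∑-cong (words N) λ u → 𝟙-cong (profile? t ν (false ∷ᵛ u)) (profile? t′ ν u)
      (λ p i → trans (sym (profile-∷ t false u i)) (p i)) (λ p i → trans (profile-∷ t false u i) (p i))) (profile-count t′ ν)
    taken : ∀ k → ν i₀ ≡ k → ∑ₗ (words N) (λ u → 𝟙 (profile? t ν (true ∷ᵛ u))) ≡ ∏Fin h
    taken zero    e = trans (trans (∑-cong (words N) λ u → 𝟙-no (profile? t ν (true ∷ᵛ u)) (λ p →
        ℕ.1+n≢0 (trans (sym (trans (profile-∷ t true u i₀) (cong (_+ profile t′ u i₀) δ₀))) (trans (p i₀) e)))) (∑-zero (words N))) (sym (∏Fin-zero i₀ h (h-zero e)))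
    taken (suc k) e = trans (∑-cong (words N) λ u → 𝟙-cong (profile? t ν (true ∷ᵛ u)) (profile? t′ ν′ u)
        (λ p i → ℕ.+-cancelˡ-≡ (δ (t zero) i) _ _ (trans (sym (profile-∷ t true u i)) (trans (p i) (sym (ν′≡ i)))))
        (λ p i → trans (profile-∷ t true u i) (trans (cong (δ (t zero) i +_) (p i)) (ν′≡ i))))
      (trans (profile-count t′ ν′) (∏-cong (allFin q) h≡))
      where
      ν′ : Fin q → ℕ
      ν′ i = ν i ∸ δ (t zero) i
      ν′≡ : ∀ i → δ (t zero) i + ν′ i ≡ ν i
      ν′≡ i with i Fin.≟ i₀
      ... | yes refl = trans (cong₂ (λ x y → x + (y ∸ x)) δ₀ e) (sym e)
      ... | no i≢    = cong (λ x → x + (ν i ∸ x)) (δ-off i i≢)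
      h≡ : ∀ i → occurrences t′ i C ν′ i ≡ h i
      h≡ i = go (i Fin.≟ i₀) (ν i) refl
        where
        go : ∀ d k → ν i ≡ k → occurrences t′ i C ν′ i ≡ H (occurrences t′ i) d k
        go (no i≢)    k       eq = cong (occurrences t′ i C_) (trans (cong (ν i ∸_) (δ-off i i≢)) eq)
        go (yes refl) (suc k) eq = cong (occurrences t′ i C_) (trans (cong (ν i ∸_) δ₀) (cong (_∸ 1) eq))
        go (yes refl) zero    eq = ⊥-elim (ℕ.1+n≢0 (trans (sym e) eq))

  profile-weight : ∀ {N} (t : Fin N → Carrier) (u : Word N) → sumFin (profile t u) ≡ weight u
  profile-weight {N} t u = trans (∑-swap (allFin q) (allFin N) _) (∑-cong (allFin N) λ k → go (u k) k)
    where
    go : ∀ b k → ∑ₗ (allFin q) (λ i → if b then δ (t k) i else 0) ≡ (if b then 1 else 0)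
    go true  k = δ-once (t k)
    go false k = ∑-zero (allFin q)

  δ-sum : ∀ x → ∑ (λ i → δ x i · el i) ≡ x
  δ-sum x = trans (∑-single (λ i → δ x i · el i) (idx x) λ j j≢ → cong (_· el j) (𝟙-no (x ≟F el j) λ e → j≢ (trans (sym (idx-el j)) (cong idx (sym e)))))
    (trans (cong (_· el (idx x)) (𝟙-yes (x ≟F el (idx x)) (sym (el-idx x)))) (trans (+-identityʳ _) (el-idx x)))

  profile-sum : ∀ {N} (t : Fin N → Carrier) (u : Word N) → ∑ (λ i → profile t u i · el i) ≡ ∑ (λ k → if u k then t k else 0F)
  profile-sum {zero}  t u = ∑-zero′ {q} (λ i → refl)
  profile-sum {suc N} t u = begin
    ∑ (λ i → profile t u i · el i)
      ≡⟨ ∑-cong′ {q} (λ i → trans (cong (_· el i) (sumFin-suc (λ k → if u k then δ (t k) i else 0))) (·-+ (if u zero then δ (t zero) i else 0) _ (el i))) ⟩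
    ∑ (λ i → ((if u zero then δ (t zero) i else 0) · el i) +F (profile (t ∘ suc) (u ∘ suc) i · el i))
      ≡⟨ ∑-+′ (λ i → (if u zero then δ (t zero) i else 0) · el i) (λ i → profile (t ∘ suc) (u ∘ suc) i · el i) ⟩
    ∑ (λ i → (if u zero then δ (t zero) i else 0) · el i) +F ∑ (λ i → profile (t ∘ suc) (u ∘ suc) i · el i)
      ≡⟨ cong₂ _+F_ (go (u zero)) (profile-sum (t ∘ suc) (u ∘ suc)) ⟩
    (if u zero then t zero else 0F) +F ∑ (λ k → if u (suc k) then t (suc k) else 0F) ∎
    where
    open ≡-Reasoning
    go : ∀ b → ∑ (λ i → (if b then δ (t zero) i else 0) · el i) ≡ (if b then t zero else 0F)
    go true  = δ-sum (t zero)
    go false = ∑-zero′ {q} (λ i → refl)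

  sumFin-≤ : ∀ {m} (f : Fin m → ℕ) i → f i ≤ sumFin f
  sumFin-≤ f zero    = ℕ.≤-trans (ℕ.m≤m+n (f zero) _) (ℕ.≤-reflexive (sym (sumFin-suc f)))
  sumFin-≤ f (suc i) = ℕ.≤-trans (sumFin-≤ (f ∘ suc) i) (ℕ.≤-trans (ℕ.m≤n+m _ (f zero)) (ℕ.≤-reflexive (sym (sumFin-suc f))))

  ∑-·-cong : {ν μ : Fin q → ℕ} → (∀ i → ν i ≡ μ i) → ∑ (λ i → ν i · el i) ≡ ∑ (λ i → μ i · el i)
  ∑-·-cong e = ∑-cong′ {q} λ i → cong (_· el i) (e i)

  -- Weight and membership in the code depend on a word only through its profile, so the words sort
  -- into the families of the sum, each word under exactly one.
  codeCount-families : ∀ {N m} (g : Fin N → Mat m m) j →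
    codeCount N g j ≡ ∑ₗ (families j) (λ ν → ∏Fin (λ i → occurrences (λ k → Tr (g k)) i C ν i))
  codeCount-families {N} g j = begin
    codeCount N g j
      ≡⟨ length-filter W? (words N) ⟩
    ∑ₗ (words N) (λ u → 𝟙 (W? u))
      ≡⟨ ∑-cong (words N) by-profile ⟩
    ∑ₗ (words N) (λ u → ∑ₗ (families j) (λ ν → 𝟙 (profile? t ν u)))
      ≡⟨ ∑-swap (words N) (families j) _ ⟩
    ∑ₗ (families j) (λ ν → ∑ₗ (words N) (λ u → 𝟙 (profile? t ν u)))
      ≡⟨ ∑-cong (families j) (λ ν → profile-count t ν) ⟩
    ∑ₗ (families j) (λ ν → ∏Fin (λ i → occurrences t i C ν i)) ∎
    where
    open ≡-Reasoning
    t : Fin N → Carrier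
    t k = Tr (g k)
    W? : ∀ u → Dec (weight u ≡ j × codeSum g u ≡ 0F)
    W? u = (weight u ℕ.≟ j) ×-dec (codeSum g u ≟F 0F)
    F? : ∀ (ν : Fin q → ℕ) → Dec (sumFin ν ≡ j × ∑ (λ i → ν i · el i) ≡ 0F)
    F? ν = (sumFin ν ℕ.≟ j) ×-dec (∑ (λ i → ν i · el i) ≟F 0F)
    all-ν = allFuns (upTo (suc j)) q
    by-profile : ∀ u → 𝟙 (W? u) ≡ ∑ₗ (families j) (λ ν → 𝟙 (profile? t ν u))
    by-profile u = sym (begin
      ∑ₗ (families j) (λ ν → 𝟙 (profile? t ν u))            ≡⟨ ∑-filter F? all-ν _ ⟩
      ∑ₗ all-ν (λ ν → 𝟙 (F? ν) * 𝟙 (profile? t ν u))        ≡⟨ ∑-cong all-ν same ⟩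
      ∑ₗ all-ν (λ ν → 𝟙 (W? u) * 𝟙 (match ν))               ≡⟨ ∑-*ˡ all-ν (𝟙 (W? u)) _ ⟩
      𝟙 (W? u) * ∑ₗ all-ν (λ ν → 𝟙 (match ν))               ≡⟨ 𝟙-*-cong (W? u) once ⟩
      𝟙 (W? u) * 1                                          ≡⟨ ℕ.*-identityʳ _ ⟩
      𝟙 (W? u)                                              ∎)
      where
      match : ∀ ν → Dec (∀ i → ν i ≡ profile t u i)
      match ν = Fin.all? λ i → ν i ℕ.≟ profile t u i
      same : ∀ ν → 𝟙 (F? ν) * 𝟙 (profile? t ν u) ≡ 𝟙 (W? u) * 𝟙 (match ν)
      same ν = trans (sym (𝟙-× (F? ν) (profile? t ν u))) (trans (𝟙-cong (F? ν ×-dec profile? t ν u) (W? u ×-dec match ν)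
        (λ ((s , z) , p) → (trans (sym (profile-weight t u)) (trans (∑-cong (allFin q) p) s) , trans (sym (profile-sum t u)) (trans (∑-·-cong p) z)) , λ i → sym (p i))
        (λ ((s , z) , p) → (trans (∑-cong (allFin q) p) (trans (profile-weight t u) s) , trans (∑-·-cong p) (trans (profile-sum t u) z)) , λ i → sym (p i)))
        (𝟙-× (W? u) (match ν)))
      once : weight u ≡ j × codeSum g u ≡ 0F → ∑ₗ all-ν (λ ν → 𝟙 (match ν)) ≡ 1
      -- No entry of a profile exceeds the weight j, so the profile occurs among the functions with
      -- values in `upTo (suc j)`.
      once (s , _) = allFuns-once {_≈_ = _≡_} ℕ._≟_ (upTo (suc j)) q (profile t u) λ i → upTo-once (suc j) (profile t u i)
        (s≤s (subst (profile t u i ≤_) (trans (profile-weight t u) s) (sumFin-≤ (profile t u) i)))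

-- Solutions of the trace equations for 1 × 1 and 2 × 2 blocks

module TraceCounts {r : ℕ} (F : BinaryField r) where
  open FieldFacts F
  open TraceFacts F
  open FiniteSetoid 𝔽 using (once; once′) renaming (elems to 𝔽-elems)

  S : (Carrier → ℕ) → ℕ
  S = ∑ₗ 𝔽-elems

  S-perm : (φ ψ : Carrier → Carrier) → (∀ x → ψ (φ x) ≡ x) → (∀ y → φ (ψ y) ≡ y) → ∀ f → S (f ∘ φ) ≡ S f
  S-perm φ ψ ψφ φψ f = begin
    S (f ∘ φ)                                        ≡⟨ fibres 𝔽 𝔽-elems φ (f ∘ φ) ⟩
    S (λ y → S (λ x → 𝟙 (φ x ≟F y) * f (φ x)))       ≡⟨ ∑-cong 𝔽-elems (λ y → trans (∑-cong 𝔽-elems (λ x → swap x y)) (∑-*ʳ 𝔽-elems (f y) _)) ⟩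
    S (λ y → S (λ x → 𝟙 (x ≟F ψ y)) * f y)           ≡⟨ ∑-cong 𝔽-elems (λ y → trans (cong (_* f y) (once (ψ y))) (ℕ.*-identityˡ _)) ⟩
    S f                                              ∎
    where
    open ≡-Reasoning
    swap : ∀ x y → 𝟙 (φ x ≟F y) * f (φ x) ≡ 𝟙 (x ≟F ψ y) * f y
    swap x y = trans (𝟙-*-cong (φ x ≟F y) (cong f)) (cong (_* f y) (𝟙-cong (φ x ≟F y) (x ≟F ψ y)
      (λ e → trans (sym (ψφ x)) (cong ψ e)) (λ e → trans (cong φ e) (φψ y))))

  S-translate : ∀ c f → S (λ x → f (x +F c)) ≡ S f
  S-translate c = S-perm (_+F c) (_+F c) x+c+c x+c+c
    where
    x+c+c : ∀ x → x +F c +F c ≡ x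
    x+c+c x = solve 2 (λ x c → x :+ c :+ c := x) refl x c

  S-const : ∀ k → S (λ _ → k) ≡ q * k
  S-const k = trans (∑-cong 𝔽-elems λ _ → sym (ℕ.*-identityˡ k)) (trans (∑-*ʳ 𝔽-elems k (λ _ → 1)) (cong (_* k) size-𝔽))

  S-𝟙-* : ∀ a f → S (λ x → 𝟙 (x ≟F a) * f x) ≡ f a
  S-𝟙-* a f = FiniteSetoid.sift 𝔽 a f λ { refl → refl }

  2≤q : 2 ≤ q
  2≤q = ℕ.^-monoʳ-≤ 2 {1} {r} 1≤r

  -- With q = p + 2 the numbers q - 1 and q - 2 become `suc p` and `p`, and the later identities are
  -- polynomial in p.
  p : ℕ
  p = q ∸ 2

  q≡ : q ≡ suc (suc p)
  q≡ = sym (ℕ.m+[n∸m]≡n 2≤q)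

  S-≢0 : S (λ x → 𝟙 (¬? (x ≟F 0F))) ≡ suc p
  S-≢0 = ℕ.suc-injective (trans #≢0 q≡)

  -- The inverse of Frobenius: squaring x^(2^(r-1)) gives x^q = x.
  sqrt : Carrier → Carrier
  sqrt x = pow x (2 ^ pred r)

  sqrt-square : ∀ x → sqrt x *F sqrt x ≡ x
  sqrt-square x = trans (sym (pow-2^suc x (pred r))) (trans (cong (λ k → pow x (2 ^ k)) (ℕ.suc-pred r {{ℕ.>-nonZero 1≤r}})) (fermat x))

  square-injective : ∀ {x y} → x *F x ≡ y *F y → x ≡ y
  square-injective {x} {y} e with *-zero⁻ {x +F y} {x +F y} (trans (solve 2 (λ x y → (x :+ y) :* (x :+ y) := x :* x :+ y :* y) refl x y) (≡-+0 e))
  ... | inj₁ h = +-≡0 h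
  ... | inj₂ h = +-≡0 h

  square-sqrt : ∀ x → sqrt (x *F x) ≡ x
  square-sqrt x = square-injective (sqrt-square (x *F x))

  1⁻¹ : 1F ⁻¹ ≡ 1F
  1⁻¹ = sym (⁻¹-unique (*-identityʳ 1F))

  c₁ : Carrier → ℕ
  c₁ β = # 𝔽 (λ x → ¬? (x ≟F 0F) ×-dec ((x +F x ⁻¹) ≟F β))

  -- The quadratic criterion produces tr (1/β²), and the trace is invariant under squaring.
  c₁-≢0 : ∀ β → β ≢ 0F → c₁ β ≡ 2 * 𝟙 (tr (β ⁻¹) ≟F 0F)
  c₁-≢0 β β≢0 = trans (#-cong 𝔽 (λ x → ¬? (x ≟F 0F) ×-dec ((x +F x ⁻¹) ≟F β)) (λ x → ¬? (x ≟F 0F) ×-dec ((x +F 1F *F x ⁻¹) ≟F β))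
      (λ x (n , e) → n , trans (cong (x +F_) (*-identityˡ _)) e) (λ x (n , e) → n , trans (cong (x +F_) (sym (*-identityˡ _))) e))
    (trans (#x+a/x≡s 1F β 1≢0 β≢0) (cong (λ z → 2 * 𝟙 (z ≟F 0F)) (trans (cong tr (*-identityˡ _)) (tr-square (β ⁻¹)))))

  self-inverse : ∀ x → x ≢ 0F → x +F x ⁻¹ ≡ 0F → x ≡ 1F
  self-inverse x x≢0 e = square-injective (trans (trans (cong (x *F_) (+-≡0 e)) (inverse x x≢0)) (sym (*-identityʳ 1F)))

  c₁-0 : c₁ 0F ≡ 1
  c₁-0 = trans (#-cong 𝔽 (λ x → ¬? (x ≟F 0F) ×-dec ((x +F x ⁻¹) ≟F 0F)) (λ x → x ≟F 1F)
    (λ x (n , e) → self-inverse x n e) (λ { _ refl → 1≢0 , ≡-+0 (sym 1⁻¹) })) (once 1F)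

  -- Traces of the elements of GL₂ come down to counting x + y + 1/x + 1/y = β,
  -- written as (x + y)(1 + 1/xy) = β.

  weigh : Carrier → Carrier → Carrier
  weigh t d = t *F (1F +F d ⁻¹)

  n₂? : ∀ β x y → Dec ((x ≢ 0F × y ≢ 0F) × weigh (x +F y) (x *F y) ≡ β)
  n₂? β x y = (¬? (x ≟F 0F) ×-dec ¬? (y ≟F 0F)) ×-dec (weigh (x +F y) (x *F y) ≟F β)

  n₂ : Carrier → ℕ
  n₂ β = S (λ x → S (λ y → 𝟙 (n₂? β x y)))

  1+⁻¹≢0 : ∀ {d} → d ≢ 0F → d ≢ 1F → 1F +F d ⁻¹ ≢ 0F
  1+⁻¹≢0 {d} d≢0 d≢1 e = d≢1 (trans (sym (⁻¹-involutive d≢0)) (trans (cong _⁻¹ (sym (+-≡0 e))) 1⁻¹))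

  1+1⁻¹ : 1F +F 1F ⁻¹ ≡ 0F
  1+1⁻¹ = ≡-+0 (sym 1⁻¹)

  -- For x ≠ 0 the solutions are y = x and y = 1/x. They coincide only for x = 1, and the `suc`
  -- makes up for this one loss.
  n₂-0 : suc (n₂ 0F) ≡ 2 * suc p
  n₂-0 = begin
    suc (n₂ 0F)                                                       ≡⟨ ℕ.+-comm 1 _ ⟩
    n₂ 0F + 1                                                         ≡⟨ cong (n₂ 0F +_) (once 1F) ⟨
    n₂ 0F + S (λ x → 𝟙 (x ≟F 1F))                                     ≡⟨ ∑-+ 𝔽-elems _ _ ⟨
    S (λ x → S (λ y → 𝟙 (n₂? 0F x y)) + 𝟙 (x ≟F 1F))                  ≡⟨ ∑-cong 𝔽-elems row ⟩
    S (λ x → 2 * 𝟙 (¬? (x ≟F 0F)))                                    ≡⟨ ∑-*ˡ 𝔽-elems 2 _ ⟩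
    2 * S (λ x → 𝟙 (¬? (x ≟F 0F)))                                    ≡⟨ cong (2 *_) S-≢0 ⟩
    2 * suc p                                                         ∎
    where
    open ≡-Reasoning
    row : ∀ x → S (λ y → 𝟙 (n₂? 0F x y)) + 𝟙 (x ≟F 1F) ≡ 2 * 𝟙 (¬? (x ≟F 0F))
    row x with x ≟F 0F
    ... | yes refl = cong₂ _+_ (∑-zero 𝔽-elems) (𝟙-no (0F ≟F 1F) 0≢1)
    ... | no x≢0   = begin
      S (λ y → 𝟙 ((yes x≢0′ ×-dec ¬? (y ≟F 0F)) ×-dec (weigh (x +F y) (x *F y) ≟F 0F))) + 𝟙 (x ≟F 1F)
        ≡⟨ cong (S (λ y → 𝟙 ((yes x≢0′ ×-dec ¬? (y ≟F 0F)) ×-dec (weigh (x +F y) (x *F y) ≟F 0F))) +_)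
             (trans (sym (S-𝟙-* x (λ _ → 𝟙 (x ≟F 1F)))) refl) ⟩
      S (λ y → 𝟙 ((yes x≢0′ ×-dec ¬? (y ≟F 0F)) ×-dec (weigh (x +F y) (x *F y) ≟F 0F))) + S (λ y → 𝟙 (y ≟F x) * 𝟙 (x ≟F 1F))
        ≡⟨ ∑-+ 𝔽-elems _ _ ⟨
      S (λ y → 𝟙 ((yes x≢0′ ×-dec ¬? (y ≟F 0F)) ×-dec (weigh (x +F y) (x *F y) ≟F 0F)) + 𝟙 (y ≟F x) * 𝟙 (x ≟F 1F))
        ≡⟨ ∑-cong 𝔽-elems entry ⟩
      S (λ y → 𝟙 (y ≟F x) + 𝟙 (y ≟F (x ⁻¹)))
        ≡⟨ trans (∑-+ 𝔽-elems _ _) (cong₂ _+_ (once x) (once (x ⁻¹))) ⟩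
      2 ∎
      where
      x≢0′ : x ≢ 0F
      x≢0′ = x≢0
      is-zero : ∀ y → y ≢ 0F → weigh (x +F y) (x *F y) ≡ 0F → y ≡ x ⊎ y ≡ x ⁻¹
      is-zero y y≢0 e with *-zero⁻ e
      ... | inj₁ h = inj₁ (sym (+-≡0 h))
      ... | inj₂ h = inj₂ (⁻¹-unique (trans (sym (⁻¹-involutive (*-≢0 x≢0 y≢0))) (trans (cong _⁻¹ (sym (+-≡0 h))) 1⁻¹)))
      zero₁ : weigh (x +F x) (x *F x) ≡ 0F
      zero₁ = trans (cong (_*F (1F +F (x *F x) ⁻¹)) (double x)) (zeroˡ _)
      zero₂ : weigh (x +F x ⁻¹) (x *F x ⁻¹) ≡ 0F
      zero₂ = trans (cong (λ z → (x +F x ⁻¹) *F (1F +F z ⁻¹)) (inverse x x≢0)) (trans (cong ((x +F x ⁻¹) *F_) 1+1⁻¹) (zeroʳ _))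
      entry : ∀ y → 𝟙 ((yes x≢0′ ×-dec ¬? (y ≟F 0F)) ×-dec (weigh (x +F y) (x *F y) ≟F 0F)) + 𝟙 (y ≟F x) * 𝟙 (x ≟F 1F)
                  ≡ 𝟙 (y ≟F x) + 𝟙 (y ≟F (x ⁻¹))
      entry y with y ≟F 0F | weigh (x +F y) (x *F y) ≟F 0F | y ≟F x | y ≟F (x ⁻¹) | x ≟F 1F
      ... | yes y≡0 | _     | yes y≡x | _        | _        = ⊥-elim (x≢0 (trans (sym y≡x) y≡0))
      ... | yes y≡0 | _     | _       | yes y≡x′ | _        = ⊥-elim (⁻¹-≢0 x≢0 (trans (sym y≡x′) y≡0))
      ... | yes _   | _     | no _    | no _     | _        = refl
      ... | no _    | yes _ | yes _   | yes _    | yes _    = refl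
      ... | no _    | yes _ | yes y≡x | yes y≡x′ | no x≢1   = ⊥-elim (x≢1 (self-inverse x x≢0 (≡-+0 (trans (sym y≡x) y≡x′))))
      ... | no _    | yes _ | yes y≡x | no y≢x′  | yes refl = ⊥-elim (y≢x′ (trans y≡x (sym 1⁻¹)))
      ... | no _    | yes _ | yes _   | no _     | no _     = refl
      ... | no _    | yes _ | no _    | yes _    | _        = refl
      ... | no y≢0  | yes z | no n₁   | no n₂    | _        with is-zero y y≢0 z
      ...   | inj₁ e = ⊥-elim (n₁ e)
      ...   | inj₂ e = ⊥-elim (n₂ e)
      entry y | no _ | no ¬z | yes refl | _        | _ = ⊥-elim (¬z zero₁)
      entry y | no _ | no ¬z | no _     | yes refl | _ = ⊥-elim (¬z zero₂)
      entry y | no _ | no _  | no _     | no _     | _ = refl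

  -- Put d = xy; then x is a root of x² + s x + d with s = β/(1 + 1/d).
  n₂-≢0 : ∀ β → β ≢ 0F → n₂ β + 2 ≡ 2 * n₀ (β ⁻¹)
  n₂-≢0 β β≢0 = begin
    n₂ β + 2
      ≡⟨ cong (_+ 2) (trans (∑-cong 𝔽-elems substitute) (∑-swap 𝔽-elems 𝔽-elems _)) ⟩
    S (λ d → S (λ x → 𝟙 (¬? (d ≟F 0F)) * 𝟙 (Q? d x))) + 2
      ≡⟨ cong (_+ 2) (∑-cong 𝔽-elems (λ d → trans (∑-*ˡ 𝔽-elems (𝟙 (¬? (d ≟F 0F))) _) (𝟙-*-cong (¬? (d ≟F 0F)) (column d)))) ⟩
    S (λ d → 𝟙 (¬? (d ≟F 0F)) * (𝟙 (¬? (d ≟F 1F)) * (2 * 𝟙 (T? d)))) + 2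
      ≡⟨ cong (S (λ d → 𝟙 (¬? (d ≟F 0F)) * (𝟙 (¬? (d ≟F 1F)) * (2 * 𝟙 (T? d)))) +_) (trans (cong (2 *_) (sym (once 1F))) (sym (∑-*ˡ 𝔽-elems 2 _))) ⟩
    S (λ d → 𝟙 (¬? (d ≟F 0F)) * (𝟙 (¬? (d ≟F 1F)) * (2 * 𝟙 (T? d)))) + S (λ d → 2 * 𝟙 (d ≟F 1F))
      ≡⟨ trans (sym (∑-+ 𝔽-elems _ _)) (∑-cong 𝔽-elems with-1) ⟩
    S (λ d → 2 * 𝟙 (¬? (d ≟F 0F) ×-dec T? d))
      ≡⟨ ∑-*ˡ 𝔽-elems 2 _ ⟩
    2 * # 𝔽 (λ d → ¬? (d ≟F 0F) ×-dec T? d)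
      ≡⟨ cong (2 *_) fourth-power ⟩
    2 * n₀ b ∎
    where
    open ≡-Reasoning
    b = β ⁻¹
    b≢0 = ⁻¹-≢0 β≢0
    Q? = λ d x → ¬? (x ≟F 0F) ×-dec (weigh (x +F d *F x ⁻¹) d ≟F β)
    T? = λ d → tr (b *F b *F (d +F d ⁻¹)) ≟F 0F
    undo : ∀ {x} y → x ≢ 0F → y *F x *F x ⁻¹ ≡ y
    undo {x} y x≢0 = trans (*-assoc y x _) (trans (cong (y *F_) (inverse x x≢0)) (*-identityʳ y))
    substitute : ∀ x → S (λ y → 𝟙 (n₂? β x y)) ≡ S (λ d → 𝟙 (¬? (d ≟F 0F)) * 𝟙 (Q? d x))
    substitute x = go (x ≟F 0F)
      where
      go : Dec (x ≡ 0F) → S (λ y → 𝟙 (n₂? β x y)) ≡ S (λ d → 𝟙 (¬? (d ≟F 0F)) * 𝟙 (Q? d x))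
      go (yes x≡0) = ∑-cong 𝔽-elems λ y → trans (𝟙-no (n₂? β x y) (λ ((n , _) , _) → n x≡0))
        (sym (trans (cong (𝟙 (¬? (y ≟F 0F)) *_) (𝟙-no (Q? y x) (λ (n , _) → n x≡0))) (ℕ.*-zeroʳ (𝟙 (¬? (y ≟F 0F))))))
      go (no x≢0) = trans (∑-cong 𝔽-elems λ y → trans (𝟙-cong (n₂? β x y) (¬? ((y *F x) ≟F 0F) ×-dec Q? (y *F x) x)
            (λ { ((_ , n) , e) → *-≢0 n x≢0 , x≢0 , trans (cong₂ weigh (cong (x +F_) (undo y x≢0)) (*-comm y x)) e })
            (λ { (n , _ , e) → (x≢0 , λ { refl → n (zeroˡ x) }) , trans (sym (cong₂ weigh (cong (x +F_) (undo y x≢0)) (*-comm y x))) e }))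
          (𝟙-× (¬? ((y *F x) ≟F 0F)) (Q? (y *F x) x)))
        (S-perm (_*F x) (_*F x ⁻¹) (λ y → undo y x≢0)
          (λ y → trans (*-assoc y _ x) (trans (cong (y *F_) (⁻¹-inverseˡ x x≢0)) (*-identityʳ y)))
          (λ d → 𝟙 (¬? (d ≟F 0F)) * 𝟙 (Q? d x)))
    column : ∀ d → d ≢ 0F → # 𝔽 (Q? d) ≡ 𝟙 (¬? (d ≟F 1F)) * (2 * 𝟙 (T? d))
    column d d≢0 = go (d ≟F 1F)
      where
      go : Dec (d ≡ 1F) → # 𝔽 (Q? d) ≡ 𝟙 (¬? (d ≟F 1F)) * (2 * 𝟙 (T? d))
      go (yes refl) = trans (trans (∑-cong 𝔽-elems λ x → 𝟙-no (Q? 1F x) (λ (_ , e) → β≢0 (trans (sym e) (trans (cong ((x +F 1F *F x ⁻¹) *F_) 1+1⁻¹) (zeroʳ _))))) (∑-zero 𝔽-elems))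
        (sym (cong (_* (2 * 𝟙 (T? 1F))) (𝟙-no (¬? (1F ≟F 1F)) (λ n → n refl))))
      go (no d≢1) = trans (#-cong 𝔽 (Q? d) (λ x → ¬? (x ≟F 0F) ×-dec ((x +F d *F x ⁻¹) ≟F s))
          (λ x (n , e) → n , to e) (λ x (n , e) → n , from e))
        (trans (#x+a/x≡s d s d≢0 s≢0) (trans (cong (λ z → 2 * 𝟙 (z ≟F 0F)) (cong tr same))
          (sym (trans (cong (_* (2 * 𝟙 (T? d))) (𝟙-yes (¬? (d ≟F 1F)) d≢1)) (ℕ.*-identityˡ _)))))
        where
        k = 1F +F d ⁻¹
        k≢0 = 1+⁻¹≢0 d≢0 d≢1
        s = β *F k ⁻¹
        s≢0 = *-≢0 β≢0 (⁻¹-≢0 k≢0)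
        to : ∀ {t} → t *F k ≡ β → t ≡ s
        to {t} refl = sym (undo t k≢0)
        from : ∀ {t} → t ≡ s → t *F k ≡ β
        from refl = trans (*-assoc β _ k) (trans (cong (β *F_) (⁻¹-inverseˡ k k≢0)) (*-identityʳ β))
        s⁻¹ : s ⁻¹ ≡ b *F k
        s⁻¹ = sym (⁻¹-unique (trans (solve 4 (λ β k b l → β :* l :* (b :* k) := β :* b :* (k :* l)) refl β k b (k ⁻¹))
          (trans (cong₂ _*F_ (inverse β β≢0) (inverse k k≢0)) (*-identityʳ 1F))))
        same : d *F (s ⁻¹ *F s ⁻¹) ≡ b *F b *F (d +F d ⁻¹)
        same = begin
          d *F (s ⁻¹ *F s ⁻¹)                               ≡⟨ cong (λ z → d *F (z *F z)) s⁻¹ ⟩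
          d *F (b *F (1F +F d ⁻¹) *F (b *F (1F +F d ⁻¹)))   ≡⟨ solve 3 (λ d b e → d :* (b :* (con true :+ e) :* (b :* (con true :+ e))) := b :* b :* (d :+ d :* e :* e)) refl d b (d ⁻¹) ⟩
          b *F b *F (d +F d *F d ⁻¹ *F d ⁻¹)                ≡⟨ cong (λ z → b *F b *F (d +F z)) (trans (cong (_*F d ⁻¹) (inverse d d≢0)) (*-identityˡ _)) ⟩
          b *F b *F (d +F d ⁻¹)                             ∎
    -- At d = 1 the factor 1 + 1/d vanishes and no pair is counted, although tr (b² (d + 1/d)) = 0
    -- there. The 2 added on the left of the lemma supplies this term and completes the sum over all
    -- d ≠ 0.
    with-1 : ∀ d → 𝟙 (¬? (d ≟F 0F)) * (𝟙 (¬? (d ≟F 1F)) * (2 * 𝟙 (T? d))) + 2 * 𝟙 (d ≟F 1F) ≡ 2 * 𝟙 (¬? (d ≟F 0F) ×-dec T? d)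
    with-1 d with d ≟F 1F
    ... | yes refl = sym (trans (cong (2 *_) (𝟙-yes (¬? (1F ≟F 0F) ×-dec T? 1F) (1≢0 , trans (cong tr (trans (cong (b *F b *F_) 1+1⁻¹) (zeroʳ _))) tr-0)))
        (sym (cong (_+ 2) (ℕ.*-zeroʳ (𝟙 (¬? (1F ≟F 0F)))))))
    ... | no _ = trans (eq (𝟙 (¬? (d ≟F 0F))) (𝟙 (T? d))) (cong (2 *_) (sym (𝟙-× (¬? (d ≟F 0F)) (T? d))))
      where
      eq : ∀ x y → x * (1 * (2 * y)) + 2 * 0 ≡ 2 * (x * y)
      eq = solve-∀
    -- Substitute d = β² y⁴, a bijection since squaring is one. With b = 1/β this gives b² (d + 1/d)
    -- = y⁴ + b⁴/y⁴ = (y + b/y)⁴, which has the same trace as y + b/y.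
    fourth-power : # 𝔽 (λ d → ¬? (d ≟F 0F) ×-dec T? d) ≡ n₀ b
    fourth-power = trans (sym (S-perm φ ψ ψφ φψ (λ d → 𝟙 (¬? (d ≟F 0F) ×-dec T? d))))
      (∑-cong 𝔽-elems λ y → 𝟙-cong (¬? (φ y ≟F 0F) ×-dec T? (φ y)) (¬? (y ≟F 0F) ×-dec (tr (y +F b *F y ⁻¹) ≟F 0F))
        (λ (n , t) → let y≢0 = λ { refl → n (trans (cong (β *F β *F_) (trans (cong (_*F (0F *F 0F)) (zeroˡ 0F)) (zeroˡ _))) (zeroʳ _)) } in
           y≢0 , trans (sym (tr-φ y y≢0)) t)
        (λ (n , t) → *-≢0 (*-≢0 β≢0 β≢0) (*-≢0 (*-≢0 n n) (*-≢0 n n)) , trans (tr-φ y n) t))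
      where
      φ ψ : Carrier → Carrier
      φ y = β *F β *F (y *F y *F (y *F y))
      ψ d = sqrt (sqrt (b *F b *F d))
      bβ : b *F b *F (β *F β) ≡ 1F
      bβ = trans (solve 2 (λ b β → b :* b :* (β :* β) := β :* b :* (β :* b)) refl b β) (trans (cong (λ z → z *F z) (inverse β β≢0)) (*-identityʳ 1F))
      ψφ : ∀ y → ψ (φ y) ≡ y
      ψφ y = trans (cong (sqrt ∘ sqrt) (trans (sym (*-assoc _ _ _)) (trans (cong (_*F (y *F y *F (y *F y))) bβ) (*-identityˡ _))))
        (trans (cong sqrt (square-sqrt (y *F y))) (square-sqrt y))
      φψ : ∀ d → φ (ψ d) ≡ d
      φψ d = begin
        β *F β *F (ψ d *F ψ d *F (ψ d *F ψ d))  ≡⟨ cong (λ z → β *F β *F (z *F z)) (sqrt-square _) ⟩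
        β *F β *F (sqrt (b *F b *F d) *F sqrt (b *F b *F d)) ≡⟨ cong (β *F β *F_) (sqrt-square _) ⟩
        β *F β *F (b *F b *F d)                 ≡⟨ solve 3 (λ b β d → β :* β :* (b :* b :* d) := b :* b :* (β :* β) :* d) refl b β d ⟩
        b *F b *F (β *F β) *F d                 ≡⟨ trans (cong (_*F d) bβ) (*-identityˡ d) ⟩
        d                                       ∎
      tr-φ : ∀ y → y ≢ 0F → tr (b *F b *F (φ y +F φ y ⁻¹)) ≡ tr (y +F b *F y ⁻¹)
      tr-φ y y≢0 = begin
        tr (b *F b *F (φ y +F φ y ⁻¹))            ≡⟨ cong (λ z → tr (b *F b *F (φ y +F z))) (sym (⁻¹-unique φ-inv)) ⟩
        tr (b *F b *F (φ y +F b *F b *F i⁴))      ≡⟨ cong tr (trans (solve 5 (λ b β y i j → b :* b :* (β :* β :* y :+ b :* b :* i) := b :* b :* (β :* β) :* y :+ b :* b :* (b :* b) :* i) refl b β (y *F y *F (y *F y)) i⁴ 0F)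
                                                        (cong (_+F b *F b *F (b *F b) *F i⁴) (trans (cong (_*F _) bβ) (*-identityˡ _)))) ⟩
        tr (y *F y *F (y *F y) +F b *F b *F (b *F b) *F i⁴)
          ≡⟨ cong tr (solve 3 (λ y b i → y :* y :* (y :* y) :+ b :* b :* (b :* b) :* (i :* i :* (i :* i)) := (y :+ b :* i) :* (y :+ b :* i) :* ((y :+ b :* i) :* (y :+ b :* i))) refl y b (y ⁻¹)) ⟩
        tr (u *F u *F (u *F u))                   ≡⟨ trans (tr-square (u *F u)) (tr-square u) ⟩
        tr u                                      ∎
        where
        u = y +F b *F y ⁻¹
        i⁴ = y ⁻¹ *F y ⁻¹ *F (y ⁻¹ *F y ⁻¹)
        φ-inv : φ y *F (b *F b *F i⁴) ≡ 1F
        φ-inv = begin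
          φ y *F (b *F b *F i⁴)  ≡⟨ solve 4 (λ b β y i → β :* β :* (y :* y :* (y :* y)) :* (b :* b :* (i :* i :* (i :* i))) := b :* b :* (β :* β) :* (y :* i :* (y :* i) :* (y :* i :* (y :* i)))) refl b β y (y ⁻¹) ⟩
          b *F b *F (β *F β) *F (y *F y ⁻¹ *F (y *F y ⁻¹) *F (y *F y ⁻¹ *F (y *F y ⁻¹)))  ≡⟨ cong₂ (λ z v → z *F (v *F v *F (v *F v))) bβ (inverse y y≢0) ⟩
          1F *F (1F *F 1F *F (1F *F 1F)) ≡⟨ solve 1 (λ x → con true :* (con true :* con true :* (con true :* con true)) := con true) refl 0F ⟩
          1F ∎

  c₂? : ∀ β x y z w → Dec (x *F w +F y *F z ≢ 0F × weigh (x +F w) (x *F w +F y *F z) ≡ β)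
  c₂? β x y z w = ¬? ((x *F w +F y *F z) ≟F 0F) ×-dec (weigh (x +F w) (x *F w +F y *F z) ≟F β)

  c₂ : Carrier → ℕ
  c₂ β = S (λ x → S (λ y → S (λ z → S (λ w → 𝟙 (c₂? β x y z w)))))

  -- Each y ≠ 0 determines z, and y = 0 admits all q values of z when e = 0. The uniform part q - 1
  -- and the excess q at e = 0 are kept apart for use in `c₂-n₂`.
  product-count : ∀ e → S (λ y → S (λ z → 𝟙 ((y *F z) ≟F e))) ≡ suc p + q * 𝟙 (e ≟F 0F)
  product-count e = begin
    S (λ y → S (λ z → 𝟙 ((y *F z) ≟F e)))                               ≡⟨ ∑-cong 𝔽-elems row ⟩
    S (λ y → 𝟙 (¬? (y ≟F 0F)) + 𝟙 (y ≟F 0F) * (q * 𝟙 (e ≟F 0F)))        ≡⟨ ∑-+ 𝔽-elems _ _ ⟩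
    S (λ y → 𝟙 (¬? (y ≟F 0F))) + S (λ y → 𝟙 (y ≟F 0F) * (q * 𝟙 (e ≟F 0F))) ≡⟨ cong₂ _+_ S-≢0 (S-𝟙-* 0F (λ _ → q * 𝟙 (e ≟F 0F))) ⟩
    suc p + q * 𝟙 (e ≟F 0F)                                             ∎
    where
    open ≡-Reasoning
    row : ∀ y → S (λ z → 𝟙 ((y *F z) ≟F e)) ≡ 𝟙 (¬? (y ≟F 0F)) + 𝟙 (y ≟F 0F) * (q * 𝟙 (e ≟F 0F))
    row y = go (y ≟F 0F)
      where
      go : Dec (y ≡ 0F) → S (λ z → 𝟙 ((y *F z) ≟F e)) ≡ 𝟙 (¬? (y ≟F 0F)) + 𝟙 (y ≟F 0F) * (q * 𝟙 (e ≟F 0F))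
      go (yes refl) = trans (∑-cong 𝔽-elems λ z → 𝟙-cong ((0F *F z) ≟F e) (e ≟F 0F) (λ h → trans (sym h) (zeroˡ z)) (λ h → trans (zeroˡ z) (sym h)))
        (trans (S-const _) (sym (cong₂ _+_ (𝟙-no (¬? (0F ≟F 0F)) (λ n → n refl)) (trans (cong (_* (q * 𝟙 (e ≟F 0F))) (𝟙-yes (0F ≟F 0F) refl)) (ℕ.*-identityˡ _)))))
      go (no y≢0) = trans (∑-cong 𝔽-elems λ z → 𝟙-cong ((y *F z) ≟F e) (z ≟F (y ⁻¹ *F e))
            (λ { refl → sym (trans (sym (*-assoc _ y z)) (trans (cong (_*F z) (⁻¹-inverseˡ y y≢0)) (*-identityˡ z))) })
            (λ { refl → trans (sym (*-assoc y _ e)) (trans (cong (_*F e) (inverse y y≢0)) (*-identityˡ e)) }))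
        (trans (once _) (sym (cong₂ _+_ (𝟙-yes (¬? (y ≟F 0F)) y≢0) (cong (_* (q * 𝟙 (e ≟F 0F))) (𝟙-no (y ≟F 0F) y≢0)))))

  -- For each d other than 0 and 1 the factor 1 + 1/d is invertible and determines s; at d = 1 every
  -- s is a solution when β = 0 and none otherwise.
  weigh-count : ∀ β → S (λ s → S (λ d → 𝟙 (¬? (d ≟F 0F) ×-dec (weigh s d ≟F β)))) ≡ p + q * 𝟙 (β ≟F 0F)
  weigh-count β = ℕ.suc-injective (begin
    suc (S (λ s → S (λ d → 𝟙 (¬? (d ≟F 0F) ×-dec (weigh s d ≟F β)))))
      ≡⟨ cong suc (trans (∑-swap 𝔽-elems 𝔽-elems _) (∑-cong 𝔽-elems λ d → trans (∑-cong 𝔽-elems λ s → 𝟙-× (¬? (d ≟F 0F)) (weigh s d ≟F β)) (trans (∑-*ˡ 𝔽-elems (𝟙 (¬? (d ≟F 0F))) _) (𝟙-*-cong (¬? (d ≟F 0F)) (column d))))) ⟩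
    suc (S (λ d → 𝟙 (¬? (d ≟F 0F)) * (𝟙 (¬? (d ≟F 1F)) + 𝟙 (d ≟F 1F) * c)))
      ≡⟨ cong (_+ S (λ d → 𝟙 (¬? (d ≟F 0F)) * (𝟙 (¬? (d ≟F 1F)) + 𝟙 (d ≟F 1F) * c))) (sym (once 1F)) ⟩
    S (λ d → 𝟙 (d ≟F 1F)) + S (λ d → 𝟙 (¬? (d ≟F 0F)) * (𝟙 (¬? (d ≟F 1F)) + 𝟙 (d ≟F 1F) * c))
      ≡⟨ trans (sym (∑-+ 𝔽-elems _ _)) (∑-cong 𝔽-elems entry) ⟩
    S (λ d → 𝟙 (¬? (d ≟F 0F)) + 𝟙 (d ≟F 1F) * c)
      ≡⟨ trans (∑-+ 𝔽-elems _ _) (cong₂ _+_ S-≢0 (S-𝟙-* 1F (λ _ → c))) ⟩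
    suc p + c ∎)
    where
    open ≡-Reasoning
    c = q * 𝟙 (β ≟F 0F)
    column : ∀ d → d ≢ 0F → S (λ s → 𝟙 (weigh s d ≟F β)) ≡ 𝟙 (¬? (d ≟F 1F)) + 𝟙 (d ≟F 1F) * c
    column d d≢0 = go (d ≟F 1F)
      where
      go : Dec (d ≡ 1F) → S (λ s → 𝟙 (weigh s d ≟F β)) ≡ 𝟙 (¬? (d ≟F 1F)) + 𝟙 (d ≟F 1F) * c
      go (yes refl) = trans (∑-cong 𝔽-elems λ s → 𝟙-cong (weigh s 1F ≟F β) (β ≟F 0F)
            (λ h → trans (sym h) (trans (cong (s *F_) 1+1⁻¹) (zeroʳ s))) (λ h → trans (trans (cong (s *F_) 1+1⁻¹) (zeroʳ s)) (sym h)))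
        (trans (S-const _) (sym (cong₂ _+_ (𝟙-no (¬? (1F ≟F 1F)) (λ n → n refl)) (trans (cong (_* c) (𝟙-yes (1F ≟F 1F) refl)) (ℕ.*-identityˡ c)))))
      go (no d≢1) = trans (∑-cong 𝔽-elems λ s → 𝟙-cong (weigh s d ≟F β) (s ≟F (β *F k ⁻¹))
            (λ { refl → sym (trans (*-assoc s k _) (trans (cong (s *F_) (inverse k k≢0)) (*-identityʳ s))) })
            (λ { refl → trans (*-assoc β _ k) (trans (cong (β *F_) (⁻¹-inverseˡ k k≢0)) (*-identityʳ β)) }))
        (trans (once _) (sym (cong₂ _+_ (𝟙-yes (¬? (d ≟F 1F)) d≢1) (cong (_* c) (𝟙-no (d ≟F 1F) d≢1)))))
        where
        k = 1F +F d ⁻¹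
        k≢0 = 1+⁻¹≢0 d≢0 d≢1
    entry : ∀ d → 𝟙 (d ≟F 1F) + 𝟙 (¬? (d ≟F 0F)) * (𝟙 (¬? (d ≟F 1F)) + 𝟙 (d ≟F 1F) * c) ≡ 𝟙 (¬? (d ≟F 0F)) + 𝟙 (d ≟F 1F) * c
    entry d with d ≟F 0F | d ≟F 1F
    ... | yes refl | yes e = ⊥-elim (0≢1 e)
    ... | yes _    | no _  = refl
    ... | no _     | yes _ = cong suc (ℕ.+-identityʳ _)
    ... | no _     | no _  = refl

  -- The off-diagonal entries matter only through e = y z, which takes each value q - 1 times, and
  -- the value 0 another q times. In the uniform part the map from w and e to trace and determinant
  -- is bijective for fixed x, whence `weigh-count`; the excess at e = 0 consists of diagonal
  -- contributions, counted by `n₂`.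
  c₂-n₂ : ∀ β → c₂ β ≡ suc p * (q * (p + q * 𝟙 (β ≟F 0F))) + q * n₂ β
  c₂-n₂ β = begin
    S (λ x → S (λ y → S (λ z → S (λ w → h x w (y *F z)))))
      ≡⟨ ∑-cong 𝔽-elems (λ x → trans (∑-cong 𝔽-elems (λ y → ∑-swap 𝔽-elems 𝔽-elems _)) (∑-swap 𝔽-elems 𝔽-elems _)) ⟩
    S (λ x → S (λ w → S (λ y → S (λ z → h x w (y *F z)))))
      ≡⟨ ∑-cong 𝔽-elems (λ x → trans (∑-cong 𝔽-elems (λ w → by-product x w)) (trans (∑-+ 𝔽-elems _ _) (cong₂ _+_ (∑-*ˡ 𝔽-elems (suc p) _) (∑-*ˡ 𝔽-elems q _)))) ⟩
    S (λ x → suc p * S (λ w → S (λ e → h x w e)) + q * S (λ w → h x w 0F))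
      ≡⟨ trans (∑-+ 𝔽-elems _ _) (cong₂ _+_ (∑-*ˡ 𝔽-elems (suc p) _) (∑-*ˡ 𝔽-elems q _)) ⟩
    suc p * S (λ x → S (λ w → S (λ e → h x w e))) + q * S (λ x → S (λ w → h x w 0F))
      ≡⟨ cong₂ (λ m n → suc p * m + q * n) (trans (∑-cong 𝔽-elems (λ x → trans (∑-cong 𝔽-elems (by-det x)) (translate x))) (trans (S-const _) (cong (q *_) (weigh-count β))))
           (∑-cong 𝔽-elems λ x → ∑-cong 𝔽-elems λ w → diagonal x w) ⟩
    suc p * (q * (p + q * 𝟙 (β ≟F 0F))) + q * n₂ β ∎
    where
    open ≡-Reasoning
    h : Carrier → Carrier → Carrier → ℕ
    h x w e = 𝟙 (¬? ((x *F w +F e) ≟F 0F) ×-dec (weigh (x +F w) (x *F w +F e) ≟F β))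
    by-product : ∀ x w → S (λ y → S (λ z → h x w (y *F z))) ≡ suc p * S (λ e → h x w e) + q * h x w 0F
    by-product x w = begin
      S (λ y → S (λ z → h x w (y *F z)))
        ≡⟨ ∑-cong 𝔽-elems (λ y → fibres 𝔽 𝔽-elems (y *F_) _) ⟩
      S (λ y → S (λ e → S (λ z → 𝟙 ((y *F z) ≟F e) * h x w (y *F z))))
        ≡⟨ ∑-cong 𝔽-elems (λ y → ∑-cong 𝔽-elems (λ e → trans (∑-cong 𝔽-elems (λ z → 𝟙-*-cong ((y *F z) ≟F e) (cong (h x w)))) (∑-*ʳ 𝔽-elems (h x w e) _))) ⟩
      S (λ y → S (λ e → S (λ z → 𝟙 ((y *F z) ≟F e)) * h x w e))
        ≡⟨ trans (∑-swap 𝔽-elems 𝔽-elems _) (∑-cong 𝔽-elems (λ e → trans (∑-*ʳ 𝔽-elems (h x w e) _) (cong (_* h x w e) (product-count e)))) ⟩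
      S (λ e → (suc p + q * 𝟙 (e ≟F 0F)) * h x w e)
        ≡⟨ ∑-cong 𝔽-elems (λ e → distrib (suc p) q (𝟙 (e ≟F 0F)) (h x w e)) ⟩
      S (λ e → suc p * h x w e + q * (𝟙 (e ≟F 0F) * h x w e))
        ≡⟨ trans (∑-+ 𝔽-elems _ _) (cong₂ _+_ (∑-*ˡ 𝔽-elems (suc p) _) (trans (∑-*ˡ 𝔽-elems q _) (cong (q *_) (S-𝟙-* 0F (h x w))))) ⟩
      suc p * S (λ e → h x w e) + q * h x w 0F ∎
      where
      distrib : ∀ a b c d → (a + b * c) * d ≡ a * d + b * (c * d)
      distrib = solve-∀
    by-det : ∀ x w → S (λ e → h x w e) ≡ S (λ d → 𝟙 (¬? (d ≟F 0F) ×-dec (weigh (x +F w) d ≟F β)))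
    by-det x w = trans (∑-cong 𝔽-elems λ e → cong (λ z → 𝟙 (¬? (z ≟F 0F) ×-dec (weigh (x +F w) z ≟F β))) (+-comm _ e))
      (S-translate (x *F w) (λ d → 𝟙 (¬? (d ≟F 0F) ×-dec (weigh (x +F w) d ≟F β))))
    translate : ∀ x → S (λ w → S (λ d → 𝟙 (¬? (d ≟F 0F) ×-dec (weigh (x +F w) d ≟F β))))
                    ≡ S (λ s → S (λ d → 𝟙 (¬? (d ≟F 0F) ×-dec (weigh s d ≟F β))))
    translate x = trans (∑-cong 𝔽-elems λ w → cong (λ t → S (λ d → 𝟙 (¬? (d ≟F 0F) ×-dec (weigh t d ≟F β)))) (+-comm x w))
      (S-translate x (λ s → S (λ d → 𝟙 (¬? (d ≟F 0F) ×-dec (weigh s d ≟F β)))))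
    diagonal : ∀ x w → h x w 0F ≡ 𝟙 (n₂? β x w)
    diagonal x w = 𝟙-cong (¬? ((x *F w +F 0F) ≟F 0F) ×-dec (weigh (x +F w) (x *F w +F 0F) ≟F β)) (n₂? β x w)
      (λ (n , e) → ((λ { refl → n (trans (+-identityʳ _) (zeroˡ w)) }) , (λ { refl → n (trans (+-identityʳ _) (zeroʳ x)) })) , trans (cong (weigh (x +F w)) (sym (+-identityʳ _))) e)
      (λ ((n , n′) , e) → (λ z → *-≢0 n n′ (trans (sym (+-identityʳ _)) z)) , trans (cong (weigh (x +F w)) (+-identityʳ _)) e)

-- Matrices, blocks, and the parabolic subgroup of the symplectic group

module Matrices {r : ℕ} (F : BinaryField r) where
  open FieldFacts F renaming (_⊠_ to infixl 7 _⊠′_; _≈M_ to infix 4 _≈M_)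

  -- A record, so that the two matrices can be inferred from a proof of equality.
  infix 4 _≋_
  record _≋_ {m k : ℕ} (X Y : Mat m k) : Set where
    constructor ≋-intro
    field at : ∀ i j → X i j ≡ Y i j
  open _≋_ public

  private variable
    m n k l a b c d : ℕ

  ≋-refl : {X : Mat m k} → X ≋ X
  ≋-refl = ≋-intro λ i j → refl

  ≋-sym : {X Y : Mat m k} → X ≋ Y → Y ≋ X
  ≋-sym e = ≋-intro λ i j → sym (at e i j)

  ≋-trans : {X Y Z : Mat m k} → X ≋ Y → Y ≋ Z → X ≋ Z
  ≋-trans e h = ≋-intro λ i j → trans (at e i j) (at h i j)

  infix 4 _≋?_
  _≋?_ : (X Y : Mat m k) → Dec (X ≋ Y)
  _≋?_ {m} {k} X Y = Dec.map′ ≋-intro at (FiniteSetoid._≟_ (Fun m (Fun k 𝔽)) X Y)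

  𝕄 : ℕ → ℕ → FiniteSetoid
  𝕄 m k = record
    { Carrier       = Mat m k
    ; _≈_           = _≋_
    ; isEquivalence = record { refl = ≋-refl ; sym = ≋-sym ; trans = ≋-trans }
    ; _≟_           = _≋?_
    ; elems         = FiniteSetoid.elems (Fun m (Fun k 𝔽))
    ; once          = FiniteSetoid.once (Fun m (Fun k 𝔽))
    }

  matSetoid : ℕ → ℕ → Setoid 0ℓ 0ℓ
  matSetoid m k = record { Carrier = Mat m k ; _≈_ = _≋_ ; isEquivalence = FiniteSetoid.isEquivalence (𝕄 m k) }

  module ≋-Reasoning {m k} = Relation.Binary.Reasoning.Setoid (matSetoid m k)

  infixl 6 _⊞_
  _⊞_ : Mat m k → Mat m k → Mat m k
  (X ⊞ Y) i j = X i j +F Y i j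

  ⊞-cong : {X X′ Y Y′ : Mat m k} → X ≋ X′ → Y ≋ Y′ → X ⊞ Y ≋ X′ ⊞ Y′
  ⊞-cong e h = ≋-intro λ i j → cong₂ _+F_ (at e i j) (at h i j)

  ⊞-0ˡ : {X Y : Mat m k} → X ≋ 0M → X ⊞ Y ≋ Y
  ⊞-0ˡ e = ≋-intro λ i j → trans (cong (_+F _) (at e i j)) (+-identityˡ _)

  ⊞-0ʳ : {X Y : Mat m k} → Y ≋ 0M → X ⊞ Y ≋ X
  ⊞-0ʳ e = ≋-intro λ i j → trans (cong (_ +F_) (at e i j)) (+-identityʳ _)

  ⊞-self : {X Y : Mat m k} → X ≋ Y → X ⊞ Y ≋ 0M
  ⊞-self e = ≋-intro λ i j → ≡-+0 (at e i j)

  ⊞-≈0 : {X Y : Mat m k} → X ⊞ Y ≋ 0M → X ≋ Y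
  ⊞-≈0 e = ≋-intro λ i j → +-≡0 (at e i j)

  opaque
    infixl 7 _⊠_
    _⊠_ : Mat m k → Mat k l → Mat m l
    X ⊠ Y = X ⊠′ Y

    ⊠≋⊠′ : (X : Mat m k) (Y : Mat k l) → X ⊠ Y ≋ X ⊠′ Y
    ⊠≋⊠′ X Y = ≋-refl

    ⊠-cong : {X X′ : Mat m k} {Y Y′ : Mat k l} → X ≋ X′ → Y ≋ Y′ → X ⊠ Y ≋ X′ ⊠ Y′
    ⊠-cong {k = k} e h = ≋-intro λ i j → ∑-cong′ {k} λ t → cong₂ _*F_ (at e i t) (at h t j)

    ⊠-congˡ : {X : Mat m k} {Y Y′ : Mat k l} → Y ≋ Y′ → X ⊠ Y ≋ X ⊠ Y′
    ⊠-congˡ {k = k} h = ≋-intro λ i j → ∑-cong′ {k} λ t → cong (_ *F_) (at h t j)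

    ⊠-congʳ : {X X′ : Mat m k} {Y : Mat k l} → X ≋ X′ → X ⊠ Y ≋ X′ ⊠ Y
    ⊠-congʳ {k = k} e = ≋-intro λ i j → ∑-cong′ {k} λ t → cong (_*F _) (at e i t)

    ⊠-assoc : (X : Mat m k) (Y : Mat k l) (Z : Mat l n) → (X ⊠ Y) ⊠ Z ≋ X ⊠ (Y ⊠ Z)
    ⊠-assoc {k = k} {l = l} X Y Z = ≋-intro λ i j → begin
      ∑ (λ u → ∑ (λ t → X i t *F Y t u) *F Z u j)     ≡⟨ ∑-cong′ {l} (λ u → ∑-*ʳ′ (Z u j) (λ t → X i t *F Y t u)) ⟨
      ∑ (λ u → ∑ (λ t → X i t *F Y t u *F Z u j))     ≡⟨ ∑-swap′ {l} {k} (λ u t → X i t *F Y t u *F Z u j) ⟩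
      ∑ (λ t → ∑ (λ u → X i t *F Y t u *F Z u j))     ≡⟨ ∑-cong′ {k} (λ t → trans (∑-cong′ {l} λ u → *-assoc (X i t) (Y t u) (Z u j)) (∑-*ˡ′ (X i t) (λ u → Y t u *F Z u j))) ⟩
      ∑ (λ t → X i t *F ∑ (λ u → Y t u *F Z u j))     ∎
      where open ≡-Reasoning

  1M-diag : (i : Fin m) → 1M i i ≡ 1F
  1M-diag i with i Fin.≟ i
  ... | yes _  = refl
  ... | no i≢i = ⊥-elim (i≢i refl)

  1M-off : {i j : Fin m} → i ≢ j → 1M i j ≡ 0F
  1M-off {i = i} {j} i≢j with i Fin.≟ j
  ... | yes i≡j = ⊥-elim (i≢j i≡j)
  ... | no _    = refl

  1M-sym : transpose (1M {m}) ≋ 1M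
  1M-sym {m} = ≋-intro go
    where
    go : (i j : Fin m) → 1M j i ≡ 1M i j
    go i j with i Fin.≟ j
    ... | yes refl = 1M-diag i
    ... | no i≢j   = 1M-off (i≢j ∘ sym)

  opaque
    unfolding _⊠_
    ⊠-identityˡ : (X : Mat m k) → 1M ⊠ X ≋ X
    ⊠-identityˡ X = ≋-intro λ i j → trans (∑-single (λ t → 1M i t *F X t j) i λ t t≢i → trans (cong (_*F X t j) (1M-off (t≢i ∘ sym))) (zeroˡ _))
      (trans (cong (_*F X i j) (1M-diag i)) (*-identityˡ _))

    ⊠-identityʳ : (X : Mat m k) → X ⊠ 1M ≋ X
    ⊠-identityʳ X = ≋-intro λ i j → trans (∑-single (λ t → X i t *F 1M t j) j λ t t≢j → trans (cong (X i t *F_) (1M-off t≢j)) (zeroʳ _))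
      (trans (cong (X i j *F_) (1M-diag j)) (*-identityʳ _))

    ⊠-zeroˡ : {X : Mat m k} {Y : Mat k l} → X ≋ 0M → X ⊠ Y ≋ 0M
    ⊠-zeroˡ {k = k} {Y = Y} e = ≋-intro λ i j → ∑-zero′ {k} λ t → trans (cong (_*F Y t j) (at e i t)) (zeroˡ _)

    ⊠-zeroʳ : {X : Mat m k} {Y : Mat k l} → Y ≋ 0M → X ⊠ Y ≋ 0M
    ⊠-zeroʳ {k = k} {X = X} e = ≋-intro λ i j → ∑-zero′ {k} λ t → trans (cong (X i t *F_) (at e t j)) (zeroʳ _)

    ⊠-distribˡ : (X : Mat m k) (Y Z : Mat k l) → X ⊠ (Y ⊞ Z) ≋ X ⊠ Y ⊞ X ⊠ Z
    ⊠-distribˡ {k = k} X Y Z = ≋-intro λ i j → trans (∑-cong′ {k} λ t → distribˡ (X i t) _ _) (∑-+′ (λ t → X i t *F Y t j) (λ t → X i t *F Z t j))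

    ⊠-distribʳ : (X Y : Mat m k) (Z : Mat k l) → (X ⊞ Y) ⊠ Z ≋ X ⊠ Z ⊞ Y ⊠ Z
    ⊠-distribʳ {k = k} X Y Z = ≋-intro λ i j → trans (∑-cong′ {k} λ t → distribʳ (Z t j) _ _) (∑-+′ (λ t → X i t *F Z t j) (λ t → Y i t *F Z t j))

    transpose-cong : {X Y : Mat m k} → X ≋ Y → transpose X ≋ transpose Y
    transpose-cong e = ≋-intro λ i j → at e j i

    transpose-⊠ : (X : Mat m k) (Y : Mat k l) → transpose (X ⊠ Y) ≋ transpose Y ⊠ transpose X
    transpose-⊠ {k = k} X Y = ≋-intro λ i j → ∑-cong′ {k} λ t → *-comm _ _

  Tr-cong : {X Y : Mat m m} → X ≋ Y → Tr X ≡ Tr Y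
  Tr-cong {m = m} e = ∑-cong′ {m} λ i → at e i i

  Tr-⊞ : (X Y : Mat m m) → Tr (X ⊞ Y) ≡ Tr X +F Tr Y
  Tr-⊞ X Y = ∑-+′ (λ i → X i i) (λ i → Y i i)

  opaque
    unfolding _⊠_
    Tr-comm : (X : Mat m k) (Y : Mat k m) → Tr (X ⊠ Y) ≡ Tr (Y ⊠ X)
    Tr-comm {m = m} {k = k} X Y = trans (∑-swap′ {m} {k} (λ i t → X i t *F Y t i)) (∑-cong′ {k} λ t → ∑-cong′ {m} λ i → *-comm _ _)

  Tr-0 : {X : Mat m m} → X ≋ 0M → Tr X ≡ 0F
  Tr-0 {m = m} e = ∑-zero′ {m} λ i → at e i i

  Inverses : Mat n n → Mat n n → Set
  Inverses A A′ = (A ⊠ A′ ≋ 1M) × (A′ ⊠ A ≋ 1M)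

  Inv : Mat n n → Set
  Inv A = ∃ (Inverses A)

  inverses-resp : {A B A′ B′ : Mat n n} → A ≋ B → A′ ≋ B′ → Inverses A A′ → Inverses B B′
  inverses-resp e e′ (h , h′) = ≋-trans (⊠-cong (≋-sym e) (≋-sym e′)) h , ≋-trans (⊠-cong (≋-sym e′) (≋-sym e)) h′

  Inv-resp : {A B : Mat n n} → A ≋ B → Inv A → Inv B
  Inv-resp e (A′ , h) = A′ , inverses-resp e ≋-refl h

  Inv? : (A : Mat n n) → Dec (Inv A)
  Inv? {n} A = FiniteSetoid.search (𝕄 n n) (inverses-resp ≋-refl) (λ A′ → ((A ⊠ A′) ≋? 1M) ×-dec ((A′ ⊠ A) ≋? 1M))

  inverse-unique : {A B C : Mat n n} → B ⊠ A ≋ 1M → A ⊠ C ≋ 1M → B ≋ C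
  inverse-unique {A = A} {B} {C} h h′ = begin
    B            ≈⟨ ⊠-identityʳ B ⟨
    B ⊠ 1M       ≈⟨ ⊠-congˡ h′ ⟨
    B ⊠ (A ⊠ C)  ≈⟨ ⊠-assoc B A C ⟨
    (B ⊠ A) ⊠ C  ≈⟨ ⊠-congʳ h ⟩
    1M ⊠ C       ≈⟨ ⊠-identityˡ C ⟩
    C            ∎
    where open ≋-Reasoning

  -- inv A = 1 when A is not invertible.
  inv : Mat n n → Mat n n
  inv A with Inv? A
  ... | yes (A′ , _) = A′
  ... | no _         = 1M

  inv-inverses : {A : Mat n n} → Inv A → Inverses A (inv A)
  inv-inverses {A = A} h with Inv? A
  ... | yes (_ , e) = e
  ... | no ¬h       = ⊥-elim (¬h h)

  inv-unique : {A A′ : Mat n n} → Inverses A A′ → inv A ≋ A′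
  inv-unique h = inverse-unique (proj₂ (inv-inverses (_ , h))) (proj₁ h)

  inv-cong : {A B : Mat n n} → Inv A → A ≋ B → inv A ≋ inv B
  inv-cong h e = ≋-sym (inv-unique (inverses-resp e ≋-refl (inv-inverses h)))

  Inverses-⊠ : {A B A′ B′ : Mat n n} → Inverses A A′ → Inverses B B′ → Inverses (A ⊠ B) (B′ ⊠ A′)
  Inverses-⊠ {A = A} {B} {A′} {B′} (h , h′) (k , k′) = cancel A B B′ A′ k h , cancel B′ A′ A B h′ k′
    where
    cancel : (A B B′ A′ : Mat n n) → B ⊠ B′ ≋ 1M → A ⊠ A′ ≋ 1M → A ⊠ B ⊠ (B′ ⊠ A′) ≋ 1M
    cancel A B B′ A′ k h = begin
      A ⊠ B ⊠ (B′ ⊠ A′)    ≈⟨ ⊠-assoc A B _ ⟩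
      A ⊠ (B ⊠ (B′ ⊠ A′))  ≈⟨ ⊠-congˡ (⊠-assoc B B′ A′) ⟨
      A ⊠ (B ⊠ B′ ⊠ A′)    ≈⟨ ⊠-congˡ (≋-trans (⊠-congʳ k) (⊠-identityˡ A′)) ⟩
      A ⊠ A′               ≈⟨ h ⟩
      1M                   ∎
      where open ≋-Reasoning

  Inv-⊠ : {A B : Mat n n} → Inv A → Inv B → Inv (A ⊠ B)
  Inv-⊠ (_ , h) (_ , k) = _ , Inverses-⊠ h k

  Inverses-swap : {A A′ : Mat n n} → Inverses A A′ → Inverses A′ A
  Inverses-swap (h , h′) = h′ , h

  Inverses-transpose : {A A′ : Mat n n} → Inverses A A′ → Inverses (transpose A) (transpose A′)
  Inverses-transpose {A = A} {A′} (h , h′) = ≋-trans (≋-sym (transpose-⊠ A′ A)) (≋-trans (transpose-cong h′) 1M-sym)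
                                         , ≋-trans (≋-sym (transpose-⊠ A A′)) (≋-trans (transpose-cong h) 1M-sym)

  p₁₁ : Mat (a + b) (c + d) → Mat a c
  p₁₂ : Mat (a + b) (c + d) → Mat a d
  p₂₁ : Mat (a + b) (c + d) → Mat b c
  p₂₂ : Mat (a + b) (c + d) → Mat b d
  p₁₁ {b = b} {d = d} M i j = M (i ↑ˡ b) (j ↑ˡ d)
  p₁₂ {b = b} {c = c} M i j = M (i ↑ˡ b) (c ↑ʳ j)
  p₂₁ {a = a} {d = d} M i j = M (a ↑ʳ i) (j ↑ˡ d)
  p₂₂ {a = a} {c = c} M i j = M (a ↑ʳ i) (c ↑ʳ j)

  blk : Mat a c → Mat a d → Mat b c → Mat b d → Mat (a + b) (c + d)
  blk {a} {c} X Y Z W i j = [ (λ i → [ X i , Y i ]′ (splitAt c j)) , (λ i → [ Z i , W i ]′ (splitAt c j)) ]′ (splitAt a i)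

  block≈blk : (X Y Z W : Mat n n) → block X Y Z W ≋ blk X Y Z W
  block≈blk {n} X Y Z W = ≋-intro go
    where
    go : ∀ i j → block X Y Z W i j ≡ blk X Y Z W i j
    go i j with splitAt n i | splitAt n j
    ... | inj₁ _ | inj₁ _ = refl
    ... | inj₁ _ | inj₂ _ = refl
    ... | inj₂ _ | inj₁ _ = refl
    ... | inj₂ _ | inj₂ _ = refl

  blk-11 : (X : Mat a c) (Y : Mat a d) (Z : Mat b c) (W : Mat b d) → p₁₁ (blk X Y Z W) ≋ X
  blk-11 {a} {c} {d} {b} X Y Z W = ≋-intro go
    where
    go : ∀ i j → blk X Y Z W (i ↑ˡ b) (j ↑ˡ d) ≡ X i j
    go i j rewrite Fin.splitAt-↑ˡ a i b | Fin.splitAt-↑ˡ c j d = refl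

  blk-12 : (X : Mat a c) (Y : Mat a d) (Z : Mat b c) (W : Mat b d) → p₁₂ (blk X Y Z W) ≋ Y
  blk-12 {a} {c} {d} {b} X Y Z W = ≋-intro go
    where
    go : ∀ i j → blk X Y Z W (i ↑ˡ b) (c ↑ʳ j) ≡ Y i j
    go i j rewrite Fin.splitAt-↑ˡ a i b | Fin.splitAt-↑ʳ c d j = refl

  blk-21 : (X : Mat a c) (Y : Mat a d) (Z : Mat b c) (W : Mat b d) → p₂₁ (blk X Y Z W) ≋ Z
  blk-21 {a} {c} {d} {b} X Y Z W = ≋-intro go
    where
    go : ∀ i j → blk X Y Z W (a ↑ʳ i) (j ↑ˡ d) ≡ Z i j
    go i j rewrite Fin.splitAt-↑ʳ a b i | Fin.splitAt-↑ˡ c j d = refl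

  blk-22 : (X : Mat a c) (Y : Mat a d) (Z : Mat b c) (W : Mat b d) → p₂₂ (blk X Y Z W) ≋ W
  blk-22 {a} {c} {d} {b} X Y Z W = ≋-intro go
    where
    go : ∀ i j → blk X Y Z W (a ↑ʳ i) (c ↑ʳ j) ≡ W i j
    go i j rewrite Fin.splitAt-↑ʳ a b i | Fin.splitAt-↑ʳ c d j = refl

  by-parts : {M N : Mat (a + b) (c + d)} → p₁₁ {a} {b} {c} {d} M ≋ p₁₁ N → p₁₂ {a} {b} {c} {d} M ≋ p₁₂ N →
             p₂₁ {a} {b} {c} {d} M ≋ p₂₁ N → p₂₂ {a} {b} {c} {d} M ≋ p₂₂ N → M ≋ N
  by-parts {a} {b} {c} {d} {M} {N} e₁₁ e₁₂ e₂₁ e₂₂ = ≋-intro λ i j →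
    subst₂ (λ i j → M i j ≡ N i j) (Fin.join-splitAt a b i) (Fin.join-splitAt c d j) (go (splitAt a i) (splitAt c j))
    where
    go : ∀ i j → M (Fin.join a b i) (Fin.join c d j) ≡ N (Fin.join a b i) (Fin.join c d j)
    go (inj₁ i) (inj₁ j) = at e₁₁ i j
    go (inj₁ i) (inj₂ j) = at e₁₂ i j
    go (inj₂ i) (inj₁ j) = at e₂₁ i j
    go (inj₂ i) (inj₂ j) = at e₂₂ i j

  ∑-↑ : ∀ a {b} (f : Fin (a + b) → Carrier) → ∑ f ≡ ∑ (f ∘ (_↑ˡ b)) +F ∑ (f ∘ (a ↑ʳ_))
  ∑-↑ zero    f = sym (+-identityˡ _)
  ∑-↑ (suc a) f = trans (cong (f zero +F_) (∑-↑ a (f ∘ suc))) (sym (+-assoc _ _ _))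

  Tr-parts : (M : Mat (a + b) (a + b)) → Tr M ≡ Tr (p₁₁ {a} {b} {a} {b} M) +F Tr (p₂₂ {a} {b} {a} {b} M)
  Tr-parts {a} M = ∑-↑ a (λ i → M i i)

  opaque
    unfolding _⊠_
    ⊠-11 : ∀ {e f} (M : Mat (a + b) (c + d)) (N : Mat (c + d) (e + f)) → p₁₁ {a} {b} {e} {f} (M ⊠ N) ≋ p₁₁ {a} {b} {c} {d} M ⊠ p₁₁ {c} {d} {e} {f} N ⊞ p₁₂ {a} {b} {c} {d} M ⊠ p₂₁ {c} {d} {e} {f} N
    ⊠-11 {a} {b} {c} {d} {e} {f} M N = ≋-intro λ i j → ∑-↑ c (λ t → M (i ↑ˡ b) t *F N t (j ↑ˡ f))

    ⊠-12 : ∀ {e f} (M : Mat (a + b) (c + d)) (N : Mat (c + d) (e + f)) → p₁₂ {a} {b} {e} {f} (M ⊠ N) ≋ p₁₁ {a} {b} {c} {d} M ⊠ p₁₂ {c} {d} {e} {f} N ⊞ p₁₂ {a} {b} {c} {d} M ⊠ p₂₂ {c} {d} {e} {f} N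
    ⊠-12 {a} {b} {c} {d} {e} {f} M N = ≋-intro λ i j → ∑-↑ c (λ t → M (i ↑ˡ b) t *F N t (e ↑ʳ j))

    ⊠-21 : ∀ {e f} (M : Mat (a + b) (c + d)) (N : Mat (c + d) (e + f)) → p₂₁ {a} {b} {e} {f} (M ⊠ N) ≋ p₂₁ {a} {b} {c} {d} M ⊠ p₁₁ {c} {d} {e} {f} N ⊞ p₂₂ {a} {b} {c} {d} M ⊠ p₂₁ {c} {d} {e} {f} N
    ⊠-21 {a} {b} {c} {d} {e} {f} M N = ≋-intro λ i j → ∑-↑ c (λ t → M (a ↑ʳ i) t *F N t (j ↑ˡ f))

    ⊠-22 : ∀ {e f} (M : Mat (a + b) (c + d)) (N : Mat (c + d) (e + f)) → p₂₂ {a} {b} {e} {f} (M ⊠ N) ≋ p₂₁ {a} {b} {c} {d} M ⊠ p₁₂ {c} {d} {e} {f} N ⊞ p₂₂ {a} {b} {c} {d} M ⊠ p₂₂ {c} {d} {e} {f} N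
    ⊠-22 {a} {b} {c} {d} {e} {f} M N = ≋-intro λ i j → ∑-↑ c (λ t → M (a ↑ʳ i) t *F N t (e ↑ʳ j))

  1M-11 : p₁₁ {a} {b} {a} {b} 1M ≋ 1M
  1M-11 {a} {b} = ≋-intro go
    where
    go : (i j : Fin a) → 1M (i ↑ˡ b) (j ↑ˡ b) ≡ 1M i j
    go i j with i Fin.≟ j
    ... | yes refl = 1M-diag (i ↑ˡ b)
    ... | no i≢j   = 1M-off (i≢j ∘ Fin.↑ˡ-injective b i j)

  1M-22 : p₂₂ {a} {b} {a} {b} 1M ≋ 1M
  1M-22 {a} {b} = ≋-intro go
    where
    go : (i j : Fin b) → 1M (a ↑ʳ i) (a ↑ʳ j) ≡ 1M i j
    go i j with i Fin.≟ j
    ... | yes refl = 1M-diag (a ↑ʳ i)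
    ... | no i≢j   = 1M-off (i≢j ∘ Fin.↑ʳ-injective a i j)

  ↑ˡ≢↑ʳ : (i : Fin a) (j : Fin b) → i ↑ˡ b ≢ a ↑ʳ j
  ↑ˡ≢↑ʳ {a} {b} i j e with trans (sym (Fin.splitAt-↑ˡ a i b)) (trans (cong (splitAt a) e) (Fin.splitAt-↑ʳ a b j))
  ... | ()

  1M-12 : p₁₂ {a} {b} {a} {b} 1M ≋ 0M
  1M-12 = ≋-intro λ i j → 1M-off (↑ˡ≢↑ʳ i j)

  1M-21 : p₂₁ {a} {b} {a} {b} 1M ≋ 0M
  1M-21 = ≋-intro λ i j → 1M-off (↑ˡ≢↑ʳ j i ∘ sym)

  p₁₁-cong : {M N : Mat (a + b) (c + d)} → M ≋ N → p₁₁ {a} {b} {c} {d} M ≋ p₁₁ N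
  p₁₁-cong e = ≋-intro λ i j → at e _ _
  p₁₂-cong : {M N : Mat (a + b) (c + d)} → M ≋ N → p₁₂ {a} {b} {c} {d} M ≋ p₁₂ N
  p₁₂-cong e = ≋-intro λ i j → at e _ _
  p₂₁-cong : {M N : Mat (a + b) (c + d)} → M ≋ N → p₂₁ {a} {b} {c} {d} M ≋ p₂₁ N
  p₂₁-cong e = ≋-intro λ i j → at e _ _
  p₂₂-cong : {M N : Mat (a + b) (c + d)} → M ≋ N → p₂₂ {a} {b} {c} {d} M ≋ p₂₂ N
  p₂₂-cong e = ≋-intro λ i j → at e _ _

  sum-id0 : {X : Mat m k} {U : Mat m m} {P : Mat m k} {V : Mat m l} {Q : Mat l k} → X ≋ U ⊠ P ⊞ V ⊠ Q → U ≋ 1M → V ≋ 0M → X ≋ P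
  sum-id0 h e e′ = ≋-trans h (≋-trans (⊞-0ʳ (⊠-zeroˡ e′)) (≋-trans (⊠-congʳ e) (⊠-identityˡ _)))

  sum-0id : {X : Mat m k} {U : Mat m l} {P : Mat l k} {V : Mat m m} {Q : Mat m k} → X ≋ U ⊠ P ⊞ V ⊠ Q → U ≋ 0M → V ≋ 1M → X ≋ Q
  sum-0id h e e′ = ≋-trans h (≋-trans (⊞-0ˡ (⊠-zeroˡ e)) (≋-trans (⊠-congʳ e′) (⊠-identityˡ _)))

  -- Symplectic matrices and the parabolic subgroup

  module Symplectic (n : ℕ) where

    M₂ : Set
    M₂ = Mat (n + n) (n + n)

    π₁₁ π₁₂ π₂₁ π₂₂ : M₂ → Mat n n
    π₁₁ = p₁₁ {n} {n} {n} {n}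
    π₁₂ = p₁₂ {n} {n} {n} {n}
    π₂₁ = p₂₁ {n} {n} {n} {n}
    π₂₂ = p₂₂ {n} {n} {n} {n}

    J : M₂
    J = blk {n} {n} {n} {n} 0M 1M 1M 0M

    J₁₁ : π₁₁ J ≋ 0M
    J₁₁ = blk-11 {n} {n} {n} {n} 0M 1M 1M 0M
    J₁₂ : π₁₂ J ≋ 1M
    J₁₂ = blk-12 {n} {n} {n} {n} 0M 1M 1M 0M
    J₂₁ : π₂₁ J ≋ 1M
    J₂₁ = blk-21 {n} {n} {n} {n} 0M 1M 1M 0M
    J₂₂ : π₂₂ J ≋ 0M
    J₂₂ = blk-22 {n} {n} {n} {n} 0M 1M 1M 0M

    J⊠-1 : (M : M₂) → (π₁₁ (J ⊠ M) ≋ π₂₁ M) × (π₁₂ (J ⊠ M) ≋ π₂₂ M)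
    J⊠-1 M = sum-0id (⊠-11 J M) J₁₁ J₁₂ , sum-0id (⊠-12 J M) J₁₁ J₁₂

    J⊠-2 : (M : M₂) → (π₂₁ (J ⊠ M) ≋ π₁₁ M) × (π₂₂ (J ⊠ M) ≋ π₁₂ M)
    J⊠-2 M = sum-id0 (⊠-21 J M) J₂₁ J₂₂ , sum-id0 (⊠-22 J M) J₂₁ J₂₂

    JJ : J ⊠ J ≋ 1M
    JJ = by-parts {n} {n} {n} {n} {J ⊠ J} {1M} (≋-trans (proj₁ (J⊠-1 J)) (≋-trans J₂₁ (≋-sym (1M-11 {n} {n})))) (≋-trans (proj₂ (J⊠-1 J)) (≋-trans J₂₂ (≋-sym (1M-12 {n} {n}))))
      (≋-trans (proj₁ (J⊠-2 J)) (≋-trans J₁₁ (≋-sym (1M-21 {n} {n})))) (≋-trans (proj₂ (J⊠-2 J)) (≋-trans J₁₂ (≋-sym (1M-22 {n} {n}))))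

    transpose-J : transpose J ≋ J
    transpose-J = by-parts {n} {n} {n} {n} {transpose J} {J} (≋-trans (transpose-cong J₁₁) (≋-sym J₁₁)) (≋-trans (transpose-cong J₂₁) (≋-trans 1M-sym (≋-sym J₁₂)))
      (≋-trans (transpose-cong J₁₂) (≋-trans 1M-sym (≋-sym J₂₁))) (≋-trans (transpose-cong J₂₂) (≋-sym J₂₂))

    Preserves : M₂ → Set
    Preserves w = w ⊠ (J ⊠ transpose w) ≋ J

    -- Asking the same of the transpose makes `adj w` a two-sided inverse by computation alone, with
    -- no appeal to dimension.
    Sp : M₂ → Set
    Sp w = Preserves w × Preserves (transpose w)

    preserves-cong : {w v : M₂} → w ≋ v → Preserves w → Preserves v
    preserves-cong e h = ≋-trans (⊠-cong (≋-sym e) (⊠-congˡ (transpose-cong (≋-sym e)))) h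

    preserves-⊠ : {w v : M₂} → Preserves w → Preserves v → Preserves (w ⊠ v)
    preserves-⊠ {w} {v} hw hv = begin
      w ⊠ v ⊠ (J ⊠ transpose (w ⊠ v))                ≈⟨ ⊠-congˡ (⊠-congˡ (transpose-⊠ w v)) ⟩
      w ⊠ v ⊠ (J ⊠ (transpose v ⊠ transpose w))      ≈⟨ ⊠-assoc w v _ ⟩
      w ⊠ (v ⊠ (J ⊠ (transpose v ⊠ transpose w)))    ≈⟨ ⊠-congˡ (⊠-congˡ (⊠-assoc J _ _)) ⟨
      w ⊠ (v ⊠ (J ⊠ transpose v ⊠ transpose w))      ≈⟨ ⊠-congˡ (⊠-assoc v _ _) ⟨
      w ⊠ (v ⊠ (J ⊠ transpose v) ⊠ transpose w)      ≈⟨ ⊠-congˡ (⊠-congʳ hv) ⟩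
      w ⊠ (J ⊠ transpose w)                          ≈⟨ hw ⟩
      J                                              ∎
      where open ≋-Reasoning

    Sp-cong : {w v : M₂} → w ≋ v → Sp w → Sp v
    Sp-cong e (h , h′) = preserves-cong e h , preserves-cong (transpose-cong e) h′

    Sp-⊠ : {w v : M₂} → Sp w → Sp v → Sp (w ⊠ v)
    Sp-⊠ {w} {v} (h , h′) (k , k′) = preserves-⊠ h k , preserves-cong (≋-sym (transpose-⊠ w v)) (preserves-⊠ k′ h′)

    Sp-J : Sp J
    Sp-J = pJ , preserves-cong (≋-sym transpose-J) pJ
      where
      pJ : Preserves J
      pJ = ≋-trans (⊠-congˡ (≋-trans (⊠-congˡ transpose-J) JJ)) (⊠-identityʳ J)

    Sp-transpose : {w : M₂} → Sp w → Sp (transpose w)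
    Sp-transpose (h , h′) = h′ , h

    -- The inverse of a symplectic matrix: w J ᵗw = J and J² = 1 give w · (J ᵗw J) = 1.
    adj : M₂ → M₂
    adj w = J ⊠ (transpose w ⊠ J)

    adj-inverses : {w : M₂} → Sp w → Inverses w (adj w)
    adj-inverses {w} (h , h′) = (begin
        w ⊠ (J ⊠ (transpose w ⊠ J))  ≈⟨ ⊠-congˡ (⊠-assoc J _ J) ⟨
        w ⊠ (J ⊠ transpose w ⊠ J)    ≈⟨ ⊠-assoc w _ J ⟨
        w ⊠ (J ⊠ transpose w) ⊠ J    ≈⟨ ⊠-congʳ h ⟩
        J ⊠ J                        ≈⟨ JJ ⟩
        1M                           ∎) , (begin
        J ⊠ (transpose w ⊠ J) ⊠ w    ≈⟨ ⊠-assoc J _ w ⟩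
        J ⊠ (transpose w ⊠ J ⊠ w)    ≈⟨ ⊠-congˡ (⊠-assoc _ J w) ⟩
        J ⊠ (transpose w ⊠ (J ⊠ w))  ≈⟨ ⊠-congˡ h′ ⟩
        J ⊠ J                        ≈⟨ JJ ⟩
        1M                           ∎)
      where open ≋-Reasoning

    Sp-adj : {w : M₂} → Sp w → Sp (adj w)
    Sp-adj h = Sp-⊠ Sp-J (Sp-⊠ (Sp-transpose h) Sp-J)

    adj-21 : (w : M₂) → π₂₁ w ≋ 0M → π₂₁ (adj w) ≋ 0M
    adj-21 w e = begin
      π₂₁ (J ⊠ (transpose w ⊠ J))                                ≈⟨ proj₁ (J⊠-2 (transpose w ⊠ J)) ⟩
      π₁₁ (transpose w ⊠ J)                                      ≈⟨ ⊠-11 (transpose w) J ⟩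
      transpose (π₁₁ w) ⊠ π₁₁ J ⊞ transpose (π₂₁ w) ⊠ π₂₁ J      ≈⟨ ⊞-0ˡ (⊠-zeroʳ J₁₁) ⟩
      transpose (π₂₁ w) ⊠ π₂₁ J                                  ≈⟨ ⊠-zeroˡ (transpose-cong e) ⟩
      0M                                                         ∎
      where open ≋-Reasoning

    -- P described by equations instead of by its parameters A and B. In this form closure under
    -- products and inverses is immediate and membership is decidable; the agreement with `InP` is
    -- proved below in both directions.
    record Parabolic (w : M₂) : Set where
      constructor parabolic
      field
        sp    : Sp w
        lower : π₂₁ w ≋ 0M

    form-parts : (w : M₂) →
      (π₁₁ (w ⊠ (J ⊠ transpose w)) ≋ π₁₁ w ⊠ transpose (π₁₂ w) ⊞ π₁₂ w ⊠ transpose (π₁₁ w)) ×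
      (π₁₂ (w ⊠ (J ⊠ transpose w)) ≋ π₁₁ w ⊠ transpose (π₂₂ w) ⊞ π₁₂ w ⊠ transpose (π₂₁ w)) ×
      (π₂₁ (w ⊠ (J ⊠ transpose w)) ≋ π₂₁ w ⊠ transpose (π₁₂ w) ⊞ π₂₂ w ⊠ transpose (π₁₁ w)) ×
      (π₂₂ (w ⊠ (J ⊠ transpose w)) ≋ π₂₁ w ⊠ transpose (π₂₂ w) ⊞ π₂₂ w ⊠ transpose (π₂₁ w))
    form-parts w = ≋-trans (⊠-11 w _) (⊞-cong (⊠-congˡ (proj₁ (J⊠-1 (transpose w)))) (⊠-congˡ (proj₁ (J⊠-2 (transpose w)))))
                 , ≋-trans (⊠-12 w _) (⊞-cong (⊠-congˡ (proj₂ (J⊠-1 (transpose w)))) (⊠-congˡ (proj₂ (J⊠-2 (transpose w)))))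
                 , ≋-trans (⊠-21 w _) (⊞-cong (⊠-congˡ (proj₁ (J⊠-1 (transpose w)))) (⊠-congˡ (proj₁ (J⊠-2 (transpose w)))))
                 , ≋-trans (⊠-22 w _) (⊞-cong (⊠-congˡ (proj₂ (J⊠-1 (transpose w)))) (⊠-congˡ (proj₂ (J⊠-2 (transpose w)))))

    -- The two factors in the definition of P multiplied out. Thanks to the default value of `inv`
    -- it is defined for all A, so a count over pairs (A , B) can impose invertibility as an
    -- indicator.
    Levi : Mat n n → Mat n n → M₂
    Levi A B = blk A (A ⊠ B) 0M (transpose (inv A))

    Levi≈ : (A A′ B : Mat n n) → Inverses A A′ → block A 0M 0M (transpose A′) ⊠ block 1M B 0M 1M ≋ Levi A B
    Levi≈ A A′ B h = ≋-trans (⊠-cong (block≈blk A 0M 0M (transpose A′)) (block≈blk 1M B 0M 1M)) (by-parts {n} {n} {n} {n}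
      (≋-trans (⊠-11 M N) (≋-trans (⊞-0ʳ (⊠-zeroʳ (blk-21 1M B 0M 1M))) (≋-trans (⊠-cong (blk-11 A 0M 0M _) (blk-11 1M B 0M 1M)) (≋-trans (⊠-identityʳ A) (≋-sym (blk-11 A (A ⊠ B) 0M _))))))
      (≋-trans (⊠-12 M N) (≋-trans (⊞-0ʳ (⊠-zeroˡ (blk-12 A 0M 0M _))) (≋-trans (⊠-cong (blk-11 A 0M 0M _) (blk-12 1M B 0M 1M)) (≋-sym (blk-12 A (A ⊠ B) 0M _)))))
      (≋-trans (⊠-21 M N) (≋-trans (⊞-0ʳ (⊠-zeroʳ (blk-21 1M B 0M 1M))) (≋-trans (⊠-zeroˡ (blk-21 A 0M 0M _)) (≋-sym (blk-21 A (A ⊠ B) 0M _)))))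
      (≋-trans (⊠-22 M N) (≋-trans (⊞-0ˡ (⊠-zeroˡ (blk-21 A 0M 0M _))) (≋-trans (⊠-cong (blk-22 A 0M 0M _) (blk-22 1M B 0M 1M)) (≋-trans (⊠-identityʳ _)
        (≋-trans (transpose-cong (≋-sym (inv-unique h))) (≋-sym (blk-22 A (A ⊠ B) 0M _))))))))
      where
      M N : M₂
      M = blk A 0M 0M (transpose A′)
      N = blk 1M B 0M 1M

    module _ {A B : Mat n n} where
      private T = transpose (inv A)

      Levi-11 : π₁₁ (Levi A B) ≋ A
      Levi-11 = blk-11 A (A ⊠ B) 0M T
      Levi-12 : π₁₂ (Levi A B) ≋ A ⊠ B
      Levi-12 = blk-12 A (A ⊠ B) 0M T
      Levi-21 : π₂₁ (Levi A B) ≋ 0M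
      Levi-21 = blk-21 A (A ⊠ B) 0M T
      Levi-22 : π₂₂ (Levi A B) ≋ T
      Levi-22 = blk-22 A (A ⊠ B) 0M T

    Symmetric : Mat n n → Set
    Symmetric B = B ≋ transpose B

    Levi-parabolic : {A B : Mat n n} → Inv A → Symmetric B → Parabolic (Levi A B)
    Levi-parabolic {A} {B} ia sB = parabolic (pw , pw′) Levi-21
      where
      w = Levi A B
      i = inv-inverses ia
      pw : Preserves w
      pw = by-parts {n} {n} {n} {n}
        (≋-trans (proj₁ (form-parts w)) (≋-trans (⊞-self ABA) (≋-sym J₁₁)))
        (≋-trans (proj₁ (proj₂ (form-parts w))) (≋-trans (⊞-0ʳ (⊠-zeroʳ (transpose-cong Levi-21))) (≋-trans (⊠-cong Levi-11 (transpose-cong Levi-22)) (≋-trans (proj₁ i) (≋-sym J₁₂)))))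
        (≋-trans (proj₁ (proj₂ (proj₂ (form-parts w)))) (≋-trans (⊞-0ˡ (⊠-zeroˡ Levi-21)) (≋-trans (⊠-cong Levi-22 (transpose-cong Levi-11))
          (≋-trans (proj₂ (Inverses-transpose i)) (≋-sym J₂₁)))))
        (≋-trans (proj₂ (proj₂ (proj₂ (form-parts w)))) (≋-trans (⊞-0ˡ (⊠-zeroˡ Levi-21)) (≋-trans (⊠-zeroʳ (transpose-cong Levi-21)) (≋-sym J₂₂))))
        where
        ABA : π₁₁ w ⊠ transpose (π₁₂ w) ≋ π₁₂ w ⊠ transpose (π₁₁ w)
        ABA = begin
          π₁₁ w ⊠ transpose (π₁₂ w)          ≈⟨ ⊠-cong Levi-11 (≋-trans (transpose-cong Levi-12) (transpose-⊠ A B)) ⟩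
          A ⊠ (transpose B ⊠ transpose A)    ≈⟨ ⊠-assoc A _ _ ⟨
          A ⊠ transpose B ⊠ transpose A      ≈⟨ ⊠-congʳ (⊠-congˡ sB) ⟨
          A ⊠ B ⊠ transpose A                ≈⟨ ⊠-cong Levi-12 (transpose-cong Levi-11) ⟨
          π₁₂ w ⊠ transpose (π₁₁ w)          ∎
          where open ≋-Reasoning
      pw′ : Preserves (transpose w)
      pw′ = by-parts {n} {n} {n} {n}
        (≋-trans (proj₁ (form-parts (transpose w))) (≋-trans (≋-trans (⊞-0ˡ (⊠-zeroʳ Levi-21)) (⊠-zeroˡ (transpose-cong Levi-21))) (≋-sym J₁₁)))
        (≋-trans (proj₁ (proj₂ (form-parts (transpose w)))) (≋-trans (⊞-0ʳ (⊠-zeroˡ (transpose-cong Levi-21))) (≋-trans (⊠-cong (transpose-cong Levi-11) Levi-22)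
          (≋-trans (proj₁ (Inverses-transpose i)) (≋-sym J₁₂)))))
        (≋-trans (proj₁ (proj₂ (proj₂ (form-parts (transpose w))))) (≋-trans (⊞-0ˡ (⊠-zeroʳ Levi-21)) (≋-trans (⊠-cong (transpose-cong Levi-22) Levi-11)
          (≋-trans (proj₂ i) (≋-sym J₂₁)))))
        (≋-trans (proj₂ (proj₂ (proj₂ (form-parts (transpose w))))) (≋-trans (⊞-self TAB) (≋-sym J₂₂)))
        where
        half : inv A ⊠ (A ⊠ B) ≋ B
        half = ≋-trans (≋-sym (⊠-assoc _ A B)) (≋-trans (⊠-congʳ (proj₂ i)) (⊠-identityˡ B))
        TAB : transpose (π₁₂ w) ⊠ π₂₂ w ≋ transpose (π₂₂ w) ⊠ π₁₂ w
        TAB = begin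
          transpose (π₁₂ w) ⊠ π₂₂ w                        ≈⟨ transpose-⊠ (transpose (π₂₂ w)) (π₁₂ w) ⟨
          transpose (transpose (π₂₂ w) ⊠ π₁₂ w)            ≈⟨ transpose-cong (⊠-cong (transpose-cong Levi-22) Levi-12) ⟩
          transpose (inv A ⊠ (A ⊠ B))                      ≈⟨ transpose-cong half ⟩
          transpose B                                      ≈⟨ sB ⟨
          B                                                ≈⟨ half ⟨
          inv A ⊠ (A ⊠ B)                                  ≈⟨ ⊠-cong (transpose-cong Levi-22) Levi-12 ⟨
          transpose (π₂₂ w) ⊠ π₁₂ w                        ∎
          where open ≋-Reasoning

    module _ {w : M₂} (pw : Parabolic w) where
      open Parabolic pw
      private
        A B : Mat n n
        A = π₁₁ w
        B = transpose (π₂₂ w) ⊠ π₁₂ w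

      parabolic-inverses : Inverses A (transpose (π₂₂ w))
      parabolic-inverses =
        ≋-trans (≋-sym (⊞-0ʳ (⊠-zeroʳ (transpose-cong lower)))) (≋-trans (≋-sym (proj₁ (proj₂ (form-parts w)))) (≋-trans (p₁₂-cong (proj₁ sp)) J₁₂)) ,
        ≋-trans (≋-sym (⊞-0ˡ (⊠-zeroʳ lower))) (≋-trans (≋-sym (proj₁ (proj₂ (proj₂ (form-parts (transpose w)))))) (≋-trans (p₂₁-cong (proj₂ sp)) J₂₁))

      parabolic-symmetric : Symmetric B
      parabolic-symmetric = ≋-trans (≋-sym (⊞-≈0 (≋-trans (≋-sym (proj₂ (proj₂ (proj₂ (form-parts (transpose w)))))) (≋-trans (p₂₂-cong (proj₂ sp)) J₂₂))))
        (≋-sym (transpose-⊠ (transpose (π₂₂ w)) (π₁₂ w)))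

      parabolic-Levi : w ≋ Levi A B
      parabolic-Levi = by-parts {n} {n} {n} {n} (≋-sym Levi-11)
        (≋-trans (≋-trans (≋-sym (⊠-identityˡ _)) (≋-trans (⊠-congʳ (≋-sym (proj₁ parabolic-inverses))) (⊠-assoc A _ _))) (≋-sym Levi-12))
        (≋-trans lower (≋-sym Levi-21))
        (≋-trans (transpose-cong (≋-sym (inv-unique parabolic-inverses))) (≋-sym Levi-22))

    parabolic-cong : {w v : M₂} → w ≋ v → Parabolic w → Parabolic v
    parabolic-cong e (parabolic s l) = parabolic (Sp-cong e s) (≋-trans (p₂₁-cong (≋-sym e)) l)

    InP⇒parabolic : {w : M₂} → InP n w → Parabolic w
    InP⇒parabolic (A , A′ , B , h , h′ , sB , e) = parabolic-cong
        (≋-sym (≋-trans (≋-intro e) (≋-trans (≋-sym (⊠≋⊠′ (block A 0M 0M (transpose A′)) (block 1M B 0M 1M))) (Levi≈ A A′ B i))))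
        (Levi-parabolic (A′ , i) (≋-intro sB))
      where
      i : Inverses A A′
      i = ≋-trans (⊠≋⊠′ A A′) (≋-intro h) , ≋-trans (⊠≋⊠′ A′ A) (≋-intro h′)

    parabolic⇒InP : {w : M₂} → Parabolic w → InP n w
    parabolic⇒InP {w} pw = A , A′ , B
      , at (≋-trans (≋-sym (⊠≋⊠′ A A′)) (proj₁ i)) , at (≋-trans (≋-sym (⊠≋⊠′ A′ A)) (proj₂ i)) , at (parabolic-symmetric pw)
      , at (≋-trans (parabolic-Levi pw) (≋-trans (≋-sym (Levi≈ A A′ B i)) (⊠≋⊠′ (block A 0M 0M (transpose A′)) (block 1M B 0M 1M))))
      where
      A  = π₁₁ w
      A′ = transpose (π₂₂ w)
      B  = transpose (π₂₂ w) ⊠ π₁₂ w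
      i : Inverses A A′
      i = parabolic-inverses pw

    parabolic-⊠ : {w v : M₂} → Parabolic w → Parabolic v → Parabolic (w ⊠ v)
    parabolic-⊠ {w} {v} (parabolic s l) (parabolic s′ l′) = parabolic (Sp-⊠ s s′)
      (≋-trans (⊠-21 w v) (≋-trans (⊞-0ˡ (⊠-zeroˡ l)) (⊠-zeroʳ l′)))

    parabolic-adj : {w : M₂} → Parabolic w → Parabolic (adj w)
    parabolic-adj {w} (parabolic s l) = parabolic (Sp-adj s) (adj-21 w l)

    parabolic? : (w : M₂) → Dec (Parabolic w)
    parabolic? w = Dec.map′ (λ ((h , h′) , l) → parabolic (h , h′) l) (λ (parabolic s l) → s , l)
      ((((w ⊠ (J ⊠ transpose w)) ≋? J) ×-dec ((transpose w ⊠ (J ⊠ w)) ≋? J)) ×-dec (π₂₁ w ≋? 0M))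

-- Block triangular matrices and the order of GL(n,q)

module MatrixCounts {r : ℕ} (F : BinaryField r) where
  open FieldFacts F hiding (_⊠_) renaming (_≈M_ to infix 4 _≈M_)
  open Matrices F

  private variable
    m n k l a b c d : ℕ

  size-𝕄 : ∀ m k → FiniteSetoid.size (𝕄 m k) ≡ (q ^ k) ^ m
  size-𝕄 m k = trans (size-Fun m (Fun k 𝔽)) (cong (_^ m) (trans (size-Fun k 𝔽) (cong (_^ k) size-𝔽)))

  ⊤? : Dec ⊤
  ⊤? = yes tt

  0M? : (X : Mat m k) → Dec (X ≋ 0M)
  0M? X = X ≋? 0M

  module Triangular (a b : ℕ) where

    N : Set
    N = Mat (a + b) (a + b)

    q₁₁ : N → Mat a a
    q₁₁ = p₁₁ {a} {b} {a} {b}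
    q₁₂ : N → Mat a b
    q₁₂ = p₁₂ {a} {b} {a} {b}
    q₂₁ : N → Mat b a
    q₂₁ = p₂₁ {a} {b} {a} {b}
    q₂₂ : N → Mat b b
    q₂₂ = p₂₂ {a} {b} {a} {b}

    -- The vanishing of both upper right blocks makes the diagonal blocks of A and of its inverse
    -- mutually inverse by block multiplication. Conversely any two invertible diagonal blocks and
    -- any lower left block give such an A, so every count over `LT` is a product with a power of q
    -- for the free block.
    LT : N → Set
    LT A = Inv A × (q₁₂ A ≋ 0M) × (q₁₂ (inv A) ≋ 0M)

    LT? : (A : N) → Dec (LT A)
    LT? A = Inv? A ×-dec (0M? (q₁₂ A) ×-dec 0M? (q₁₂ (inv A)))

    module _ {A A′ : N} (i : Inverses A A′) (z : q₁₂ A ≋ 0M) (z′ : q₁₂ A′ ≋ 0M) where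
      private
        corner₁₁ : {X Y : N} → X ⊠ Y ≋ 1M → q₁₂ X ≋ 0M → q₁₁ X ⊠ q₁₁ Y ≋ 1M
        corner₁₁ {X} {Y} h e = ≋-trans (≋-sym (⊞-0ʳ (⊠-zeroˡ e))) (≋-trans (≋-sym (⊠-11 X Y)) (≋-trans (p₁₁-cong h) (1M-11 {a} {b})))
        corner₂₂ : {X Y : N} → X ⊠ Y ≋ 1M → q₁₂ Y ≋ 0M → q₂₂ X ⊠ q₂₂ Y ≋ 1M
        corner₂₂ {X} {Y} h e = ≋-trans (≋-sym (⊞-0ˡ (⊠-zeroʳ e))) (≋-trans (≋-sym (⊠-22 X Y)) (≋-trans (p₂₂-cong h) (1M-22 {a} {b})))

      inverses-11 : Inverses (q₁₁ A) (q₁₁ A′)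
      inverses-11 = corner₁₁ (proj₁ i) z , corner₁₁ (proj₂ i) z′

      inverses-22 : Inverses (q₂₂ A) (q₂₂ A′)
      inverses-22 = corner₂₂ (proj₁ i) z′ , corner₂₂ (proj₂ i) z

    tri : Mat a a → Mat b a → Mat b b → N
    tri Y Z D = blk Y 0M Z D

    module _ {Y : Mat a a} {Z : Mat b a} {D : Mat b b} where
      tri-11 : q₁₁ (tri Y Z D) ≋ Y
      tri-11 = blk-11 Y 0M Z D
      tri-12 : q₁₂ (tri Y Z D) ≋ 0M
      tri-12 = blk-12 Y 0M Z D
      tri-21 : q₂₁ (tri Y Z D) ≋ Z
      tri-21 = blk-21 Y 0M Z D
      tri-22 : q₂₂ (tri Y Z D) ≋ D
      tri-22 = blk-22 Y 0M Z D

    tri-⊠ : ∀ Y Z D Y′ Z′ D′ → tri Y Z D ⊠ tri Y′ Z′ D′ ≋ tri (Y ⊠ Y′) (Z ⊠ Y′ ⊞ D ⊠ Z′) (D ⊠ D′)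
    tri-⊠ Y Z D Y′ Z′ D′ = by-parts {a} {b} {a} {b}
      (≋-trans (⊠-11 M M′) (≋-trans (⊞-0ʳ (⊠-zeroˡ tri-12)) (≋-trans (⊠-cong tri-11 tri-11) (≋-sym tri-11))))
      (≋-trans (⊠-12 M M′) (≋-trans (⊞-0ˡ (⊠-zeroʳ tri-12)) (≋-trans (⊠-zeroˡ tri-12) (≋-sym tri-12))))
      (≋-trans (⊠-21 M M′) (≋-trans (⊞-cong (⊠-cong tri-21 tri-11) (⊠-cong tri-22 tri-21)) (≋-sym tri-21)))
      (≋-trans (⊠-22 M M′) (≋-trans (⊞-0ˡ (⊠-zeroʳ tri-12)) (≋-trans (⊠-cong tri-22 tri-22) (≋-sym tri-22))))
      where
      M M′ : N
      M = tri Y Z D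
      M′ = tri Y′ Z′ D′

    tri-1 : ∀ {Y Z D} → Y ≋ 1M → Z ≋ 0M → D ≋ 1M → tri Y Z D ≋ 1M
    tri-1 e e′ e″ = by-parts {a} {b} {a} {b} (≋-trans tri-11 (≋-trans e (≋-sym (1M-11 {a} {b})))) (≋-trans tri-12 (≋-sym (1M-12 {a} {b})))
      (≋-trans tri-21 (≋-trans e′ (≋-sym (1M-21 {a} {b})))) (≋-trans tri-22 (≋-trans e″ (≋-sym (1M-22 {a} {b}))))

    tri-inverses : ∀ {Y Y′ D D′} Z → Inverses Y Y′ → Inverses D D′ → Inverses (tri Y Z D) (tri Y′ (D′ ⊠ Z ⊠ Y′) D′)
    tri-inverses {Y} {Y′} {D} {D′} Z (h , h′) (k , k′) =
      ≋-trans (tri-⊠ Y Z D Y′ _ D′) (tri-1 h (⊞-self (≋-sym (≋-trans (⊠-congˡ (⊠-assoc D′ Z Y′)) (≋-trans (≋-sym (⊠-assoc D D′ _)) (≋-trans (⊠-congʳ k) (⊠-identityˡ _)))))) k) ,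
      ≋-trans (tri-⊠ Y′ _ D′ Y Z D) (tri-1 h′ (⊞-self (≋-trans (⊠-assoc _ Y′ Y) (≋-trans (⊠-congˡ h′) (⊠-identityʳ _)))) k′)

    inv-tri-12 : ∀ {Y Z D} → Inv Y → Inv D → q₁₂ (inv (tri Y Z D)) ≋ 0M
    inv-tri-12 (_ , i) (_ , j) = ≋-trans (p₁₂-cong (inv-unique (tri-inverses _ i j))) tri-12

    LT-tri : ∀ {Y D} Z → Inv Y → Inv D → LT (tri Y Z D)
    LT-tri Z (_ , i) (_ , j) = (_ , tri-inverses Z i j) , tri-12 , inv-tri-12 (_ , i) (_ , j)

    #-LT : {R₁ : Mat a a → Set} {R₂ : Mat b b → Set} (R₁? : ∀ Y → Dec (R₁ Y)) (R₂? : ∀ D → Dec (R₂ D)) →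
      (∀ {Y Y′} → Y ≋ Y′ → R₁ Y → R₁ Y′) → (∀ {D D′} → D ≋ D′ → Inv D → R₂ D → R₂ D′) →
      # (𝕄 (a + b) (a + b)) (λ A → LT? A ×-dec (R₁? (q₁₁ A) ×-dec R₂? (q₂₂ A)))
        ≡ # (𝕄 a a) (λ Y → Inv? Y ×-dec R₁? Y) * ((q ^ a) ^ b * # (𝕄 b b) (λ D → Inv? D ×-dec R₂? D))
    #-LT {R₁} {R₂} R₁? R₂? resp₁ resp₂ = begin
      # (𝕄 (a + b) (a + b)) (λ A → LT? A ×-dec (R₁? (q₁₁ A) ×-dec R₂? (q₂₂ A)))
        ≡⟨ #-bij (𝕄 (a + b) (a + b)) (𝕄 a a ×ˢ 𝕄 b a ×ˢ 𝕄 b b) (λ A → LT? A ×-dec (R₁? (q₁₁ A) ×-dec R₂? (q₂₂ A)))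
             (λ (Y , Z , D) → (Inv? Y ×-dec R₁? Y) ×-dec (⊤? ×-dec (Inv? D ×-dec R₂? D)))
             (λ A → q₁₁ A , q₂₁ A , q₂₂ A) (λ (Y , Z , D) → tri Y Z D) to from ⟩
      # (𝕄 a a ×ˢ 𝕄 b a ×ˢ 𝕄 b b) (λ (Y , Z , D) → (Inv? Y ×-dec R₁? Y) ×-dec (⊤? ×-dec (Inv? D ×-dec R₂? D)))
        ≡⟨ #-×ˢ (𝕄 a a) (𝕄 b a ×ˢ 𝕄 b b) (λ Y → Inv? Y ×-dec R₁? Y) (λ (Z , D) → ⊤? ×-dec (Inv? D ×-dec R₂? D)) ⟩
      # (𝕄 a a) (λ Y → Inv? Y ×-dec R₁? Y) * # (𝕄 b a ×ˢ 𝕄 b b) (λ (Z , D) → ⊤? ×-dec (Inv? D ×-dec R₂? D))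
        ≡⟨ cong (# (𝕄 a a) (λ Y → Inv? Y ×-dec R₁? Y) *_) (trans (#-×ˢ (𝕄 b a) (𝕄 b b) {W = λ D → Inv D × R₂ D} (λ _ → ⊤?) (λ D → Inv? D ×-dec R₂? D))
             (cong (_* # (𝕄 b b) (λ D → Inv? D ×-dec R₂? D)) (size-𝕄 b a))) ⟩
      # (𝕄 a a) (λ Y → Inv? Y ×-dec R₁? Y) * ((q ^ a) ^ b * # (𝕄 b b) (λ D → Inv? D ×-dec R₂? D)) ∎
      where
      open ≡-Reasoning
      to : ∀ A ((Y , Z , D) : Mat a a × Mat b a × Mat b b) → LT A × (R₁ (q₁₁ A) × R₂ (q₂₂ A)) → q₁₁ A ≋ Y × q₂₁ A ≋ Z × q₂₂ A ≋ D →
           ((Inv Y × R₁ Y) × (⊤ × (Inv D × R₂ D))) × tri Y Z D ≋ A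
      to A (Y , Z , D) ((iA , z , z′) , r₁ , r₂) (e₁ , e₂ , e₃) =
        ((Inv-resp e₁ (_ , i₁) , resp₁ e₁ r₁) , (_ , (Inv-resp e₃ (_ , i₂) , resp₂ e₃ (_ , i₂) r₂))) ,
        by-parts {a} {b} {a} {b} (≋-trans tri-11 (≋-sym e₁)) (≋-trans tri-12 (≋-sym z)) (≋-trans tri-21 (≋-sym e₂)) (≋-trans tri-22 (≋-sym e₃))
        where
        i₁ = inverses-11 (inv-inverses iA) z z′
        i₂ = inverses-22 (inv-inverses iA) z z′
      from : ∀ A ((Y , Z , D) : Mat a a × Mat b a × Mat b b) → (Inv Y × R₁ Y) × (⊤ × (Inv D × R₂ D)) → tri Y Z D ≋ A →
             (LT A × (R₁ (q₁₁ A) × R₂ (q₂₂ A))) × (q₁₁ A ≋ Y × q₂₁ A ≋ Z × q₂₂ A ≋ D)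
      from A (Y , Z , D) ((iY , r₁) , (_ , (iD , r₂))) e =
        ((Inv-resp e (proj₁ lt) , ≋-trans (p₁₂-cong (≋-sym e)) tri-12 , ≋-trans (p₁₂-cong (≋-sym (inv-cong (proj₁ lt) e))) (proj₂ (proj₂ lt)))
          , resp₁ (≋-sym e₁) r₁ , resp₂ (≋-sym e₃) iD r₂) , (e₁ , ≋-trans (p₂₁-cong (≋-sym e)) tri-21 , e₃)
        where
        lt = LT-tri Z iY iD
        e₁ : q₁₁ A ≋ Y
        e₁ = ≋-trans (p₁₁-cong (≋-sym e)) tri-11
        e₃ : q₂₂ A ≋ D
        e₃ = ≋-trans (p₂₂-cong (≋-sym e)) tri-22

  inverseTrace? : ∀ β (D : Mat m m) → Dec (Inv D × Tr D +F Tr (inv D) ≡ β)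
  inverseTrace? β D = Inv? D ×-dec ((Tr D +F Tr (inv D)) ≟F β)

  GL : ℕ → ℕ
  GL n = # (𝕄 n n) Inv?

  row₀ : Mat (suc m) k → Mat 1 k
  row₀ A _ j = A zero j

  row₀-cong : {A B : Mat (suc m) k} → A ≋ B → row₀ A ≋ row₀ B
  row₀-cong e = ≋-intro λ _ j → at e zero j

  opaque
    unfolding _⊠_
    row₀-⊠ : (A : Mat (suc m) k) (B : Mat k l) → row₀ (A ⊠ B) ≋ row₀ A ⊠ B
    row₀-⊠ A B = ≋-refl

    ⊠-1×1 : (X : Mat 1 1) (Y : Mat 1 1) → (X ⊠ Y) zero zero ≡ X zero zero *F Y zero zero
    ⊠-1×1 X Y = +-identityʳ _

  1×1 : {X Y : Mat 1 1} → X zero zero ≡ Y zero zero → X ≋ Y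
  1×1 e = ≋-intro λ { zero zero → e }

  Inv-1×1 : {X : Mat 1 1} → X zero zero ≢ 0F → Inverses X (λ _ _ → X zero zero ⁻¹)
  Inv-1×1 {X} x≢0 = 1×1 (trans (⊠-1×1 X _) (inverse _ x≢0)) , 1×1 (trans (⊠-1×1 _ X) (⁻¹-inverseˡ _ x≢0))

  Inv-1×1⁻ : {X : Mat 1 1} → Inv X → X zero zero ≢ 0F
  Inv-1×1⁻ {X} (X′ , h , _) e = 1≢0 (trans (sym (at h zero zero)) (trans (⊠-1×1 X X′) (trans (cong (_*F X′ zero zero) e) (zeroˡ _))))

  with-pivot : (v : Mat 1 (suc n)) → v zero zero ≢ 0F → ∃ λ G → Inv G × row₀ G ≋ v
  with-pivot {n} v v₀≢0 = transpose M , (_ , Inverses-transpose (tri-inverses {D = 1M} {D′ = 1M} Z (Inv-1×1 {X} v₀≢0) (⊠-identityˡ 1M , ⊠-identityˡ 1M))) , ≋-intro (λ { zero j → row j })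
    where
    open Triangular 1 n
    X : Mat 1 1
    X _ _ = v zero zero
    Z : Mat n 1
    Z j _ = v zero (suc j)
    M : Mat (1 + n) (1 + n)
    M = tri X Z 1M
    row : ∀ j → M j zero ≡ v zero j
    row zero    = at (tri-11 {X} {Z} {1M}) zero zero
    row (suc j) = at (tri-21 {X} {Z} {1M}) j zero

  -- If the first coordinate vanishes, first add another one to it.
  transitive : (v : Mat 1 (suc n)) → ¬ (v ≋ 0M) → ∃ λ G → Inv G × row₀ G ≋ v
  transitive {n} v v≢0 with Fin.any? (λ i → ¬? (v zero i ≟F 0F))
  ... | no ¬h = ⊥-elim (v≢0 (≋-intro λ { zero j → Dec.decidable-stable (v zero j ≟F 0F) (λ vj≢0 → ¬h (j , vj≢0)) }))
  ... | yes (zero , h) = with-pivot v h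
  ... | yes (suc i , h) with v zero zero ≟F 0F
  ...   | no v₀≢0 = with-pivot v v₀≢0
  ...   | yes v₀≡0 = G₀ ⊠ T , Inv-⊠ i₀ (T , TT , TT) , (begin
      row₀ (G₀ ⊠ T)  ≈⟨ row₀-⊠ G₀ T ⟩
      row₀ G₀ ⊠ T    ≈⟨ ⊠-congʳ e₀ ⟩
      v ⊠ T ⊠ T      ≈⟨ ⊠-assoc v T T ⟩
      v ⊠ (T ⊠ T)    ≈⟨ ⊠-congˡ TT ⟩
      v ⊠ 1M         ≈⟨ ⊠-identityʳ v ⟩
      v              ∎)
    where
    open ≋-Reasoning
    -- Right multiplication by T adds coordinate i + 1 to coordinate 0, so v T begins with the
    -- nonzero entry h. Since E² = 0 in characteristic 2, T is its own inverse and carries the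
    -- result back to v.
    E T : Mat (suc n) (suc n)
    E j k = 1M j (suc i) *F 1M k zero
    T = 1M ⊞ E
    opaque
      unfolding _⊠_
      EE : E ⊠ E ≋ 0M
      EE = ≋-intro λ j k → ∑-zero′ {suc n} {λ t → E j t *F E t k} λ
        { zero    → trans (cong (E j zero *F_) (trans (cong (_*F 1M k zero) (1M-off {i = zero} {suc i} λ ())) (zeroˡ _))) (zeroʳ _)
        ; (suc t) → trans (cong (_*F E (suc t) k) (trans (cong (1M j (suc i) *F_) (1M-off {i = suc t} {zero} λ ())) (zeroʳ _))) (zeroˡ _) }
      vE : (v ⊠ E) zero zero ≡ v zero (suc i)
      vE = trans (∑-single (λ t → v zero t *F E t zero) (suc i) (λ t t≢i → trans (cong (v zero t *F_) (trans (cong (_*F 1M {suc n} zero zero) (1M-off t≢i)) (zeroˡ _))) (zeroʳ _)))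
        (trans (cong (v zero (suc i) *F_) (trans (cong₂ _*F_ (1M-diag (suc i)) (1M-diag {suc n} zero)) (*-identityˡ _))) (*-identityʳ _))
    TT : T ⊠ T ≋ 1M
    TT = begin
      (1M ⊞ E) ⊠ T               ≈⟨ ⊠-distribʳ 1M E T ⟩
      1M ⊠ T ⊞ E ⊠ T             ≈⟨ ⊞-cong (⊠-identityˡ T) (≋-trans (⊠-distribˡ E 1M E) (≋-trans (⊞-0ʳ EE) (⊠-identityʳ E))) ⟩
      1M ⊞ E ⊞ E                 ≈⟨ ≋-intro (λ j k → trans (+-assoc _ _ _) (trans (cong (1M j k +F_) (double _)) (+-identityʳ _))) ⟩
      1M                         ∎
    pivot : (v ⊠ T) zero zero ≢ 0F
    pivot e = h (trans (sym vE) (trans (sym (trans (cong (_+F (v ⊠ E) zero zero) (trans (at (⊠-identityʳ v) zero zero) v₀≡0)) (+-identityˡ _)))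
      (trans (sym (at (⊠-distribˡ v 1M E) zero zero)) e)))
    g₀ = with-pivot (v ⊠ T) pivot
    G₀ = proj₁ g₀
    i₀ = proj₁ (proj₂ g₀)
    e₀ = proj₂ (proj₂ g₀)

  #-≢0 : ∀ k → suc (# (𝕄 1 k) (λ v → ¬? (0M? v))) ≡ q ^ k
  #-≢0 k = trans (cong (_+ # (𝕄 1 k) (λ v → ¬? (0M? v))) (sym (FiniteSetoid.once (𝕄 1 k) 0M)))
    (trans (#-¬ (𝕄 1 k) 0M?) (trans (size-𝕄 1 k) (ℕ.*-identityʳ _)))

  -- Used for the first row of an invertible matrix and for the top row of an invertible alternating
  -- one. In both cases a group acting transitively on nonzero rows makes every fibre as large as
  -- the one over the first unit vector.
  orbit-count : (S : FiniteSetoid) (let open FiniteSetoid S using () renaming (Carrier to X)) (k : ℕ) {P : X → Set} (P? : ∀ x → Dec (P x))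
    (φ : X → Mat 1 k) (c : ℕ) → (∀ x → P x → ¬ (φ x ≋ 0M)) →
    (∀ v → ¬ (v ≋ 0M) → # S (λ x → P? x ×-dec (φ x ≋? v)) ≡ c) →
    # S P? ≡ # (𝕄 1 k) (λ v → ¬? (0M? v)) * c
  orbit-count S k P? φ c nonzero fibre = begin
    # S P?                                                                ≡⟨ fibres (𝕄 1 k) (FiniteSetoid.elems S) φ _ ⟩
    ∑ₗ 𝕍 (λ v → ∑ₗ 𝕊 (λ x → 𝟙 (φ x ≋? v) * 𝟙 (P? x)))                     ≡⟨ ∑-cong 𝕍 (λ v → trans (∑-cong 𝕊 λ x → trans (ℕ.*-comm (𝟙 (φ x ≋? v)) _) (sym (𝟙-× (P? x) (φ x ≋? v)))) (go v (0M? v))) ⟩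
    ∑ₗ 𝕍 (λ v → 𝟙 (¬? (0M? v)) * c)                                       ≡⟨ ∑-*ʳ 𝕍 c _ ⟩
    # (𝕄 1 k) (λ v → ¬? (0M? v)) * c                                      ∎
    where
    open ≡-Reasoning
    𝕍 = FiniteSetoid.elems (𝕄 1 k)
    𝕊 = FiniteSetoid.elems S
    go : ∀ v → Dec (v ≋ 0M) → # S (λ x → P? x ×-dec (φ x ≋? v)) ≡ 𝟙 (¬? (0M? v)) * c
    go v (yes v≈0) = trans (trans (∑-cong 𝕊 λ x → 𝟙-no (P? x ×-dec (φ x ≋? v)) (λ (p , e) → nonzero x p (≋-trans e v≈0))) (∑-zero 𝕊))
      (sym (cong (_* c) (𝟙-no (¬? (0M? v)) (λ n → n v≈0))))
    go v (no v≢0) = trans (fibre v v≢0) (sym (trans (cong (_* c) (𝟙-yes (¬? (0M? v)) v≢0)) (ℕ.*-identityˡ c)))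

  module _ (n : ℕ) where
    open Triangular 1 n

    private
      fixed? : (A : Mat (suc n) (suc n)) → Dec (Inv A × row₀ A ≋ row₀ 1M)
      fixed? A = Inv? A ×-dec (row₀ A ≋? row₀ 1M)

    #-fixed : # (𝕄 (suc n) (suc n)) fixed? ≡ q ^ n * GL n
    #-fixed = trans (#-cong (𝕄 (suc n) (suc n)) fixed? (λ A → LT? A ×-dec ((q₁₁ A ≋? 1M) ×-dec ⊤?)) to from)
      (trans (#-LT {R₁ = _≋ 1M} {R₂ = λ _ → ⊤} (_≋? 1M) (λ _ → ⊤?) (λ e h → ≋-trans (≋-sym e) h) (λ _ _ _ → _))
        (trans (cong₂ _*_ one (cong₂ _*_ (cong (_^ n) (ℕ.*-identityʳ q)) (#-cong (𝕄 n n) (λ D → Inv? D ×-dec ⊤?) Inv? (λ _ → proj₁) (λ _ i → i , _)))) (ℕ.*-identityˡ _)))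
      where
      one : # (𝕄 1 1) (λ Y → Inv? Y ×-dec (Y ≋? 1M)) ≡ 1
      one = trans (#-cong (𝕄 1 1) (λ Y → Inv? Y ×-dec (Y ≋? 1M)) (_≋? 1M) (λ _ → proj₂)
        (λ Y e → Inv-resp (≋-sym e) (1M , ⊠-identityˡ 1M , ⊠-identityˡ 1M) , e)) (FiniteSetoid.once (𝕄 1 1) 1M)
      to : ∀ A → Inv A × row₀ A ≋ row₀ 1M → LT A × (q₁₁ A ≋ 1M × ⊤)
      to A (iA , e) = (iA , ≋-intro (λ { zero j → trans (at e zero (suc j)) (1M-off {i = zero} {suc j} λ ()) }) , ≋-intro (λ { zero j → trans (at e′ zero (suc j)) (1M-off {i = zero} {suc j} λ ()) }))
        , 1×1 (trans (at e zero zero) (trans (1M-diag {suc n} zero) (sym (1M-diag {1} zero)))) , _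
        where
        e′ : row₀ (inv A) ≋ row₀ 1M
        e′ = begin
          row₀ (inv A)           ≈⟨ row₀-cong (⊠-identityˡ (inv A)) ⟨
          row₀ (1M ⊠ inv A)      ≈⟨ row₀-⊠ 1M (inv A) ⟩
          row₀ 1M ⊠ inv A        ≈⟨ ⊠-congʳ e ⟨
          row₀ A ⊠ inv A         ≈⟨ row₀-⊠ A (inv A) ⟨
          row₀ (A ⊠ inv A)       ≈⟨ row₀-cong (proj₁ (inv-inverses iA)) ⟩
          row₀ 1M                ∎
          where open ≋-Reasoning
      from : ∀ A → LT A × (q₁₁ A ≋ 1M × ⊤) → Inv A × row₀ A ≋ row₀ 1M
      from A ((iA , z , _) , e , _) = iA , ≋-intro λ
        { zero zero    → trans (at e zero zero) (trans (1M-diag {1} zero) (sym (1M-diag {suc n} zero)))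
        ; zero (suc j) → trans (at z zero j) (sym (1M-off {i = zero} {suc j} λ ())) }

    -- If G has first row v, right multiplication by G⁻¹ carries the matrices with first row v to
    -- those with first row (1 , 0 , ...). The latter are block lower triangular with corner 1, with
    -- a free column and a free element of GL(n,q).
    GL-suc : GL (suc n) ≡ # (𝕄 1 (suc n)) (λ v → ¬? (0M? v)) * (q ^ n * GL n)
    GL-suc = orbit-count (𝕄 (suc n) (suc n)) (suc n) Inv? row₀ (q ^ n * GL n) nonzero fibre
      where
      nonzero : ∀ A → Inv A → ¬ (row₀ A ≋ 0M)
      nonzero A (A′ , h , _) e = 1≢0 (trans (sym (1M-diag {suc n} zero)) (trans (sym (at h zero zero))
        (trans (at (row₀-⊠ A A′) zero zero) (at (⊠-zeroˡ {Y = A′} e) zero zero))))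
      fibre : ∀ v → ¬ (v ≋ 0M) → # (𝕄 (suc n) (suc n)) (λ A → Inv? A ×-dec (row₀ A ≋? v)) ≡ q ^ n * GL n
      fibre v v≢0 with transitive v v≢0
      ... | G , (G′ , i) , e = trans (#-bij (𝕄 (suc n) (suc n)) (𝕄 (suc n) (suc n)) (λ A → Inv? A ×-dec (row₀ A ≋? v)) fixed? (_⊠ G′) (_⊠ G) to from) #-fixed
        where
        undo : (A : Mat (suc n) (suc n)) {X Y : Mat (suc n) (suc n)} → X ⊠ Y ≋ 1M → A ⊠ X ⊠ Y ≋ A
        undo A {X} {Y} h = ≋-trans (⊠-assoc A X Y) (≋-trans (⊠-congˡ h) (⊠-identityʳ A))
        to : ∀ A X → Inv A × row₀ A ≋ v → A ⊠ G′ ≋ X → (Inv X × row₀ X ≋ row₀ 1M) × X ⊠ G ≋ A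
        to A X (iA , r) x = (Inv-resp x (Inv-⊠ iA (G , Inverses-swap i)) , (begin
            row₀ X            ≈⟨ row₀-cong x ⟨
            row₀ (A ⊠ G′)     ≈⟨ row₀-⊠ A G′ ⟩
            row₀ A ⊠ G′       ≈⟨ ⊠-congʳ (≋-trans r (≋-sym e)) ⟩
            row₀ G ⊠ G′       ≈⟨ row₀-⊠ G G′ ⟨
            row₀ (G ⊠ G′)     ≈⟨ row₀-cong (proj₁ i) ⟩
            row₀ 1M           ∎)) , ≋-trans (⊠-congʳ (≋-sym x)) (undo A (proj₂ i))
          where open ≋-Reasoning
        from : ∀ A X → Inv X × row₀ X ≋ row₀ 1M → X ⊠ G ≋ A → (Inv A × row₀ A ≋ v) × A ⊠ G′ ≋ X
        from A X (iX , r) x = (Inv-resp x (Inv-⊠ iX (G′ , i)) , (begin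
            row₀ A            ≈⟨ row₀-cong x ⟨
            row₀ (X ⊠ G)      ≈⟨ row₀-⊠ X G ⟩
            row₀ X ⊠ G        ≈⟨ ⊠-congʳ r ⟩
            row₀ 1M ⊠ G       ≈⟨ row₀-⊠ 1M G ⟨
            row₀ (1M ⊠ G)     ≈⟨ row₀-cong (⊠-identityˡ G) ⟩
            row₀ G            ≈⟨ e ⟩
            v                 ∎)) , ≋-trans (⊠-congʳ (≋-sym x)) (undo X (proj₁ i))
          where open ≋-Reasoning

-- Symmetric and alternating matrices

module FormCounts {r : ℕ} (F : BinaryField r) where
  open FieldFacts F hiding (_⊠_) renaming (_≈M_ to infix 4 _≈M_)
  open Matrices F
  open MatrixCounts F

  private variable
    m n k l a b c d : ℕ

  Symm : Mat n n → Set
  Symm B = B ≋ transpose B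

  Symm? : (B : Mat n n) → Dec (Symm B)
  Symm? B = B ≋? transpose B

  #Sym : ℕ → ℕ
  #Sym n = # (𝕄 n n) Symm?

  #-Sym : ∀ a b {R : Mat a a → Set} (R? : ∀ Y → Dec (R Y)) → (∀ {Y Y′} → Y ≋ Y′ → R Y → R Y′) →
    # (𝕄 (a + b) (a + b)) (λ B → Symm? B ×-dec R? (p₁₁ {a} {b} {a} {b} B)) ≡ # (𝕄 a a) (λ Y → Symm? Y ×-dec R? Y) * ((q ^ a) ^ b * #Sym b)
  #-Sym a b {R} R? resp = begin
    # (𝕄 (a + b) (a + b)) (λ B → Symm? B ×-dec R? (q₁₁ B))
      ≡⟨ #-bij (𝕄 (a + b) (a + b)) (𝕄 a a ×ˢ 𝕄 b a ×ˢ 𝕄 b b) (λ B → Symm? B ×-dec R? (q₁₁ B))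
           (λ (Y , Z , D) → (Symm? Y ×-dec R? Y) ×-dec (⊤? ×-dec Symm? D)) (λ B → q₁₁ B , q₂₁ B , q₂₂ B) (λ (Y , Z , D) → sym-blk Y Z D) to from ⟩
    # (𝕄 a a ×ˢ 𝕄 b a ×ˢ 𝕄 b b) (λ (Y , Z , D) → (Symm? Y ×-dec R? Y) ×-dec (⊤? ×-dec Symm? D))
      ≡⟨ #-×ˢ (𝕄 a a) (𝕄 b a ×ˢ 𝕄 b b) (λ Y → Symm? Y ×-dec R? Y) (λ (Z , D) → ⊤? ×-dec Symm? D) ⟩
    # (𝕄 a a) (λ Y → Symm? Y ×-dec R? Y) * # (𝕄 b a ×ˢ 𝕄 b b) (λ (Z , D) → ⊤? ×-dec Symm? D)
      ≡⟨ cong (# (𝕄 a a) (λ Y → Symm? Y ×-dec R? Y) *_) (trans (#-×ˢ (𝕄 b a) (𝕄 b b) {W = Symm} (λ _ → ⊤?) Symm?) (cong (_* #Sym b) (size-𝕄 b a))) ⟩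
    # (𝕄 a a) (λ Y → Symm? Y ×-dec R? Y) * ((q ^ a) ^ b * #Sym b) ∎
    where
    open ≡-Reasoning
    open Triangular a b using (q₁₁; q₁₂; q₂₁; q₂₂)
    sym-blk : Mat a a → Mat b a → Mat b b → Mat (a + b) (a + b)
    sym-blk Y Z D = blk Y (transpose Z) Z D
    to : ∀ B ((Y , Z , D) : Mat a a × Mat b a × Mat b b) → Symm B × R (q₁₁ B) → q₁₁ B ≋ Y × q₂₁ B ≋ Z × q₂₂ B ≋ D →
         ((Symm Y × R Y) × (⊤ × Symm D)) × sym-blk Y Z D ≋ B
    to B (Y , Z , D) (s , ρ) (e₁ , e₂ , e₃) = ((restrict e₁ (p₁₁-cong s) , resp e₁ ρ) , (_ , restrict e₃ (p₂₂-cong s))) ,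
        by-parts {a} {b} {a} {b} (≋-trans (blk-11 Y _ Z D) (≋-sym e₁)) (≋-trans (blk-12 Y _ Z D) (≋-trans (transpose-cong (≋-sym e₂)) (≋-sym (p₁₂-cong s))))
          (≋-trans (blk-21 Y _ Z D) (≋-sym e₂)) (≋-trans (blk-22 Y _ Z D) (≋-sym e₃))
      where
      restrict : {X Y : Mat k k} → X ≋ Y → X ≋ transpose X → Symm Y
      restrict e s = ≋-trans (≋-sym e) (≋-trans s (transpose-cong e))
    from : ∀ B ((Y , Z , D) : Mat a a × Mat b a × Mat b b) → (Symm Y × R Y) × (⊤ × Symm D) → sym-blk Y Z D ≋ B →
           (Symm B × R (q₁₁ B)) × (q₁₁ B ≋ Y × q₂₁ B ≋ Z × q₂₂ B ≋ D)
    from B (Y , Z , D) ((sY , ρ) , (_ , sD)) e = (s , resp (≋-sym e₁) ρ) , e₁ , e₂ , e₃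
      where
      e₁ : q₁₁ B ≋ Y
      e₁ = ≋-trans (p₁₁-cong (≋-sym e)) (blk-11 Y _ Z D)
      e₀ : q₁₂ B ≋ transpose Z
      e₀ = ≋-trans (p₁₂-cong (≋-sym e)) (blk-12 Y _ Z D)
      e₂ : q₂₁ B ≋ Z
      e₂ = ≋-trans (p₂₁-cong (≋-sym e)) (blk-21 Y _ Z D)
      e₃ : q₂₂ B ≋ D
      e₃ = ≋-trans (p₂₂-cong (≋-sym e)) (blk-22 Y _ Z D)
      s : Symm B
      s = by-parts {a} {b} {a} {b} (≋-trans e₁ (≋-trans sY (transpose-cong (≋-sym e₁)))) (≋-trans e₀ (transpose-cong (≋-sym e₂)))
        (≋-trans e₂ (transpose-cong (≋-sym e₀))) (≋-trans e₃ (≋-trans sD (transpose-cong (≋-sym e₃))))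

  #Sym-1 : #Sym 1 ≡ q
  #Sym-1 = trans (∑-cong (FiniteSetoid.elems (𝕄 1 1)) λ B → 𝟙-yes (Symm? B) (1×1 refl)) (trans (size-𝕄 1 1) (trans (ℕ.*-identityʳ _) (ℕ.*-identityʳ q)))

  #Sym-suc : ∀ n → #Sym (suc n) ≡ q * (q ^ n * #Sym n)
  #Sym-suc n = trans (#-cong (𝕄 (suc n) (suc n)) Symm? (λ B → Symm? B ×-dec ⊤?) (λ _ s → s , _) (λ _ → proj₁))
    (trans (#-Sym 1 n {R = λ _ → ⊤} (λ _ → ⊤?) _) (cong₂ _*_ (trans (#-cong (𝕄 1 1) (λ B → Symm? B ×-dec ⊤?) Symm? (λ _ → proj₁) (λ _ s → s , _)) #Sym-1)
      (cong (λ x → x ^ n * #Sym n) (ℕ.*-identityʳ q))))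

  -- In characteristic 2 antisymmetric means symmetric, so the vanishing diagonal is what
  -- distinguishes alternating matrices.
  record Alt (X : Mat n n) : Set where
    constructor alternating
    field
      diag : ∀ i → X i i ≡ 0F
      symm : Symm X
  open Alt

  Alt? : (X : Mat n n) → Dec (Alt X)
  Alt? X = Dec.map′ (λ (d , s) → alternating d s) (λ (alternating d s) → d , s) (Fin.all? (λ i → X i i ≟F 0F) ×-dec Symm? X)

  Alt-resp : {X Y : Mat n n} → X ≋ Y → Alt X → Alt Y
  Alt-resp e (alternating d s) = alternating (λ i → trans (sym (at e i i)) (d i)) (≋-trans (≋-sym e) (≋-trans s (transpose-cong e)))

  -- Off-diagonal entries cancel in symmetric pairs. This one fact shows both that congruence
  -- preserves a zero diagonal and that alternating matrices are trace-orthogonal to symmetric ones.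
  alternating-sum : (Y : Mat n n) → Alt Y → ∑ (λ i → ∑ (Y i)) ≡ 0F
  alternating-sum {zero}  Y _ = refl
  alternating-sum {suc n} Y (alternating d s) = begin
    Y zero zero +F ∑ {n} (λ j → Y zero (suc j)) +F ∑ {n} (λ i → Y (suc i) zero +F ∑ {n} (λ j → Y (suc i) (suc j)))
      ≡⟨ cong₂ _+F_ (trans (cong (_+F ∑ {n} (λ j → Y zero (suc j))) (d zero)) (+-identityˡ _))
           (trans (∑-+′ {n} (λ i → Y (suc i) zero) (λ i → ∑ {n} (λ j → Y (suc i) (suc j))))
             (cong₂ _+F_ (∑-cong′ {n} λ i → at s (suc i) zero) (alternating-sum {n} (λ i j → Y (suc i) (suc j)) (alternating (d ∘ suc) (≋-intro λ i j → at s (suc i) (suc j)))))) ⟩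
    ∑ {n} (λ j → Y zero (suc j)) +F (∑ {n} (λ j → Y zero (suc j)) +F 0F)
      ≡⟨ trans (cong (∑ {n} (λ j → Y zero (suc j)) +F_) (+-identityʳ _)) (double _) ⟩
    0F ∎
    where open ≡-Reasoning

  conj : Mat n k → Mat n n → Mat k k
  conj G X = transpose G ⊠ (X ⊠ G)

  Alt-conj : (G : Mat n k) {X : Mat n n} → Alt X → Alt (conj G X)
  Alt-conj {n} {k} G {X} aX = alternating diagonal (begin
      transpose G ⊠ (X ⊠ G)                        ≈⟨ ⊠-assoc (transpose G) X G ⟨
      transpose G ⊠ X ⊠ G                          ≈⟨ ⊠-congʳ (⊠-congˡ (symm aX)) ⟩
      transpose G ⊠ transpose X ⊠ G                ≈⟨ ⊠-congʳ (transpose-⊠ X G) ⟨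
      transpose (X ⊠ G) ⊠ G                        ≈⟨ transpose-⊠ (transpose G) (X ⊠ G) ⟨
      transpose (transpose G ⊠ (X ⊠ G))            ∎)
    where
    open ≋-Reasoning
    opaque
      unfolding _⊠_
      diagonal : ∀ i → conj G X i i ≡ 0F
      diagonal i = trans (∑-cong′ {n} λ t → sym (∑-*ˡ′ (G t i) (λ u → X t u *F G u i)))
        (alternating-sum (λ t u → G t i *F (X t u *F G u i)) (alternating (λ t → trans (cong (λ z → G t i *F (z *F G t i)) (diag aX t)) (trans (cong (G t i *F_) (zeroˡ _)) (zeroʳ _)))
          (≋-intro λ t u → trans (solve 3 (λ x y z → x :* (y :* z) := z :* (y :* x)) refl (G t i) (X t u) (G u i)) (cong (λ z → G u i *F (z *F G t i)) (at (symm aX) t u)))))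

  conj-cong : {G : Mat n k} {X Y : Mat n n} → X ≋ Y → conj G X ≋ conj G Y
  conj-cong e = ⊠-congˡ (⊠-congʳ e)

  conj-inverse : {G G′ : Mat n n} (X : Mat n n) → G ⊠ G′ ≋ 1M → conj G′ (conj G X) ≋ X
  conj-inverse {G = G} {G′} X h = begin
    transpose G′ ⊠ (transpose G ⊠ (X ⊠ G) ⊠ G′)      ≈⟨ ⊠-congˡ (⊠-assoc (transpose G) (X ⊠ G) G′) ⟩
    transpose G′ ⊠ (transpose G ⊠ (X ⊠ G ⊠ G′))      ≈⟨ ⊠-congˡ (⊠-congˡ (≋-trans (⊠-assoc X G G′) (≋-trans (⊠-congˡ h) (⊠-identityʳ X)))) ⟩
    transpose G′ ⊠ (transpose G ⊠ X)                 ≈⟨ ⊠-assoc (transpose G′) (transpose G) X ⟨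
    transpose G′ ⊠ transpose G ⊠ X                   ≈⟨ ⊠-congʳ (≋-trans (≋-sym (transpose-⊠ G G′)) (≋-trans (transpose-cong h) 1M-sym)) ⟩
    1M ⊠ X                                           ≈⟨ ⊠-identityˡ X ⟩
    X                                                ∎
    where open ≋-Reasoning

  Inv-conj : {G X : Mat n n} → Inv G → Inv X → Inv (conj G X)
  Inv-conj (G′ , i) iX = Inv-⊠ (_ , Inverses-transpose i) (Inv-⊠ iX (G′ , i))

  AltGL? : (X : Mat n n) → Dec (Inv X × Alt X)
  AltGL? X = Inv? X ×-dec Alt? X

  AltGL : ℕ → ℕ
  AltGL n = # (𝕄 n n) AltGL?

  Inv⇒row₀≢0 : (A : Mat (suc n) (suc n)) → Inv A → ¬ (row₀ A ≋ 0M)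
  Inv⇒row₀≢0 {n} A (A′ , h , _) e = 1≢0 (trans (sym (1M-diag {suc n} zero)) (trans (sym (at h zero zero))
    (trans (at (row₀-⊠ A A′) zero zero) (at (⊠-zeroˡ {Y = A′} e) zero zero))))

  -- One hyperbolic plane is split off. A congruence brings the top row to (0 , 1 , 0 , ...); the
  -- upper left block is then S, the remaining alternating block Y is free, and so is the rest w of
  -- the second row. This reduces the size by 2 with q^s choices of w.
  module AltStep (s : ℕ) where
    open Triangular 2 s

    S : Mat 2 2
    S zero       zero       = 0F
    S zero       (suc zero) = 1F
    S (suc zero) zero       = 1F
    S (suc zero) (suc zero) = 0F

    -- Only the first row is nonzero. So S U carries w in its second row, as wanted, and ᵗU S U = 0,
    -- whence the lower right block of `build w Y` is Y itself without a correction term.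
    U : Mat 1 s → Mat 2 s
    U w zero       j = w zero j
    U w (suc zero) j = 0F

    opaque
      unfolding _⊠_
      SS : S ⊠ S ≋ 1M
      SS = ≋-intro λ
        { zero       zero       → solve 1 (λ _ → con false :* con false :+ (con true :* con true :+ con false) := con true) refl 0F
        ; zero       (suc zero) → solve 1 (λ _ → con false :* con true :+ (con true :* con false :+ con false) := con false) refl 0F
        ; (suc zero) zero       → solve 1 (λ _ → con true :* con false :+ (con false :* con true :+ con false) := con false) refl 0F
        ; (suc zero) (suc zero) → solve 1 (λ _ → con true :* con true :+ (con false :* con false :+ con false) := con true) refl 0F }

      SU₀ : ∀ w j → (S ⊠ U w) zero j ≡ 0F
      SU₀ w j = solve 1 (λ x → con false :* x :+ (con true :* con false :+ con false) := con false) refl (w zero j)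

      SU₁ : ∀ w j → (S ⊠ U w) (suc zero) j ≡ w zero j
      SU₁ w j = solve 1 (λ x → con true :* x :+ (con false :* con false :+ con false) := x) refl (w zero j)

      UᵀSU : ∀ w → transpose (U w) ⊠ (S ⊠ U w) ≋ 0M
      UᵀSU w = ≋-intro λ i j → trans (cong₂ (λ x y → w zero i *F x +F (0F *F y +F 0F)) (SU₀ w j) (SU₁ w j))
        (solve 2 (λ x y → x :* con false :+ (con false :* y :+ con false) := con false) refl (w zero i) (w zero j))

    S-sym : Symm S
    S-sym = ≋-intro λ { zero zero → refl ; zero (suc zero) → refl ; (suc zero) zero → refl ; (suc zero) (suc zero) → refl }

    T : Mat 1 s → N
    T w = tri 1M (transpose (U w)) 1M

    S⊕ : Mat s s → N
    S⊕ Y = tri S 0M Y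

    T-11 : ∀ w → q₁₁ (T w) ≋ 1M
    T-11 w = tri-11 {1M} {transpose (U w)} {1M}
    T-12 : ∀ w → q₁₂ (T w) ≋ 0M
    T-12 w = tri-12 {1M} {transpose (U w)} {1M}
    T-21 : ∀ w → q₂₁ (T w) ≋ transpose (U w)
    T-21 w = tri-21 {1M} {transpose (U w)} {1M}
    T-22 : ∀ w → q₂₂ (T w) ≋ 1M
    T-22 w = tri-22 {1M} {transpose (U w)} {1M}
    S⊕-11 : ∀ Y → q₁₁ (S⊕ Y) ≋ S
    S⊕-11 Y = tri-11 {S} {0M} {Y}
    S⊕-12 : ∀ Y → q₁₂ (S⊕ Y) ≋ 0M
    S⊕-12 Y = tri-12 {S} {0M} {Y}
    S⊕-21 : ∀ Y → q₂₁ (S⊕ Y) ≋ 0M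
    S⊕-21 Y = tri-21 {S} {0M} {Y}
    S⊕-22 : ∀ Y → q₂₂ (S⊕ Y) ≋ Y
    S⊕-22 Y = tri-22 {S} {0M} {Y}

    T-inv : ∀ w → Inv (T w)
    T-inv w = _ , tri-inverses (transpose (U w)) (⊠-identityˡ 1M , ⊠-identityˡ 1M) (⊠-identityˡ 1M , ⊠-identityˡ 1M)

    build : Mat 1 s → Mat s s → N
    build w Y = conj (transpose (T w)) (S⊕ Y)

    module _ (w : Mat 1 s) (Y : Mat s s) where
      private
        right : N
        right = S⊕ Y ⊠ transpose (T w)
        r₁₁ : q₁₁ right ≋ S
        r₁₁ = ≋-trans (⊠-11 (S⊕ Y) (transpose (T w))) (≋-trans (⊞-0ʳ (⊠-zeroˡ (S⊕-12 Y))) (≋-trans (⊠-cong (S⊕-11 Y) (≋-trans (transpose-cong (T-11 w)) 1M-sym)) (⊠-identityʳ S)))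
        r₁₂ : q₁₂ right ≋ S ⊠ U w
        r₁₂ = ≋-trans (⊠-12 (S⊕ Y) (transpose (T w))) (≋-trans (⊞-0ʳ (⊠-zeroˡ (S⊕-12 Y))) (⊠-cong (S⊕-11 Y) (transpose-cong (T-21 w))))
        r₂₁ : q₂₁ right ≋ 0M
        r₂₁ = ≋-trans (⊠-21 (S⊕ Y) (transpose (T w))) (≋-trans (⊞-0ˡ (⊠-zeroˡ (S⊕-21 Y))) (⊠-zeroʳ (transpose-cong (T-12 w))))
        r₂₂ : q₂₂ right ≋ Y
        r₂₂ = ≋-trans (⊠-22 (S⊕ Y) (transpose (T w))) (≋-trans (⊞-0ˡ (⊠-zeroˡ (S⊕-21 Y))) (≋-trans (⊠-cong (S⊕-22 Y) (≋-trans (transpose-cong (T-22 w)) 1M-sym)) (⊠-identityʳ Y)))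

      build-11 : q₁₁ (build w Y) ≋ S
      build-11 = ≋-trans (⊠-11 (T w) right) (≋-trans (⊞-0ʳ (⊠-zeroˡ (T-12 w))) (≋-trans (⊠-cong (T-11 w) r₁₁) (⊠-identityˡ S)))
      build-12 : q₁₂ (build w Y) ≋ S ⊠ U w
      build-12 = ≋-trans (⊠-12 (T w) right) (≋-trans (⊞-0ʳ (⊠-zeroˡ (T-12 w))) (≋-trans (⊠-cong (T-11 w) r₁₂) (⊠-identityˡ _)))
      build-21 : q₂₁ (build w Y) ≋ transpose (U w) ⊠ S
      build-21 = ≋-trans (⊠-21 (T w) right) (≋-trans (⊞-0ʳ (⊠-zeroʳ r₂₁)) (⊠-cong (T-21 w) r₁₁))
      build-22 : q₂₂ (build w Y) ≋ Y
      build-22 = ≋-trans (⊠-22 (T w) right) (≋-trans (⊞-cong (≋-trans (⊠-cong (T-21 w) r₁₂) (UᵀSU w)) (≋-trans (⊠-cong (T-22 w) r₂₂) (⊠-identityˡ Y))) (⊞-0ˡ ≋-refl))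

    Alt-tri : {Y : Mat s s} → Alt Y → Alt (S⊕ Y)
    Alt-tri {Y} (alternating d s′) = alternating (λ { zero → refl ; (suc zero) → refl ; (suc (suc i)) → d i })
      (by-parts {2} {s} {2} {s} (≋-trans (S⊕-11 Y) (≋-trans S-sym (transpose-cong (≋-sym (S⊕-11 Y))))) (≋-trans (S⊕-12 Y) (transpose-cong (≋-sym (S⊕-21 Y))))
        (≋-trans (S⊕-21 Y) (transpose-cong (≋-sym (S⊕-12 Y)))) (≋-trans (S⊕-22 Y) (≋-trans s′ (transpose-cong (≋-sym (S⊕-22 Y))))))

    Inv-tri : {Y : Mat s s} → Inv Y → Inv (S⊕ Y)
    Inv-tri (_ , i) = _ , tri-inverses 0M (SS , SS) i

    Inv-tri⁻ : {Y : Mat s s} → Inv (S⊕ Y) → Inv Y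
    Inv-tri⁻ {Y} (X′ , i) = _ , inverses-resp (S⊕-22 Y) ≋-refl (inverses-22 i (S⊕-12 Y) z)
      where
      z : q₁₂ X′ ≋ 0M
      z = begin
        q₁₂ X′                                          ≈⟨ ⊠-identityˡ _ ⟨
        1M ⊠ q₁₂ X′                                     ≈⟨ ⊠-congʳ SS ⟨
        S ⊠ S ⊠ q₁₂ X′                                  ≈⟨ ⊠-assoc S S _ ⟩
        S ⊠ (S ⊠ q₁₂ X′)                                ≈⟨ ⊠-congˡ (≋-trans (⊠-congʳ (≋-sym (S⊕-11 Y))) (≋-trans (≋-sym (⊞-0ʳ (⊠-zeroˡ (S⊕-12 Y)))) (≋-trans (≋-sym (⊠-12 (S⊕ Y) X′)) (≋-trans (p₁₂-cong (proj₁ i)) (1M-12 {2} {s}))))) ⟩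
        S ⊠ 0M                                          ≈⟨ ⊠-zeroʳ ≋-refl ⟩
        0M                                              ∎
        where open ≋-Reasoning

    e₁ : Mat 1 (suc s)
    e₁ = row₀ 1M

    top : N → Mat 1 (suc s)
    top = p₁₂ {1} {suc s} {1} {suc s}

    base? : (X : N) → Dec ((Inv X × Alt X) × top X ≋ e₁)
    base? X = AltGL? X ×-dec (top X ≋? e₁)

    #-base : # (𝕄 (2 + s) (2 + s)) base? ≡ q ^ s * AltGL s
    #-base = trans (#-bij (𝕄 (2 + s) (2 + s)) (𝕄 1 s ×ˢ 𝕄 s s) base? (λ (w , Y) → ⊤? ×-dec AltGL? Y)
        (λ X → (λ _ j → X (suc zero) (suc (suc j))) , q₂₂ X) (λ (w , Y) → build w Y) to from)
      (trans (#-×ˢ (𝕄 1 s) (𝕄 s s) {W = λ Y → Inv Y × Alt Y} (λ _ → ⊤?) AltGL?) (cong (_* AltGL s) (trans (size-𝕄 1 s) (ℕ.*-identityʳ (q ^ s)))))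
      where
      to : ∀ X ((w , Y) : Mat 1 s × Mat s s) → (Inv X × Alt X) × top X ≋ e₁ → (λ _ j → X (suc zero) (suc (suc j))) ≋ w × q₂₂ X ≋ Y →
           (⊤ × (Inv Y × Alt Y)) × build w Y ≋ X
      to X (w , Y) ((iX , aX) , t) (ew , eY) = (_ , (Inv-tri⁻ (Inv-resp (conj-inverse (S⊕ Y) (proj₁ iT)) (Inv-conj (_ , Inverses-swap iT) (Inv-resp (≋-sym built) iX)))
          , Alt-resp eY (alternating (λ i → diag aX (suc (suc i))) (p₂₂-cong (symm aX))))) , built
        where
        iT : Inverses (transpose (T w)) (transpose (proj₁ (T-inv w)))
        iT = Inverses-transpose (proj₂ (T-inv w))
        x₁₁ : q₁₁ X ≋ S
        x₁₁ = ≋-intro λ { zero zero → diag aX zero ; zero (suc zero) → trans (at t zero zero) (1M-diag {suc s} zero)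
          ; (suc zero) zero → trans (at (symm aX) (suc zero) zero) (trans (at t zero zero) (1M-diag {suc s} zero)) ; (suc zero) (suc zero) → diag aX (suc zero) }
        x₁₂ : q₁₂ X ≋ S ⊠ U w
        x₁₂ = ≋-intro λ { zero j → trans (at t zero (suc j)) (trans (1M-off {i = zero} {suc j} λ ()) (sym (SU₀ w j))) ; (suc zero) j → trans (at ew zero j) (sym (SU₁ w j)) }
        built : build w Y ≋ X
        built = by-parts {2} {s} {2} {s} (≋-trans (build-11 w Y) (≋-sym x₁₁)) (≋-trans (build-12 w Y) (≋-sym x₁₂))
          (≋-trans (build-21 w Y) (≋-trans (≋-trans (⊠-congˡ S-sym) (≋-sym (transpose-⊠ S (U w)))) (≋-trans (transpose-cong (≋-sym x₁₂)) (≋-sym (p₂₁-cong (symm aX))))))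
          (≋-trans (build-22 w Y) (≋-sym eY))
      from : ∀ X ((w , Y) : Mat 1 s × Mat s s) → ⊤ × (Inv Y × Alt Y) → build w Y ≋ X →
             ((Inv X × Alt X) × top X ≋ e₁) × ((λ _ j → X (suc zero) (suc (suc j))) ≋ w × q₂₂ X ≋ Y)
      from X (w , Y) (_ , iY , aY) e = ((Inv-resp e (Inv-conj (_ , Inverses-transpose (proj₂ (T-inv w))) (Inv-tri iY)) , Alt-resp e (Alt-conj (transpose (T w)) (Alt-tri aY)))
          , ≋-intro (λ { zero zero → trans (sym (at e zero (suc zero))) (trans (at (build-11 w Y) zero (suc zero)) (sym (1M-diag {suc s} zero)))
                       ; zero (suc j) → trans (sym (at e zero (suc (suc j)))) (trans (at (build-12 w Y) zero j) (trans (SU₀ w j) (sym (1M-off {i = zero} {suc j} λ ())))) }))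
        , ≋-intro (λ { zero j → trans (sym (at e (suc zero) (suc (suc j)))) (trans (at (build-12 w Y) (suc zero) j) (SU₁ w j)) })
        , ≋-trans (p₂₂-cong (≋-sym e)) (build-22 w Y)

    AltGL-step : AltGL (2 + s) ≡ # (𝕄 1 (suc s)) (λ v → ¬? (0M? v)) * (q ^ s * AltGL s)
    AltGL-step = orbit-count (𝕄 (2 + s) (2 + s)) (suc s) AltGL? top (q ^ s * AltGL s) nonzero fibre
      where
      open Triangular 1 (suc s) using () renaming (q₁₁ to t₁₁; q₁₂ to t₁₂; q₂₁ to t₂₁; q₂₂ to t₂₂; tri to tri′; tri-inverses to tri′-inverses;
        tri-11 to tri′-11; tri-12 to tri′-12; tri-21 to tri′-21; tri-22 to tri′-22)
      nonzero : ∀ X → Inv X × Alt X → ¬ (top X ≋ 0M)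
      nonzero X (iX , aX) e = Inv⇒row₀≢0 X iX (≋-intro λ { zero zero → diag aX zero ; zero (suc j) → at e zero j })
      -- Congruence by 1 ⊕ G₀ multiplies the top row by G₀.
      top-conj : ∀ {G} X → t₁₁ G ≋ 1M → t₁₂ G ≋ 0M → t₂₁ G ≋ 0M → top (conj G X) ≋ top X ⊠ t₂₂ G
      top-conj {G} X e₁₁ e₁₂ e₂₁ = ≋-trans (⊠-12 (transpose G) (X ⊠ G)) (≋-trans (⊞-0ʳ (⊠-zeroˡ (transpose-cong e₂₁)))
        (≋-trans (⊠-congʳ (≋-trans (transpose-cong e₁₁) 1M-sym)) (≋-trans (⊠-identityˡ _) (≋-trans (⊠-12 X G) (⊞-0ˡ (⊠-zeroʳ e₁₂))))))
      fibre : ∀ v → ¬ (v ≋ 0M) → # (𝕄 (2 + s) (2 + s)) (λ X → AltGL? X ×-dec (top X ≋? v)) ≡ q ^ s * AltGL s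
      fibre v v≢0 with transitive v v≢0
      ... | G₀ , (G₀′ , i) , e = trans (#-bij (𝕄 (2 + s) (2 + s)) (𝕄 (2 + s) (2 + s)) (λ X → AltGL? X ×-dec (top X ≋? v)) base? (conj G′) (conj G) to from) #-base
        where
        G G′ : N
        G  = tri′ 1M 0M G₀
        G′ = tri′ 1M (G₀′ ⊠ 0M ⊠ 1M) G₀′
        g₁₁ : t₁₁ G ≋ 1M
        g₁₁ = tri′-11 {1M} {0M} {G₀}
        g₁₂ : t₁₂ G ≋ 0M
        g₁₂ = tri′-12 {1M} {0M} {G₀}
        g₂₁ : t₂₁ G ≋ 0M
        g₂₁ = tri′-21 {1M} {0M} {G₀}
        g₁₁′ : t₁₁ G′ ≋ 1M
        g₁₁′ = tri′-11 {1M} {G₀′ ⊠ 0M ⊠ 1M} {G₀′}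
        g₁₂′ : t₁₂ G′ ≋ 0M
        g₁₂′ = tri′-12 {1M} {G₀′ ⊠ 0M ⊠ 1M} {G₀′}
        g₂₁′ : t₂₁ G′ ≋ 0M
        g₂₁′ = ≋-trans (tri′-21 {1M} {G₀′ ⊠ 0M ⊠ 1M} {G₀′}) (⊠-zeroˡ (⊠-zeroʳ ≋-refl))
        iG : Inverses G G′
        iG = tri′-inverses 0M (⊠-identityˡ 1M , ⊠-identityˡ 1M) i
        to : ∀ X X₀ → (Inv X × Alt X) × top X ≋ v → conj G′ X ≋ X₀ → ((Inv X₀ × Alt X₀) × top X₀ ≋ e₁) × conj G X₀ ≋ X
        to X X₀ ((iX , aX) , t) x = ((Inv-resp x (Inv-conj (_ , Inverses-swap iG) iX) , Alt-resp x (Alt-conj G′ aX)) , (begin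
            top X₀              ≈⟨ p₁₂-cong x ⟨
            top (conj G′ X)     ≈⟨ top-conj X g₁₁′ g₁₂′ g₂₁′ ⟩
            top X ⊠ t₂₂ G′      ≈⟨ ⊠-cong (≋-trans t (≋-sym e)) (tri′-22 {1M} {G₀′ ⊠ 0M ⊠ 1M} {G₀′}) ⟩
            row₀ G₀ ⊠ G₀′       ≈⟨ row₀-⊠ G₀ G₀′ ⟨
            row₀ (G₀ ⊠ G₀′)     ≈⟨ row₀-cong (proj₁ i) ⟩
            e₁                  ∎)) , ≋-trans (conj-cong (≋-sym x)) (conj-inverse X (proj₂ iG))
          where open ≋-Reasoning
        from : ∀ X X₀ → (Inv X₀ × Alt X₀) × top X₀ ≋ e₁ → conj G X₀ ≋ X → ((Inv X × Alt X) × top X ≋ v) × conj G′ X ≋ X₀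
        from X X₀ ((iX , aX) , t) x = ((Inv-resp x (Inv-conj (_ , iG) iX) , Alt-resp x (Alt-conj G aX)) , (begin
            top X               ≈⟨ p₁₂-cong x ⟨
            top (conj G X₀)     ≈⟨ top-conj X₀ g₁₁ g₁₂ g₂₁ ⟩
            top X₀ ⊠ t₂₂ G      ≈⟨ ⊠-cong t (tri′-22 {1M} {0M} {G₀}) ⟩
            e₁ ⊠ G₀             ≈⟨ row₀-⊠ 1M G₀ ⟨
            row₀ (1M ⊠ G₀)      ≈⟨ row₀-cong (⊠-identityˡ G₀) ⟩
            row₀ G₀             ≈⟨ e ⟩
            v                   ∎)) , ≋-trans (conj-cong (≋-sym x)) (conj-inverse X₀ (proj₁ iG))
          where open ≋-Reasoning

-- Factorisations in the double coset PσP

module Cosets {r : ℕ} (F : BinaryField r) (s m : ℕ) where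
  open FieldFacts F hiding (_⊠_; σ) renaming (_≈M_ to infix 4 _≈M_)
  open Over F using () renaming (_⊠_ to _⊠′_; σ to σ′)
  open Matrices F
  open MatrixCounts F
  open FormCounts F

  n : ℕ
  n = s + m

  open Symplectic n
  open Triangular s m

  -- Complementary idempotents for the block sizes s and m. All properties of σ follow from E² = E,
  -- E′² = E′, EE′ = E′E = 0 and E + E′ = 1.
  E E′ : N
  E  = blk {s} {s} {m} {m} 1M 0M 0M 0M
  E′ = blk {s} {s} {m} {m} 0M 0M 0M 1M

  E₁₁ : q₁₁ E ≋ 1M
  E₁₁ = blk-11 {s} {s} {m} {m} 1M 0M 0M 0M
  E₁₂ : q₁₂ E ≋ 0M
  E₁₂ = blk-12 {s} {s} {m} {m} 1M 0M 0M 0M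
  E₂₁ : q₂₁ E ≋ 0M
  E₂₁ = blk-21 {s} {s} {m} {m} 1M 0M 0M 0M
  E₂₂ : q₂₂ E ≋ 0M
  E₂₂ = blk-22 {s} {s} {m} {m} 1M 0M 0M 0M
  E′₁₁ : q₁₁ E′ ≋ 0M
  E′₁₁ = blk-11 {s} {s} {m} {m} 0M 0M 0M 1M
  E′₁₂ : q₁₂ E′ ≋ 0M
  E′₁₂ = blk-12 {s} {s} {m} {m} 0M 0M 0M 1M
  E′₂₁ : q₂₁ E′ ≋ 0M
  E′₂₁ = blk-21 {s} {s} {m} {m} 0M 0M 0M 1M
  E′₂₂ : q₂₂ E′ ≋ 1M
  E′₂₂ = blk-22 {s} {s} {m} {m} 0M 0M 0M 1M

  module _ (X : N) where
    EX-11 : q₁₁ (E ⊠ X) ≋ q₁₁ X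
    EX-11 = sum-id0 (⊠-11 E X) E₁₁ E₁₂
    EX-12 : q₁₂ (E ⊠ X) ≋ q₁₂ X
    EX-12 = sum-id0 (⊠-12 E X) E₁₁ E₁₂
    EX-21 : q₂₁ (E ⊠ X) ≋ 0M
    EX-21 = ≋-trans (⊠-21 E X) (≋-trans (⊞-0ˡ (⊠-zeroˡ E₂₁)) (⊠-zeroˡ E₂₂))
    EX-22 : q₂₂ (E ⊠ X) ≋ 0M
    EX-22 = ≋-trans (⊠-22 E X) (≋-trans (⊞-0ˡ (⊠-zeroˡ E₂₁)) (⊠-zeroˡ E₂₂))
    E′X-11 : q₁₁ (E′ ⊠ X) ≋ 0M
    E′X-11 = ≋-trans (⊠-11 E′ X) (≋-trans (⊞-0ˡ (⊠-zeroˡ E′₁₁)) (⊠-zeroˡ E′₁₂))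
    E′X-12 : q₁₂ (E′ ⊠ X) ≋ 0M
    E′X-12 = ≋-trans (⊠-12 E′ X) (≋-trans (⊞-0ˡ (⊠-zeroˡ E′₁₁)) (⊠-zeroˡ E′₁₂))
    E′X-21 : q₂₁ (E′ ⊠ X) ≋ q₂₁ X
    E′X-21 = sum-0id (⊠-21 E′ X) E′₂₁ E′₂₂
    E′X-22 : q₂₂ (E′ ⊠ X) ≋ q₂₂ X
    E′X-22 = sum-0id (⊠-22 E′ X) E′₂₁ E′₂₂

  transpose-E : transpose E ≋ E
  transpose-E = by-parts {s} {m} {s} {m} {transpose E} {E} (≋-trans (transpose-cong E₁₁) (≋-trans 1M-sym (≋-sym E₁₁))) (≋-trans (transpose-cong E₂₁) (≋-sym E₁₂))
    (≋-trans (transpose-cong E₁₂) (≋-sym E₂₁)) (≋-trans (transpose-cong E₂₂) (≋-sym E₂₂))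

  transpose-E′ : transpose E′ ≋ E′
  transpose-E′ = by-parts {s} {m} {s} {m} {transpose E′} {E′} (≋-trans (transpose-cong E′₁₁) (≋-sym E′₁₁)) (≋-trans (transpose-cong E′₂₁) (≋-sym E′₁₂))
    (≋-trans (transpose-cong E′₁₂) (≋-sym E′₂₁)) (≋-trans (transpose-cong E′₂₂) (≋-trans 1M-sym (≋-sym E′₂₂)))

  EE : E ⊠ E ≋ E
  EE = by-parts {s} {m} {s} {m} (EX-11 E) (EX-12 E) (≋-trans (EX-21 E) (≋-sym E₂₁)) (≋-trans (EX-22 E) (≋-sym E₂₂))

  E′E′ : E′ ⊠ E′ ≋ E′
  E′E′ = by-parts {s} {m} {s} {m} (≋-trans (E′X-11 E′) (≋-sym E′₁₁)) (≋-trans (E′X-12 E′) (≋-sym E′₁₂)) (E′X-21 E′) (E′X-22 E′)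

  E′E : E′ ⊠ E ≋ 0M
  E′E = by-parts {s} {m} {s} {m} (E′X-11 E) (E′X-12 E) (≋-trans (E′X-21 E) E₂₁) (≋-trans (E′X-22 E) E₂₂)

  EE′ : E ⊠ E′ ≋ 0M
  EE′ = by-parts {s} {m} {s} {m} (≋-trans (EX-11 E′) E′₁₁) (≋-trans (EX-12 E′) E′₁₂) (EX-21 E′) (EX-22 E′)

  E+E′ : E ⊞ E′ ≋ 1M
  E+E′ = by-parts {s} {m} {s} {m} (≋-trans (⊞-0ʳ E′₁₁) (≋-trans E₁₁ (≋-sym (1M-11 {s} {m})))) (≋-trans (⊞-0ʳ E′₁₂) (≋-trans E₁₂ (≋-sym (1M-12 {s} {m}))))
    (≋-trans (⊞-0ʳ E′₂₁) (≋-trans E₂₁ (≋-sym (1M-21 {s} {m})))) (≋-trans (⊞-0ˡ E₂₂) (≋-trans E′₂₂ (≋-sym (1M-22 {s} {m}))))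

  ⊞-comm : (X Y : Mat n n) → X ⊞ Y ≋ Y ⊞ X
  ⊞-comm X Y = ≋-intro λ i j → +-comm _ _

  σ : M₂
  σ = blk E′ E E E′

  σ₁₁ : π₁₁ σ ≋ E′
  σ₁₁ = blk-11 {n} {n} {n} {n} E′ E E E′
  σ₁₂ : π₁₂ σ ≋ E
  σ₁₂ = blk-12 {n} {n} {n} {n} E′ E E E′
  σ₂₁ : π₂₁ σ ≋ E
  σ₂₁ = blk-21 {n} {n} {n} {n} E′ E E E′
  σ₂₂ : π₂₂ σ ≋ E′
  σ₂₂ = blk-22 {n} {n} {n} {n} E′ E E E′

  σσ : σ ⊠ σ ≋ 1M
  σσ = by-parts {n} {n} {n} {n} {σ ⊠ σ} {1M}
    (≋-trans (⊠-11 σ σ) (≋-trans (⊞-cong (⊠-cong σ₁₁ σ₁₁) (⊠-cong σ₁₂ σ₂₁)) (≋-trans (⊞-cong E′E′ EE) (≋-trans (⊞-comm E′ E) (≋-trans E+E′ (≋-sym (1M-11 {n} {n})))))))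
    (≋-trans (⊠-12 σ σ) (≋-trans (⊞-cong (⊠-cong σ₁₁ σ₁₂) (⊠-cong σ₁₂ σ₂₂)) (≋-trans (⊞-0ʳ EE′) (≋-trans E′E (≋-sym (1M-12 {n} {n}))))))
    (≋-trans (⊠-21 σ σ) (≋-trans (⊞-cong (⊠-cong σ₂₁ σ₁₁) (⊠-cong σ₂₂ σ₂₁)) (≋-trans (⊞-0ʳ E′E) (≋-trans EE′ (≋-sym (1M-21 {n} {n}))))))
    (≋-trans (⊠-22 σ σ) (≋-trans (⊞-cong (⊠-cong σ₂₁ σ₁₂) (⊠-cong σ₂₂ σ₂₂)) (≋-trans (⊞-cong EE E′E′) (≋-trans E+E′ (≋-sym (1M-22 {n} {n}))))))

  transpose-σ : transpose σ ≋ σ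
  transpose-σ = by-parts {n} {n} {n} {n} {transpose σ} {σ} (≋-trans (transpose-cong σ₁₁) (≋-trans transpose-E′ (≋-sym σ₁₁))) (≋-trans (transpose-cong σ₂₁) (≋-trans transpose-E (≋-sym σ₁₂)))
    (≋-trans (transpose-cong σ₁₂) (≋-trans transpose-E (≋-sym σ₂₁))) (≋-trans (transpose-cong σ₂₂) (≋-trans transpose-E′ (≋-sym σ₂₂)))

  Sp-σ : Sp σ
  Sp-σ = pσ , preserves-cong (≋-sym transpose-σ) pσ
    where
    E′ᵀ : {X : N} → X ≋ E′ → transpose X ≋ E′
    E′ᵀ e = ≋-trans (transpose-cong e) transpose-E′
    Eᵀ : {X : N} → X ≋ E → transpose X ≋ E
    Eᵀ e = ≋-trans (transpose-cong e) transpose-E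
    pσ : Preserves σ
    pσ = by-parts {n} {n} {n} {n} {σ ⊠ (J ⊠ transpose σ)} {J}
      (≋-trans (proj₁ (form-parts σ)) (≋-trans (⊞-cong (⊠-cong σ₁₁ (Eᵀ σ₁₂)) (⊠-cong σ₁₂ (E′ᵀ σ₁₁))) (≋-trans (⊞-0ʳ EE′) (≋-trans E′E (≋-sym J₁₁)))))
      (≋-trans (proj₁ (proj₂ (form-parts σ))) (≋-trans (⊞-cong (⊠-cong σ₁₁ (E′ᵀ σ₂₂)) (⊠-cong σ₁₂ (Eᵀ σ₂₁))) (≋-trans (⊞-cong E′E′ EE) (≋-trans (⊞-comm E′ E) (≋-trans E+E′ (≋-sym J₁₂))))))
      (≋-trans (proj₁ (proj₂ (proj₂ (form-parts σ)))) (≋-trans (⊞-cong (⊠-cong σ₂₁ (Eᵀ σ₁₂)) (⊠-cong σ₂₂ (E′ᵀ σ₁₁))) (≋-trans (⊞-cong EE E′E′) (≋-trans E+E′ (≋-sym J₂₁)))))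
      (≋-trans (proj₂ (proj₂ (proj₂ (form-parts σ)))) (≋-trans (⊞-cong (⊠-cong σ₂₁ (E′ᵀ σ₂₂)) (⊠-cong σ₂₂ (Eᵀ σ₂₁))) (≋-trans (⊞-0ʳ E′E) (≋-trans EE′ (≋-sym J₂₂)))))

  σ′≋σ : σ′ n s ≋ σ
  σ′≋σ = ≋-trans (block≈blk (Ediag′ n s) (Ediag″ n s) (Ediag″ n s) (Ediag′ n s)) (by-parts {n} {n} {n} {n}
      (≋-trans (blk-11 {n} {n} {n} {n} _ _ _ _) (≋-trans D′ (≋-sym σ₁₁))) (≋-trans (blk-12 {n} {n} {n} {n} (Ediag′ n s) _ _ _) (≋-trans D (≋-sym σ₁₂)))
      (≋-trans (blk-21 {n} {n} {n} {n} (Ediag′ n s) _ _ _) (≋-trans D (≋-sym σ₂₁))) (≋-trans (blk-22 {n} {n} {n} {n} (Ediag′ n s) _ _ _) (≋-trans D′ (≋-sym σ₂₂))))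
    where
    Ediag′ = Over.Ediag' F
    Ediag″ = Over.Ediag F
    low : (i : Fin s) → (suc (toℕ (i ↑ˡ m)) ≤ᵇ s) ≡ true
    low i with suc (toℕ (i ↑ˡ m)) ≤ᵇ s in eq
    ... | true  = refl
    ... | false = ⊥-elim (subst Data.Bool.T eq (ℕ.≤⇒≤ᵇ (subst (_< s) (sym (Fin.toℕ-↑ˡ i m)) (Fin.toℕ<n i))))
    high : (i : Fin m) → (suc (toℕ (s ↑ʳ i)) ≤ᵇ s) ≡ false
    high i with suc (toℕ (s ↑ʳ i)) ≤ᵇ s in eq
    ... | false = refl
    ... | true  = ⊥-elim (ℕ.<⇒≱ (ℕ.≤ᵇ⇒≤ (suc (toℕ (s ↑ʳ i))) s (subst Data.Bool.T (sym eq) _)) (subst (s ≤_) (sym (Fin.toℕ-↑ʳ s i)) (ℕ.m≤m+n s (toℕ i))))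
    on-diag : ∀ i j → (suc (toℕ i) ≤ᵇ s) ≡ true → (Ediag″ n s i j ≡ 1M i j) × (Ediag′ n s i j ≡ 0F)
    on-diag i j e with i Fin.≟ j | suc (toℕ i) ≤ᵇ s
    on-diag i j refl | yes _ | true = refl , refl
    on-diag i j refl | no _  | true = refl , refl
    off-diag : ∀ i j → (suc (toℕ i) ≤ᵇ s) ≡ false → (Ediag″ n s i j ≡ 0F) × (Ediag′ n s i j ≡ 1M i j)
    off-diag i j e with i Fin.≟ j | suc (toℕ i) ≤ᵇ s
    off-diag i j refl | yes _ | false = refl , refl
    off-diag i j refl | no _  | false = refl , refl
    D : Ediag″ n s ≋ E
    D = by-parts {s} {m} {s} {m}
      (≋-trans (≋-intro λ i j → proj₁ (on-diag (i ↑ˡ m) (j ↑ˡ m) (low i))) (≋-trans (1M-11 {s} {m}) (≋-sym E₁₁)))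
      (≋-trans (≋-intro λ i j → proj₁ (on-diag (i ↑ˡ m) (s ↑ʳ j) (low i))) (≋-trans (1M-12 {s} {m}) (≋-sym E₁₂)))
      (≋-trans (≋-intro λ i j → proj₁ (off-diag (s ↑ʳ i) (j ↑ˡ m) (high i))) (≋-sym E₂₁))
      (≋-trans (≋-intro λ i j → proj₁ (off-diag (s ↑ʳ i) (s ↑ʳ j) (high i))) (≋-sym E₂₂))
    D′ : Ediag′ n s ≋ E′
    D′ = by-parts {s} {m} {s} {m}
      (≋-trans (≋-intro λ i j → proj₂ (on-diag (i ↑ˡ m) (j ↑ˡ m) (low i))) (≋-sym E′₁₁))
      (≋-trans (≋-intro λ i j → proj₂ (on-diag (i ↑ˡ m) (s ↑ʳ j) (low i))) (≋-sym E′₁₂))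
      (≋-trans (≋-intro λ i j → proj₂ (off-diag (s ↑ʳ i) (j ↑ˡ m) (high i))) (≋-trans (1M-21 {s} {m}) (≋-sym E′₂₁)))
      (≋-trans (≋-intro λ i j → proj₂ (off-diag (s ↑ʳ i) (s ↑ʳ j) (high i))) (≋-trans (1M-22 {s} {m}) (≋-sym E′₂₂)))

  -- Counting the double coset

  𝕄₂ : FiniteSetoid
  𝕄₂ = 𝕄 (n + n) (n + n)

  twist : M₂ → M₂
  twist w = σ ⊠ (w ⊠ σ)

  H? : (w : M₂) → Dec (Parabolic w × Parabolic (twist w))
  H? w = parabolic? w ×-dec parabolic? (twist w)

  X? : ∀ β (w : M₂) → Dec (Parabolic w × Tr (σ ⊠ w) ≡ β)
  X? β w = parabolic? w ×-dec (Tr (σ ⊠ w) ≟F β)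

  module _ {L : ℕ} (g : Fin L → M₂) (ord : IsOrdering (InPσP n s) L g) where
    private
      ks = allFin L
      ws = FiniteSetoid.elems 𝕄₂
      P = parabolic?
      cancel : {x y : M₂} (z : M₂) → x ⊠ y ≋ 1M → x ⊠ (y ⊠ z) ≋ z
      cancel {x} {y} z h = ≋-trans (≋-sym (⊠-assoc x y z)) (≋-trans (⊠-congʳ h) (⊠-identityˡ z))
      cancelʳ : {x y : M₂} (z : M₂) → x ⊠ y ≋ 1M → z ⊠ x ⊠ y ≋ z
      cancelʳ {x} {y} z h = ≋-trans (⊠-assoc z x y) (≋-trans (⊠-congˡ h) (⊠-identityʳ z))

    trace-count : Carrier → ℕ
    trace-count β = ∑ₗ ks (λ k → 𝟙 (Tr (g k) ≟F β))

    -- These pairs in P × P are counted twice: by moving v cyclically to the right, which leaves Tr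
    -- (σ w v) with w v ranging over P, and by the element g k that v σ w equals.
    pairs : Carrier → ℕ
    pairs β = ∑ₗ ws (λ v → ∑ₗ ws (λ w → 𝟙 (P v) * (𝟙 (P w) * 𝟙 (Tr (v ⊠ (σ ⊠ w)) ≟F β))))

    pairs-X : ∀ β → pairs β ≡ # 𝕄₂ P * # 𝕄₂ (X? β)
    pairs-X β = trans (∑-cong ws λ v → trans (∑-*ˡ ws (𝟙 (P v)) _) (𝟙-*-cong (P v) (row v))) (∑-*ʳ ws _ _)
      where
      row : ∀ v → Parabolic v → ∑ₗ ws (λ w → 𝟙 (P w) * 𝟙 (Tr (v ⊠ (σ ⊠ w)) ≟F β)) ≡ # 𝕄₂ (X? β)
      row v pv = trans (∑-cong ws λ w → sym (𝟙-× (P w) (Tr (v ⊠ (σ ⊠ w)) ≟F β)))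
        (#-bij 𝕄₂ 𝕄₂ (λ w → P w ×-dec (Tr (v ⊠ (σ ⊠ w)) ≟F β)) (X? β) (_⊠ v) (_⊠ adj v)
          (λ w x (pw , t) e → (parabolic-cong e (parabolic-⊠ pw pv) , trans (sym (turn w e)) t) , ≋-trans (⊠-congʳ (≋-sym e)) (cancelʳ w (proj₁ i)))
          (λ w x (px , t) e → let e′ = ≋-trans (⊠-congʳ (≋-sym e)) (cancelʳ x (proj₂ i)) in
            (parabolic-cong e (parabolic-⊠ px (parabolic-adj pv)) , trans (turn w e′) t) , e′))
        where
        i = adj-inverses (Parabolic.sp pv)
        turn : ∀ w {x} → w ⊠ v ≋ x → Tr (v ⊠ (σ ⊠ w)) ≡ Tr (σ ⊠ x)
        turn w e = trans (Tr-comm v (σ ⊠ w)) (Tr-cong (≋-trans (⊠-assoc σ w v) (⊠-congˡ e)))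

    in-coset : ∀ {h} v w → Parabolic v → Parabolic w → h ≋ v ⊠ (σ ⊠ w) → InPσP n s h
    in-coset v w pv pw e = v , w , parabolic⇒InP pv , parabolic⇒InP pw
      , at (≋-trans e (≋-trans (≋-sym (⊠-assoc v σ w)) (≋-trans (⊠-congʳ (⊠-congˡ (≋-sym σ′≋σ))) (≋-trans (⊠-congʳ (⊠≋⊠′ v (σ′ n s))) (⊠≋⊠′ _ w)))))

    coset-form : ∀ k → ∃₂ λ v w → Parabolic v × Parabolic w × g k ≋ v ⊠ (σ ⊠ w)
    coset-form k with proj₁ ord k
    ... | v , w , pv , pw , e = v , w , InP⇒parabolic pv , InP⇒parabolic pw
      , ≋-trans (≋-intro e) (≋-trans (≋-sym (⊠≋⊠′ (v ⊠′ σ′ n s) w)) (≋-trans (⊠-congʳ (≋-trans (≋-sym (⊠≋⊠′ v (σ′ n s))) (⊠-congˡ σ′≋σ))) (⊠-assoc v σ w)))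

    listed-once : ∀ v w → Parabolic v → Parabolic w → ∑ₗ ks (λ k → 𝟙 ((v ⊠ (σ ⊠ w)) ≋? g k)) ≡ 1
    listed-once v w pv pw = trans (∑-cong ks λ k → 𝟙-cong ((v ⊠ (σ ⊠ w)) ≋? g k) (k Fin.≟ k₀)
        (λ e′ → proj₁ (proj₂ ord) k k₀ (at (≋-trans (≋-sym e′) e))) (λ { refl → e })) (∑ₗ-allFin-once k₀)
      where
      found : ∃ λ k → (v ⊠ (σ ⊠ w)) ≈M g k
      found = proj₂ (proj₂ ord) _ (in-coset v w pv pw ≋-refl)
      k₀ : Fin L
      k₀ = proj₁ found
      e : v ⊠ (σ ⊠ w) ≋ g k₀
      e = ≋-intro (proj₂ found)

    -- The number of factorisations of an element of PσP is the order of P ∩ σPσ.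
    factorisations : ∀ k → ∑ₗ ws (λ v → ∑ₗ ws (λ w → 𝟙 (P v) * (𝟙 (P w) * 𝟙 ((v ⊠ (σ ⊠ w)) ≋? g k)))) ≡ # 𝕄₂ H?
    factorisations k = begin
        ∑ₗ ws (λ v → ∑ₗ ws (λ w → 𝟙 (P v) * (𝟙 (P w) * 𝟙 ((v ⊠ (σ ⊠ w)) ≋? g k))))
          ≡⟨ ∑-cong ws (λ v → trans (∑-*ˡ ws (𝟙 (P v)) _) (𝟙-*-cong (P v) λ pv → trans (∑-cong ws λ w → trans (sym (𝟙-× (P w) ((v ⊠ (σ ⊠ w)) ≋? g k)))
                (𝟙-cong (P w ×-dec ((v ⊠ (σ ⊠ w)) ≋? g k)) (P w ×-dec ((h v ⊠ w) ≋? b)) (λ (pw , e) → pw , to v w e) (λ (pw , e) → pw , from v w e))) (column v pv (P (h v))))) ⟩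
        ∑ₗ ws (λ v → 𝟙 (P v) * 𝟙 (P (h v)))
          ≡⟨ ∑-cong ws (λ v → sym (𝟙-× (P v) (P (h v)))) ⟩
        # 𝕄₂ (λ v → P v ×-dec P (h v))
          ≡⟨ #-bij 𝕄₂ 𝕄₂ (λ v → P v ×-dec P (h v)) H? (adj a ⊠_) (a ⊠_)
               (λ v x (pv , ph) e → (parabolic-cong e (parabolic-⊠ (parabolic-adj pa) pv) , parabolic-cong (twist-cong e) ph) , ≋-trans (⊠-congˡ (≋-sym e)) (cancel v (proj₁ i)))
               (λ v x (px , ph) e → let e′ = ≋-trans (⊠-congˡ (≋-sym e)) (cancel x (proj₂ i)) in
                 (parabolic-cong e (parabolic-⊠ pa px) , parabolic-cong (twist-cong (≋-sym e′)) ph) , e′) ⟩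
        # 𝕄₂ H? ∎
      where
      open ≡-Reasoning
      form = coset-form k
      a b : M₂
      a = proj₁ form
      b = proj₁ (proj₂ form)
      pa : Parabolic a
      pa = proj₁ (proj₂ (proj₂ form))
      pb : Parabolic b
      pb = proj₁ (proj₂ (proj₂ (proj₂ form)))
      gk : g k ≋ a ⊠ (σ ⊠ b)
      gk = proj₂ (proj₂ (proj₂ (proj₂ form)))
      i = adj-inverses (Parabolic.sp pa)
      -- With g k = a σ b, the equation v σ w = a σ b is equivalent to (σ a⁻¹ v σ) w = b. So w is
      -- determined by v, and it lies in P exactly when h v does; then a⁻¹ v ranges over P ∩ σPσ.
      h : M₂ → M₂
      h v = twist (adj a ⊠ v)
      twist-cong : {x y : M₂} → x ≋ y → twist x ≋ twist y
      twist-cong e = ⊠-congˡ (⊠-congʳ e)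
      unfold : ∀ v w → h v ⊠ w ≋ σ ⊠ (adj a ⊠ (v ⊠ (σ ⊠ w)))
      unfold v w = ≋-trans (⊠-assoc σ _ w) (⊠-congˡ (≋-trans (⊠-assoc (adj a ⊠ v) σ w) (⊠-assoc (adj a) v _)))
      to : ∀ v w → v ⊠ (σ ⊠ w) ≋ g k → h v ⊠ w ≋ b
      to v w e = ≋-trans (unfold v w) (≋-trans (⊠-congˡ (≋-trans (⊠-congˡ (≋-trans e gk)) (cancel _ (proj₂ i)))) (cancel b σσ))
      from : ∀ v w → h v ⊠ w ≋ b → v ⊠ (σ ⊠ w) ≋ g k
      from v w e = ≋-trans (≋-sym (≋-trans (⊠-congˡ (≋-trans (⊠-congˡ (≋-trans (≋-sym e) (unfold v w))) (cancel _ σσ))) (cancel _ (proj₁ i)))) (≋-sym gk)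
      column : ∀ v → Parabolic v → Dec (Parabolic (h v)) → # 𝕄₂ (λ w → P w ×-dec ((h v ⊠ w) ≋? b)) ≡ 𝟙 (P (h v))
      column v pv (yes ph) = trans (#-cong 𝕄₂ (λ w → P w ×-dec ((h v ⊠ w) ≋? b)) (_≋? (adj (h v) ⊠ b))
          (λ w (_ , e) → ≋-trans (≋-sym (cancel w (proj₂ j))) (⊠-congˡ e))
          (λ w e → parabolic-cong (≋-sym e) (parabolic-⊠ (parabolic-adj ph) pb) , ≋-trans (⊠-congˡ e) (cancel b (proj₁ j))))
        (trans (FiniteSetoid.once 𝕄₂ _) (sym (𝟙-yes (P (h v)) ph)))
        where j = adj-inverses (Parabolic.sp ph)
      column v pv (no ¬ph) = trans (∑-cong ws λ w → 𝟙-no (P w ×-dec ((h v ⊠ w) ≋? b)) (λ (pw , e) → ¬ph (parabolic-cong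
          (≋-trans (⊠-congʳ (≋-sym e)) (cancelʳ (h v) (proj₁ (adj-inverses (Parabolic.sp pw))))) (parabolic-⊠ pb (parabolic-adj pw)))))
        (trans (∑-zero ws) (sym (𝟙-no (P (h v)) ¬ph)))

    pairs-H : ∀ β → pairs β ≡ trace-count β * # 𝕄₂ H?
    pairs-H β = begin
      pairs β
        ≡⟨ ∑-cong ws (λ v → ∑-cong ws (λ w → expand v w)) ⟩
      ∑ₗ ws (λ v → ∑ₗ ws (λ w → ∑ₗ ks (λ k → 𝟙 (Tr (g k) ≟F β) * t v w k)))
        ≡⟨ trans (∑-cong ws (λ v → ∑-swap ws ks _)) (∑-swap ws ks _) ⟩
      ∑ₗ ks (λ k → ∑ₗ ws (λ v → ∑ₗ ws (λ w → 𝟙 (Tr (g k) ≟F β) * t v w k)))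
        ≡⟨ ∑-cong ks (λ k → trans (∑-cong ws λ v → ∑-*ˡ ws (𝟙 (Tr (g k) ≟F β)) _) (trans (∑-*ˡ ws (𝟙 (Tr (g k) ≟F β)) _) (cong (𝟙 (Tr (g k) ≟F β) *_) (factorisations k)))) ⟩
      ∑ₗ ks (λ k → 𝟙 (Tr (g k) ≟F β) * # 𝕄₂ H?)
        ≡⟨ ∑-*ʳ ks _ _ ⟩
      trace-count β * # 𝕄₂ H? ∎
      where
      open ≡-Reasoning
      t : M₂ → M₂ → Fin L → ℕ
      t v w k = 𝟙 (P v) * (𝟙 (P w) * 𝟙 ((v ⊠ (σ ⊠ w)) ≋? g k))
      rearrange : ∀ a b c d → a * (b * (c * d)) ≡ d * (a * (b * c))
      rearrange = solve-∀
      expand : ∀ v w → 𝟙 (P v) * (𝟙 (P w) * 𝟙 (Tr (v ⊠ (σ ⊠ w)) ≟F β)) ≡ ∑ₗ ks (λ k → 𝟙 (Tr (g k) ≟F β) * t v w k)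
      expand v w = trans (𝟙-*-cong (P v) λ pv → 𝟙-*-cong (P w) λ pw → trans (sym (trans (cong (_* τ) (listed-once v w pv pw)) (ℕ.*-identityˡ τ)))
          (trans (sym (∑-*ʳ ks τ _)) (∑-cong ks λ k → 𝟙-*-cong ((v ⊠ (σ ⊠ w)) ≋? g k) (λ e → cong (λ z → 𝟙 (z ≟F β)) (Tr-cong e)))))
        (trans (cong (𝟙 (P v) *_) (sym (∑-*ˡ ks (𝟙 (P w)) _))) (trans (sym (∑-*ˡ ks (𝟙 (P v)) _))
          (∑-cong ks λ k → rearrange (𝟙 (P v)) (𝟙 (P w)) (𝟙 ((v ⊠ (σ ⊠ w)) ≋? g k)) (𝟙 (Tr (g k) ≟F β)))))
        where τ = 𝟙 (Tr (v ⊠ (σ ⊠ w)) ≟F β)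

    coset-equation : ∀ β → trace-count β * # 𝕄₂ H? ≡ # 𝕄₂ P * # 𝕄₂ (X? β)
    coset-equation β = trans (sym (pairs-H β)) (pairs-X β)

-- Orders of P and P ∩ σPσ, and the distribution of Tr (σp) over P

module CosetCounts {r : ℕ} (F : BinaryField r) (s m : ℕ) where
  open FieldFacts F hiding (_⊠_; σ) renaming (_≈M_ to infix 4 _≈M_)
  open Matrices F
  open MatrixCounts F
  open FormCounts F
  open Cosets F s m
  open Symplectic n
  open Triangular s m
  open TraceCounts F using (S-const)

  private
    𝕄ₙ : FiniteSetoid
    𝕄ₙ = 𝕄 n n
    as = FiniteSetoid.elems 𝕄ₙ

  Levi-cong : {A A′ B B′ : N} → Inv A → A ≋ A′ → B ≋ B′ → Levi A B ≋ Levi A′ B′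
  Levi-cong iA e h = by-parts {n} {n} {n} {n} (≋-trans Levi-11 (≋-trans e (≋-sym Levi-11))) (≋-trans Levi-12 (≋-trans (⊠-cong e h) (≋-sym Levi-12)))
    (≋-trans Levi-21 (≋-sym Levi-21)) (≋-trans Levi-22 (≋-trans (transpose-cong (inv-cong iA e)) (≋-sym Levi-22)))

  #-parabolic : {R : M₂ → Set} (R? : ∀ w → Dec (R w)) → (∀ {w v} → w ≋ v → R w → R v) →
    # 𝕄₂ (λ w → parabolic? w ×-dec R? w) ≡ # (𝕄ₙ ×ˢ 𝕄ₙ) (λ (A , B) → (Inv? A ×-dec Symm? B) ×-dec R? (Levi A B))
  #-parabolic {R} R? resp = #-bij 𝕄₂ (𝕄ₙ ×ˢ 𝕄ₙ) (λ w → parabolic? w ×-dec R? w) (λ (A , B) → (Inv? A ×-dec Symm? B) ×-dec R? (Levi A B))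
      (λ w → π₁₁ w , transpose (π₂₂ w) ⊠ π₁₂ w) (λ (A , B) → Levi A B) to from
    where
    to : ∀ w ((A , B) : N × N) → Parabolic w × R w → π₁₁ w ≋ A × transpose (π₂₂ w) ⊠ π₁₂ w ≋ B → ((Inv A × Symm B) × R (Levi A B)) × Levi A B ≋ w
    to w (A , B) (pw , ρ) (e , h) = ((Inv-resp e iA , ≋-trans (≋-sym h) (≋-trans (parabolic-symmetric pw) (transpose-cong h))) , resp (≋-sym l) ρ) , l
      where
      iA = _ , parabolic-inverses pw
      l : Levi A B ≋ w
      l = ≋-trans (≋-sym (Levi-cong iA e h)) (≋-sym (parabolic-Levi pw))
    from : ∀ w ((A , B) : N × N) → (Inv A × Symm B) × R (Levi A B) → Levi A B ≋ w → (Parabolic w × R w) × (π₁₁ w ≋ A × transpose (π₂₂ w) ⊠ π₁₂ w ≋ B)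
    from w (A , B) ((iA , sB) , ρ) e = (parabolic-cong e (Levi-parabolic iA sB) , resp e ρ) , ≋-trans (p₁₁-cong (≋-sym e)) Levi-11 , (begin
        transpose (π₂₂ w) ⊠ π₁₂ w      ≈⟨ ⊠-cong (transpose-cong (≋-trans (p₂₂-cong (≋-sym e)) Levi-22)) (≋-trans (p₁₂-cong (≋-sym e)) Levi-12) ⟩
        inv A ⊠ (A ⊠ B)                ≈⟨ ⊠-assoc (inv A) A B ⟨
        inv A ⊠ A ⊠ B                  ≈⟨ ⊠-congʳ (proj₂ (inv-inverses iA)) ⟩
        1M ⊠ B                         ≈⟨ ⊠-identityˡ B ⟩
        B                              ∎)
      where open ≋-Reasoning

  #P : # 𝕄₂ parabolic? ≡ GL n * #Sym n
  #P = trans (#-cong 𝕄₂ parabolic? (λ w → parabolic? w ×-dec ⊤?) (λ _ p → p , _) (λ _ → proj₁)) (trans (#-parabolic {R = λ _ → ⊤} (λ _ → ⊤?) _)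
    (trans (#-cong (𝕄ₙ ×ˢ 𝕄ₙ) (λ (A , B) → (Inv? A ×-dec Symm? B) ×-dec ⊤?) (λ (A , B) → Inv? A ×-dec Symm? B) (λ _ → proj₁) (λ _ h → h , _))
      (#-×ˢ 𝕄ₙ 𝕄ₙ Inv? Symm?)))

  -- The intersection P ∩ σPσ

  module _ {A B : N} (iA : Inv A) (sB : Symm B) where
    private
      D : N
      D = transpose (inv A)
      w : M₂
      w = Levi A B
      c₁ c₂ : N
      c₁ = π₁₁ (w ⊠ σ)
      c₂ = π₂₁ (w ⊠ σ)
      c₁≋ : c₁ ≋ A ⊠ E′ ⊞ A ⊠ B ⊠ E
      c₁≋ = ≋-trans (⊠-11 w σ) (⊞-cong (⊠-cong Levi-11 σ₁₁) (⊠-cong Levi-12 σ₂₁))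
      c₂≋ : c₂ ≋ D ⊠ E
      c₂≋ = ≋-trans (⊠-21 w σ) (≋-trans (⊞-0ˡ (⊠-zeroˡ Levi-21)) (⊠-cong Levi-22 σ₂₁))
      lower : π₂₁ (twist w) ≋ E ⊠ c₁ ⊞ E′ ⊠ c₂
      lower = ≋-trans (⊠-21 σ (w ⊠ σ)) (⊞-cong (⊠-congʳ σ₂₁) (⊠-congʳ σ₂₂))

      XE-11 : ∀ (X : N) → q₁₁ (X ⊠ E) ≋ q₁₁ X
      XE-11 X = ≋-trans (⊠-11 X E) (≋-trans (⊞-0ʳ (⊠-zeroʳ E₂₁)) (≋-trans (⊠-congˡ E₁₁) (⊠-identityʳ _)))
      XE-12 : ∀ (X : N) → q₁₂ (X ⊠ E) ≋ 0M
      XE-12 X = ≋-trans (⊠-12 X E) (≋-trans (⊞-0ˡ (⊠-zeroʳ E₁₂)) (⊠-zeroʳ E₂₂))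
      XE-21 : ∀ (X : N) → q₂₁ (X ⊠ E) ≋ q₂₁ X
      XE-21 X = ≋-trans (⊠-21 X E) (≋-trans (⊞-0ʳ (⊠-zeroʳ E₂₁)) (≋-trans (⊠-congˡ E₁₁) (⊠-identityʳ _)))
      XE-22 : ∀ (X : N) → q₂₂ (X ⊠ E) ≋ 0M
      XE-22 X = ≋-trans (⊠-22 X E) (≋-trans (⊞-0ˡ (⊠-zeroʳ E₁₂)) (⊠-zeroʳ E₂₂))
      XE′-11 : ∀ (X : N) → q₁₁ (X ⊠ E′) ≋ 0M
      XE′-11 X = ≋-trans (⊠-11 X E′) (≋-trans (⊞-0ˡ (⊠-zeroʳ E′₁₁)) (⊠-zeroʳ E′₂₁))
      XE′-12 : ∀ (X : N) → q₁₂ (X ⊠ E′) ≋ q₁₂ X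
      XE′-12 X = ≋-trans (⊠-12 X E′) (≋-trans (⊞-0ˡ (⊠-zeroʳ E′₁₂)) (≋-trans (⊠-congˡ E′₂₂) (⊠-identityʳ _)))

      l₁₁ : q₁₁ (π₂₁ (twist w)) ≋ q₁₁ (A ⊠ B)
      l₁₁ = ≋-trans (p₁₁-cong lower) (≋-trans (⊞-0ʳ (E′X-11 c₂)) (≋-trans (EX-11 c₁) (≋-trans (p₁₁-cong c₁≋) (≋-trans (⊞-0ˡ (XE′-11 A)) (XE-11 (A ⊠ B))))))
      l₁₂ : q₁₂ (π₂₁ (twist w)) ≋ q₁₂ A
      l₁₂ = ≋-trans (p₁₂-cong lower) (≋-trans (⊞-0ʳ (E′X-12 c₂)) (≋-trans (EX-12 c₁) (≋-trans (p₁₂-cong c₁≋) (≋-trans (⊞-0ʳ (XE-12 (A ⊠ B))) (XE′-12 A)))))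
      l₂₁ : q₂₁ (π₂₁ (twist w)) ≋ transpose (q₁₂ (inv A))
      l₂₁ = ≋-trans (p₂₁-cong lower) (≋-trans (⊞-0ˡ (EX-21 c₁)) (≋-trans (E′X-21 c₂) (≋-trans (p₂₁-cong c₂≋) (XE-21 D))))
      l₂₂ : q₂₂ (π₂₁ (twist w)) ≋ 0M
      l₂₂ = ≋-trans (p₂₂-cong lower) (≋-trans (⊞-0ˡ (EX-22 c₁)) (≋-trans (E′X-22 c₂) (≋-trans (p₂₂-cong c₂≋) (XE-22 D))))

    -- The lower left block of σwσ has the blocks (AB)₁₁, A₁₂, ᵗ(A⁻¹)₁₂ and 0. Once A₁₂ = 0 the
    -- first of them is A₁₁B₁₁ with A₁₁ invertible, so the conditions on A and on B separate.
    twist-parabolic : LT A → q₁₁ B ≋ 0M → Parabolic (twist w)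
    twist-parabolic (_ , z , z′) zB = parabolic (Sp-⊠ Sp-σ (Sp-⊠ (Parabolic.sp (Levi-parabolic iA sB)) Sp-σ)) (by-parts {s} {m} {s} {m}
      (≋-trans l₁₁ (≋-trans (⊠-11 A B) (≋-trans (⊞-0ʳ (⊠-zeroˡ z)) (⊠-zeroʳ zB)))) (≋-trans l₁₂ z) (≋-trans l₂₁ (transpose-cong z′)) l₂₂)

    twist-parabolic⁻ : Parabolic (twist w) → LT A × q₁₁ B ≋ 0M
    twist-parabolic⁻ (parabolic _ l) = (iA , z , z′) , (begin
        q₁₁ B                            ≈⟨ ⊠-identityˡ _ ⟨
        1M ⊠ q₁₁ B                       ≈⟨ ⊠-congʳ (proj₂ (inverses-11 (inv-inverses iA) z z′)) ⟨
        q₁₁ (inv A) ⊠ q₁₁ A ⊠ q₁₁ B      ≈⟨ ⊠-assoc _ _ _ ⟩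
        q₁₁ (inv A) ⊠ (q₁₁ A ⊠ q₁₁ B)    ≈⟨ ⊠-zeroʳ (≋-trans (≋-sym (≋-trans l₁₁ (≋-trans (⊠-11 A B) (⊞-0ʳ (⊠-zeroˡ z))))) (p₁₁-cong l)) ⟩
        0M                               ∎)
      where
      open ≋-Reasoning
      z : q₁₂ A ≋ 0M
      z = ≋-trans (≋-sym l₁₂) (p₁₂-cong l)
      z′ : q₁₂ (inv A) ≋ 0M
      z′ = transpose-cong (≋-trans (≋-sym l₂₁) (p₂₁-cong l))

  #LT : # 𝕄ₙ LT? ≡ GL s * ((q ^ s) ^ m * GL m)
  #LT = trans (#-cong 𝕄ₙ LT? (λ A → LT? A ×-dec (⊤? ×-dec ⊤?)) (λ _ h → h , _) (λ _ → proj₁))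
    (trans (#-LT {R₁ = λ _ → ⊤} {R₂ = λ _ → ⊤} (λ _ → ⊤?) (λ _ → ⊤?) _ _) (cong₂ (λ x y → x * ((q ^ s) ^ m * y))
      (#-cong (𝕄 s s) (λ A → Inv? A ×-dec ⊤?) Inv? (λ _ → proj₁) (λ _ h → h , _)) (#-cong (𝕄 m m) (λ A → Inv? A ×-dec ⊤?) Inv? (λ _ → proj₁) (λ _ h → h , _))))

  #H : # 𝕄₂ H? ≡ GL s * ((q ^ s) ^ m * GL m) * ((q ^ s) ^ m * #Sym m)
  #H = begin
    # 𝕄₂ H?
      ≡⟨ #-parabolic (λ w → parabolic? (twist w)) (λ e → parabolic-cong (⊠-congˡ (⊠-congʳ e))) ⟩
    # (𝕄ₙ ×ˢ 𝕄ₙ) (λ (A , B) → (Inv? A ×-dec Symm? B) ×-dec parabolic? (twist (Levi A B)))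
      ≡⟨ #-cong (𝕄ₙ ×ˢ 𝕄ₙ) (λ (A , B) → (Inv? A ×-dec Symm? B) ×-dec parabolic? (twist (Levi A B))) (λ (A , B) → LT? A ×-dec (Symm? B ×-dec 0M? (q₁₁ B)))
           (λ (A , B) ((iA , sB) , p) → let lt , z = twist-parabolic⁻ iA sB p in lt , sB , z)
           (λ (A , B) (lt , sB , z) → (proj₁ lt , sB) , twist-parabolic (proj₁ lt) sB lt z) ⟩
    # (𝕄ₙ ×ˢ 𝕄ₙ) (λ (A , B) → LT? A ×-dec (Symm? B ×-dec 0M? (q₁₁ B)))
      ≡⟨ #-×ˢ 𝕄ₙ 𝕄ₙ LT? (λ B → Symm? B ×-dec 0M? (q₁₁ B)) ⟩
    # 𝕄ₙ LT? * # 𝕄ₙ (λ B → Symm? B ×-dec 0M? (q₁₁ B))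
      ≡⟨ cong₂ _*_ #LT (trans (#-Sym s m 0M? (λ e h → ≋-trans (≋-sym e) h)) (trans (cong (_* ((q ^ s) ^ m * #Sym m))
           (trans (#-cong (𝕄 s s) (λ Y → Symm? Y ×-dec 0M? Y) 0M? (λ _ → proj₂) (λ Y e → ≋-trans e (transpose-cong (≋-sym e)) , e)) (FiniteSetoid.once (𝕄 s s) 0M))) (ℕ.*-identityˡ _))) ⟩
    GL s * ((q ^ s) ^ m * GL m) * ((q ^ s) ^ m * #Sym m) ∎
    where open ≡-Reasoning

  -- Linear functionals on symmetric matrices

  infixr 7 _∙_
  _∙_ : Carrier → N → N
  (c ∙ X) i j = c *F X i j

  Symm-shift : ∀ c {B B₀ : N} → Symm B → Symm B₀ → Symm (B ⊞ c ∙ B₀)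
  Symm-shift c h h₀ = ≋-intro λ i j → cong₂ _+F_ (at h i j) (cong (c *F_) (at h₀ i j))

  -- Translation by multiples of a matrix with ℓ B₀ ≠ 0 permutes the fibres of ℓ.
  equidistributed : (ℓ : N → Carrier) → (∀ {B B′} → B ≋ B′ → ℓ B ≡ ℓ B′) → (∀ c B B₀ → ℓ (B ⊞ c ∙ B₀) ≡ ℓ B +F c *F ℓ B₀) →
    ∀ B₀ → Symm B₀ → ℓ B₀ ≢ 0F → ∀ γ → q * # 𝕄ₙ (λ B → Symm? B ×-dec (ℓ B ≟F γ)) ≡ #Sym n
  equidistributed ℓ ℓ-cong ℓ-linear B₀ s₀ ℓ≢0 γ = begin
    q * # 𝕄ₙ (fibre γ)                                                       ≡⟨ S-const _ ⟨
    ∑ₗ (FiniteSetoid.elems 𝔽) (λ γ′ → # 𝕄ₙ (fibre γ))                        ≡⟨ ∑-cong (FiniteSetoid.elems 𝔽) (λ γ′ → same γ γ′) ⟩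
    ∑ₗ (FiniteSetoid.elems 𝔽) (λ γ′ → # 𝕄ₙ (fibre γ′))                       ≡⟨ ∑-cong (FiniteSetoid.elems 𝔽) (λ γ′ → ∑-cong as λ B → trans (𝟙-× (Symm? B) (ℓ B ≟F γ′)) (ℕ.*-comm (𝟙 (Symm? B)) _)) ⟩
    ∑ₗ (FiniteSetoid.elems 𝔽) (λ γ′ → ∑ₗ as (λ B → 𝟙 (ℓ B ≟F γ′) * 𝟙 (Symm? B))) ≡⟨ fibres 𝔽 as ℓ _ ⟨
    #Sym n                                                                   ∎
    where
    open ≡-Reasoning
    fibre : ∀ γ B → Dec (Symm B × ℓ B ≡ γ)
    fibre γ B = Symm? B ×-dec (ℓ B ≟F γ)
    same : ∀ γ γ′ → # 𝕄ₙ (fibre γ) ≡ # 𝕄ₙ (fibre γ′)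
    same γ γ′ = #-bij 𝕄ₙ 𝕄ₙ (fibre γ) (fibre γ′) shift shift
        (λ B B′ (h , e) x → (Symm-resp x (Symm-shift c h s₀) , moves γ γ′ refl B B′ e x) , undo B B′ x)
        (λ B B′ (h , e) x → (Symm-resp x (Symm-shift c h s₀) , moves γ′ γ (+-comm γ′ γ) B′ B e x) , undo B′ B x)
      where
      c = (γ +F γ′) *F ℓ B₀ ⁻¹
      shift : N → N
      shift B = B ⊞ c ∙ B₀
      Symm-resp : {B B′ : N} → B ≋ B′ → Symm B → Symm B′
      Symm-resp e h = ≋-trans (≋-sym e) (≋-trans h (transpose-cong e))
      cℓ : c *F ℓ B₀ ≡ γ +F γ′
      cℓ = trans (*-assoc _ _ _) (trans (cong ((γ +F γ′) *F_) (⁻¹-inverseˡ _ ℓ≢0)) (*-identityʳ _))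
      moves : ∀ δ δ′ → δ +F δ′ ≡ γ +F γ′ → ∀ B B′ → ℓ B ≡ δ → shift B ≋ B′ → ℓ B′ ≡ δ′
      moves δ δ′ h B B′ e x = trans (sym (ℓ-cong x)) (trans (ℓ-linear c B B₀) (trans (cong₂ _+F_ e (trans cℓ (sym h))) (solve 2 (λ x y → x :+ (x :+ y) := y) refl δ δ′)))
      undo : ∀ B B′ → shift B ≋ B′ → shift B′ ≋ B
      undo B B′ x = ≋-intro λ i j → trans (cong (_+F c *F B₀ i j) (sym (at x i j))) (solve 2 (λ x y → x :+ y :+ y := x) refl (B i j) (c *F B₀ i j))

  opaque
    unfolding _⊠_
    Tr-⊠-linear : ∀ (X : N) c B B₀ → Tr (X ⊠ (B ⊞ c ∙ B₀)) ≡ Tr (X ⊠ B) +F c *F Tr (X ⊠ B₀)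
    Tr-⊠-linear X c B B₀ = trans (∑-cong′ {n} λ i → trans (∑-cong′ {n} λ t → solve 4 (λ x b c d → x :* (b :+ c :* d) := x :* b :+ c :* (x :* d)) refl (X i t) (B t i) c (B₀ t i))
        (trans (∑-+′ {n} (λ t → X i t *F B t i) (λ t → c *F (X i t *F B₀ t i))) (cong ((X ⊠ B) i i +F_) (∑-*ˡ′ {n} c (λ t → X i t *F B₀ t i)))))
      (trans (∑-+′ {n} (λ i → (X ⊠ B) i i) (λ i → c *F (X ⊠ B₀) i i)) (cong (Tr (X ⊠ B) +F_) (∑-*ˡ′ {n} c (λ i → (X ⊠ B₀) i i))))

    Alt⇒Tr≡0 : ∀ {X B : N} → Alt X → Symm B → Tr (X ⊠ B) ≡ 0F
    Alt⇒Tr≡0 {X} {B} (alternating d h) sB = alternating-sum (λ i t → X i t *F B t i) (alternating (λ i → trans (cong (_*F B i i) (d i)) (zeroˡ _))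
      (≋-intro λ i t → cong₂ _*F_ (at h i t) (at sB t i)))

    unit : Fin n → Fin n → N
    unit k l i j = 1M i k *F 1M j l

    Tr-unit : ∀ (X : N) k l → Tr (X ⊠ unit k l) ≡ X l k
    Tr-unit X k l = trans (∑-cong′ {n} λ i → trans (∑-single (λ t → X i t *F unit k l t i) k λ t t≢k → trans (cong (λ z → X i t *F (z *F 1M i l)) (1M-off t≢k)) (trans (cong (X i t *F_) (zeroˡ _)) (zeroʳ _)))
        (cong (λ z → X i k *F (z *F 1M i l)) (1M-diag k)))
      (trans (∑-single (λ i → X i k *F (1F *F 1M i l)) l λ i i≢l → trans (cong (λ z → X i k *F (1F *F z)) (1M-off i≢l)) (trans (cong (X i k *F_) (zeroʳ _)) (zeroʳ _)))
        (trans (cong (λ z → X l k *F (1F *F z)) (1M-diag l)) (trans (cong (X l k *F_) (*-identityˡ _)) (*-identityʳ _))))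

    unit-sym : ∀ k l → transpose (unit k l) ≋ unit l k
    unit-sym k l = ≋-intro λ i j → *-comm _ _

  -- The symmetric matrices `unit i i` detect the diagonal of X, and `unit j i ⊞ unit i j` detects X
  -- i j + X j i. Together with `Alt⇒Tr≡0`, alternating matrices are exactly the functionals that
  -- vanish on symmetric ones.
  Tr≡0⇒Alt : ∀ (X : N) → (∀ B → Symm B → Tr (X ⊠ B) ≡ 0F) → Alt X
  Tr≡0⇒Alt X h = alternating (λ i → trans (sym (Tr-unit X i i)) (h (unit i i) (≋-sym (unit-sym i i))))
    (≋-intro λ i j → +-≡0 (trans (sym (cong₂ _+F_ (Tr-unit X j i) (Tr-unit X i j))) (trans (sym (Tr-⊞ (X ⊠ unit j i) (X ⊠ unit i j))) (trans (sym (Tr-cong (⊠-distribˡ X (unit j i) (unit i j))))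
      (h (unit j i ⊞ unit i j) (≋-intro λ k l → trans (+-comm _ _) (cong₂ _+F_ (sym (at (unit-sym j i) k l)) (sym (at (unit-sym i j) k l)))))))))

  -- The trace over the double coset

  t : N → Carrier
  t A = Tr (q₂₂ A) +F Tr (q₂₂ (inv A))

  ℓ : N → N → Carrier
  ℓ A B = Tr (E ⊠ A ⊠ B)

  Tr-E′ : (X : N) → Tr (E′ ⊠ X) ≡ Tr (q₂₂ X)
  Tr-E′ X = trans (Tr-parts {s} {m} (E′ ⊠ X)) (trans (cong₂ _+F_ (Tr-0 (E′X-11 X)) (Tr-cong (E′X-22 X))) (+-identityˡ _))

  Tr-σ-Levi : ∀ {A} B → Tr (σ ⊠ Levi A B) ≡ t A +F ℓ A B
  Tr-σ-Levi {A} B = begin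
    Tr (σ ⊠ w)                                                   ≡⟨ Tr-parts {n} {n} (σ ⊠ w) ⟩
    Tr (π₁₁ (σ ⊠ w)) +F Tr (π₂₂ (σ ⊠ w))                          ≡⟨ cong₂ _+F_ (Tr-cong u₁) (trans (Tr-cong u₂) (Tr-⊞ (E ⊠ A ⊠ B) (E′ ⊠ transpose (inv A)))) ⟩
    Tr (E′ ⊠ A) +F (ℓ A B +F Tr (E′ ⊠ transpose (inv A)))         ≡⟨ cong₂ (λ x y → x +F (ℓ A B +F y)) (Tr-E′ A) (Tr-E′ (transpose (inv A))) ⟩
    Tr (q₂₂ A) +F (ℓ A B +F Tr (q₂₂ (inv A)))                     ≡⟨ solve 3 (λ x y z → x :+ (y :+ z) := x :+ z :+ y) refl (Tr (q₂₂ A)) (ℓ A B) (Tr (q₂₂ (inv A))) ⟩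
    t A +F ℓ A B                                                 ∎
    where
    open ≡-Reasoning
    w = Levi A B
    u₁ : π₁₁ (σ ⊠ w) ≋ E′ ⊠ A
    u₁ = ≋-trans (⊠-11 σ w) (≋-trans (⊞-0ʳ (⊠-zeroʳ Levi-21)) (⊠-cong σ₁₁ Levi-11))
    u₂ : π₂₂ (σ ⊠ w) ≋ E ⊠ A ⊠ B ⊞ E′ ⊠ transpose (inv A)
    u₂ = ≋-trans (⊠-22 σ w) (⊞-cong (≋-trans (⊠-cong σ₂₁ Levi-12) (≋-sym (⊠-assoc E A B))) (⊠-cong σ₂₂ Levi-22))

  M? : (A : N) → Dec (Inv A × Alt (E ⊠ A))
  M? A = Inv? A ×-dec Alt? (E ⊠ A)

  -- One equation free of division covers two cases. If EA is not alternating, each value of the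
  -- functional is taken by a share 1/q of the symmetric matrices; if it is alternating, the
  -- functional is zero, and all symmetric matrices count or none, as t A = β or not.
  fibre-count : ∀ β A → q * # 𝕄ₙ (λ B → Symm? B ×-dec ((t A +F ℓ A B) ≟F β)) + #Sym n * 𝟙 (Alt? (E ⊠ A))
                      ≡ #Sym n * (1 + q * (𝟙 (Alt? (E ⊠ A)) * 𝟙 (t A ≟F β)))
  fibre-count β A = go (FiniteSetoid.search 𝕄ₙ {R = λ B → Symm B × ℓ A B ≢ 0F}
      (λ e (h , ne) → ≋-trans (≋-sym e) (≋-trans h (transpose-cong e)) , λ z → ne (trans (ℓ-cong e) z)) (λ B → Symm? B ×-dec ¬? (ℓ A B ≟F 0F)))
    where
    k = 𝟙 (Alt? (E ⊠ A))
    ℓ-cong : {B B′ : N} → B ≋ B′ → ℓ A B ≡ ℓ A B′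
    ℓ-cong e = Tr-cong (⊠-congˡ e)
    F? : ∀ γ B → Dec (Symm B × ℓ A B ≡ γ)
    F? γ B = Symm? B ×-dec (ℓ A B ≟F γ)
    shift : # 𝕄ₙ (λ B → Symm? B ×-dec ((t A +F ℓ A B) ≟F β)) ≡ # 𝕄ₙ (F? (t A +F β))
    shift = #-cong 𝕄ₙ (λ B → Symm? B ×-dec ((t A +F ℓ A B) ≟F β)) (F? (t A +F β))
      (λ B (h , e) → h , trans (solve 2 (λ x y → y := x :+ (x :+ y)) refl (t A) (ℓ A B)) (cong (t A +F_) e))
      (λ B (h , e) → h , trans (cong (t A +F_) e) (solve 2 (λ x y → x :+ (x :+ y) := y) refl (t A) β))
    go : Dec (∃ λ B → Symm B × ℓ A B ≢ 0F) → q * # 𝕄ₙ (λ B → Symm? B ×-dec ((t A +F ℓ A B) ≟F β)) + #Sym n * k ≡ #Sym n * (1 + q * (k * 𝟙 (t A ≟F β)))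
    go (yes (B₀ , s₀ , ne)) = trans (cong₂ _+_ (trans (cong (q *_) shift) (equidistributed (ℓ A) ℓ-cong (Tr-⊠-linear (E ⊠ A)) B₀ s₀ ne (t A +F β))) (cong (#Sym n *_) k≡0))
        (trans (eq (#Sym n) q (𝟙 (t A ≟F β))) (cong (λ k → #Sym n * (1 + q * (k * 𝟙 (t A ≟F β)))) (sym k≡0)))
      where
      k≡0 : k ≡ 0
      k≡0 = 𝟙-no (Alt? (E ⊠ A)) (λ al → ne (Alt⇒Tr≡0 al s₀))
      eq : ∀ x q y → x + x * 0 ≡ x * (1 + q * (0 * y))
      eq = solve-∀
    go (no ¬h) = trans (cong₂ _+_ (cong (q *_) (trans (∑-cong as λ B → trans (𝟙-× (Symm? B) ((t A +F ℓ A B) ≟F β)) (𝟙-*-cong (Symm? B) λ h → 𝟙-cong ((t A +F ℓ A B) ≟F β) (t A ≟F β)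
          (λ e → trans (sym (trans (cong (t A +F_) (ℓ≡0 B h)) (+-identityʳ _))) e) (λ e → trans (trans (cong (t A +F_) (ℓ≡0 B h)) (+-identityʳ _)) e))) (∑-*ʳ as _ _))) (cong (#Sym n *_) k≡1))
        (trans (eq (#Sym n) q (𝟙 (t A ≟F β))) (cong (λ k → #Sym n * (1 + q * (k * 𝟙 (t A ≟F β)))) (sym k≡1)))
      where
      ℓ≡0 : ∀ B → Symm B → ℓ A B ≡ 0F
      ℓ≡0 B h = Dec.decidable-stable (ℓ A B ≟F 0F) (λ ne → ¬h (B , h , ne))
      k≡1 : k ≡ 1
      k≡1 = 𝟙-yes (Alt? (E ⊠ A)) (Tr≡0⇒Alt (E ⊠ A) ℓ≡0)
      eq : ∀ x q y → q * (x * y) + x * 1 ≡ x * (1 + q * (1 * y))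
      eq = solve-∀

  Mβ? : ∀ β A → Dec ((Inv A × Alt (E ⊠ A)) × t A ≡ β)
  Mβ? β A = M? A ×-dec (t A ≟F β)

  #X : ∀ β → q * # 𝕄₂ (X? β) + #Sym n * # 𝕄ₙ M? ≡ #Sym n * (GL n + q * # 𝕄ₙ (Mβ? β))
  #X β = begin
    q * # 𝕄₂ (X? β) + σₙ * # 𝕄ₙ M?
      ≡⟨ cong₂ (λ x y → q * x + σₙ * y) (trans (#-parabolic (λ w → Tr (σ ⊠ w) ≟F β) (λ e h → trans (sym (Tr-cong (⊠-congˡ e))) h))
           (trans (∑-×ˢ 𝕄ₙ 𝕄ₙ _) (∑-cong as λ A → trans (∑-cong as λ B → regroup A B) (∑-*ˡ as (𝟙 (Inv? A)) _)))) (∑-cong as λ A → 𝟙-× (Inv? A) (Alt? (E ⊠ A))) ⟩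
    q * ∑ₗ as (λ A → 𝟙 (Inv? A) * f A) + σₙ * ∑ₗ as (λ A → 𝟙 (Inv? A) * 𝟙 (Alt? (E ⊠ A)))
      ≡⟨ trans (cong₂ _+_ (sym (∑-*ˡ as q _)) (sym (∑-*ˡ as σₙ _))) (sym (∑-+ as _ _)) ⟩
    ∑ₗ as (λ A → q * (𝟙 (Inv? A) * f A) + σₙ * (𝟙 (Inv? A) * 𝟙 (Alt? (E ⊠ A))))
      ≡⟨ ∑-cong as (λ A → trans (pull q σₙ (𝟙 (Inv? A)) (f A) (𝟙 (Alt? (E ⊠ A)))) (trans (cong (𝟙 (Inv? A) *_) (fibre-count β A))
           (trans (push q σₙ (𝟙 (Inv? A)) (𝟙 (Alt? (E ⊠ A))) (𝟙 (t A ≟F β))) (cong (λ z → σₙ * (𝟙 (Inv? A) + q * z)) (sym (trans (𝟙-× (M? A) (t A ≟F β)) (cong (_* 𝟙 (t A ≟F β)) (𝟙-× (Inv? A) (Alt? (E ⊠ A)))))))))) ⟩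
    ∑ₗ as (λ A → σₙ * (𝟙 (Inv? A) + q * 𝟙 (Mβ? β A)))
      ≡⟨ trans (∑-*ˡ as σₙ _) (cong (σₙ *_) (trans (∑-+ as _ _) (cong (GL n +_) (∑-*ˡ as q _)))) ⟩
    σₙ * (GL n + q * # 𝕄ₙ (Mβ? β)) ∎
    where
    open ≡-Reasoning
    σₙ = #Sym n
    f : N → ℕ
    f A = # 𝕄ₙ (λ B → Symm? B ×-dec ((t A +F ℓ A B) ≟F β))
    regroup : ∀ A B → 𝟙 ((Inv? A ×-dec Symm? B) ×-dec (Tr (σ ⊠ Levi A B) ≟F β)) ≡ 𝟙 (Inv? A) * 𝟙 (Symm? B ×-dec ((t A +F ℓ A B) ≟F β))
    regroup A B = trans (𝟙-cong ((Inv? A ×-dec Symm? B) ×-dec (Tr (σ ⊠ Levi A B) ≟F β)) (Inv? A ×-dec (Symm? B ×-dec ((t A +F ℓ A B) ≟F β)))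
      (λ ((i , h) , e) → i , h , trans (sym (Tr-σ-Levi B)) e) (λ (i , h , e) → (i , h) , trans (Tr-σ-Levi B) e)) (𝟙-× (Inv? A) (Symm? B ×-dec ((t A +F ℓ A B) ≟F β)))
    pull : ∀ q s i x y → q * (i * x) + s * (i * y) ≡ i * (q * x + s * y)
    pull = solve-∀
    push : ∀ q s i k t → i * (s * (1 + q * (k * t))) ≡ s * (i + q * (i * k * t))
    push = solve-∀

  -- EA consists of the first s rows of A over zero rows. Its symmetry equates A₁₂ with a transposed
  -- zero block, and what remains of the condition is that A₁₁ is alternating.
  Alt-E⇒LT : ∀ {A} → Inv A → Alt (E ⊠ A) → LT A × Alt (q₁₁ A)
  Alt-E⇒LT {A} iA al = (iA , z , z′) , al₁₁
    where
    open ≋-Reasoning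
    z : q₁₂ A ≋ 0M
    z = ≋-trans (≋-sym (EX-12 A)) (≋-trans (p₁₂-cong (Alt.symm al)) (transpose-cong (EX-21 A)))
    al₁₁ : Alt (q₁₁ A)
    al₁₁ = Alt-resp (EX-11 A) (alternating (λ i → Alt.diag al (i ↑ˡ m)) (p₁₁-cong (Alt.symm al)))
    i = inv-inverses iA
    right : q₁₁ A ⊠ q₁₁ (inv A) ≋ 1M
    right = ≋-trans (≋-sym (≋-trans (⊠-11 A (inv A)) (⊞-0ʳ (⊠-zeroˡ z)))) (≋-trans (p₁₁-cong (proj₁ i)) (1M-11 {s} {m}))
    -- A₁₁ is symmetric, so the transpose of its right inverse is a left inverse; multiplied onto
    -- A₁₁ (A⁻¹)₁₂ = 0 it gives (A⁻¹)₁₂ = 0.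
    left : transpose (q₁₁ (inv A)) ⊠ q₁₁ A ≋ 1M
    left = ≋-trans (⊠-congˡ (Alt.symm al₁₁)) (≋-trans (≋-sym (transpose-⊠ (q₁₁ A) (q₁₁ (inv A)))) (≋-trans (transpose-cong right) 1M-sym))
    z′ : q₁₂ (inv A) ≋ 0M
    z′ = begin
      q₁₂ (inv A)                                               ≈⟨ ⊠-identityˡ _ ⟨
      1M ⊠ q₁₂ (inv A)                                          ≈⟨ ⊠-congʳ left ⟨
      transpose (q₁₁ (inv A)) ⊠ q₁₁ A ⊠ q₁₂ (inv A)             ≈⟨ ⊠-assoc _ _ _ ⟩
      transpose (q₁₁ (inv A)) ⊠ (q₁₁ A ⊠ q₁₂ (inv A))           ≈⟨ ⊠-zeroʳ (≋-trans (≋-sym (≋-trans (⊠-12 A (inv A)) (⊞-0ʳ (⊠-zeroˡ z)))) (≋-trans (p₁₂-cong (proj₁ i)) (1M-12 {s} {m}))) ⟩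
      0M                                                        ∎

  LT⇒Alt-E : ∀ {A} → LT A → Alt (q₁₁ A) → Alt (E ⊠ A)
  LT⇒Alt-E {A} (_ , z , _) al = alternating diag′ (by-parts {s} {m} {s} {m}
      (≋-trans (EX-11 A) (≋-trans (Alt.symm al) (transpose-cong (≋-sym (EX-11 A))))) (≋-trans (EX-12 A) (≋-trans z (transpose-cong (≋-sym (EX-21 A)))))
      (≋-trans (EX-21 A) (transpose-cong (≋-sym (≋-trans (EX-12 A) z)))) (≋-trans (EX-22 A) (transpose-cong (≋-sym (EX-22 A)))))
    where
    diag′ : ∀ i → (E ⊠ A) i i ≡ 0F
    diag′ i = subst (λ i → (E ⊠ A) i i ≡ 0F) (Fin.join-splitAt s m i) (go (splitAt s i))
      where
      go : ∀ i → (E ⊠ A) (Fin.join s m i) (Fin.join s m i) ≡ 0F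
      go (inj₁ i) = trans (at (EX-11 A) i i) (Alt.diag al i)
      go (inj₂ i) = at (EX-22 A) i i

  t-LT : ∀ {A} → LT A → t A ≡ Tr (q₂₂ A) +F Tr (inv (q₂₂ A))
  t-LT {A} (iA , z , z′) = cong (Tr (q₂₂ A) +F_) (Tr-cong (≋-sym (inv-unique (inverses-22 (inv-inverses iA) z z′))))

  #M : # 𝕄ₙ M? ≡ AltGL s * ((q ^ s) ^ m * GL m)
  #M = trans (#-cong 𝕄ₙ M? (λ A → LT? A ×-dec (Alt? (q₁₁ A) ×-dec ⊤?)) (λ A (i , al) → let l , al′ = Alt-E⇒LT i al in l , al′ , _) (λ A (l , al , _) → proj₁ l , LT⇒Alt-E l al))
    (trans (#-LT {R₂ = λ _ → ⊤} Alt? (λ _ → ⊤?) Alt-resp _) (cong (λ x → AltGL s * ((q ^ s) ^ m * x)) (#-cong (𝕄 m m) (λ A → Inv? A ×-dec ⊤?) Inv? (λ _ → proj₁) (λ _ h → h , _))))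

  #Mβ : ∀ β → # 𝕄ₙ (Mβ? β) ≡ AltGL s * ((q ^ s) ^ m * # (𝕄 m m) (inverseTrace? β))
  #Mβ β = trans (#-cong 𝕄ₙ (Mβ? β) (λ A → LT? A ×-dec (Alt? (q₁₁ A) ×-dec R? (q₂₂ A)))
      (λ A ((i , al) , e) → let l , al′ = Alt-E⇒LT i al in l , al′ , trans (sym (t-LT l)) e) (λ A (l , al , e) → (proj₁ l , LT⇒Alt-E l al) , trans (t-LT l) e))
    (#-LT Alt? R? Alt-resp (λ e iD h → trans (sym (cong₂ _+F_ (Tr-cong e) (Tr-cong (inv-cong iD e)))) h))
    where
    R? : ∀ D → Dec (Tr D +F Tr (inv D) ≡ β)
    R? D = (Tr D +F Tr (inv D)) ≟F β

-- Traces of D and its inverse for 1 × 1 and 2 × 2 matrices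

module SmallGL {r : ℕ} (F : BinaryField r) where
  open FieldFacts F hiding (_⊠_) renaming (_≈M_ to infix 4 _≈M_)
  open Matrices F
  open MatrixCounts F
  open TraceCounts F

  #-trace₁ : ∀ β → # (𝕄 1 1) (inverseTrace? β) ≡ c₁ β
  #-trace₁ β = #-bij (𝕄 1 1) 𝔽 (inverseTrace? β) (λ x → ¬? (x ≟F 0F) ×-dec ((x +F x ⁻¹) ≟F β)) (λ D → D zero zero) (λ x _ _ → x)
      (λ { D _ (i , e) refl → let d≢0 = Inv-1×1⁻ i in (d≢0 , trans (sym (traces D d≢0)) e) , 1×1 refl })
      (λ D x (x≢0 , e) h → let d≡x = sym (at h zero zero) ; d≢0 = λ z → x≢0 (trans (sym d≡x) z) in
        ((_ , Inv-1×1 d≢0) , trans (traces D d≢0) (trans (cong (λ z → z +F z ⁻¹) d≡x) e)) , d≡x)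
    where
    traces : ∀ (D : Mat 1 1) → D zero zero ≢ 0F → Tr D +F Tr (inv D) ≡ D zero zero +F D zero zero ⁻¹
    traces D d≢0 = cong₂ _+F_ (+-identityʳ _) (trans (+-identityʳ _) (at (inv-unique (Inv-1×1 {D} d≢0)) zero zero))

  det : Mat 2 2 → Carrier
  det D = D zero zero *F D (suc zero) (suc zero) +F D zero (suc zero) *F D (suc zero) zero

  -- The adjugate, without signs in characteristic 2, scaled by k: with k = 1/det D it is the
  -- inverse, and with k = 1 it serves for singular D.
  adjugate : Carrier → Mat 2 2 → Mat 2 2
  adjugate k D zero       zero       = k *F D (suc zero) (suc zero)
  adjugate k D zero       (suc zero) = k *F D zero (suc zero)
  adjugate k D (suc zero) zero       = k *F D (suc zero) zero
  adjugate k D (suc zero) (suc zero) = k *F D zero zero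

  2×2 : {X Y : Mat 2 2} → X zero zero ≡ Y zero zero → X zero (suc zero) ≡ Y zero (suc zero) →
        X (suc zero) zero ≡ Y (suc zero) zero → X (suc zero) (suc zero) ≡ Y (suc zero) (suc zero) → X ≋ Y
  2×2 a b c d = ≋-intro λ { zero zero → a ; zero (suc zero) → b ; (suc zero) zero → c ; (suc zero) (suc zero) → d }

  opaque
    unfolding _⊠_
    ⊠-2×2 : (X Y : Mat 2 2) (i j : Fin 2) → (X ⊠ Y) i j ≡ X i zero *F Y zero j +F X i (suc zero) *F Y (suc zero) j
    ⊠-2×2 X Y i j = cong (X i zero *F Y zero j +F_) (+-identityʳ _)

  scale : ∀ k x y z w → x *F (k *F w) +F y *F (k *F z) ≡ (x *F w +F y *F z) *F k
  scale k x y z w = solve 5 (λ k x y z w → x :* (k :* w) :+ y :* (k :* z) := (x :* w :+ y :* z) :* k) refl k x y z w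

  vanish : ∀ k x y → x *F (k *F y) +F y *F (k *F x) ≡ 0F
  vanish k x y = solve 3 (λ k x y → x :* (k :* y) :+ y :* (k :* x) := con false) refl k x y

  module _ (k : Carrier) (D : Mat 2 2) where
    private
      x = D zero zero
      y = D zero (suc zero)
      z = D (suc zero) zero
      w = D (suc zero) (suc zero)

    ⊠-adjugate : ∀ {e} → det D *F k ≡ e → D ⊠ adjugate k D ≋ λ i j → e *F 1M i j
    ⊠-adjugate {e} h = 2×2
      (trans (⊠-2×2 D (adjugate k D) zero zero) (trans (scale k x y z w) (trans h (sym (*-identityʳ e)))))
      (trans (⊠-2×2 D (adjugate k D) zero (suc zero)) (trans (vanish k x y) (sym (zeroʳ e))))
      (trans (⊠-2×2 D (adjugate k D) (suc zero) zero) (trans (vanish k z w) (sym (zeroʳ e))))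
      (trans (⊠-2×2 D (adjugate k D) (suc zero) (suc zero)) (trans (trans (scale k z w x y) (trans (cong (_*F k) (trans (+-comm _ _) (cong₂ _+F_ (*-comm w x) (*-comm z y)))) h)) (sym (*-identityʳ e))))

    adjugate-⊠ : det D *F k ≡ 1F → adjugate k D ⊠ D ≋ 1M
    adjugate-⊠ h = 2×2
      (trans (⊠-2×2 (adjugate k D) D zero zero) (trans (cong₂ _+F_ (*-comm _ x) (*-comm _ z)) (trans (cong (x *F (k *F w) +F_) (solve 3 (λ k y z → z :* (k :* y) := y :* (k :* z)) refl k y z)) (trans (scale k x y z w) h))))
      (trans (⊠-2×2 (adjugate k D) D zero (suc zero)) (trans (cong₂ _+F_ (*-comm _ y) (*-comm _ w)) (vanish k y w)))
      (trans (⊠-2×2 (adjugate k D) D (suc zero) zero) (trans (cong₂ _+F_ (*-comm _ x) (*-comm _ z)) (vanish k x z)))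
      (trans (⊠-2×2 (adjugate k D) D (suc zero) (suc zero)) (trans (cong₂ _+F_ (*-comm _ y) (*-comm _ w)) (trans (trans (cong (y *F (k *F z) +F_) (solve 3 (λ k x w → w :* (k :* x) := x :* (k :* w)) refl k x w)) (+-comm _ _)) (trans (scale k x y z w) h))))

  adjugate-inverses : (D : Mat 2 2) → det D ≢ 0F → Inverses D (adjugate (det D ⁻¹) D)
  adjugate-inverses D ne = ≋-trans (⊠-adjugate (det D ⁻¹) D (inverse (det D) ne)) (≋-intro λ i j → *-identityˡ _) , adjugate-⊠ (det D ⁻¹) D (inverse (det D) ne)

  adjugate-det : (D : Mat 2 2) → det D ≡ 0F → D ⊠ adjugate 1F D ≋ 0M
  adjugate-det D e = ≋-trans (⊠-adjugate 1F D (trans (*-identityʳ _) e)) (≋-intro λ i j → zeroˡ _)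

  -- If det D = 0 then D times its adjugate vanishes, so an inverse would kill D.
  det-≢0 : (D : Mat 2 2) → Inv D → det D ≢ 0F
  det-≢0 D (D′ , h , h′) e = 1≢0 (trans (sym (at h zero zero)) (at (⊠-zeroˡ {Y = D′} D≋0) zero zero))
    where
    adj≋0 : adjugate 1F D ≋ 0M
    adj≋0 = ≋-trans (≋-sym (≋-trans (≋-sym (⊠-assoc D′ D _)) (≋-trans (⊠-congʳ h′) (⊠-identityˡ _)))) (⊠-zeroʳ (adjugate-det D e))
    D≋0 : D ≋ 0M
    D≋0 = ≋-intro λ
      { zero       zero       → trans (sym (*-identityˡ _)) (at adj≋0 (suc zero) (suc zero))
      ; zero       (suc zero) → trans (sym (*-identityˡ _)) (at adj≋0 zero (suc zero))
      ; (suc zero) zero       → trans (sym (*-identityˡ _)) (at adj≋0 (suc zero) zero)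
      ; (suc zero) (suc zero) → trans (sym (*-identityˡ _)) (at adj≋0 zero zero) }

  entries : Carrier × Carrier × Carrier × Carrier → Mat 2 2
  entries (x , y , z , w) zero       zero       = x
  entries (x , y , z , w) zero       (suc zero) = y
  entries (x , y , z , w) (suc zero) zero       = z
  entries (x , y , z , w) (suc zero) (suc zero) = w

  #-trace₂ : ∀ β → # (𝕄 2 2) (inverseTrace? β) ≡ c₂ β
  #-trace₂ β = trans (#-bij (𝕄 2 2) 𝔽⁴ (inverseTrace? β) (λ (x , y , z , w) → c₂? β x y z w) (λ D → D zero zero , D zero (suc zero) , D (suc zero) zero , D (suc zero) (suc zero)) entries to from)
      (trans (∑-×ˢ 𝔽 (𝔽 ×ˢ 𝔽 ×ˢ 𝔽) (λ (x , y , z , w) → 𝟙 (c₂? β x y z w))) (∑-cong es λ x →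
        trans (∑-×ˢ 𝔽 (𝔽 ×ˢ 𝔽) (λ (y , z , w) → 𝟙 (c₂? β x y z w))) (∑-cong es λ y → ∑-×ˢ 𝔽 𝔽 (λ (z , w) → 𝟙 (c₂? β x y z w)))))
    where
    es = FiniteSetoid.elems 𝔽
    𝔽⁴ = 𝔽 ×ˢ 𝔽 ×ˢ 𝔽 ×ˢ 𝔽
    traces : ∀ (D : Mat 2 2) → det D ≢ 0F → Tr D +F Tr (inv D) ≡ weigh (D zero zero +F D (suc zero) (suc zero)) (det D)
    traces D ne = trans (cong (Tr D +F_) (Tr-cong (inv-unique (adjugate-inverses D ne))))
      (solve 3 (λ x w k → (x :+ (w :+ con false)) :+ (k :* w :+ (k :* x :+ con false)) := (x :+ w) :* (con true :+ k)) refl (D zero zero) (D (suc zero) (suc zero)) (det D ⁻¹))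
    to : ∀ D ((x , y , z , w) : Carrier × Carrier × Carrier × Carrier) → Inv D × Tr D +F Tr (inv D) ≡ β →
         (D zero zero ≡ x × D zero (suc zero) ≡ y × D (suc zero) zero ≡ z × D (suc zero) (suc zero) ≡ w) →
         (x *F w +F y *F z ≢ 0F × weigh (x +F w) (x *F w +F y *F z) ≡ β) × entries (x , y , z , w) ≋ D
    to D _ (i , e) (refl , refl , refl , refl) = (ne , trans (sym (traces D ne)) e)
        , ≋-intro λ { zero zero → refl ; zero (suc zero) → refl ; (suc zero) zero → refl ; (suc zero) (suc zero) → refl }
      where ne = det-≢0 D i
    from : ∀ D ((x , y , z , w) : Carrier × Carrier × Carrier × Carrier) → x *F w +F y *F z ≢ 0F × weigh (x +F w) (x *F w +F y *F z) ≡ β →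
         entries (x , y , z , w) ≋ D → (Inv D × Tr D +F Tr (inv D) ≡ β) × (D zero zero ≡ x × D zero (suc zero) ≡ y × D (suc zero) zero ≡ z × D (suc zero) (suc zero) ≡ w)
    from D (x , y , z , w) (ne , e) h = (Inv-resp h (_ , adjugate-inverses M ne) , trans (sym (cong₂ _+F_ (Tr-cong h) (Tr-cong (inv-cong (_ , adjugate-inverses M ne) h)))) (trans (traces M ne) e))
        , sym (at h zero zero) , sym (at h zero (suc zero)) , sym (at h (suc zero) zero) , sym (at h (suc zero) (suc zero))
      where M = entries (x , y , z , w)

-- Closed formulas for the group orders, and the reduced count

module ClosedForms {r : ℕ} (F : BinaryField r) where
  open FieldFacts F hiding (_⊠_) renaming (_≈M_ to infix 4 _≈M_)
  open Matrices F
  open MatrixCounts F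
  open FormCounts F
  open TraceCounts F using (2≤q)

  u : ℕ → ℕ
  u k = q ^ k ∸ 1

  1≤q : 1 ≤ q
  1≤q = ℕ.<⇒≤ 2≤q

  instance
    q-nonZero : ℕ.NonZero q
    q-nonZero = ℕ.>-nonZero 1≤q

  suc-u : ∀ k → suc (u k) ≡ q ^ k
  suc-u k = ℕ.m+[n∸m]≡n (ℕ.m^n>0 q k)

  u≢0 : ∀ k → u (suc k) ≢ 0
  u≢0 k e = ℕ.<⇒≢ (ℕ.^-monoʳ-< q 2≤q {0} {suc k} (s≤s z≤n)) (trans (cong suc (sym e)) (suc-u (suc k)))

  u-+ : ∀ a b → u (a + b) ≡ u a + q ^ a * u b
  u-+ a b = ℕ.suc-injective (trans (suc-u (a + b)) (trans (ℕ.^-distribˡ-+-* q a b) (trans (cong (q ^ a *_) (sym (suc-u b)))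
    (trans (ℕ.*-suc (q ^ a) (u b)) (cong (_+ q ^ a * u b) (sym (suc-u a)))))))

  -- Makes the divisions inside the Gaussian binomials exact. It rests on q^(a+b) - 1 = (q^a - 1) +
  -- q^a (q^b - 1).
  u-∣ : ∀ a j → ∃ λ g → u (j * a) ≡ g * u a
  u-∣ a zero    = 0 , refl
  u-∣ a (suc j) with u-∣ a j
  ... | g , e = 1 + q ^ a * g , trans (u-+ a (j * a)) (trans (cong (λ x → u a + q ^ a * x) e) (eq (u a) (q ^ a) g))
    where
    eq : ∀ x y g → x + y * (g * x) ≡ (1 + y * g) * x
    eq = solve-∀

  divℕ-exact : ∀ a b → b ≢ 0 → divℕ (a * b) b ≡ a
  divℕ-exact a zero    h = ⊥-elim (h refl)
  divℕ-exact a (suc b) h = m*n/n≡m a (suc b)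

  #-nonzero : ∀ k → # (𝕄 1 k) (λ v → ¬? (0M? v)) ≡ u k
  #-nonzero k = ℕ.suc-injective (trans (#-≢0 k) (sym (suc-u k)))

  GL-step : ∀ n → GL (suc n) ≡ u (suc n) * (q ^ n * GL n)
  GL-step n = trans (GL-suc n) (cong (_* (q ^ n * GL n)) (#-nonzero (suc n)))

  #-empty : {R : Mat 0 0 → Set} (R? : ∀ X → Dec (R X)) → (∀ X → R X) → # (𝕄 0 0) R? ≡ 1
  #-empty R? h = cong (_+ 0) (𝟙-yes (R? _) (h _))

  GL-0 : GL 0 ≡ 1
  GL-0 = #-empty Inv? (λ X → X , ≋-intro (λ ()) , ≋-intro (λ ()))

  GL-1 : GL 1 ≡ u 1
  GL-1 = trans (GL-step 0) (trans (cong (λ x → u 1 * (1 * x)) GL-0) (ℕ.*-identityʳ (u 1)))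

  GL-2 : GL 2 ≡ u 2 * (q * u 1)
  GL-2 = trans (GL-step 1) (cong₂ (λ x y → u 2 * (x * y)) (ℕ.*-identityʳ q) GL-1)

  *-≢0ℕ : ∀ {a b} → a ≢ 0 → b ≢ 0 → a * b ≢ 0
  *-≢0ℕ {a} h h′ e = [ h , h′ ]′ (ℕ.m*n≡0⇒m≡0∨n≡0 a e)

  q^≢0 : ∀ k → q ^ k ≢ 0
  q^≢0 k e = ℕ.<⇒≢ (ℕ.m^n>0 q k) (sym e)

  GL≢0 : ∀ n → GL n ≢ 0
  GL≢0 zero    e = ℕ.1+n≢0 (trans (sym GL-0) e)
  GL≢0 (suc n) e = *-≢0ℕ (u≢0 n) (*-≢0ℕ (q^≢0 n) (GL≢0 n)) (trans (sym (GL-step n)) e)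

  T : ℕ → ℕ
  T zero    = 0
  T (suc n) = suc n + T n

  #Sym-T : ∀ n → #Sym n ≡ q ^ T n
  #Sym-T zero    = #-empty Symm? (λ X → ≋-intro (λ ()))
  #Sym-T (suc n) = trans (#Sym-suc n) (trans (cong (λ x → q * (q ^ n * x)) (#Sym-T n)) (cong (q *_) (sym (ℕ.^-distribˡ-+-* q n (T n)))))

  T-even : ∀ k → T (2 * k) ≡ k * (2 * k + 1)
  T-even zero    = refl
  T-even (suc k) = trans (cong T (ℕ.*-suc 2 k)) (trans (cong (λ x → suc (suc (2 * k)) + (suc (2 * k) + x)) (T-even k)) (eq k))
    where
    eq : ∀ k → suc (suc (2 * k)) + (suc (2 * k) + k * (2 * k + 1)) ≡ suc k * (2 * suc k + 1)
    eq = solve-∀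

  Podd Peven : ℕ → ℕ
  Podd k  = prodFromTo 1 k (λ j → q ^ (2 * j ∸ 1) ∸ 1)
  Peven k = prodFromTo 1 k (λ j → q ^ (2 * j) ∸ 1)

  prodFromTo-suc : ∀ k f → prodFromTo 1 (suc k) f ≡ prodFromTo 1 k f * f (suc k)
  prodFromTo-suc k f = trans (cong (λ l → product (map (λ k → f (1 + k)) l)) (sym (upTo-∷ʳ k))) (trans (cong product (map-++ (λ k → f (1 + k)) (upTo k) (k ∷ [])))
    (trans (product-++ (map (λ k → f (1 + k)) (upTo k)) _) (cong (prodFromTo 1 k f *_) (ℕ.*-identityʳ _))))

  AltGL-suc : ∀ k → AltGL (2 * suc k) ≡ u (suc (2 * k)) * (q ^ (2 * k) * AltGL (2 * k))
  AltGL-suc k = trans (cong AltGL (ℕ.*-suc 2 k)) (trans (AltStep.AltGL-step (2 * k)) (cong (_* (q ^ (2 * k) * AltGL (2 * k))) (#-nonzero (suc (2 * k)))))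

  q^2k : ∀ k → q ^ (2 * k) ≡ q ^ k * q ^ k
  q^2k k = trans (cong (λ x → q ^ (k + x)) (ℕ.+-identityʳ k)) (ℕ.^-distribˡ-+-* q k k)

  q^square : ∀ k → q ^ (suc k * suc k) ≡ q * (q ^ k * q ^ k) * q ^ (k * k)
  q^square k = trans (cong (q ^_) (eq k)) (trans (ℕ.^-distribˡ-+-* q (suc (2 * k)) (k * k)) (cong (λ x → q * x * q ^ (k * k)) (q^2k k)))
    where
    eq : ∀ k → suc k * suc k ≡ suc (2 * k) + k * k
    eq = solve-∀

  Podd-suc : ∀ k → Podd (suc k) ≡ Podd k * u (suc (2 * k))
  Podd-suc k = trans (prodFromTo-suc k (λ j → q ^ (2 * j ∸ 1) ∸ 1)) (cong (λ x → Podd k * (q ^ (x ∸ 1) ∸ 1)) (ℕ.*-suc 2 k))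

  Peven-suc : ∀ k → Peven (suc k) ≡ Peven k * u (suc (suc (2 * k)))
  Peven-suc k = trans (prodFromTo-suc k (λ j → q ^ (2 * j) ∸ 1)) (cong (λ x → Peven k * (q ^ x ∸ 1)) (ℕ.*-suc 2 k))

  -- The classical count of invertible alternating matrices has the exponent k² - k; the factor q^k
  -- on the left avoids this subtraction.
  AltGL-even : ∀ k → AltGL (2 * k) * q ^ k ≡ q ^ (k * k) * Podd k
  AltGL-even zero    = cong (_* 1) (#-empty AltGL? (λ X → (X , ≋-intro (λ ()) , ≋-intro (λ ())) , alternating (λ ()) (≋-intro λ ())))
  AltGL-even (suc k) = begin
    AltGL (2 * suc k) * q ^ suc k                                        ≡⟨ cong (_* q ^ suc k) (AltGL-suc k) ⟩
    u (suc (2 * k)) * (q ^ (2 * k) * AltGL (2 * k)) * (q * q ^ k)        ≡⟨ e₁ (u (suc (2 * k))) (q ^ (2 * k)) (AltGL (2 * k)) q (q ^ k) ⟩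
    q * q ^ (2 * k) * u (suc (2 * k)) * (AltGL (2 * k) * q ^ k)          ≡⟨ cong₂ (λ x y → q * x * u (suc (2 * k)) * y) (q^2k k) (AltGL-even k) ⟩
    q * (q ^ k * q ^ k) * u (suc (2 * k)) * (q ^ (k * k) * Podd k)       ≡⟨ e₂ (q * (q ^ k * q ^ k)) (u (suc (2 * k))) (q ^ (k * k)) (Podd k) ⟩
    q * (q ^ k * q ^ k) * q ^ (k * k) * (Podd k * u (suc (2 * k)))       ≡⟨ cong₂ _*_ (q^square k) (Podd-suc k) ⟨
    q ^ (suc k * suc k) * Podd (suc k)                                   ∎
    where
    open ≡-Reasoning
    e₁ : ∀ u x a q y → u * (x * a) * (q * y) ≡ q * x * u * (a * y)
    e₁ = solve-∀
    e₂ : ∀ a b c d → a * b * (c * d) ≡ a * c * (d * b)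
    e₂ = solve-∀

  -- The cofactor q^(k²) · `Peven k` is the order of Sp(2k,q), the stabiliser of one invertible
  -- alternating matrix under congruence. Comparing the two recursions in k proves the formula
  -- directly.
  GL-even : ∀ k → GL (2 * k) ≡ AltGL (2 * k) * (q ^ (k * k) * Peven k)
  GL-even zero    = trans GL-0 (sym (cong (_* 1) (#-empty AltGL? (λ X → (X , ≋-intro (λ ()) , ≋-intro (λ ())) , alternating (λ ()) (≋-intro λ ())))))
  GL-even (suc k) = begin
    GL (2 * suc k)                                                                ≡⟨ trans (cong GL (ℕ.*-suc 2 k)) (trans (GL-step (suc (2 * k))) (cong (λ x → u₂ * (q ^ suc (2 * k) * x)) (GL-step (2 * k)))) ⟩
    u₂ * (q * q ^ (2 * k) * (u₁ * (q ^ (2 * k) * GL (2 * k))))                    ≡⟨ cong₂ (λ x y → u₂ * (q * x * (u₁ * (q ^ (2 * k) * y)))) (q^2k k) (GL-even k) ⟩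
    u₂ * (q * (q ^ k * q ^ k) * (u₁ * (q ^ (2 * k) * (AltGL (2 * k) * (q ^ (k * k) * Peven k))))) ≡⟨ e u₂ (q * (q ^ k * q ^ k)) u₁ (q ^ (2 * k)) (AltGL (2 * k)) (q ^ (k * k)) (Peven k) ⟩
    u₁ * (q ^ (2 * k) * AltGL (2 * k)) * (q * (q ^ k * q ^ k) * q ^ (k * k) * (Peven k * u₂))     ≡⟨ cong₂ _*_ (AltGL-suc k) (cong₂ _*_ (q^square k) (Peven-suc k)) ⟨
    AltGL (2 * suc k) * (q ^ (suc k * suc k) * Peven (suc k))                     ∎
    where
    open ≡-Reasoning
    u₁ = u (suc (2 * k))
    u₂ = u (suc (suc (2 * k)))
    e : ∀ a b c d x y z → a * (b * (c * (d * (x * (y * z))))) ≡ c * (d * x) * (b * y * (z * a))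
    e = solve-∀

  cancel-*ˡ : ∀ x {y z} → x ≢ 0 → x * y ≡ x * z → y ≡ z
  cancel-*ˡ zero    h e = ⊥-elim (h refl)
  cancel-*ˡ (suc x) h e = ℕ.*-cancelˡ-≡ _ _ (suc x) e

  module Reduced (s m : ℕ) (G B′ : ℕ) where
    open Cosets F s m using (n; trace-count; coset-equation)
    open CosetCounts F s m using (#P; #H; #X; #M; #Mβ)

    D W : ℕ
    D = AltGL s * (q ^ s) ^ m
    W = G * #Sym s * #Sym n * D

    -- h K₂ is the order of P ∩ σPσ. `G` is the index in GL n of the block triangular matrices, and
    -- D · GL m counts the invertible A with EA alternating. These two factorisations of GL n make h
    -- K₂ a visible common factor of both sides; after its cancellation W is the A of the theorem,
    -- up to a factor q.
    reduced : GL n ≡ G * (GL s * ((q ^ s) ^ m * GL m)) → GL n ≡ D * B′ →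
      ∀ {L} (g : Fin L → Mat (n + n) (n + n)) (ord : IsOrdering (InPσP n s) L g) β →
      q * trace-count g ord β + W * GL m ≡ W * (B′ + q * # (𝕄 m m) (inverseTrace? β))
    reduced hG hB g ord β = cancel-*ˡ (h * K₂) hK≢0 (begin
        h * K₂ * (q * N + W * GL m)
          ≡⟨ e₁ h K₂ q N G Sₛ Sₙ (AltGL s) Q (GL m) ⟩
        q * (N * (h * K₂)) + G * h * (Sₛ * K₂) * (Sₙ * (AltGL s * (Q * GL m)))
          ≡⟨ cong₂ (λ x y → q * x + y) E1 (cong₂ (λ x y → x * y * (Sₙ * (AltGL s * (Q * GL m)))) (sym hG) (sym hS)) ⟩
        q * (GL n * Sₙ * X) + GL n * Sₙ * (Sₙ * (AltGL s * (Q * GL m)))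
          ≡⟨ e₂ q (GL n) Sₙ X (Sₙ * (AltGL s * (Q * GL m))) ⟩
        GL n * Sₙ * (q * X + Sₙ * (AltGL s * (Q * GL m)))
          ≡⟨ cong (GL n * Sₙ *_) E2 ⟩
        GL n * Sₙ * (Sₙ * (GL n + q * (AltGL s * (Q * c))))
          ≡⟨ cong₂ (λ x y → x * (Sₙ * (y + q * (AltGL s * (Q * c))))) (cong₂ _*_ hG hS) hB ⟩
        G * h * (Sₛ * K₂) * (Sₙ * (AltGL s * Q * B′ + q * (AltGL s * (Q * c))))
          ≡⟨ e₃ h K₂ G Sₛ Sₙ (AltGL s) Q B′ q c ⟩
        h * K₂ * (W * (B′ + q * c)) ∎)
      where
      open ≡-Reasoning
      Q = (q ^ s) ^ m
      h = GL s * (Q * GL m)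
      K₂ = Q * #Sym m
      Sₛ = #Sym s
      Sₙ = #Sym n
      N = trace-count g ord β
      X = # (Cosets.𝕄₂ F s m) (Cosets.X? F s m β)
      c = # (𝕄 m m) (inverseTrace? β)
      E1 : N * (h * K₂) ≡ GL n * Sₙ * X
      E1 = trans (cong (N *_) (sym #H)) (trans (coset-equation g ord β) (cong (_* X) #P))
      E2 : q * X + Sₙ * (AltGL s * (Q * GL m)) ≡ Sₙ * (GL n + q * (AltGL s * (Q * c)))
      E2 = trans (cong (λ x → q * X + Sₙ * x) (sym #M)) (trans (#X β) (cong (λ x → Sₙ * (GL n + q * x)) (#Mβ β)))
      hS : Sₙ ≡ Sₛ * K₂
      hS = trans (#-cong (𝕄 n n) Symm? (λ B → Symm? B ×-dec ⊤?) (λ _ x → x , _) (λ _ → proj₁)) (trans (#-Sym s m {R = λ _ → ⊤} (λ _ → ⊤?) _)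
        (cong (_* K₂) (#-cong (𝕄 s s) (λ B → Symm? B ×-dec ⊤?) Symm? (λ _ → proj₁) (λ _ x → x , _))))
      Q≢0 : Q ≢ 0
      Q≢0 e = ℕ.<⇒≢ (ℕ.m^n>0 (q ^ s) {{ℕ.m^n≢0 q s}} m) (sym e)
      hK≢0 : h * K₂ ≢ 0
      hK≢0 = *-≢0ℕ (*-≢0ℕ (GL≢0 s) (*-≢0ℕ Q≢0 (GL≢0 m))) (*-≢0ℕ Q≢0 (λ e → q^≢0 (T m) (trans (sym (#Sym-T m)) e)))
      e₁ : ∀ h K q N G S S′ A Q g → h * K * (q * N + G * S * S′ * (A * Q) * g) ≡ q * (N * (h * K)) + G * h * (S * K) * (S′ * (A * (Q * g)))
      e₁ = solve-∀
      e₂ : ∀ q g S X y → q * (g * S * X) + g * S * y ≡ g * S * (q * X + y)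
      e₂ = solve-∀
      e₃ : ∀ h K G S S′ A Q B q c → G * h * (S * K) * (S′ * (A * Q * B + q * (A * (Q * c)))) ≡ h * K * (G * S * S′ * (A * Q) * (B + q * c))
      e₃ = solve-∀

-- From the counting equations to the formulas of the theorem

open import Data.Integer using (ℤ; +_; -[1+_])

-- The counting equations live in ℕ with all terms positive. Moving a x across yields the correction
-- c = y - x, which may be negative, as in the tops of the binomial coefficients.
top-factor : ∀ {N a B x y} {c : ℤ} → N + a * x ≡ a * (B + y) → c ℤ.+ + x ≡ + y → + N ≡ + a ℤ.* (+ B ℤ.+ c)
top-factor {N} {a} {B} {x} {y} {c} e h = ∙-cancelʳ (+ (a * x)) (+ N) (+ a ℤ.* (+ B ℤ.+ c)) (begin
    + N ℤ.+ + (a * x)                          ≡⟨ cong +_ e ⟩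
    + (a * (B + y))                            ≡⟨ ℤ.pos-* a (B + y) ⟩
    + a ℤ.* (+ B ℤ.+ + y)                      ≡⟨ cong (λ z → + a ℤ.* (+ B ℤ.+ z)) h ⟨
    + a ℤ.* (+ B ℤ.+ (c ℤ.+ + x))              ≡⟨ eq (+ a) (+ B) c (+ x) ⟩
    + a ℤ.* (+ B ℤ.+ c) ℤ.+ + a ℤ.* + x        ≡⟨ cong (λ z → + a ℤ.* (+ B ℤ.+ c) ℤ.+ z) (ℤ.pos-* a x) ⟨
    + a ℤ.* (+ B ℤ.+ c) ℤ.+ + (a * x)          ∎)
  where
  open ≡-Reasoning
  open import Algebra.Properties.AbelianGroup ℤ.+-0-abelianGroup using (∙-cancelʳ)
  eq : ∀ a b c x → a ℤ.* (b ℤ.+ (c ℤ.+ x)) ≡ a ℤ.* (b ℤ.+ c) ℤ.+ a ℤ.* x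
  eq = ℤ.solve-∀

difference : ∀ {a b x y} → a + x ≡ y + b + 1 → (+ a ℤ.- + b ℤ.- + 1) ℤ.+ + x ≡ + y
difference {a} {b} {x} {y} e = trans (e₁ (+ a) (+ b) (+ x)) (trans (cong (λ z → z ℤ.- + b ℤ.- + 1) (cong +_ e)) (e₂ (+ y) (+ b)))
  where
  e₁ : ∀ a b x → (a ℤ.- b ℤ.- + 1) ℤ.+ x ≡ (a ℤ.+ x) ℤ.- b ℤ.- + 1
  e₁ = ℤ.solve-∀
  e₂ : ∀ y b → (y ℤ.+ b ℤ.+ + 1) ℤ.- b ℤ.- + 1 ≡ y
  e₂ = ℤ.solve-∀

module IndexProducts {r : ℕ} (F : BinaryField r) where
  open FieldFacts F
  open Codewords F

  ∏-idx0 : (f : Fin q → ℕ) → f (idx 0F) ≡ ∏Fin (λ i → if does (i Fin.≟ idx 0F) then f i else 1)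
  ∏-idx0 f = sym (∏-once Fin._≟_ (allFin q) (idx 0F) f (∑ₗ-allFin-once (idx 0F)))

  ∏-nonzeroIdx : (P : Carrier → Bool) (f : Fin q → ℕ) →
    ∏over (nonzeroIdx P) f ≡ ∏Fin (λ i → if ⌊ ¬? (el i ≟F 0F) ⌋ ∧ P (el i) then f i else 1)
  ∏-nonzeroIdx P f = trans (∏-filter (λ i → Data.Bool._≟_ (⌊ ¬? (el i ≟F 0F) ⌋ ∧ P (el i)) true) (allFin q) f)
    (∏-cong (allFin q) λ i → go (⌊ ¬? (el i ≟F 0F) ⌋ ∧ P (el i)) i)
    where
    go : ∀ b i → (if does (Data.Bool._≟_ b true) then f i else 1) ≡ (if b then f i else 1)
    go true  i = refl
    go false i = refl

  at-idx0 : ∀ i → el i ≡ 0F → i ≡ idx 0F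
  at-idx0 i e = trans (sym (idx-el i)) (cong idx e)

  off-idx0 : ∀ i → el i ≢ 0F → i ≢ idx 0F
  off-idx0 i ne refl = ne (el-idx 0F)

-- Odd n: blocks of sizes n - 1 and 1

module Odd {r : ℕ} (F : BinaryField r) (k : ℕ) where
  open FieldFacts F hiding (_⊠_) renaming (_≈M_ to infix 4 _≈M_)
  open Matrices F using (inv)
  open MatrixCounts F
  open FormCounts F
  open TraceFacts F using (tr-0∨1)
  open TraceCounts F
  open ClosedForms F
  open SmallGL F
  open Codewords F
  open IndexProducts F

  n : ℕ
  n = 2 * k + 1

  n≡ : n ≡ suc (2 * k)
  n≡ = ℕ.+-comm (2 * k) 1

  open Reduced (2 * k) 1 (gauss n 1) (Bminus n)

  q-1-divides : gauss n 1 * u 1 ≡ u n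
  q-1-divides with u-∣ 1 n
  ... | g , e = trans (cong (_* u 1) gauss≡) (sym un≡)
    where
    un≡ : u n ≡ g * u 1
    un≡ = trans (cong u (sym (ℕ.*-identityʳ n))) e
    gauss≡ : gauss n 1 ≡ g
    gauss≡ = trans (cong₂ divℕ (trans (ℕ.*-identityʳ (u n)) un≡) (ℕ.*-identityʳ (u 1))) (divℕ-exact g (u 1) (u≢0 0))

  GL-n : GL n ≡ u n * (q ^ (2 * k) * GL (2 * k))
  GL-n = trans (cong GL n≡) (trans (GL-step (2 * k)) (cong (λ x → u x * (q ^ (2 * k) * GL (2 * k))) (sym n≡)))

  -- The index of the block triangular group is the Gaussian binomial of n over n - 1, which equals
  -- that of n over 1 by symmetry.
  flags : GL n ≡ gauss n 1 * (GL (2 * k) * ((q ^ (2 * k)) ^ 1 * GL 1))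
  flags = begin
    GL n                                                          ≡⟨ GL-n ⟩
    u n * (q ^ (2 * k) * GL (2 * k))                              ≡⟨ cong (_* (q ^ (2 * k) * GL (2 * k))) q-1-divides ⟨
    gauss n 1 * u 1 * (q ^ (2 * k) * GL (2 * k))                  ≡⟨ eq (gauss n 1) (u 1) (q ^ (2 * k)) (GL (2 * k)) ⟩
    gauss n 1 * (GL (2 * k) * ((q ^ (2 * k)) * 1 * u 1))          ≡⟨ cong (λ x → gauss n 1 * (GL (2 * k) * ((q ^ (2 * k)) * 1 * x))) GL-1 ⟨
    gauss n 1 * (GL (2 * k) * ((q ^ (2 * k)) ^ 1 * GL 1))         ∎
    where
    open ≡-Reasoning
    eq : ∀ a b c d → a * b * (c * d) ≡ a * (d * (c * 1 * b))
    eq = solve-∀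

  half : (n ∸ 1) / 2 ≡ k
  half = trans (cong (_/ 2) (trans (ℕ.m+n∸n≡m (2 * k) 1) (ℕ.*-comm 2 k))) (m*n/n≡m k 2)

  Bminus≡ : Bminus n ≡ q ^ (k * k) * u n * Peven k
  Bminus≡ = cong₂ (λ x y → q ^ x * u n * Peven y) (trans (cong (λ x → x * x / 4) (ℕ.m+n∸n≡m (2 * k) 1)) (trans (cong (_/ 4) (eq k)) (m*n/n≡m (k * k) 4))) half
    where
    eq : ∀ k → 2 * k * (2 * k) ≡ k * k * 4
    eq = solve-∀

  order : GL n ≡ D * Bminus n
  order = trans GL-n (trans (cong (λ x → u n * (q ^ (2 * k) * x)) (GL-even k)) (trans (eq (u n) (q ^ (2 * k)) (AltGL (2 * k)) (q ^ (k * k)) (Peven k)) (cong (D *_) (sym Bminus≡))))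
    where
    eq : ∀ u x a y p → u * (x * (a * (y * p))) ≡ a * (x * 1) * (y * u * p)
    eq = solve-∀

  -- For n = 2k + 1 the exponent (5n² - 1)/4 is e₀ + 1, so `A₀` is the quotient of `Aminus n` by q.
  e₀ A₀ : ℕ
  e₀ = 5 * k * k + 5 * k
  A₀ = q ^ e₀ * gauss n 1 * Podd k

  Aminus≡ : Aminus n ≡ q * A₀
  Aminus≡ = trans (cong₂ (λ x y → q ^ x * gauss n 1 * Podd y) (trans (cong (λ x → (x ∸ 1) / 4) (eq k)) (m*n/n≡m (suc e₀) 4)) half) (eq′ q (q ^ e₀) (gauss n 1) (Podd k))
    where
    eq : ∀ k → 5 * (2 * k + 1) * (2 * k + 1) ≡ suc (suc (5 * k * k + 5 * k) * 4)
    eq = solve-∀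
    eq′ : ∀ q x g p → q * x * g * p ≡ q * (x * g * p)
    eq′ = solve-∀

  A₀≡ : divℕ (Aminus n) q ≡ A₀
  A₀≡ = trans (cong (λ x → divℕ x q) (trans Aminus≡ (ℕ.*-comm q A₀))) (divℕ-exact A₀ q (λ e → ℕ.<⇒≢ 1≤q (sym e)))

  W≡ : W ≡ q * A₀
  W≡ = begin
    g * #Sym (2 * k) * #Sym n * (AltGL (2 * k) * (q ^ (2 * k)) ^ 1)
      ≡⟨ cong₂ (λ x y → g * x * y * (AltGL (2 * k) * (q ^ (2 * k)) ^ 1)) (#Sym-T (2 * k)) (trans (#Sym-T n) (cong (λ x → q ^ T x) n≡)) ⟩
    g * q ^ T (2 * k) * q ^ T (suc (2 * k)) * (AltGL (2 * k) * (q ^ (2 * k) * 1))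
      ≡⟨ cong (λ x → g * q ^ T (2 * k) * q ^ T (suc (2 * k)) * (AltGL (2 * k) * (x * 1))) (q^2k k) ⟩
    g * q ^ T (2 * k) * q ^ T (suc (2 * k)) * (AltGL (2 * k) * (q ^ k * q ^ k * 1))
      ≡⟨ e₁ g (q ^ T (2 * k)) (q ^ T (suc (2 * k))) (AltGL (2 * k)) (q ^ k) ⟩
    g * (q ^ T (2 * k) * q ^ T (suc (2 * k)) * q ^ k * (AltGL (2 * k) * q ^ k))
      ≡⟨ cong₂ (λ x y → g * (x * q ^ k * y)) (sym (ℕ.^-distribˡ-+-* q (T (2 * k)) (T (suc (2 * k))))) (AltGL-even k) ⟩
    g * (q ^ (T (2 * k) + T (suc (2 * k))) * q ^ k * (q ^ (k * k) * Podd k))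
      ≡⟨ e₂ g (q ^ (T (2 * k) + T (suc (2 * k)))) (q ^ k) (q ^ (k * k)) (Podd k) ⟩
    g * Podd k * (q ^ (T (2 * k) + T (suc (2 * k))) * q ^ k * q ^ (k * k))
      ≡⟨ cong (λ x → g * Podd k * x) (trans (cong (_* q ^ (k * k)) (sym (ℕ.^-distribˡ-+-* q (T (2 * k) + T (suc (2 * k))) k))) (sym (ℕ.^-distribˡ-+-* q (T (2 * k) + T (suc (2 * k)) + k) (k * k)))) ⟩
    g * Podd k * q ^ (T (2 * k) + T (suc (2 * k)) + k + k * k)
      ≡⟨ cong (λ x → g * Podd k * q ^ x) (trans (cong (λ x → x + (suc (2 * k) + x) + k + k * k) (T-even k)) (e₃ k)) ⟩
    g * Podd k * (q * q ^ e₀)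
      ≡⟨ e₄ g (Podd k) q (q ^ e₀) ⟩
    q * A₀ ∎
    where
    open ≡-Reasoning
    g = gauss n 1
    e₁ : ∀ g x y a z → g * x * y * (a * (z * z * 1)) ≡ g * (x * y * z * (a * z))
    e₁ = solve-∀
    e₂ : ∀ g x y z p → g * (x * y * (z * p)) ≡ g * p * (x * y * z)
    e₂ = solve-∀
    e₃ : ∀ k → k * (2 * k + 1) + (suc (2 * k) + k * (2 * k + 1)) + k + k * k ≡ suc (5 * k * k + 5 * k)
    e₃ = solve-∀
    e₄ : ∀ g p q x → g * p * (q * x) ≡ q * (x * g * p)
    e₄ = solve-∀

  module _ {L : ℕ} (g : Fin L → Mat (n + n) (n + n)) (ord : IsOrdering (InPσP n (2 * k)) L g) where

    count : Fin q → ℕ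
    count = occurrences (λ j → Tr (g j))

    -- Moving q - 1 across, the values 1, 2 and 0 of `c₁` yield the corrections 1, q + 1 and 1 - q
    -- of the three kinds of binomials.
    count-equation : ∀ i → count i + A₀ * u 1 ≡ A₀ * (Bminus n + q * c₁ (el i))
    count-equation i = cancel-*ˡ q (λ e → ℕ.<⇒≢ 1≤q (sym e)) (begin
      q * (count i + A₀ * u 1)                     ≡⟨ eq q (count i) A₀ (u 1) ⟩
      q * count i + q * A₀ * u 1                   ≡⟨ cong₂ (λ x y → q * count i + x * y) (sym W≡) (sym GL-1) ⟩
      q * count i + W * GL 1                       ≡⟨ reduced flags order g ord (el i) ⟩
      W * (Bminus n + q * # 𝕄₁₁ (inverseTrace? (el i)))  ≡⟨ cong₂ (λ x y → x * (Bminus n + q * y)) W≡ (#-trace₁ (el i)) ⟩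
      q * A₀ * (Bminus n + q * c₁ (el i))          ≡⟨ ℕ.*-assoc q A₀ _ ⟩
      q * (A₀ * (Bminus n + q * c₁ (el i)))        ∎)
      where
      open ≡-Reasoning
      𝕄₁₁ = Matrices.𝕄 F 1 1
      eq : ∀ q x a y → q * (x + a * y) ≡ q * x + q * a * y
      eq = solve-∀

    count-top : ∀ i (c : ℤ) → c ℤ.+ + u 1 ≡ + (q * c₁ (el i)) → + count i ≡ topℤ (Aminus n) (Bminus n) c
    count-top i c h = trans (top-factor {N = count i} {A₀} {Bminus n} {u 1} {q * c₁ (el i)} {c} (count-equation i) h) (cong (λ x → + x ℤ.* (+ Bminus n ℤ.+ c)) (sym A₀≡))

    suc-u1 : suc (u 1) ≡ q
    suc-u1 = trans (suc-u 1) (ℕ.*-identityʳ q)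

    count-0 : ∀ i → el i ≡ 0F → + count i ≡ topℤ (Aminus n) (Bminus n) (+ 1)
    count-0 i e = count-top i (+ 1) (cong +_ (trans (suc-u 1) (cong (q *_) (sym (trans (cong c₁ e) c₁-0)))))

    count-tr0 : ∀ i → el i ≢ 0F → tr (el i ⁻¹) ≡ 0F → + count i ≡ topℤ (Aminus n) (Bminus n) (+ q ℤ.+ + 1)
    count-tr0 i ne e = count-top i (+ q ℤ.+ + 1) (cong +_ (trans (ℕ.+-assoc q 1 (u 1)) (trans (cong (λ x → q + x) suc-u1)
      (trans (eq q) (cong (q *_) (sym (trans (c₁-≢0 (el i) ne) (cong (2 *_) (𝟙-yes (tr (el i ⁻¹) ≟F 0F) e)))))))))
      where
      eq : ∀ x → x + x ≡ x * 2
      eq = solve-∀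

    count-tr1 : ∀ i → el i ≢ 0F → tr (el i ⁻¹) ≢ 0F → + count i ≡ topℤ (Aminus n) (Bminus n) (ℤ.- (+ q) ℤ.+ + 1)
    count-tr1 i ne e = count-top i (ℤ.- (+ q) ℤ.+ + 1) (trans (ℤ.+-assoc (ℤ.- (+ q)) (+ 1) (+ u 1)) (trans (cong (λ x → ℤ.- (+ q) ℤ.+ + x) suc-u1)
      (trans (ℤ.+-inverseˡ (+ q)) (cong +_ (sym (trans (cong (q *_) (trans (c₁-≢0 (el i) ne) (cong (2 *_) (𝟙-no (tr (el i ⁻¹) ≟F 0F) e)))) (ℕ.*-zeroʳ q)))))))

    private
      term₀ term₁ term₂ : (Fin q → ℕ) → Fin q → ℕ
      term₀ ν i = binomℤ (topℤ (Aminus n) (Bminus n) (+ 1)) (ν i)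
      term₁ ν i = binomℤ (topℤ (Aminus n) (Bminus n) (+ q ℤ.+ + 1)) (ν i)
      term₂ ν i = binomℤ (topℤ (Aminus n) (Bminus n) (ℤ.- (+ q) ℤ.+ + 1)) (ν i)

    factor : ∀ ν i → count i C ν i ≡ (if does (i Fin.≟ idx 0F) then term₀ ν i else 1)
      * (if ⌊ ¬? (el i ≟F 0F) ⌋ ∧ ⌊ tr (el i ⁻¹) ≟F 0F ⌋ then term₁ ν i else 1)
      * (if ⌊ ¬? (el i ≟F 0F) ⌋ ∧ ⌊ tr (el i ⁻¹) ≟F 1F ⌋ then term₂ ν i else 1)
    factor ν i with el i ≟F 0F | i Fin.≟ idx 0F
    ... | yes e | yes _ = trans (cong (λ z → binomℤ z (ν i)) (count-0 i e)) (sym (trans (ℕ.*-identityʳ _) (ℕ.*-identityʳ _)))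
    ... | yes e | no ne = ⊥-elim (ne (at-idx0 i e))
    ... | no ne | yes e = ⊥-elim (off-idx0 i ne e)
    ... | no ne | no _ with tr (el i ⁻¹) ≟F 0F | tr (el i ⁻¹) ≟F 1F
    ...   | yes t | no _  = trans (cong (λ z → binomℤ z (ν i)) (count-tr0 i ne t)) (sym (trans (ℕ.*-identityʳ _) (ℕ.*-identityˡ _)))
    ...   | no t  | yes _ = trans (cong (λ z → binomℤ z (ν i)) (count-tr1 i ne t)) (sym (ℕ.*-identityˡ _))
    ...   | yes t | yes t′ = ⊥-elim (0≢1 (trans (sym t) t′))
    ...   | no t  | no t′ with tr-0∨1 (el i ⁻¹)
    ...     | inj₁ z = ⊥-elim (t z)
    ...     | inj₂ z = ⊥-elim (t′ z)

    codeCount-minus : ∀ j → codeCount L g j ≡ formulaMinus n j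
    codeCount-minus j = trans (codeCount-families g j) (∑-cong (families j) λ ν → trans (∏-cong (allFin q) (factor ν)) (trans (∏-* (allFin q) _ _)
      (cong₂ _*_ (trans (∏-* (allFin q) _ _) (cong₂ _*_ (sym (∏-idx0 (term₀ ν))) (sym (∏-nonzeroIdx (λ β → ⌊ tr (β ⁻¹) ≟F 0F ⌋) (term₁ ν)))))
        (sym (∏-nonzeroIdx (λ β → ⌊ tr (β ⁻¹) ≟F 1F ⌋) (term₂ ν))))))

-- Even n: blocks of sizes n - 2 and 2

module Even {r : ℕ} (F : BinaryField r) (4≤q : 4 ≤ 2 ^ r) (k : ℕ) where
  open FieldFacts F hiding (_⊠_) renaming (_≈M_ to infix 4 _≈M_)
  open MatrixCounts F
  open FormCounts F
  open TraceFacts F using (n₀; n₁; n₀+n₁; K≡n₀-n₁)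
  open TraceCounts F
  open ClosedForms F
  open SmallGL F
  open Codewords F
  open IndexProducts F

  n : ℕ
  n = 2 * k + 2

  n≡ : n ≡ suc (suc (2 * k))
  n≡ = ℕ.+-comm (2 * k) 2

  n-1≡ : n ∸ 1 ≡ suc (2 * k)
  n-1≡ = cong (_∸ 1) n≡

  -- In the even case GL n has the order D · q · B⁺. The q included here, together with the q in GL
  -- 2, cancels against the q in front of the count, so W is A⁺/q, whereas in the odd case W is A⁻
  -- itself.
  open Reduced (2 * k) 2 (gauss n 2) (q * Bplus n)

  -- The quotient splits into two exact ones: q² - 1 divides q^n - 1 because n is even, and q - 1
  -- divides q^(n-1) - 1.
  gauss-2 : gauss n 2 * (u 2 * u 1) ≡ u n * u (n ∸ 1)
  gauss-2 with u-∣ 2 (suc k) | u-∣ 1 (n ∸ 1)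
  ... | g , e | g′ , e′ = trans (cong (_* (u 2 * u 1)) gauss≡) (trans (eq g g′ (u 2) (u 1)) (sym (cong₂ _*_ un≡ un-1≡)))
    where
    eq : ∀ g g′ x y → g * g′ * (x * y) ≡ g * x * (g′ * y)
    eq = solve-∀
    index : ∀ k → 2 * k + 2 ≡ suc k * 2
    index = solve-∀
    un≡ : u n ≡ g * u 2
    un≡ = trans (cong u (index k)) e
    un-1≡ : u (n ∸ 1) ≡ g′ * u 1
    un-1≡ = trans (cong u (sym (ℕ.*-identityʳ (n ∸ 1)))) e′
    gauss≡ : gauss n 2 ≡ g * g′
    gauss≡ = trans (cong₂ divℕ (trans (cong₂ _*_ un≡ (trans (ℕ.*-identityʳ (u (n ∸ 1))) un-1≡)) (sym (eq g g′ (u 2) (u 1)))) (cong (u 2 *_) (ℕ.*-identityʳ (u 1))))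
      (divℕ-exact (g * g′) (u 2 * u 1) (*-≢0ℕ (u≢0 1) (u≢0 0)))

  GL-n : GL n ≡ u n * (q ^ suc (2 * k) * (u (n ∸ 1) * (q ^ (2 * k) * GL (2 * k))))
  GL-n = trans (cong GL n≡) (trans (GL-step (suc (2 * k))) (trans (cong (λ x → u (suc (suc (2 * k))) * (q ^ suc (2 * k) * x)) (GL-step (2 * k)))
    (cong₂ (λ x y → u x * (q ^ suc (2 * k) * (u y * (q ^ (2 * k) * GL (2 * k))))) (sym n≡) (sym n-1≡))))

  flags : GL n ≡ gauss n 2 * (GL (2 * k) * ((q ^ (2 * k)) ^ 2 * GL 2))
  flags = begin
    GL n                                                                         ≡⟨ GL-n ⟩
    u n * (q * q ^ (2 * k) * (u (n ∸ 1) * (q ^ (2 * k) * GL (2 * k))))           ≡⟨ e₁ (u n) (u (n ∸ 1)) q (q ^ (2 * k)) (GL (2 * k)) ⟩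
    u n * u (n ∸ 1) * (q * (q ^ (2 * k) * q ^ (2 * k)) * GL (2 * k))             ≡⟨ cong (_* (q * (q ^ (2 * k) * q ^ (2 * k)) * GL (2 * k))) gauss-2 ⟨
    gauss n 2 * (u 2 * u 1) * (q * (q ^ (2 * k) * q ^ (2 * k)) * GL (2 * k))     ≡⟨ e₂ (gauss n 2) (u 2) (u 1) q (q ^ (2 * k)) (GL (2 * k)) ⟩
    gauss n 2 * (GL (2 * k) * ((q ^ (2 * k)) ^ 2 * (u 2 * (q * u 1))))           ≡⟨ cong (λ x → gauss n 2 * (GL (2 * k) * ((q ^ (2 * k)) ^ 2 * x))) GL-2 ⟨
    gauss n 2 * (GL (2 * k) * ((q ^ (2 * k)) ^ 2 * GL 2))                        ∎
    where
    open ≡-Reasoning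
    e₁ : ∀ a b q x g → a * (q * x * (b * (x * g))) ≡ a * b * (q * (x * x) * g)
    e₁ = solve-∀
    e₂ : ∀ G a b q x g → G * (a * b) * (q * (x * x) * g) ≡ G * (g * (x * (x * 1) * (a * (q * b))))
    e₂ = solve-∀

  half : (n ∸ 2) / 2 ≡ k
  half = trans (cong (_/ 2) (trans (ℕ.m+n∸n≡m (2 * k) 2) (ℕ.*-comm 2 k))) (m*n/n≡m k 2)

  Bplus≡ : Bplus n ≡ q ^ (k * k) * u n * u (n ∸ 1) * Peven k
  Bplus≡ = cong₂ (λ x y → q ^ x * u n * u (n ∸ 1) * Peven y) (trans (cong (λ x → x * x / 4) (ℕ.m+n∸n≡m (2 * k) 2)) (trans (cong (_/ 4) (eq k)) (m*n/n≡m (k * k) 4))) half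
    where
    eq : ∀ k → 2 * k * (2 * k) ≡ k * k * 4
    eq = solve-∀

  order : GL n ≡ D * (q * Bplus n)
  order = trans GL-n (trans (cong (λ x → u n * (q ^ suc (2 * k) * (u (n ∸ 1) * (q ^ (2 * k) * x)))) (GL-even k))
      (trans (eq (u n) (u (n ∸ 1)) q (q ^ (2 * k)) (AltGL (2 * k)) (q ^ (k * k)) (Peven k)) (cong (λ x → D * (q * x)) (sym Bplus≡))))
    where
    eq : ∀ u v q x a y p → u * (q * x * (v * (x * (a * (y * p))))) ≡ a * (x * (x * 1)) * (q * (y * u * v * p))
    eq = solve-∀

  -- For n = 2k + 2 the exponent (5n² - 2n)/4 of A⁺ is e₀ + 1.
  e₀ : ℕ
  e₀ = 5 * k * k + 9 * k + 3

  W≡ : W ≡ q ^ e₀ * gauss n 2 * Podd k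
  W≡ = begin
    g * #Sym (2 * k) * #Sym n * (AltGL (2 * k) * (q ^ (2 * k)) ^ 2)
      ≡⟨ cong₂ (λ x y → g * x * y * (AltGL (2 * k) * (q ^ (2 * k)) ^ 2)) (#Sym-T (2 * k)) (trans (#Sym-T n) (cong (λ x → q ^ T x) n≡)) ⟩
    g * q ^ T (2 * k) * q ^ t₂ * (AltGL (2 * k) * (q ^ (2 * k) * (q ^ (2 * k) * 1)))
      ≡⟨ cong (λ x → g * q ^ T (2 * k) * q ^ t₂ * (AltGL (2 * k) * (x * (x * 1)))) (q^2k k) ⟩
    g * q ^ T (2 * k) * q ^ t₂ * (AltGL (2 * k) * (q ^ k * q ^ k * (q ^ k * q ^ k * 1)))
      ≡⟨ e₁ g (q ^ T (2 * k)) (q ^ t₂) (AltGL (2 * k)) (q ^ k) ⟩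
    g * (q ^ T (2 * k) * q ^ t₂ * (q ^ k * (q ^ k * q ^ k)) * (AltGL (2 * k) * q ^ k))
      ≡⟨ cong₂ (λ x y → g * (q ^ T (2 * k) * q ^ t₂ * x * y)) (trans (cong (q ^ k *_) (sym (q^2k k))) (sym (ℕ.^-distribˡ-+-* q k (2 * k)))) (AltGL-even k) ⟩
    g * (q ^ T (2 * k) * q ^ t₂ * q ^ (k + 2 * k) * (q ^ (k * k) * Podd k))
      ≡⟨ e₂ g (q ^ T (2 * k)) (q ^ t₂) (q ^ (k + 2 * k)) (q ^ (k * k)) (Podd k) ⟩
    q ^ T (2 * k) * q ^ t₂ * (q ^ (k + 2 * k) * q ^ (k * k)) * g * Podd k
      ≡⟨ cong (λ x → x * g * Podd k) (trans (cong₂ _*_ (sym (ℕ.^-distribˡ-+-* q (T (2 * k)) t₂)) (sym (ℕ.^-distribˡ-+-* q (k + 2 * k) (k * k)))) (sym (ℕ.^-distribˡ-+-* q (T (2 * k) + t₂) (k + 2 * k + k * k)))) ⟩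
    q ^ (T (2 * k) + t₂ + (k + 2 * k + k * k)) * g * Podd k
      ≡⟨ cong (λ x → q ^ x * g * Podd k) (trans (cong (λ x → x + (suc (suc (2 * k)) + (suc (2 * k) + x)) + (k + 2 * k + k * k)) (T-even k)) (e₃ k)) ⟩
    q ^ e₀ * g * Podd k ∎
    where
    open ≡-Reasoning
    g = gauss n 2
    t₂ = T (suc (suc (2 * k)))
    e₁ : ∀ g x y a z → g * x * y * (a * (z * z * (z * z * 1))) ≡ g * (x * y * (z * (z * z)) * (a * z))
    e₁ = solve-∀
    e₂ : ∀ g x y z w p → g * (x * y * z * (w * p)) ≡ x * y * (z * w) * g * p
    e₂ = solve-∀
    e₃ : ∀ k → k * (2 * k + 1) + (suc (suc (2 * k)) + (suc (2 * k) + k * (2 * k + 1))) + (k + 2 * k + k * k) ≡ 5 * k * k + 9 * k + 3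
    e₃ = solve-∀

  Aplus≡ : Aplus n ≡ q * W
  Aplus≡ = trans (cong₂ (λ x y → q ^ x * gauss n 2 * Podd y) exponent half) (trans (eq′ q (q ^ e₀) (gauss n 2) (Podd k)) (cong (q *_) (sym W≡)))
    where
    eq : ∀ k → 5 * (2 * k + 2) * (2 * k + 2) ≡ suc (5 * k * k + 9 * k + 3) * 4 + 2 * (2 * k + 2)
    eq = solve-∀
    exponent : (5 * n * n ∸ 2 * n) / 4 ≡ suc e₀
    exponent = trans (cong (_/ 4) (trans (cong (_∸ 2 * n) (eq k)) (ℕ.m+n∸n≡m (suc e₀ * 4) (2 * n)))) (m*n/n≡m (suc e₀) 4)
    eq′ : ∀ q x g p → q * x * g * p ≡ q * (x * g * p)
    eq′ = solve-∀

  A/q≡ : divℕ (Aplus n) q ≡ W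
  A/q≡ = trans (cong (λ x → divℕ x q) (trans Aplus≡ (ℕ.*-comm q W))) (divℕ-exact W q (λ e → ℕ.<⇒≢ 1≤q (sym e)))

  u1≡ : u 1 ≡ suc p
  u1≡ = ℕ.suc-injective (trans (suc-u 1) (trans (ℕ.*-identityʳ q) q≡))

  u2u1 : u 2 * u 1 ≡ suc p * (p + 3) * suc p
  u2u1 = cong₂ _*_ (ℕ.suc-injective (trans (suc-u 2) (trans (cong (λ x → x * (x * 1)) q≡) (eq p)))) u1≡
    where
    eq : ∀ p → suc (suc p) * (suc (suc p) * 1) ≡ suc (suc p * (p + 3))
    eq = solve-∀

  -- This is where the constant q³ - q² - 1 for β = 0 comes from: it is c₂ less (q² - 1)(q - 1), the
  -- order of GL(2,q) divided by q.
  c₂-0 : q ^ 3 + u 2 * u 1 ≡ c₂ 0F + q ^ 2 + 1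
  -- The additional q turns q · n₂ into q · (n₂ + 1), the combination whose value `n₂-0` provides.
  c₂-0 = ℕ.+-cancelʳ-≡ q _ _ (begin
    q ^ 3 + u 2 * u 1 + q
      ≡⟨ cong₂ (λ x y → x ^ 3 + y + x) q≡ u2u1 ⟩
    suc (suc p) ^ 3 + suc p * (p + 3) * suc p + suc (suc p)
      ≡⟨ e p ⟩
    suc p * (suc (suc p) * (p + suc (suc p) * 1)) + suc (suc p) * (2 * suc p) + suc (suc p) ^ 2 + 1
      ≡⟨ cong₂ (λ x y → suc p * (x * (p + x * 1)) + x * y + x ^ 2 + 1) q≡ n₂-0 ⟨
    suc p * (q * (p + q * 1)) + q * suc (n₂ 0F) + q ^ 2 + 1
      ≡⟨ cong (λ x → suc p * (q * (p + q * x)) + q * suc (n₂ 0F) + q ^ 2 + 1) (𝟙-yes (0F ≟F 0F) refl) ⟨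
    suc p * (q * (p + q * 𝟙 (0F ≟F 0F))) + q * suc (n₂ 0F) + q ^ 2 + 1
      ≡⟨ e′ (suc p * (q * (p + q * 𝟙 (0F ≟F 0F)))) q (n₂ 0F) (q ^ 2) ⟩
    suc p * (q * (p + q * 𝟙 (0F ≟F 0F))) + q * n₂ 0F + q ^ 2 + 1 + q
      ≡⟨ cong (λ x → x + q ^ 2 + 1 + q) (c₂-n₂ 0F) ⟨
    c₂ 0F + q ^ 2 + 1 + q ∎)
    where
    open ≡-Reasoning
    e : ∀ p → (2 + p) * ((2 + p) * ((2 + p) * 1)) + (1 + p) * (p + 3) * (1 + p) + (2 + p)
            ≡ (1 + p) * ((2 + p) * (p + (2 + p) * 1)) + (2 + p) * (2 * (1 + p)) + (2 + p) * ((2 + p) * 1) + 1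
    e = solve-∀
    e′ : ∀ a q n x → a + q * suc n + x + 1 ≡ a + q * n + x + 1 + q
    e′ = solve-∀

  -- For β ≠ 0 the count has the term 2 q n₀, and 2 n₀ = q - 1 + K, so one multiple q K survives;
  -- the other terms depend on q alone.
  c₂-≢0 : ∀ β → β ≢ 0F → (+ q ℤ.* K (β ⁻¹) ℤ.- + (q ^ 2) ℤ.- + 1) ℤ.+ + (u 2 * u 1) ≡ + c₂ β
  c₂-≢0 β β≢0 = ∙-cancelʳ (+ (q * n₁ b)) _ _ (begin
      (+ q ℤ.* K b ℤ.- + (q ^ 2) ℤ.- + 1) ℤ.+ + (u 2 * u 1) ℤ.+ + (q * n₁ b)
        ≡⟨ cong (λ z → (+ q ℤ.* K b ℤ.- + (q ^ 2) ℤ.- + 1) ℤ.+ + (u 2 * u 1) ℤ.+ z) (ℤ.pos-* q (n₁ b)) ⟩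
      (+ q ℤ.* K b ℤ.- + (q ^ 2) ℤ.- + 1) ℤ.+ + (u 2 * u 1) ℤ.+ + q ℤ.* + n₁ b
        ≡⟨ z₁ (+ q) (K b) (+ (q ^ 2)) (+ (u 2 * u 1)) (+ n₁ b) ⟩
      (+ q ℤ.* (K b ℤ.+ + n₁ b) ℤ.- + (q ^ 2) ℤ.- + 1) ℤ.+ + (u 2 * u 1)
        ≡⟨ cong (λ z → (z ℤ.- + (q ^ 2) ℤ.- + 1) ℤ.+ + (u 2 * u 1)) (trans (cong (+ q ℤ.*_) (K≡n₀-n₁ b)) (sym (ℤ.pos-* q (n₀ b)))) ⟩
      (+ (q * n₀ b) ℤ.- + (q ^ 2) ℤ.- + 1) ℤ.+ + (u 2 * u 1)
        ≡⟨ difference {q * n₀ b} {q ^ 2} {u 2 * u 1} {c₂ β + q * n₁ b} natural ⟩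
      + (c₂ β + q * n₁ b) ∎)
    where
    open ≡-Reasoning
    open import Algebra.Properties.AbelianGroup ℤ.+-0-abelianGroup using (∙-cancelʳ)
    b = β ⁻¹
    z₁ : ∀ q k s x n → (q ℤ.* k ℤ.- s ℤ.- + 1) ℤ.+ x ℤ.+ q ℤ.* n ≡ (q ℤ.* (k ℤ.+ n) ℤ.- s ℤ.- + 1) ℤ.+ x
    z₁ = ℤ.solve-∀
    natural : q * n₀ b + u 2 * u 1 ≡ c₂ β + q * n₁ b + q ^ 2 + 1
    -- The added terms complete q n₂ to q (n₂ + 2) and q n₁ to q (1 + n₀ + n₁), whose values are
    -- known.
    natural = ℕ.+-cancelʳ-≡ (q * n₀ b + 3 * q) _ _ (begin
      q * n₀ b + u 2 * u 1 + (q * n₀ b + 3 * q)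
        ≡⟨ cong₂ (λ x y → x * n₀ b + y + (x * n₀ b + 3 * x)) q≡ u2u1 ⟩
      suc (suc p) * n₀ b + suc p * (p + 3) * suc p + (suc (suc p) * n₀ b + 3 * suc (suc p))
        ≡⟨ e₁ p (n₀ b) ⟩
      suc p * (suc (suc p) * (p + suc (suc p) * 0)) + suc (suc p) * (2 * n₀ b) + suc (suc p) * suc (suc p) + suc (suc p) ^ 2 + 1
        ≡⟨ cong (λ x → suc p * (x * (p + x * 0)) + x * (2 * n₀ b) + x * x + x ^ 2 + 1) q≡ ⟨
      suc p * (q * (p + q * 0)) + q * (2 * n₀ b) + q * q + q ^ 2 + 1
        ≡⟨ cong₂ (λ x y → suc p * (q * (p + q * 0)) + q * x + q * y + q ^ 2 + 1) (n₂-≢0 β β≢0) (n₀+n₁ b) ⟨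
      suc p * (q * (p + q * 0)) + q * (n₂ β + 2) + q * suc (n₀ b + n₁ b) + q ^ 2 + 1
        ≡⟨ e₂ (suc p * (q * (p + q * 0))) q (n₂ β) (n₀ b) (n₁ b) (q ^ 2) ⟩
      suc p * (q * (p + q * 0)) + q * n₂ β + q * n₁ b + q ^ 2 + 1 + (q * n₀ b + 3 * q)
        ≡⟨ cong (λ x → x + q * n₁ b + q ^ 2 + 1 + (q * n₀ b + 3 * q)) (trans (c₂-n₂ β) (cong (λ x → suc p * (q * (p + q * x)) + q * n₂ β) (𝟙-no (β ≟F 0F) β≢0))) ⟨
      c₂ β + q * n₁ b + q ^ 2 + 1 + (q * n₀ b + 3 * q) ∎)
      where
      e₁ : ∀ p n → (2 + p) * n + (1 + p) * (p + 3) * (1 + p) + ((2 + p) * n + 3 * (2 + p))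
                 ≡ (1 + p) * ((2 + p) * (p + (2 + p) * 0)) + (2 + p) * (2 * n) + (2 + p) * (2 + p) + (2 + p) * ((2 + p) * 1) + 1
      e₁ = solve-∀
      e₂ : ∀ a q n x y z → a + q * (n + 2) + q * suc (x + y) + z + 1 ≡ a + q * n + q * y + z + 1 + (q * x + 3 * q)
      e₂ = solve-∀

  τ-at : ℕ → ℤ
  τ-at j = + j ℤ.- + (2 * q)

  InTau? : (τ : ℤ) → Dec ((τ ℤ.* τ ℤ.< + (4 * q)) × (τ ℤ.%ℕ 4 ≡ 3))
  InTau? τ = ((τ ℤ.* τ) ℤ.<? + (4 * q)) ×-dec (τ ℤ.%ℕ 4 ℕ.≟ 3)

  tau-once′ : ∀ κ j → j < suc (4 * q) → τ-at j ≡ κ → (κ ℤ.* κ ℤ.< + (4 * q)) × (κ ℤ.%ℕ 4 ≡ 3) →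
              ∑ₗ tauRange (λ τ → 𝟙 (τ ℤ.≟ κ)) ≡ 1
  tau-once′ κ j j<  refl inτ = begin
    ∑ₗ tauRange (λ τ → 𝟙 (τ ℤ.≟ τ-at j))                                           ≡⟨ ∑-filter InTau? (map τ-at (upTo (suc (4 * q)))) _ ⟩
    ∑ₗ (map τ-at (upTo (suc (4 * q)))) (λ τ → 𝟙 (InTau? τ) * 𝟙 (τ ℤ.≟ τ-at j))     ≡⟨ ∑-map (upTo (suc (4 * q))) τ-at _ ⟩
    ∑ₗ (upTo (suc (4 * q))) (λ i → 𝟙 (InTau? (τ-at i)) * 𝟙 (τ-at i ℤ.≟ τ-at j))    ≡⟨ ∑-cong (upTo (suc (4 * q))) (λ i → trans (sym (𝟙-× (InTau? (τ-at i)) (τ-at i ℤ.≟ τ-at j)))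
                                                                                        (𝟙-cong (InTau? (τ-at i) ×-dec (τ-at i ℤ.≟ τ-at j)) (i ℕ.≟ j) (λ (_ , e) → ℤ.+-injective (∙-cancelʳ (ℤ.- (+ (2 * q))) (+ i) (+ j) e)) (λ { refl → inτ , refl }))) ⟩
    ∑ₗ (upTo (suc (4 * q))) (λ i → 𝟙 (i ℕ.≟ j))                                    ≡⟨ upTo-once (suc (4 * q)) j j< ⟩
    1                                                                              ∎
    where
    open ≡-Reasoning
    open import Algebra.Properties.AbelianGroup ℤ.+-0-abelianGroup using (∙-cancelʳ)

  -- `tauRange` filters the integers from -2q to 2q; this coarse bound shows that every τ with τ² <
  -- 4q lies among them.
  small : ∀ {x} → x * x < 4 * q → x ≤ 2 * q
  small {x} h = ℕ.≮⇒≥ λ 2q<x → ℕ.<⇒≱ h (ℕ.≤-trans (ℕ.≤-trans (ℕ.m≤m*n (4 * q) q) (ℕ.≤-reflexive (eq q))) (ℕ.*-mono-≤ (ℕ.<⇒≤ 2q<x) (ℕ.<⇒≤ 2q<x)))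
    where
    eq : ∀ q → 4 * q * q ≡ 2 * q * (2 * q)
    eq = solve-∀

  index-of : ∀ κ → κ ℤ.* κ ℤ.< + (4 * q) → ∃ λ j → j < suc (4 * q) × τ-at j ≡ κ
  index-of (+ x) h = x + 2 * q , s≤s (ℕ.≤-trans (ℕ.+-monoˡ-≤ (2 * q) (small {x} (ℤ.drop‿+<+ (subst (ℤ._< + (4 * q)) (sym (ℤ.pos-* x x)) h)))) (ℕ.≤-reflexive (eq q))) , z (+ x) (+ (2 * q))
    where
    eq : ∀ q → 2 * q + 2 * q ≡ 4 * q
    eq = solve-∀
    z : ∀ x y → (x ℤ.+ y) ℤ.- y ≡ x
    z = ℤ.solve-∀
  index-of -[1+ x ] h = 2 * q ∸ suc x , s≤s (ℕ.≤-trans (ℕ.m∸n≤m (2 * q) (suc x)) (ℕ.*-monoˡ-≤ q (s≤s (s≤s (z≤n {2}))))) ,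
      trans (cong (λ y → + (2 * q ∸ suc x) ℤ.- + y) (sym (ℕ.m∸n+n≡m (small {suc x} (ℤ.drop‿+<+ h))))) (z (+ (2 * q ∸ suc x)) (+ suc x))
    where
    z : ∀ x y → x ℤ.- (x ℤ.+ y) ≡ ℤ.- y
    z = ℤ.solve-∀

  -- By the Hasse bound and the congruence modulo 4, each β ≠ 0 appears under exactly one τ. The
  -- double product over τ and β therefore has one factor for each β, and otherwise only factors 1.
  tau-once : ∀ b → b ≢ 0F → ∑ₗ tauRange (λ τ → 𝟙 (τ ℤ.≟ K b)) ≡ 1
  tau-once b b≢0 = let j , j< , e = index-of (K b) hasse in tau-once′ (K b) j j< e (hasse , K-mod4)
    where open KloostermanBounds F 4≤q b b≢0

  module _ {L : ℕ} (g : Fin L → Mat (n + n) (n + n)) (ord : IsOrdering (InPσP n (2 * k)) L g) where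

    count : Fin q → ℕ
    count = occurrences (λ j → Tr (g j))

    count-equation : ∀ i → count i + W * (u 2 * u 1) ≡ W * (Bplus n + c₂ (el i))
    count-equation i = cancel-*ˡ q (λ e → ℕ.<⇒≢ 1≤q (sym e)) (begin
      q * (count i + W * (u 2 * u 1))                    ≡⟨ e₁ q (count i) W (u 2) (u 1) ⟩
      q * count i + W * (u 2 * (q * u 1))                ≡⟨ cong (λ x → q * count i + W * x) GL-2 ⟨
      q * count i + W * GL 2                             ≡⟨ reduced flags order g ord (el i) ⟩
      W * (q * Bplus n + q * # 𝕄₂₂ (inverseTrace? (el i))) ≡⟨ cong (λ x → W * (q * Bplus n + q * x)) (#-trace₂ (el i)) ⟩
      W * (q * Bplus n + q * c₂ (el i))                  ≡⟨ e₂ W q (Bplus n) (c₂ (el i)) ⟩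
      q * (W * (Bplus n + c₂ (el i)))                    ∎)
      where
      open ≡-Reasoning
      𝕄₂₂ = Matrices.𝕄 F 2 2
      e₁ : ∀ q x w a b → q * (x + w * (a * b)) ≡ q * x + w * (a * (q * b))
      e₁ = solve-∀
      e₂ : ∀ w q b c → w * (q * b + q * c) ≡ q * (w * (b + c))
      e₂ = solve-∀

    count-top : ∀ i (c : ℤ) → c ℤ.+ + (u 2 * u 1) ≡ + c₂ (el i) → + count i ≡ topℤ (Aplus n) (Bplus n) c
    count-top i c h = trans (top-factor {N = count i} {W} {Bplus n} {u 2 * u 1} {c₂ (el i)} {c} (count-equation i) h) (cong (λ x → + x ℤ.* (+ Bplus n ℤ.+ c)) (sym A/q≡))

    top₀ : ℤ
    top₀ = topℤ (Aplus n) (Bplus n) (+ (q ^ 3) ℤ.- + (q ^ 2) ℤ.- + 1)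

    top-τ : ℤ → ℤ
    top-τ τ = topℤ (Aplus n) (Bplus n) (+ q ℤ.* τ ℤ.- + (q ^ 2) ℤ.- + 1)

    count-0 : ∀ i → el i ≡ 0F → + count i ≡ top₀
    count-0 i e = count-top i (+ (q ^ 3) ℤ.- + (q ^ 2) ℤ.- + 1) (difference {q ^ 3} {q ^ 2} {u 2 * u 1} {c₂ (el i)} (subst (λ β → q ^ 3 + u 2 * u 1 ≡ c₂ β + q ^ 2 + 1) (sym e) c₂-0))

    count-≢0 : ∀ i → el i ≢ 0F → + count i ≡ top-τ (K (el i ⁻¹))
    count-≢0 i ne = count-top i (+ q ℤ.* K (el i ⁻¹) ℤ.- + (q ^ 2) ℤ.- + 1) (c₂-≢0 (el i) ne)

    τ-factor : (Fin q → ℕ) → Fin q → ℤ → ℕ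
    τ-factor ν i τ = if ⌊ ¬? (el i ≟F 0F) ⌋ ∧ ⌊ K (el i ⁻¹) ℤ.≟ τ ⌋ then binomℤ (top-τ τ) (ν i) else 1

    factor : ∀ ν i → count i C ν i ≡ (if does (i Fin.≟ idx 0F) then binomℤ top₀ (ν i) else 1) * ∏ₗ tauRange (τ-factor ν i)
    factor ν i = go (el i ≟F 0F) (i Fin.≟ idx 0F)
      where
      at-zero : el i ≡ 0F → ∀ τ → τ-factor ν i τ ≡ 1
      at-zero e τ with el i ≟F 0F
      ... | yes _ = refl
      ... | no ne = ⊥-elim (ne e)
      off-zero : el i ≢ 0F → ∀ τ → τ-factor ν i τ ≡ (if does (τ ℤ.≟ K (el i ⁻¹)) then binomℤ (top-τ τ) (ν i) else 1)
      off-zero ne τ with el i ≟F 0F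
      ... | yes e = ⊥-elim (ne e)
      ... | no _ with K (el i ⁻¹) ℤ.≟ τ | τ ℤ.≟ K (el i ⁻¹)
      ...   | yes _  | yes _  = refl
      ...   | no _   | no _   = refl
      ...   | yes e  | no ne′ = ⊥-elim (ne′ (sym e))
      ...   | no ne′ | yes e  = ⊥-elim (ne′ (sym e))
      go : Dec (el i ≡ 0F) → (d : Dec (i ≡ idx 0F)) → count i C ν i ≡ (if does d then binomℤ top₀ (ν i) else 1) * ∏ₗ tauRange (τ-factor ν i)
      go (yes e) (yes _) = trans (cong (λ z → binomℤ z (ν i)) (count-0 i e)) (sym (trans (cong (binomℤ top₀ (ν i) *_) (trans (∏-cong tauRange (at-zero e)) (∏-one tauRange))) (ℕ.*-identityʳ _)))
      go (yes e) (no ne) = ⊥-elim (ne (at-idx0 i e))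
      go (no ne) (yes e) = ⊥-elim (off-idx0 i ne e)
      go (no ne) (no _)  = trans (cong (λ z → binomℤ z (ν i)) (count-≢0 i ne)) (sym (trans (ℕ.*-identityˡ _) (trans (∏-cong tauRange (off-zero ne))
        (∏-once ℤ._≟_ tauRange (K (el i ⁻¹)) (λ τ → binomℤ (top-τ τ) (ν i)) (tau-once (el i ⁻¹) (⁻¹-≢0 ne))))))

    codeCount-plus : ∀ j → codeCount L g j ≡ formulaPlus n j
    codeCount-plus j = trans (codeCount-families g j) (∑-cong (families j) λ ν → trans (∏-cong (allFin q) (factor ν)) (trans (∏-* (allFin q) _ _)
      (cong₂ _*_ (sym (∏-idx0 (λ i → binomℤ top₀ (ν i)))) (trans (∏-swap (allFin q) tauRange (τ-factor ν))
        (∏-cong tauRange λ τ → sym (∏-nonzeroIdx (λ β → ⌊ K (β ⁻¹) ℤ.≟ τ ⌋) (λ i → binomℤ (top-τ τ) (ν i))))))))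

theorem19 : ((r : ℕ) (F : BinaryField r) → let open Over F in
    (n : ℕ) → 1 ≤ n → n % 2 ≡ 1 →
    (N : ℕ) (g : Fin N → Mat (n + n) (n + n)) → IsOrdering (DCminus n) N g →
    (j : ℕ) → j ≤ N →
    codeCount N g j ≡ formulaMinus n j)
    ×
    ((r : ℕ) (F : BinaryField r) → let open Over F in
    4 ≤ 2 ^ r →
    (n : ℕ) → 2 ≤ n → n % 2 ≡ 0 →
    (N : ℕ) (g : Fin N → Mat (n + n) (n + n)) → IsOrdering (DCplus n) N g →
    (j : ℕ) → j ≤ N →
    codeCount N g j ≡ formulaPlus n j)
theorem19 = (λ r F n _ odd → minus r F n (n / 2) (trans (m≡m%n+[m/n]*n n 2) (trans (cong (_+ n / 2 * 2) odd) (e₁ (n / 2)))))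
  , (λ r F 4≤q n 2≤n even → plus r F 4≤q n (n / 2) 2≤n (trans (m≡m%n+[m/n]*n n 2) (cong (_+ n / 2 * 2) even)))
  where
  e₁ : ∀ k → 1 + k * 2 ≡ 2 * k + 1
  e₁ = solve-∀
  e₂ : ∀ k → suc k * 2 ≡ 2 * k + 2
  e₂ = solve-∀
  minus : ∀ r (F : BinaryField r) n k → n ≡ 2 * k + 1 → (let open Over F) (N : ℕ) (g : Fin N → Mat (n + n) (n + n)) →
          IsOrdering (DCminus n) N g → (j : ℕ) → j ≤ N → codeCount N g j ≡ formulaMinus n j
  minus r F _ k refl N g ord j _ = Odd.codeCount-minus F k g
    (subst (λ s → Over.IsOrdering F (Over.InPσP F (2 * k + 1) s) N g) (ℕ.m+n∸n≡m (2 * k) 1) ord) j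
  plus : ∀ r (F : BinaryField r) → 4 ≤ 2 ^ r → ∀ n k → 2 ≤ n → n ≡ k * 2 → (let open Over F) (N : ℕ) (g : Fin N → Mat (n + n) (n + n)) →
         IsOrdering (DCplus n) N g → (j : ℕ) → j ≤ N → codeCount N g j ≡ formulaPlus n j
  plus r F 4≤q n zero    2≤n e = ⊥-elim (ℕ.n≮0 (subst (2 ≤_) e 2≤n))
  plus r F 4≤q n (suc k) _   e = go n (trans e (e₂ k))
    where
    go : ∀ n → n ≡ 2 * k + 2 → (let open Over F) (N : ℕ) (g : Fin N → Mat (n + n) (n + n)) →
         IsOrdering (DCplus n) N g → (j : ℕ) → j ≤ N → codeCount N g j ≡ formulaPlus n j
    go _ refl N g ord j _ = Even.codeCount-plus F 4≤q k g
      (subst (λ s → Over.IsOrdering F (Over.InPσP F (2 * k + 2) s) N g) (ℕ.m+n∸n≡m (2 * k) 2) ord) j
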